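{- Let $V$ be the universe (a model of $\mathsf{ZFC}$). Let $\mathcal L$ be a first-order language, $M$ an $\mathcal L$-structure, $\mathscr G\subseteq\mathrm{Aut}(M)$ a group of automorphisms of $M$, and $\mathcal I$ an ideal of subsets of $M$. Then there is a symmetric extension $W$ of $V$, with $V\subseteq W\subseteq V[G]$, in which there is a symmetric copy $N$ of $M$ such that for every $k$, every subset of $N^k$ which lies in $W$ is a symmetric copy of a subset of $M^k$ that is stable under a large group of automorphisms. Moreover, if $\mathcal I$ is $\kappa$-complete, then $W$ can be taken to satisfy $\mathsf{DC}_{<\kappa}$. One can also require that $M$ does not have any new subsets.
   Context: Symmetric extensions. A symmetric system is a triple $\langle\mathbb P,\mathscr H,\mathscr F\rangle$ where $\mathbb P$ is a notion of forcing (a preordered set with a maximum), $\mathscr H$ is a group of automorphisms of $\mathbb P$, and $\mathscr F$ is a normal filter of subgroups of $\mathscr H$: a non-empty collection of subgroups closed under supergroups, finite intersections, and conjugation by elements of $\mathscr H$, and not containing the trivial group. Automorphisms act on $\mathbb P$-names by $\pi\dot x=\{\langle\pi p,\pi\dot y\rangle\mid\langle p,\dot y\rangle\in\dot x\}$. A name $\dot x$ is $\mathscr F$-symmetric if $\{\pi\in\mathscr H\mid\pi\dot x=\dot x\}\in\mathscr F$, and hereditarily $\mathscr F$-symmetric if this holds for $\dot x$ and, hereditarily, for all names appearing in its transitive closure. For a $V$-generic filter $G\subseteq\mathbb P$, the symmetric extension is the class $W$ of all $\dot x^G$ with $\dot x$ hereditarily $\mathscr F$-symmetric; it is a transitive model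 of $\mathsf{ZF}$ with $V\subseteq W\subseteq V[G]$. Symmetric copies. A symmetric copy of $M$ is a structure $N\in W$ such that $V[G]\models M\cong_{\mathcal L}N$. Subsets of $M^k$ are transported to subsets of $N^k$ via a fixed such isomorphism in $V[G]$: a subset $X\subseteq N^k$ in $W$ is a symmetric copy of a subset $X_*\subseteq M^k$ (with $X_*\in V[G]$) if this isomorphism carries $X_*$ onto $X$. Large groups and stability. A subgroup of $\mathscr G$ is large if it contains $\mathrm{fix}(A)=\{\pi\in\mathscr G\mid\pi\restriction A=\mathrm{id}\}$ for some $A\in\mathcal I$. A set $X$ is stable under an automorphism $\pi$ if $\pi``X=X$ (with $\pi$ acting coordinatewise on $M^k$), and stable under a group $H$ if it is stable under every $\pi\in H$. An ideal is $\kappa$-complete if it is closed under unions of fewer than $\kappa$ of its members. For an aleph $\lambda$, $\mathsf{DC}_\lambda$ is the statement "every $\lambda$-closed tree has a maximal element or a chain of type $\lambda$", where $\lambda$-closed means that every chain of length less than $\lambda$ has an upper bound; $\mathsf{DC}_{<\kappa}$ means $\mathsf{DC}_\lambda$ for all $\lambda<\kappa$.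
   Formalization: The ideal 𝓘 is assumed to contain all singletons of M; without this the claim fails (𝓘={∅} and 𝓖 moving a point m: the singleton of the copy of m lies in W, but {m} is not stable under 𝓖, the only large group). -}

module Defs where

open import Level using (Lift; 0ℓ) renaming (suc to lsuc)
open import Data.Bool using (Bool; true; false)
open import Data.Empty using (⊥)
open import Data.Fin using (Fin)
open import Data.Maybe using (Maybe; maybe)
open import Data.Nat using (ℕ; zero; suc)
open import Data.Product using (Σ; ∃; ∃-syntax; Σ-syntax; _×_; _,_)
open import Data.Sum using (_⊎_)
open import Data.Vec using (Vec; []; _∷_; lookup)
open import Data.Vec.Relation.Unary.All using (All)
open import Data.Vec.Relation.Binary.Pointwise.Inductive using (Pointwise)
open import Function.Bundles using (_⇔_)
open import Relation.Nullary using (¬_)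

infix 4 _≐_ _∈_ _⊆_ _⊑_

-- V, W and V[G] are transitive classes of iterative sets, so
-- "x ∈ V" and "V ⊆ W ⊆ V[G]" are literal and Δ₀ notions need no relativisation.

data 𝕍 : Set₁ where
  sup : (A : Set) → (A → 𝕍) → 𝕍

idx : 𝕍 → Set
idx (sup A _) = A

elt : (x : 𝕍) → idx x → 𝕍
elt (sup _ f) = f

_≐_ : 𝕍 → 𝕍 → Set
sup A f ≐ sup B g = (∀ a → ∃[ b ] f a ≐ g b) × (∀ b → ∃[ a ] f a ≐ g b)

_∈_ : 𝕍 → 𝕍 → Set
x ∈ y = ∃[ i ] x ≐ elt y i

_⊆_ : 𝕍 → 𝕍 → Set₁
x ⊆ y = ∀ z → z ∈ x → z ∈ y

∅ : 𝕍
∅ = sup ⊥ λ ()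

｛_,_｝ : 𝕍 → 𝕍 → 𝕍
｛ x , y ｝ = sup Bool λ { true → x ; false → y }

⟨_,_⟩ : 𝕍 → 𝕍 → 𝕍
⟨ x , y ⟩ = ｛ ｛ x , x ｝ , ｛ x , y ｝ ｝

num : ℕ → 𝕍
num zero    = ∅
num (suc n) = sup (Maybe (idx (num n))) (maybe (elt (num n)) (num n))

ω : 𝕍
ω = sup ℕ num

-- k-tuples are coded as nested pairs ending in ∅.
tuple : ∀ {k} → Vec 𝕍 k → 𝕍
tuple []       = ∅
tuple (x ∷ xs) = ⟨ x , tuple xs ⟩

-- { z ∈ a | φ z } ∈ F
⦅_∣_⦆∈_ : 𝕍 → (𝕍 → Set₁) → 𝕍 → Set₁
⦅ a ∣ φ ⦆∈ F = ∃[ b ] b ∈ F × (∀ z → z ∈ b ⇔ (z ∈ a × φ z))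

Class : Set₂
Class = 𝕍 → Set₁

_⊑_ : Class → Class → Set₁
C ⊑ D = ∀ x → C x → D x

record IsTransitive (C : Class) : Set₁ where
  field
    respects   : ∀ x y → x ≐ y → C x → C y
    transitive : ∀ x y → C x → y ∈ x → C y

data Formula (n : ℕ) : Set where
  _∈̇_ _≐̇_ : Fin n → Fin n → Formula n
  ⊥̇        : Formula n
  _⇒̇_      : Formula n → Formula n → Formula n
  ∀̇_       : Formula (suc n) → Formula n

Sat : Class → ∀ {n} → Formula n → Vec 𝕍 n → Set₁
Sat C (i ∈̇ j) ρ = Lift (lsuc 0ℓ) (lookup ρ i ∈ lookup ρ j)
Sat C (i ≐̇ j) ρ = Lift (lsuc 0ℓ) (lookup ρ i ≐ lookup ρ j)
Sat C ⊥̇       ρ = Lift (lsuc 0ℓ) ⊥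
Sat C (φ ⇒̇ ψ) ρ = Sat C φ ρ → Sat C ψ ρ
Sat C (∀̇ φ)   ρ = ∀ x → C x → Sat C φ (x ∷ ρ)

record IsZFC (C : Class) : Set₁ where
  field
    extensionality : ∀ x y → C x → C y → (∀ z → C z → z ∈ x ⇔ z ∈ y) → x ≐ y
    foundation     : ∀ x → C x → (∃[ y ] C y × y ∈ x) →
                     ∃[ y ] C y × y ∈ x × (∀ z → C z → ¬ (z ∈ y × z ∈ x))
    pairing        : ∀ x y → C x → C y →
                     ∃[ z ] C z × (∀ w → C w → w ∈ z ⇔ (w ≐ x ⊎ w ≐ y))
    union          : ∀ x → C x →
                     ∃[ u ] C u × (∀ z → C z → z ∈ u ⇔ (∃[ y ] C y × y ∈ x × z ∈ y))
    powerset       : ∀ x → C x →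
                     ∃[ p ] C p × (∀ z → C z → z ∈ p ⇔ (∀ w → C w → w ∈ z → w ∈ x))
    infinity       : ∃[ a ] C a
                     × (∃[ e ] C e × e ∈ a × (∀ z → C z → ¬ z ∈ e))
                     × (∀ x → C x → x ∈ a →
                        ∃[ s ] C s × s ∈ a × (∀ z → C z → z ∈ s ⇔ (z ∈ x ⊎ z ≐ x)))
    separation     : ∀ {n} (φ : Formula (suc n)) (ρ : Vec 𝕍 n) → All C ρ →
                     ∀ a → C a →
                     ∃[ b ] C b × (∀ z → C z → z ∈ b ⇔ (z ∈ a × Sat C φ (z ∷ ρ)))
    replacement    : ∀ {n} (φ : Formula (suc (suc n))) (ρ : Vec 𝕍 n) → All C ρ →
                     ∀ a → C a →
                     (∀ x → C x → x ∈ a → ∃[ y ] C y × Sat C φ (x ∷ y ∷ ρ)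
                        × (∀ y′ → C y′ → Sat C φ (x ∷ y′ ∷ ρ) → y′ ≐ y)) →
                     ∃[ b ] C b × (∀ y → C y →
                        y ∈ b ⇔ (∃[ x ] C x × x ∈ a × Sat C φ (x ∷ y ∷ ρ)))
    choice         : ∀ a → C a →
                     (∀ x → C x → x ∈ a → ∃[ z ] C z × z ∈ x) →
                     (∀ x y z → C x → C y → C z → x ∈ a → y ∈ a → z ∈ x → z ∈ y → x ≐ y) →
                     ∃[ t ] C t × (∀ x → C x → x ∈ a →
                        ∃[ z ] C z × z ∈ x × z ∈ t
                        × (∀ z′ → C z′ → z′ ∈ x → z′ ∈ t → z′ ≐ z))

Countable : Class → Set₁
Countable C = Σ[ e ∈ (ℕ → 𝕍) ] (∀ x → C x → Σ[ n ∈ ℕ ] x ≐ e n)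

record IsFunction (A B f : 𝕍) : Set₁ where
  field
    graph         : ∀ z → z ∈ f → ∃[ a ] ∃[ b ] a ∈ A × b ∈ B × z ≐ ⟨ a , b ⟩
    total         : ∀ a → a ∈ A → ∃[ b ] ⟨ a , b ⟩ ∈ f
    single-valued : ∀ a b b′ → ⟨ a , b ⟩ ∈ f → ⟨ a , b′ ⟩ ∈ f → b ≐ b′

record IsBijection (A B f : 𝕍) : Set₁ where
  field
    isFunction : IsFunction A B f
    injective  : ∀ a a′ b → ⟨ a , b ⟩ ∈ f → ⟨ a′ , b ⟩ ∈ f → a ≐ a′
    surjective : ∀ b → b ∈ B → ∃[ a ] ⟨ a , b ⟩ ∈ f

IsId : 𝕍 → 𝕍 → Set₁
IsId A π = ∀ x y → ⟨ x , y ⟩ ∈ π ⇔ (x ∈ A × x ≐ y)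

IsInverse : 𝕍 → 𝕍 → Set₁
IsInverse σ π = ∀ x y → ⟨ x , y ⟩ ∈ σ ⇔ ⟨ y , x ⟩ ∈ π

-- ρ = σ ∘ τ
IsComp : 𝕍 → 𝕍 → 𝕍 → Set₁
IsComp ρ σ τ = ∀ x z → ⟨ x , z ⟩ ∈ ρ ⇔ (∃[ y ] ⟨ x , y ⟩ ∈ τ × ⟨ y , z ⟩ ∈ σ)

record IsPermGroup (A H : 𝕍) : Set₁ where
  field
    bijections : ∀ π → π ∈ H → IsBijection A A π
    identity   : ∃[ ι ] ι ∈ H × IsId A ι
    inverses   : ∀ π → π ∈ H → ∃[ σ ] σ ∈ H × IsInverse σ π
    products   : ∀ σ τ → σ ∈ H → τ ∈ H → ∃[ ρ ] ρ ∈ H × IsComp ρ σ τ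

IsSubgroup : 𝕍 → 𝕍 → 𝕍 → Set₁
IsSubgroup A H K = K ⊆ H × IsPermGroup A K

record Language : Set₁ where
  field
    Fun Rel arFun arRel : 𝕍

record IsLanguageIn (C : Class) (L : Language) : Set₁ where
  open Language L
  field
    Fun∈ : C Fun
    Rel∈ : C Rel
    arFun∈ : C arFun
    arRel∈ : C arRel
    arFun-function : IsFunction Fun ω arFun
    arRel-function : IsFunction Rel ω arRel

-- ⟨ R , tuple xs ⟩ ∈ rels means R(xs);  ⟨ ⟨ g , tuple xs ⟩ , y ⟩ ∈ funs means g(xs) = y.
record Structure : Set₁ where
  field
    dom rels funs : 𝕍

record IsStructureIn (C : Class) (L : Language) (S : Structure) : Set₁ where
  open Language L
  open Structure S
  field
    dom∈  : C dom
    rels∈ : C rels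
    funs∈ : C funs
    rels-graph : ∀ z → z ∈ rels →
      Σ[ n ∈ ℕ ] ∃[ R ] Σ[ xs ∈ Vec 𝕍 n ]
        ⟨ R , num n ⟩ ∈ arRel × All (_∈ dom) xs × z ≐ ⟨ R , tuple xs ⟩
    funs-graph : ∀ z → z ∈ funs →
      Σ[ n ∈ ℕ ] ∃[ g ] Σ[ xs ∈ Vec 𝕍 n ] ∃[ y ]
        ⟨ g , num n ⟩ ∈ arFun × All (_∈ dom) xs × y ∈ dom × z ≐ ⟨ ⟨ g , tuple xs ⟩ , y ⟩
    funs-total : ∀ n g (xs : Vec 𝕍 n) → ⟨ g , num n ⟩ ∈ arFun → All (_∈ dom) xs →
      ∃[ y ] ⟨ ⟨ g , tuple xs ⟩ , y ⟩ ∈ funs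
    funs-single-valued : ∀ w y y′ → ⟨ w , y ⟩ ∈ funs → ⟨ w , y′ ⟩ ∈ funs → y ≐ y′

Maps : 𝕍 → ∀ {k} → Vec 𝕍 k → Vec 𝕍 k → Set₁
Maps f = Pointwise (λ x y → ⟨ x , y ⟩ ∈ f)

record IsIso (L : Language) (S T : Structure) (f : 𝕍) : Set₁ where
  open Language L
  module S = Structure S
  module T = Structure T
  field
    bijection : IsBijection S.dom T.dom f
    relations : ∀ n R (xs ys : Vec 𝕍 n) → ⟨ R , num n ⟩ ∈ arRel → Maps f xs ys →
      ⟨ R , tuple xs ⟩ ∈ S.rels ⇔ ⟨ R , tuple ys ⟩ ∈ T.rels
    functions : ∀ n g (xs ys : Vec 𝕍 n) x y → ⟨ g , num n ⟩ ∈ arFun →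
      Maps f xs ys → ⟨ x , y ⟩ ∈ f →
      ⟨ ⟨ g , tuple xs ⟩ , x ⟩ ∈ S.funs → ⟨ ⟨ g , tuple ys ⟩ , y ⟩ ∈ T.funs

record IsAutGroup (L : Language) (S : Structure) (𝓖 : 𝕍) : Set₁ where
  field
    group         : IsPermGroup (Structure.dom S) 𝓖
    automorphisms : ∀ π → π ∈ 𝓖 → IsIso L S S π

SubsetOfPower : ℕ → 𝕍 → 𝕍 → Set₁
SubsetOfPower k A X = ∀ z → z ∈ X → Σ[ xs ∈ Vec 𝕍 k ] All (_∈ A) xs × z ≐ tuple xs

-- f `` X = Y, for X and Y sets of k-tuples
Carries : ℕ → 𝕍 → 𝕍 → 𝕍 → Set₁
Carries k f X Y = ∀ (ys : Vec 𝕍 k) →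
  tuple ys ∈ Y ⇔ (Σ[ xs ∈ Vec 𝕍 k ] tuple xs ∈ X × Maps f xs ys)

-- An ideal on A contains all singletons.  If some {m} were not in 𝓘, a
-- group moving m could have no large subgroup stabilising {m}, although the
-- image of m is an element of any symmetric copy.
record IsIdealIn (C : Class) (A 𝓘 : 𝕍) : Set₁ where
  field
    member     : C 𝓘
    subsets    : ∀ B → B ∈ 𝓘 → B ⊆ A
    empty      : ∅ ∈ 𝓘
    downward   : ∀ B B′ → C B′ → B ∈ 𝓘 → B′ ⊆ B → B′ ∈ 𝓘
    unions     : ∀ B B′ → B ∈ 𝓘 → B′ ∈ 𝓘 → ⦅ A ∣ (λ z → Lift (lsuc 0ℓ) (z ∈ B ⊎ z ∈ B′)) ⦆∈ 𝓘
    singletons : ∀ a → a ∈ A → ｛ a , a ｝ ∈ 𝓘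

record IsOrdinal (α : 𝕍) : Set₁ where
  field
    transitive : ∀ β γ → β ∈ α → γ ∈ β → γ ∈ α
    linear     : ∀ β γ → β ∈ α → γ ∈ α → (β ∈ γ) ⊎ (β ≐ γ) ⊎ (γ ∈ β)

record IsAlephIn (C : Class) (λ′ : 𝕍) : Set₁ where
  field
    member   : C λ′
    ordinal  : IsOrdinal λ′
    infinite : ω ⊆ λ′
    initial  : ∀ α f → α ∈ λ′ → C f → ¬ IsBijection α λ′ f

IsCompleteIn : Class → 𝕍 → 𝕍 → 𝕍 → Set₁
IsCompleteIn C A 𝓘 κ = ∀ γ f → γ ∈ κ → C f → IsFunction γ 𝓘 f →
  ⦅ A ∣ (λ z → ∃[ ξ ] ∃[ B ] ⟨ ξ , B ⟩ ∈ f × z ∈ B) ⦆∈ 𝓘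

IsLargeIn : Class → (A 𝓖 𝓘 K : 𝕍) → Set₁
IsLargeIn C A 𝓖 𝓘 K = C K × IsSubgroup A 𝓖 K ×
  (∃[ B ] B ∈ 𝓘 × (∀ π → π ∈ 𝓖 → (∀ b → b ∈ B → ⟨ b , b ⟩ ∈ π) → π ∈ K))

record IsTreeIn (C : Class) (T ≤T : 𝕍) : Set₁ where
  field
    T∈            : C T
    ≤T∈           : C ≤T
    reflexive     : ∀ s → s ∈ T → ⟨ s , s ⟩ ∈ ≤T
    antisymmetric : ∀ s t → s ∈ T → t ∈ T → ⟨ s , t ⟩ ∈ ≤T → ⟨ t , s ⟩ ∈ ≤T → s ≐ t
    transitive    : ∀ s t u → s ∈ T → t ∈ T → u ∈ T →
                    ⟨ s , t ⟩ ∈ ≤T → ⟨ t , u ⟩ ∈ ≤T → ⟨ s , u ⟩ ∈ ≤T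
    predecessors-well-ordered : ∀ t Y → t ∈ T → C Y →
      (∀ s → s ∈ Y → s ∈ T × ⟨ s , t ⟩ ∈ ≤T × ¬ s ≐ t) →
      (∃[ s ] s ∈ Y) → ∃[ m ] m ∈ Y × (∀ s → s ∈ Y → ⟨ m , s ⟩ ∈ ≤T)

-- c is the increasing enumeration of a chain of order type α
record IsChainOfType (T ≤T α c : 𝕍) : Set₁ where
  field
    function   : IsFunction α T c
    increasing : ∀ β γ s t → β ∈ γ → ⟨ β , s ⟩ ∈ c → ⟨ γ , t ⟩ ∈ c →
                 ⟨ s , t ⟩ ∈ ≤T × ¬ s ≐ t

DC : Class → 𝕍 → Set₁
DC C λ′ = ∀ T ≤T → IsTreeIn C T ≤T →
  (∀ α c → α ∈ λ′ → C c → IsChainOfType T ≤T α c →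
     ∃[ u ] u ∈ T × (∀ β s → ⟨ β , s ⟩ ∈ c → ⟨ s , u ⟩ ∈ ≤T)) →
  (∃[ m ] m ∈ T × (∀ t → t ∈ T → ⟨ m , t ⟩ ∈ ≤T → t ≐ m))
  ⊎ (∃[ c ] C c × IsChainOfType T ≤T λ′ c)

DC< : Class → 𝕍 → Set₁
DC< C κ = ∀ λ′ → λ′ ∈ κ → IsAlephIn C λ′ → DC C λ′

record SymmetricSystem : Set₁ where
  field
    P ≤P 𝟙 H F : 𝕍

record IsSymmetricSystemIn (C : Class) (S : SymmetricSystem) : Set₁ where
  open SymmetricSystem S
  field
    P∈  : C P
    ≤P∈ : C ≤P
    H∈  : C H
    F∈  : C F

    reflexive  : ∀ p → p ∈ P → ⟨ p , p ⟩ ∈ ≤P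
    transitive : ∀ p q r → p ∈ P → q ∈ P → r ∈ P →
                 ⟨ p , q ⟩ ∈ ≤P → ⟨ q , r ⟩ ∈ ≤P → ⟨ p , r ⟩ ∈ ≤P
    𝟙∈P        : 𝟙 ∈ P
    maximum    : ∀ p → p ∈ P → ⟨ p , 𝟙 ⟩ ∈ ≤P

    group         : IsPermGroup P H
    automorphisms : ∀ π p p′ q q′ → π ∈ H → ⟨ p , p′ ⟩ ∈ π → ⟨ q , q′ ⟩ ∈ π →
                    ⟨ p , q ⟩ ∈ ≤P ⇔ ⟨ p′ , q′ ⟩ ∈ ≤P

    subgroups     : ∀ K → K ∈ F → IsSubgroup P H K
    nonempty      : ∃[ K ] K ∈ F
    supergroups   : ∀ K K′ → C K′ → K ∈ F → IsSubgroup P H K′ → K ⊆ K′ → K′ ∈ F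
    intersections : ∀ K K′ → K ∈ F → K′ ∈ F → ⦅ K ∣ (λ π → Lift (lsuc 0ℓ) (π ∈ K′)) ⦆∈ F
    -- τ = π σ π⁻¹ is expressed as τ π = π σ
    conjugates    : ∀ K π → K ∈ F → π ∈ H →
                    ⦅ H ∣ (λ τ → ∃[ σ ] σ ∈ K × (∃[ ρ ] IsComp ρ τ π × IsComp ρ π σ)) ⦆∈ F
    nontrivial    : ∀ K → K ∈ F → ¬ (∀ π → π ∈ K → IsId P π)

-- A pair ⟨ p , y ⟩ has y as an element of an element, which gives the
-- structural recursion  rec x = { out i (rec y) ∣ i ∈ I , ⟨ cond i , y ⟩ ∈ x }.

module _ (I : Set) (cond : I → 𝕍) (out : I → 𝕍 → 𝕍) where

  nameRec  : 𝕍 → 𝕍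
  nameRec₂ : (z : 𝕍) (b : idx z) → idx (elt z b) → 𝕍
  nameRec₁ : (z : 𝕍) → idx z → 𝕍

  nameRec (sup A f) =
    sup (Σ[ a ∈ A ] Σ[ b ∈ idx (f a) ] Σ[ c ∈ idx (elt (f a) b) ] Σ[ i ∈ I ]
           f a ≐ ⟨ cond i , elt (elt (f a) b) c ⟩)
        λ { (a , b , c , i , _) → out i (nameRec₂ (f a) b c) }
  nameRec₂ (sup B g) b c = nameRec₁ (g b) c
  nameRec₁ (sup C h) c   = nameRec (h c)

-- val G x = { val G y ∣ p ∈ G , ⟨ p , y ⟩ ∈ x }
val : 𝕍 → 𝕍 → 𝕍
val G = nameRec (idx G) (elt G) (λ _ y → y)

-- act P π x = { ⟨ π p , act P π y ⟩ ∣ p ∈ P , ⟨ p , y ⟩ ∈ x }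
act : 𝕍 → 𝕍 → 𝕍 → 𝕍
act P π = nameRec
  (Σ[ i ∈ idx P ] Σ[ j ∈ idx P ] ⟨ elt P i , elt P j ⟩ ∈ π)
  (λ { (i , _ , _) → elt P i })
  (λ { (_ , j , _) y → ⟨ elt P j , y ⟩ })

data IsName (P : 𝕍) : 𝕍 → Set₁ where
  name : ∀ {x} → (∀ z → z ∈ x → ∃[ p ] ∃[ y ] p ∈ P × z ≐ ⟨ p , y ⟩ × IsName P y) → IsName P x

module _ (V : Class) (S : SymmetricSystem) where
  open SymmetricSystem S

  IsSymmetric : 𝕍 → Set₁
  IsSymmetric x = ⦅ H ∣ (λ π → Lift (lsuc 0ℓ) (act P π x ≐ x)) ⦆∈ F

  data IsHereditarilySymmetric : 𝕍 → Set₁ where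
    hs : ∀ {x} → IsSymmetric x →
         (∀ p y → ⟨ p , y ⟩ ∈ x → IsHereditarilySymmetric y) → IsHereditarilySymmetric x

  IsDense : 𝕍 → Set₁
  IsDense D = D ⊆ P × (∀ p → p ∈ P → ∃[ q ] q ∈ D × ⟨ q , p ⟩ ∈ ≤P)

  record IsGeneric (G : 𝕍) : Set₁ where
    field
      subset   : G ⊆ P
      nonempty : ∃[ p ] p ∈ G
      upward   : ∀ p q → p ∈ G → q ∈ P → ⟨ p , q ⟩ ∈ ≤P → q ∈ G
      directed : ∀ p q → p ∈ G → q ∈ G → ∃[ r ] r ∈ G × ⟨ r , p ⟩ ∈ ≤P × ⟨ r , q ⟩ ∈ ≤P
      generic  : ∀ D → V D → IsDense D → ∃[ p ] p ∈ G × p ∈ D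

  GenericExtension : 𝕍 → Class
  GenericExtension G x = ∃[ ẋ ] V ẋ × IsName P ẋ × x ≐ val G ẋ

  SymmetricExtension : 𝕍 → Class
  SymmetricExtension G x = ∃[ ẋ ] V ẋ × IsName P ẋ × IsHereditarilySymmetric ẋ × x ≐ val G ẋ

HasSymmetricCopy : (V W V[G] : Class) → Language → Structure → (𝓖 𝓘 : 𝕍) → Set₁
HasSymmetricCopy V W V[G] L M 𝓖 𝓘 =
  ∃[ N ] IsStructureIn W L N ×
  (∃[ f ] V[G] f × IsIso L M N f ×
   (∀ k X → W X → SubsetOfPower k (dom N) X →
    ∃[ X* ] V[G] X* × SubsetOfPower k (dom M) X* × Carries k f X* X ×
    (∃[ K ] IsLargeIn V (dom M) 𝓖 𝓘 K × (∀ π → π ∈ K → Carries k π X* X*))))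
  where open Structure

NoNewSubsets : (V V[G] : Class) → 𝕍 → Set₁
NoNewSubsets V V[G] A = ∀ X → V[G] X → X ⊆ A → V X

-- "There is a symmetric extension W of V such that Φ W V[G]": some symmetric
-- system in V has this property for every V-generic G, and such a G exists as
-- soon as V is countable.
ThereIsSymmetricExtension : Class → (Φ : (W V[G] : Class) → Set₁) → Set₁
ThereIsSymmetricExtension V Φ =
  ∃[ S ] IsSymmetricSystemIn V S ×
  (Countable V → ∃[ G ] IsGeneric V S G) ×
  (∀ G → IsGeneric V S G →
     let W = SymmetricExtension V S G; V[G] = GenericExtension V S G in
     V ⊑ W × W ⊑ V[G] × Φ W V[G])

{-# OPTIONS --safe #-}
module Submission where

-- Write D for the domain of M and I for the power set of a set B ⊇ D closed under pairing.  Force with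
-- small partial functions (D ∪ {⋆}) × I × I → 2, where small means covered by B (the extra point ⋆ is D
-- itself).  The group consists of the permutations of the atoms (D ∪ {⋆}) × I that lie over an element of 𝓖,
-- the filter is generated by the pointwise stabilisers of A × I for A in the largest 𝓖-invariant subideal of
-- 𝓘, and m ∈ D is copied to the set of the generic subsets of I indexed by {m} × I.
-- Forcing equality is taken to be the greatest forcing bisimulation, a set in V; instead of a symmetry lemma
-- for the forcing relation, the truth lemma is applied to the generic filter σ⁻¹G.  Conditions supported
-- off A × I are made compatible by translating the fibres by a fresh symmetric difference, so membership in
-- a symmetric subset of Nᵏ only depends on the support, and the subset is stable under a large group.
-- A Zorn argument along chains of small conditions shows that no new subsets of D appear, and it builds the
-- long chains of DC<κ, whose supports have their union in 𝓘 by completeness.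

open import Defs
open import Level using (Level; Lift; lift; 0ℓ; _⊔_) renaming (suc to lsuc)
open import Axiom.ExcludedMiddle using (ExcludedMiddle)
open import Data.Bool using (true; false)
open import Data.Empty using (⊥; ⊥-elim)
open import Data.Fin using (Fin; zero; suc; _↑ˡ_; _↑ʳ_; splitAt)
open import Data.Maybe using (just; nothing)
open import Data.Nat using (ℕ; zero; suc; _+_)
open import Data.Nat.Properties using (+-comm)
open import Data.Product using (Σ; ∃; ∃-syntax; Σ-syntax; _×_; _,_; proj₁; proj₂)
open import Data.Sum using (_⊎_; inj₁; inj₂; [_,_]′)
open import Data.Vec using (Vec; []; _∷_; lookup; tabulate; _++_; map)
open import Data.Vec.Properties using (lookup-++ˡ; lookup-++ʳ; lookup-splitAt; lookup∘tabulate)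
open import Data.Vec.Relation.Binary.Pointwise.Inductive using (Pointwise; []; _∷_)
open import Data.Vec.Relation.Unary.All using (All; []; _∷_)
import Data.Vec.Relation.Unary.All.Properties as All
open import Function.Bundles using (_⇔_; mk⇔; Equivalence)
open import Relation.Binary.PropositionalEquality using (_≡_; refl; sym; trans; cong; subst; subst₂)
open import Relation.Nullary using (¬_; Dec; yes; no)


infix 4 _≈_ _∊_ _⊂_
infix 1 _⟺_

-- Record wrappers: _≐_ and _∈_ compute, which would block unification.
record _≈_ (x y : 𝕍) : Set where
  constructor eq
  field uneq : x ≐ y
open _≈_ public

record _∊_ (x y : 𝕍) : Set where
  constructor mem
  field unmem : x ∈ y
open _∊_ public

_⟺_ : ∀ {a b} → Set a → Set b → Set (a ⊔ b)
A ⟺ B = (A → B) × (B → A)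

to⇔ : ∀ {a b} {A : Set a} {B : Set b} → A ⟺ B → A ⇔ B
to⇔ (f , g) = mk⇔ f g

of⇔ : ∀ {a b} {A : Set a} {B : Set b} → A ⇔ B → A ⟺ B
of⇔ e = Equivalence.to e , Equivalence.from e

_⊂_ : 𝕍 → 𝕍 → Set₁
x ⊂ y = ∀ z → z ∊ x → z ∊ y

private
  ≐-refl : ∀ x → x ≐ x
  ≐-refl (sup A f) = (λ a → a , ≐-refl (f a)) , (λ a → a , ≐-refl (f a))

  ≐-sym : ∀ x y → x ≐ y → y ≐ x
  ≐-sym (sup A f) (sup B g) (p , q) =
    (λ b → proj₁ (q b) , ≐-sym _ _ (proj₂ (q b))) ,
    (λ a → proj₁ (p a) , ≐-sym _ _ (proj₂ (p a)))

  ≐-trans : ∀ x y z → x ≐ y → y ≐ z → x ≐ z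
  ≐-trans (sup A f) (sup B g) (sup C h) (p , q) (r , s) =
    (λ a → let (b , u) = p a ; (c , v) = r b in c , ≐-trans (f a) (g b) (h c) u v) ,
    (λ c → let (b , v) = s c ; (a , u) = q b in a , ≐-trans (f a) (g b) (h c) u v)

  ∈-respʳ : ∀ x y z → y ≐ z → x ∈ y → x ∈ z
  ∈-respʳ x (sup A f) (sup B g) (p , q) (a , u) =
    let (b , v) = p a in b , ≐-trans x (f a) (g b) u v

≈refl : ∀ {x} → x ≈ x
≈refl {x} = eq (≐-refl x)

≈sym : ∀ {x y} → x ≈ y → y ≈ x
≈sym {x} {y} (eq p) = eq (≐-sym x y p)

≈trans : ∀ {x y z} → x ≈ y → y ≈ z → x ≈ z
≈trans {x} {y} {z} (eq p) (eq q) = eq (≐-trans x y z p q)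

∊l : ∀ {x y z} → x ≈ y → x ∊ z → y ∊ z
∊l {x} {y} p (mem (i , q)) = mem (i , uneq (≈trans (≈sym p) (eq q)))

∊r : ∀ {x y z} → y ≈ z → x ∊ y → x ∊ z
∊r {x} {y} {z} (eq p) (mem q) = mem (∈-respʳ x y z p q)

elt∊ : ∀ x i → elt x i ∊ x
elt∊ x i = mem (i , ≐-refl (elt x i))

∊idx : ∀ {z x} → z ∊ x → Σ[ i ∈ idx x ] z ≈ elt x i
∊idx (mem (i , p)) = i , eq p

idx∊ : ∀ {z x} (i : idx x) → z ≈ elt x i → z ∊ x
idx∊ i (eq p) = mem (i , p)

≈ext : ∀ {x y} → x ⊂ y → y ⊂ x → x ≈ y
≈ext {sup A f} {sup B g} p q = eq
  ((λ a → unmem (p (f a) (elt∊ (sup A f) a))) ,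
   (λ b → let (a , u) = unmem (q (g b) (elt∊ (sup B g) b)) in a , ≐-sym _ _ u))

∈-ind : ∀ {ℓ} (Q : 𝕍 → Set ℓ) → (∀ x → (∀ y → y ∊ x → Q y) → Q x) → ∀ x → Q x
∈-ind Q step x = go x x ≈refl
  where
  go : ∀ x y → y ≈ x → Q y
  go (sup A f) y e = step y λ z z∊y →
    let (a , u) = ∊idx (∊r e z∊y) in go (f a) z u

∊-irrefl : ∀ x → ¬ x ∊ x
∊-irrefl = ∈-ind _ λ x ih p → ih x p p

∊-asym : ∀ x y → x ∊ y → ¬ y ∊ x
∊-asym = ∈-ind _ λ x ih y p q → ih y q x q p

∉∅ : ∀ {z} → ¬ z ∊ ∅
∉∅ (mem (() , _))

infix 5 ⟪_,_⟫

opaque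
  up : 𝕍 → 𝕍 → 𝕍
  up = ｛_,_｝

  ⟪_,_⟫ : 𝕍 → 𝕍 → 𝕍
  ⟪ x , y ⟫ = ⟨ x , y ⟩

  up≡ : ∀ {x y} → up x y ≡ ｛ x , y ｝
  up≡ = refl

  ⟪⟫≡ : ∀ {x y} → ⟪ x , y ⟫ ≡ ⟨ x , y ⟩
  ⟪⟫≡ = refl

  ⟪⟫≡up : ∀ {x y} → ⟪ x , y ⟫ ≡ up (up x x) (up x y)
  ⟪⟫≡up = refl

  ∊up : ∀ {x y z} → z ∊ up x y → z ≈ x ⊎ z ≈ y
  ∊up (mem (true , p)) = inj₁ (eq p)
  ∊up (mem (false , p)) = inj₂ (eq p)

  upl : ∀ {x y z} → z ≈ x → z ∊ up x y
  upl (eq p) = mem (true , p)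

  upr : ∀ {x y z} → z ≈ y → z ∊ up x y
  upr (eq p) = mem (false , p)

  ∊sing : ∀ {x z} → z ∊ up x x → z ≈ x
  ∊sing p with ∊up p
  ... | inj₁ q = q
  ... | inj₂ q = q

  up-cong : ∀ {x y x′ y′} → x ≈ x′ → y ≈ y′ → up x y ≈ up x′ y′
  up-cong p q = ≈ext (half p q) (half (≈sym p) (≈sym q))
    where
    half : ∀ {x y x′ y′} → x ≈ x′ → y ≈ y′ → up x y ⊂ up x′ y′
    half p q z m with ∊up m
    ... | inj₁ r = upl (≈trans r p)
    ... | inj₂ r = upr (≈trans r q)

  ⟪⟫-cong : ∀ {x y x′ y′} → x ≈ x′ → y ≈ y′ → ⟪ x , y ⟫ ≈ ⟪ x′ , y′ ⟫
  ⟪⟫-cong p q = up-cong (up-cong p p) (up-cong p q)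

  sing-inj : ∀ {x y z} → up x x ≈ up y z → x ≈ y × x ≈ z
  sing-inj p = ≈sym (∊sing (∊r (≈sym p) (upl ≈refl))) , ≈sym (∊sing (∊r (≈sym p) (upr ≈refl)))

  ⟪⟫-inj : ∀ {x y x′ y′} → ⟪ x , y ⟫ ≈ ⟪ x′ , y′ ⟫ → x ≈ x′ × y ≈ y′
  ⟪⟫-inj {x} {y} {x′} {y′} p = a , b
    where
    a : x ≈ x′
    a with ∊up (∊r p (upl ≈refl))
    ... | inj₁ q = proj₁ (sing-inj q)
    ... | inj₂ q = proj₁ (sing-inj q)
    b : y ≈ y′
    b with ∊up (∊r p (upr ≈refl)) | ∊up (∊r (≈sym p) (upr ≈refl))
    ... | inj₂ q | _ with ∊up (∊r q (upr ≈refl))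
    ...   | inj₂ r = r
    ...   | inj₁ r with ∊up (∊r (≈sym q) (upr ≈refl))
    ...     | inj₁ s = ≈trans r (≈trans (≈sym a) (≈sym s))
    ...     | inj₂ s = ≈sym s
    b | inj₁ q | inj₁ r =
      ≈trans (≈sym (proj₂ (sing-inj (≈sym q)))) (≈trans (≈sym a) (proj₂ (sing-inj (≈sym r))))
    b | inj₁ q | inj₂ r with ∊up (∊r r (upr ≈refl))
    ... | inj₁ s = ≈trans (≈sym (proj₂ (sing-inj (≈sym q)))) (≈sym (≈trans s a))
    ... | inj₂ s = ≈sym s

  ⟪⟫-resp : ∀ {x y x′ y′ z} → x ≈ x′ → y ≈ y′ → ⟪ x , y ⟫ ∊ z → ⟪ x′ , y′ ⟫ ∊ z
  ⟪⟫-resp p q = ∊l (⟪⟫-cong p q)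

  ⟪⟫≉∅ : ∀ {x y} → ¬ ⟪ x , y ⟫ ≈ ∅
  ⟪⟫≉∅ p = ∉∅ (∊r p (upl ≈refl))

in⟨ : ∀ {x y z} → ⟨ x , y ⟩ ∈ z → ⟪ x , y ⟫ ∊ z
in⟨ {x} {y} {z} p = subst (_∊ z) (sym ⟪⟫≡) (mem p)

out⟨ : ∀ {x y z} → ⟪ x , y ⟫ ∊ z → ⟨ x , y ⟩ ∈ z
out⟨ {x} {y} {z} p = unmem (subst (_∊ z) ⟪⟫≡ p)

≈⟨ : ∀ {x y z} → z ≐ ⟨ x , y ⟩ → z ≈ ⟪ x , y ⟫
≈⟨ {x} {y} {z} p = subst (z ≈_) (sym ⟪⟫≡) (eq p)

≐⟨ : ∀ {x y z} → z ≈ ⟪ x , y ⟫ → z ≐ ⟨ x , y ⟩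
≐⟨ {x} {y} {z} p = uneq (subst (z ≈_) ⟪⟫≡ p)

⟪⟫∋ : ∀ {x y} → up x y ∊ ⟪ x , y ⟫
⟪⟫∋ {x} {y} = subst (up x y ∊_) (sym ⟪⟫≡up) (upr ≈refl)

pair-ind : ∀ {ℓ} (Q : 𝕍 → Set ℓ) →
  (∀ x → (∀ s z → ⟪ s , z ⟫ ∊ x → Q z) → Q x) → ∀ x → Q x
pair-ind Q step x = proj₁ (∈-ind Q′ step′ x)
  where
  Q′ : 𝕍 → Set _
  Q′ x = Q x × (∀ y → y ∊ x → Q y) × (∀ y → y ∊ x → ∀ z → z ∊ y → Q z)
  step′ : ∀ x → (∀ y → y ∊ x → Q′ y) → Q′ x
  step′ x ih =
    step x (λ s z m → proj₂ (proj₂ (ih _ m)) _ ⟪⟫∋ z (upr ≈refl)) ,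
    (λ y m → proj₁ (ih y m)) , (λ y m → proj₁ (proj₂ (ih y m)))

infixr 6 _∪_
infixr 7 _⊗_

opaque
  _∪_ : 𝕍 → 𝕍 → 𝕍
  x ∪ y = sup (idx x ⊎ idx y) λ { (inj₁ i) → elt x i ; (inj₂ j) → elt y j }

  ∊∪ : ∀ {x y z} → z ∊ x ∪ y → z ∊ x ⊎ z ∊ y
  ∊∪ (mem (inj₁ i , p)) = inj₁ (mem (i , p))
  ∊∪ (mem (inj₂ i , p)) = inj₂ (mem (i , p))

  ∪l : ∀ {x y z} → z ∊ x → z ∊ x ∪ y
  ∪l (mem (i , p)) = mem (inj₁ i , p)

  ∪r : ∀ {x y z} → z ∊ y → z ∊ x ∪ y
  ∪r (mem (i , p)) = mem (inj₂ i , p)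

  ⋃ : 𝕍 → 𝕍
  ⋃ x = sup (Σ[ i ∈ idx x ] idx (elt x i)) λ (i , j) → elt (elt x i) j

  ∊⋃ : ∀ {x z} → z ∊ ⋃ x → ∃[ y ] y ∊ x × z ∊ y
  ∊⋃ {x} (mem ((i , j) , p)) = elt x i , elt∊ x i , mem (j , p)

  ⋃i : ∀ {x y z} → y ∊ x → z ∊ y → z ∊ ⋃ x
  ⋃i {x} p q with ∊idx p
  ... | i , e with ∊idx (∊r e q)
  ... | j , e′ = idx∊ (i , j) e′

  img : 𝕍 → (𝕍 → 𝕍) → 𝕍
  img a t = sup (idx a) λ i → t (elt a i)

  ∊img : ∀ {a t z} → z ∊ img a t → ∃[ x ] x ∊ a × z ≈ t x
  ∊img {a} (mem (i , p)) = elt a i , elt∊ a i , eq p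

  img-i : ∀ {a t x z} → (∀ y → y ∊ a → x ≈ y → t x ≈ t y) → x ∊ a → z ≈ t x → z ∊ img a t
  img-i {a} r p q = let (i , e) = ∊idx p in idx∊ i (≈trans q (r _ (elt∊ a i) e))

  _⊗_ : 𝕍 → 𝕍 → 𝕍
  a ⊗ b = ⋃ (img a λ x → img b λ y → ⟪ x , y ⟫)

  ∊⊗ : ∀ {a b z} → z ∊ a ⊗ b → ∃[ x ] ∃[ y ] x ∊ a × y ∊ b × z ≈ ⟪ x , y ⟫
  ∊⊗ m with ∊⋃ m
  ... | w , p , q with ∊img p
  ... | x , xa , e with ∊img (∊r e q)
  ... | y , yb , e′ = x , y , xa , yb , e′

  ⊗i : ∀ {a b x y} → x ∊ a → y ∊ b → ⟪ x , y ⟫ ∊ a ⊗ b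
  ⊗i {a} {b} p q with ∊idx p | ∊idx q
  ... | i , e | j , e′ = idx∊ (i , j) (⟪⟫-cong e e′)

  ⊗e : ∀ {a b x y} → ⟪ x , y ⟫ ∊ a ⊗ b → x ∊ a × y ∊ b
  ⊗e m with ∊⊗ m
  ... | x , y , p , q , e with ⟪⟫-inj e
  ... | u , v = ∊l (≈sym u) p , ∊l (≈sym v) q

∊num-suc : ∀ n {z} → z ∊ num (suc n) → z ∊ num n ⊎ z ≈ num n
∊num-suc n (mem (just i , p)) = inj₁ (mem (i , p))
∊num-suc n (mem (nothing , p)) = inj₂ (eq p)

num-l : ∀ n {z} → z ∊ num n → z ∊ num (suc n)
num-l n (mem (i , p)) = mem (just i , p)

num-r : ∀ n {z} → z ≈ num n → z ∊ num (suc n)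
num-r n (eq p) = mem (nothing , p)

module _ (I : Set) (cond : I → 𝕍) (out : I → 𝕍 → 𝕍)
  (out-cong : ∀ i {x y} → x ≈ y → out i x ≈ out i y) where

  private
    rec : 𝕍 → 𝕍
    rec = nameRec I cond out

    rec₁ : ∀ w c → nameRec₁ I cond out w c ≡ rec (elt w c)
    rec₁ (sup C h) c = refl

    rec₂ : ∀ z b c → nameRec₂ I cond out z b c ≡ rec (elt (elt z b) c)
    rec₂ (sup B g) b c = rec₁ (g b) c

  nameRec⇒ : ∀ {x z} → z ∊ rec x → Σ[ i ∈ I ] ∃[ y ] ⟪ cond i , y ⟫ ∊ x × z ≈ out i (rec y)
  nameRec⇒ {sup A f} {z} (mem ((a , b , c , i , e) , p)) =
    i , elt (elt (f a) b) c , idx∊ {x = sup A f} a (≈sym (≈⟨ e)) , subst (λ w → z ≈ out i w) (rec₂ (f a) b c) (eq p)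

  private
    rep : ∀ {x i y} → ⟪ cond i , y ⟫ ∊ x →
      ∃[ y′ ] y ≈ y′ × ⟪ cond i , y′ ⟫ ∊ x × (∀ {z} → z ≈ out i (rec y′) → z ∊ rec x)
    rep {sup A f} {i} {y} m with ∊idx m
    ... | a , e with ∊idx (∊r e ⟪⟫∋)
    ... | b , e₁ with ∊idx (∊r e₁ (upr ≈refl))
    ... | c , e₂ = elt (elt (f a) b) c , e₂ , ⟪⟫-resp ≈refl e₂ m ,
      λ {z} q → mem ((a , b , c , i , ≐⟨ (≈trans (≈sym e) (⟪⟫-cong ≈refl e₂))) ,
        uneq (subst (λ w → z ≈ out i w) (sym (rec₂ (f a) b c)) q))

  nameRec-cong : ∀ {x y} → x ≈ y → rec x ≈ rec y
  nameRec-cong {x} {y} = pair-ind (λ x → ∀ y → x ≈ y → rec x ≈ rec y) step x y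
    where
    step : ∀ x → (∀ s z → ⟪ s , z ⟫ ∊ x → ∀ y → z ≈ y → rec z ≈ rec y) → ∀ y → x ≈ y → rec x ≈ rec y
    step x ih y e = ≈ext
      (λ z p → let (i , w , m , q) = nameRec⇒ p
                   (w′ , e′ , m′ , k) = rep (∊r e m)
               in k (≈trans q (out-cong i (ih _ w m w′ e′))))
      (λ z p → let (i , w , m , q) = nameRec⇒ p
                   (w′ , e′ , m′ , k) = rep (∊r (≈sym e) m)
               in k (≈trans q (out-cong i (≈sym (ih _ w′ m′ w (≈sym e′))))))

  nameRec⇐ : ∀ {x z} i y → ⟪ cond i , y ⟫ ∊ x → z ≈ out i (rec y) → z ∊ rec x
  nameRec⇐ i y m q = let (y′ , e , _ , k) = rep m in k (≈trans q (out-cong i (nameRec-cong e)))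

opaque
  Val : 𝕍 → 𝕍 → 𝕍
  Val = val

  Val≡ : ∀ {G x} → Val G x ≡ val G x
  Val≡ = refl

  Act : 𝕍 → 𝕍 → 𝕍 → 𝕍
  Act = act

  Act≡ : ∀ {P π x} → Act P π x ≡ act P π x
  Act≡ = refl

module _ {G : 𝕍} where
  private
    oc : ∀ (i : idx G) {x y} → x ≈ y → x ≈ y
    oc _ e = e

  opaque
    unfolding Val
    val-cong : ∀ {x y} → x ≈ y → Val G x ≈ Val G y
    val-cong = nameRec-cong (idx G) (elt G) (λ _ y → y) oc

    ∊val : ∀ {x z} → z ∊ Val G x → ∃[ p ] ∃[ y ] p ∊ G × ⟪ p , y ⟫ ∊ x × z ≈ Val G y
    ∊val m = let (i , y , p , e) = nameRec⇒ (idx G) (elt G) (λ _ y → y) oc m in elt G i , y , elt∊ G i , p , e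

    val-i : ∀ {x z p y} → p ∊ G → ⟪ p , y ⟫ ∊ x → z ≈ Val G y → z ∊ Val G x
    val-i {y = y} p m e = let (i , q) = ∊idx p in
      nameRec⇐ (idx G) (elt G) (λ _ y → y) oc i y (⟪⟫-resp q ≈refl m) e

⟨⟩-cong : ∀ {x y x′ y′} → x ≈ x′ → y ≈ y′ → ⟨ x , y ⟩ ≈ ⟨ x′ , y′ ⟩
⟨⟩-cong {x} {y} {x′} {y′} e e′ = subst (_≈ ⟨ x′ , y′ ⟩) ⟪⟫≡ (subst (⟪ x , y ⟫ ≈_) ⟪⟫≡ (⟪⟫-cong e e′))

module _ {P π : 𝕍} where
  private
    I : Set
    I = Σ[ i ∈ idx P ] Σ[ j ∈ idx P ] ⟨ elt P i , elt P j ⟩ ∈ π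

  opaque
    unfolding Act
    act-cong : ∀ {x y} → x ≈ y → Act P π x ≈ Act P π y
    act-cong = nameRec-cong I _ _ λ { (i , j , p) e → ⟨⟩-cong ≈refl e }

    ∊act : ∀ {x z} → z ∊ Act P π x →
      ∃[ p ] ∃[ p′ ] ∃[ y ] p ∊ P × p′ ∊ P × ⟪ p , p′ ⟫ ∊ π × ⟪ p , y ⟫ ∊ x × z ≈ ⟪ p′ , Act P π y ⟫
    ∊act {x} {z} m =
      let ((i , j , q) , y , p , e) = nameRec⇒ I _ _ (λ { (i , j , p) e → ⟨⟩-cong ≈refl e }) m in
      elt P i , elt P j , y , elt∊ P i , elt∊ P j , in⟨ q , p , subst (z ≈_) (sym ⟪⟫≡) e

    act-i : ∀ {x z p p′ y} → p ∊ P → p′ ∊ P → ⟪ p , p′ ⟫ ∊ π → ⟪ p , y ⟫ ∊ x → z ≈ ⟪ p′ , Act P π y ⟫ → z ∊ Act P π x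
    act-i {x} {z} {p} {p′} {y} pP pP′ m q e =
      let (i , ei) = ∊idx pP ; (j , ej) = ∊idx pP′ in
      nameRec⇐ I _ _ (λ { (i , j , p) e → ⟨⟩-cong ≈refl e }) (i , j , out⟨ (⟪⟫-resp ei ej m)) y (⟪⟫-resp ei ≈refl q)
        (subst (z ≈_) ⟪⟫≡ (≈trans e (⟪⟫-cong ej ≈refl)))

name-cong : ∀ {P x y} → x ≈ y → IsName P x → IsName P y
name-cong e (name h) = name λ z m → h z (unmem (∊r (≈sym e) (mem m)))

name⇒ : ∀ {P x z} → IsName P x → z ∊ x → ∃[ p ] ∃[ y ] p ∊ P × z ≈ ⟪ p , y ⟫ × IsName P y
name⇒ (name h) (mem m) = let (p , y , q , e , k) = h _ m in p , y , mem q , ≈⟨ e , k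

name-sub : ∀ {P x p y} → IsName P x → ⟪ p , y ⟫ ∊ x → IsName P y
name-sub n m = let (p , y , q , e , k) = name⇒ n m in name-cong (≈sym (proj₂ (⟪⟫-inj e))) k

name-i : ∀ {P x} → (∀ z → z ∊ x → ∃[ p ] ∃[ y ] p ∊ P × z ≈ ⟪ p , y ⟫ × IsName P y) → IsName P x
name-i h = name λ z m → let (p , y , q , e , k) = h z (mem m) in p , y , unmem q , ≐⟨ e , k

unAct : ∀ {P π x y} → Act P π x ≈ y → act P π x ≐ y
unAct {y = y} e = uneq (subst (_≈ y) Act≡ e)

mkAct : ∀ {P π x y} → act P π x ≐ y → Act P π x ≈ y
mkAct {y = y} e = subst (_≈ y) (sym Act≡) (eq e)

unVal : ∀ {G x y} → y ≈ Val G x → y ≐ val G x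
unVal {y = y} e = uneq (subst (y ≈_) Val≡ e)

mkVal : ∀ {G x y} → y ≐ val G x → y ≈ Val G x
mkVal {y = y} e = subst (y ≈_) (sym Val≡) (eq e)

module Universe (em : ExcludedMiddle (lsuc 0ℓ)) (V : Class) (tr : IsTransitive V) (zfc : IsZFC V) where

 module Definability where
  private variable
    n m k : ℕ
    a b ℓ : Level

  dec₀ : (A : Set) → Dec A
  dec₀ A with em {Lift (lsuc 0ℓ) A}
  ... | yes (lift x) = yes x
  ... | no x = no λ y → x (lift y)

  dec₁ : (A : Set₁) → Dec A
  dec₁ A = em

  V≈ : ∀ {x y} → x ≈ y → V x → V y
  V≈ (eq p) = IsTransitive.respects tr _ _ p

  V∊ : ∀ {x y} → V x → y ∊ x → V y
  V∊ v (mem p) = IsTransitive.transitive tr _ _ v p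

  V⟨l : ∀ {x y} → V ⟪ x , y ⟫ → V x
  V⟨l v = V∊ (V∊ v ⟪⟫∋) (upl ≈refl)

  V⟨r : ∀ {x y} → V ⟪ x , y ⟫ → V y
  V⟨r v = V∊ (V∊ v ⟪⟫∋) (upr ≈refl)

  private
    liftR : (Fin n → Fin m) → Fin (suc n) → Fin (suc m)
    liftR r zero = zero
    liftR r (suc i) = suc (r i)

    ren : (Fin n → Fin m) → Formula n → Formula m
    ren r (i ∈̇ j) = r i ∈̇ r j
    ren r (i ≐̇ j) = r i ≐̇ r j
    ren r ⊥̇ = ⊥̇
    ren r (φ ⇒̇ ψ) = ren r φ ⇒̇ ren r ψ
    ren r (∀̇ φ) = ∀̇ ren (liftR r) φ

    sat-ren : ∀ (φ : Formula n) (r : Fin n → Fin m) {ρ ρ′} →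
      (∀ i → lookup ρ′ (r i) ≡ lookup ρ i) → Sat V (ren r φ) ρ′ ⟺ Sat V φ ρ
    sat-ren (i ∈̇ j) r e rewrite e i | e j = (λ x → x) , (λ x → x)
    sat-ren (i ≐̇ j) r e rewrite e i | e j = (λ x → x) , (λ x → x)
    sat-ren ⊥̇ r e = (λ x → x) , (λ x → x)
    sat-ren (φ ⇒̇ ψ) r e =
      (λ f x → proj₁ (sat-ren ψ r e) (f (proj₂ (sat-ren φ r e) x))) ,
      (λ f x → proj₂ (sat-ren ψ r e) (f (proj₁ (sat-ren φ r e) x)))
    sat-ren {n} {m} (∀̇ φ) r {ρ} {ρ′} e =
      (λ f x v → proj₁ (sat-ren φ (liftR r) (e′ x)) (f x v)) ,
      (λ f x v → proj₂ (sat-ren φ (liftR r) (e′ x)) (f x v))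
      where
      e′ : ∀ x i → lookup (x ∷ ρ′) (liftR r i) ≡ lookup (x ∷ ρ) i
      e′ x zero = refl
      e′ x (suc i) = e i

    sat-resp : ∀ (φ : Formula n) {ρ ρ′ : Vec 𝕍 n} →
      (∀ i → lookup ρ i ≈ lookup ρ′ i) → Sat V φ ρ → Sat V φ ρ′
    sat-resp (i ∈̇ j) e (lift p) = lift (unmem (∊l (e i) (∊r (e j) (mem p))))
    sat-resp (i ≐̇ j) e (lift p) = lift (uneq (≈trans (≈sym (e i)) (≈trans (eq p) (e j))))
    sat-resp ⊥̇ e x = x
    sat-resp (φ ⇒̇ ψ) e f x = sat-resp ψ e (f (sat-resp φ (λ i → ≈sym (e i)) x))
    sat-resp (∀̇ φ) e f x v = sat-resp φ (λ { zero → ≈refl ; (suc i) → e i }) (f x v)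

    emb : ∀ n {m k} → (Fin m → Fin k) → Fin (n + m) → Fin (n + k)
    emb zero f i = f i
    emb (suc n) f zero = zero
    emb (suc n) f (suc i) = suc (emb n f i)

  Env : ℕ → Set₁
  Env n = Fin n → 𝕍

  infixr 5 _◂_
  _◂_ : {A : Fin (suc n) → Set a} → A zero → (∀ i → A (suc i)) → ∀ i → A i
  (x ◂ ρ) zero = x
  (x ◂ ρ) (suc i) = ρ i

  ∅ₑ : {A : Fin 0 → Set a} → ∀ i → A i
  ∅ₑ ()

  VEnv : Env n → Set₁
  VEnv ρ = ∀ i → V (ρ i)

  private
    lookup-emb : ∀ {n m k} (ρ : Env n) (f : Fin m → Fin k) {ps : Vec 𝕍 m} {qs : Vec 𝕍 k} →
      (∀ j → lookup qs (f j) ≡ lookup ps j) →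
      ∀ i → lookup (tabulate ρ ++ qs) (emb n f i) ≡ lookup (tabulate ρ ++ ps) i
    lookup-emb {zero} ρ f e i = e i
    lookup-emb {suc n} ρ f e zero = refl
    lookup-emb {suc n} ρ f e (suc i) = lookup-emb (λ i → ρ (suc i)) f e i

    lookup-env : (ρ : Env n) (ps : Vec 𝕍 m) (i : Fin n) → lookup (tabulate ρ ++ ps) (i ↑ˡ m) ≡ ρ i
    lookup-env ρ ps i = trans (lookup-++ˡ (tabulate ρ) ps i) (lookup∘tabulate ρ i)

  record Def {n ℓ} (R : Env n → Set ℓ) : Set (lsuc 0ℓ ⊔ ℓ) where
    constructor mkDef
    field
      {#ps} : ℕ
      ps  : Vec 𝕍 #ps
      Vps : All V ps
      φ   : Formula (n + #ps)
      sat : ∀ ρ → VEnv ρ → R ρ ⟺ Sat V φ (tabulate ρ ++ ps)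

  opaque
    dMap : {A : Env n → Set a} {B : Env n → Set b} →
      (∀ ρ → VEnv ρ → A ρ ⟺ B ρ) → Def A → Def B
    dMap f (mkDef ps Vps φ sat) = mkDef ps Vps φ λ ρ v →
      (λ x → proj₁ (sat ρ v) (proj₂ (f ρ v) x)) , (λ x → proj₁ (f ρ v) (proj₂ (sat ρ v) x))

    decDef : {A : Env n → Set a} → Def A → ∀ ρ → VEnv ρ → Dec (A ρ)
    decDef (mkDef ps Vps φ sat) ρ v with em {Sat V φ (tabulate ρ ++ ps)}
    ... | yes x = yes (proj₂ (sat ρ v) x)
    ... | no x = no λ y → x (proj₁ (sat ρ v) y)

    private
      lookup-≈ : ∀ {n m} (ρ ρ′ : Env n) (ps : Vec 𝕍 m) → (∀ i → ρ i ≈ ρ′ i) →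
        ∀ i → lookup (tabulate ρ ++ ps) i ≈ lookup (tabulate ρ′ ++ ps) i
      lookup-≈ {zero} ρ ρ′ ps e i = ≈refl
      lookup-≈ {suc n} ρ ρ′ ps e zero = e zero
      lookup-≈ {suc n} ρ ρ′ ps e (suc i) = lookup-≈ (λ i → ρ (suc i)) (λ i → ρ′ (suc i)) ps (λ i → e (suc i)) i

    dResp : {A : Env n → Set a} → Def A → ∀ {ρ ρ′} → VEnv ρ → VEnv ρ′ →
      (∀ i → ρ i ≈ ρ′ i) → A ρ → A ρ′
    dResp (mkDef ps Vps φ sat) {ρ} {ρ′} v v′ e x =
      proj₂ (sat ρ′ v′) (sat-resp φ (lookup-≈ ρ ρ′ ps e) (proj₁ (sat ρ v) x))

    private
      d→′ : {A : Env n → Set a} {B : Env n → Set b} → Def A → Def B → Def (λ ρ → A ρ → B ρ)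
      d→′ {n} {A = A} {B} (mkDef {m₁} ps₁ V₁ φ₁ s₁) (mkDef {m₂} ps₂ V₂ φ₂ s₂) =
        mkDef (ps₁ ++ ps₂) (All.++⁺ V₁ V₂) (ren r₁ φ₁ ⇒̇ ren r₂ φ₂) λ ρ v →
          (λ f x → proj₂ (e₂ ρ) (proj₁ (s₂ ρ v) (f (proj₂ (s₁ ρ v) (proj₁ (e₁ ρ) x))))) ,
          (λ f x → proj₂ (s₂ ρ v) (proj₁ (e₂ ρ) (f (proj₂ (e₁ ρ) (proj₁ (s₁ ρ v) x)))))
        where
        r₁ : Fin (n + m₁) → Fin (n + (m₁ + m₂))
        r₁ = emb n (_↑ˡ m₂)
        r₂ : Fin (n + m₂) → Fin (n + (m₁ + m₂))
        r₂ = emb n (m₁ ↑ʳ_)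
        e₁ : ∀ ρ → Sat V (ren r₁ φ₁) (tabulate ρ ++ (ps₁ ++ ps₂)) ⟺ Sat V φ₁ (tabulate ρ ++ ps₁)
        e₁ ρ = sat-ren φ₁ r₁ (lookup-emb ρ (_↑ˡ m₂) (lookup-++ˡ ps₁ ps₂))
        e₂ : ∀ ρ → Sat V (ren r₂ φ₂) (tabulate ρ ++ (ps₁ ++ ps₂)) ⟺ Sat V φ₂ (tabulate ρ ++ ps₂)
        e₂ ρ = sat-ren φ₂ r₂ (lookup-emb ρ (m₁ ↑ʳ_) (lookup-++ʳ ps₁ ps₂))

      dAllV′ : {R : 𝕍 → Env n → Set a} → Def {suc n} (λ ρ → R (ρ zero) (λ i → ρ (suc i))) →
        Def (λ ρ → ∀ z → V z → R z ρ)
      dAllV′ (mkDef ps Vps φ s) = mkDef ps Vps (∀̇ φ) λ ρ v →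
        (λ f x vx → proj₁ (s (x ◂ ρ) (vx ◂ v)) (f x vx)) ,
        (λ f x vx → proj₂ (s (x ◂ ρ) (vx ◂ v)) (f x vx))

      dRen : (r : Fin n → Fin k) {R : Env n → Set a} → Def R → Def (λ ρ → R (λ i → ρ (r i)))
      dRen {n} {k} r (mkDef {m} ps Vps φ sat) = mkDef ps Vps (ren r′ φ) λ ρ v →
        (λ x → proj₂ (sr ρ) (proj₁ (sat _ (λ i → v (r i))) x)) ,
        (λ x → proj₂ (sat _ (λ i → v (r i))) (proj₁ (sr ρ) x))
        where
        r′ : Fin (n + m) → Fin (k + m)
        r′ i = [ (λ j → r j ↑ˡ m) , k ↑ʳ_ ]′ (splitAt n i)
        sr : ∀ ρ → Sat V (ren r′ φ) (tabulate ρ ++ ps) ⟺ Sat V φ (tabulate (λ i → ρ (r i)) ++ ps)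
        sr ρ = sat-ren φ r′ λ i → trans (h i (splitAt n i)) (sym (lookup-splitAt n (tabulate (λ i → ρ (r i))) ps i))
          where
          h : ∀ (i : Fin (n + m)) (x : Fin n ⊎ Fin m) →
            lookup (tabulate ρ ++ ps) ([ (λ j → r j ↑ˡ m) , k ↑ʳ_ ]′ x) ≡ [ lookup (tabulate (λ i → ρ (r i))) , lookup ps ]′ x
          h i (inj₁ j) = trans (lookup-env ρ ps (r j)) (sym (lookup∘tabulate (λ i → ρ (r i)) j))
          h i (inj₂ j) = lookup-++ʳ (tabulate ρ) ps j

    d⊥′ : Def {n} (λ ρ → ⊥)
    d⊥′ = mkDef [] [] ⊥̇ λ ρ v → (λ ()) , (λ { (lift ()) })

    private
      d¬′ : {A : Env n → Set a} → Def A → Def (λ ρ → ¬ A ρ)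
      d¬′ A = d→′ A d⊥′

      dAnd′ : {A : Env n → Set a} {B : Env n → Set b} → Def A → Def B → Def (λ ρ → A ρ × B ρ)
      dAnd′ {A = A} {B} dA dB = dMap (λ ρ v → f ρ v , λ (x , y) g → g x y) (d¬′ (d→′ dA (d¬′ dB)))
        where
        f : ∀ ρ → VEnv ρ → ¬ (A ρ → ¬ B ρ) → A ρ × B ρ
        f ρ v g with decDef dA ρ v | decDef dB ρ v
        ... | yes x | yes y = x , y
        ... | no x | _ = ⊥-elim (g λ y → ⊥-elim (x y))
        ... | _ | no y = ⊥-elim (g λ _ → y)

      dOr′ : {A : Env n → Set a} {B : Env n → Set b} → Def A → Def B → Def (λ ρ → A ρ ⊎ B ρ)
      dOr′ {A = A} {B} dA dB = dMap (λ ρ v → f ρ v , g ρ) (d→′ (d¬′ dA) dB)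
        where
        f : ∀ ρ → VEnv ρ → (¬ A ρ → B ρ) → A ρ ⊎ B ρ
        f ρ v h with decDef dA ρ v
        ... | yes x = inj₁ x
        ... | no x = inj₂ (h x)
        g : ∀ ρ → A ρ ⊎ B ρ → ¬ A ρ → B ρ
        g ρ (inj₁ x) h = ⊥-elim (h x)
        g ρ (inj₂ y) h = y

      dExV′ : {R : 𝕍 → Env n → Set a} → Def {suc n} (λ ρ → R (ρ zero) (λ i → ρ (suc i))) →
        Def (λ ρ → ∃[ z ] V z × R z ρ)
      dExV′ {R = R} d = dMap (λ ρ v → f ρ v , λ (z , vz , x) h → h z vz x) (d¬′ (dAllV′ {R = λ z ρ → ¬ R z ρ} (d¬′ d)))
        where
        f : ∀ ρ → VEnv ρ → ¬ (∀ z → V z → ¬ R z ρ) → ∃[ z ] V z × R z ρ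
        f ρ v h with em {∃[ z ] V z × Sat V (Def.φ d) (z ∷ tabulate ρ ++ Def.ps d)}
        ... | yes (z , vz , x) = z , vz , proj₂ (Def.sat d (z ◂ ρ) (vz ◂ v)) x
        ... | no g = ⊥-elim (h λ z vz x → g (z , vz , proj₁ (Def.sat d (z ◂ ρ) (vz ◂ v)) x))

  record DefT {n} (t : Env n → 𝕍) : Set₁ where
    constructor mkDefT
    field
      closed : ∀ ρ → VEnv ρ → V (t ρ)
      graph  : Def {suc n} (λ ρ → ρ zero ≈ t (λ i → ρ (suc i)))

  private
    dVar≈ : (i j : Fin n) → Def (λ ρ → ρ i ≈ ρ j)
    dVar≈ i j = mkDef [] [] ((i ↑ˡ 0) ≐̇ (j ↑ˡ 0)) λ ρ v →
      (λ { (eq p) → lift (subst₂ _≐_ (sym (lookup-env ρ [] i)) (sym (lookup-env ρ [] j)) p) }) ,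
      (λ { (lift p) → eq (subst₂ _≐_ (lookup-env ρ [] i) (lookup-env ρ [] j) p) })

    dVar∊ : (i j : Fin n) → Def (λ ρ → ρ i ∊ ρ j)
    dVar∊ i j = mkDef [] [] ((i ↑ˡ 0) ∈̇ (j ↑ˡ 0)) λ ρ v →
      (λ { (mem p) → lift (subst₂ _∈_ (sym (lookup-env ρ [] i)) (sym (lookup-env ρ [] j)) p) }) ,
      (λ { (lift p) → mem (subst₂ _∈_ (lookup-env ρ [] i) (lookup-env ρ [] j) p) })

  opaque

    private
      wk₁ : {R : 𝕍 → Env n → Set a} → Def {suc n} (λ ρ → R (ρ zero) (λ i → ρ (suc i))) →
        Def {suc (suc n)} (λ ρ → R (ρ zero) (λ i → ρ (suc (suc i))))
      wk₁ {n} {R = R} = dRen (zero ◂ λ i → suc (suc i)) {R = λ ρ → R (ρ zero) (λ i → ρ (suc i))}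

    dDrop : {R : 𝕍 → 𝕍 → Env n → Set a} → Def {2 + n} (λ ρ → R (ρ zero) (ρ (suc zero)) (λ i → ρ (suc (suc i)))) →
      Def {3 + n} (λ ρ → R (ρ zero) (ρ (suc zero)) (λ i → ρ (suc (suc (suc i)))))
    dDrop {R = R} = dRen (zero ◂ suc zero ◂ λ i → suc (suc (suc i)))
      {R = λ ρ → R (ρ zero) (ρ (suc zero)) (λ i → ρ (suc (suc i)))}

    wkT : {t : Env n → 𝕍} → DefT t → DefT {suc n} (λ ρ → t (λ i → ρ (suc i)))
    wkT {t = t} (mkDefT c g) = mkDefT (λ ρ v → c _ (λ i → v (suc i))) (wk₁ {R = λ z ρ → z ≈ t ρ} g)

    dSubst : {R : 𝕍 → Env n → Set a} {t : Env n → 𝕍} →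
      DefT t → Def {suc n} (λ ρ → R (ρ zero) (λ i → ρ (suc i))) → Def (λ ρ → R (t ρ) ρ)
    dSubst {R = R} {t} (mkDefT c g) d = dMap (λ ρ v → f ρ v , λ x → t ρ , c ρ v , ≈refl , x)
        (dExV′ {R = λ z ρ → z ≈ t ρ × R z ρ} (dAnd′ g d))
      where
      f : ∀ ρ → VEnv ρ → ∃[ z ] V z × z ≈ t ρ × R z ρ → R (t ρ) ρ
      f ρ v (z , vz , e , x) = dResp d {z ◂ ρ} {t ρ ◂ ρ} (vz ◂ v) (c ρ v ◂ v)
        (λ { zero → e ; (suc i) → ≈refl }) x

    tResp : {t : Env n → 𝕍} → DefT t → ∀ {ρ ρ′} → VEnv ρ → VEnv ρ′ →
      (∀ i → ρ i ≈ ρ′ i) → t ρ ≈ t ρ′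
    tResp {t = t} (mkDefT c g) {ρ} {ρ′} v v′ e =
      dResp g {t ρ ◂ ρ} {t ρ ◂ ρ′} (c ρ v ◂ v) (c ρ v ◂ v′) (λ { zero → ≈refl ; (suc i) → e i }) ≈refl

  private variable
    A B : Env n → Set a
    s t u : Env n → 𝕍

  opaque

    private
      var : (i : Fin n) → DefT (λ ρ → ρ i)
      var i = mkDefT (λ ρ v → v i) (dVar≈ zero (suc i))
      v0 : DefT {suc n} (λ ρ → ρ zero)
      v0 = var zero
      v1 : DefT {suc (suc n)} (λ ρ → ρ (suc zero))
      v1 = var (suc zero)

      d∊′ : DefT {n} s → DefT t → Def (λ ρ → s ρ ∊ t ρ)
      d∊′ {s = s} {t} S T = dSubst {R = λ x ρ → x ∊ t ρ} S
        (dSubst {R = λ y ρ → ρ zero ∊ y} (wkT T)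
          (dVar∊ (suc zero) zero))

      d≈′ : DefT {n} s → DefT t → Def (λ ρ → s ρ ≈ t ρ)
      d≈′ {s = s} {t} S T = dSubst {R = λ x ρ → x ≈ t ρ} S (DefT.graph T)

    mkT : (∀ ρ → VEnv ρ → V (t ρ)) → Def {suc n} (λ ρ → ρ zero ∊ t (λ i → ρ (suc i))) → DefT t
    mkT {t = t} c d = mkDefT c (dMap f
        (dAllV′ {R = λ z ρ → z ∊ ρ zero ⟺ z ∊ t (λ i → ρ (suc i))}
          (dAnd′ (d→′ (d∊′ v0 v1) d′) (d→′ d′ (d∊′ v0 v1)))))
      where
      d′ : Def {suc (suc _)} (λ ρ → ρ zero ∊ t (λ i → ρ (suc (suc i))))
      d′ = wk₁ {R = λ z ρ → z ∊ t ρ} d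
      f : ∀ ρ → VEnv ρ → (∀ z → V z → z ∊ ρ zero ⟺ z ∊ t (λ i → ρ (suc i))) ⟺ (ρ zero ≈ t (λ i → ρ (suc i)))
      f ρ v =
        (λ h → ≈ext (λ z p → proj₁ (h z (V∊ (v zero) p)) p) (λ z p → proj₂ (h z (V∊ (c _ (λ i → v (suc i))) p)) p)) ,
        (λ e z _ → ∊r e , ∊r (≈sym e))

    dUP′ : DefT {n} s → DefT t → DefT (λ ρ → up (s ρ) (t ρ))
    dUP′ {s = s} {t} S T = mkT cl (dMap
        (λ ρ v → (λ { (inj₁ p) → upl p ; (inj₂ p) → upr p }) , ∊up)
        (dOr′ (d≈′ v0 (wkT S)) (d≈′ v0 (wkT T))))
      where
      cl : ∀ ρ → VEnv ρ → V (up (s ρ) (t ρ))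
      cl ρ v with IsZFC.pairing zfc (s ρ) (t ρ) (DefT.closed S ρ v) (DefT.closed T ρ v)
      ... | z , vz , h = V≈ (≈ext
          (λ w p → f (proj₁ (of⇔ (h w (V∊ vz p))) (unmem p)))
          (λ w p → g w (∊up p))) vz
        where
        f : ∀ {w} → w ≐ s ρ ⊎ w ≐ t ρ → w ∊ up (s ρ) (t ρ)
        f (inj₁ p) = upl (eq p)
        f (inj₂ p) = upr (eq p)
        g : ∀ w → w ≈ s ρ ⊎ w ≈ t ρ → w ∊ z
        g w (inj₁ p) = mem (proj₂ (of⇔ (h w (V≈ (≈sym p) (DefT.closed S ρ v)))) (inj₁ (uneq p)))
        g w (inj₂ p) = mem (proj₂ (of⇔ (h w (V≈ (≈sym p) (DefT.closed T ρ v)))) (inj₂ (uneq p)))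

    private
      dPair′ : DefT {n} s → DefT t → DefT (λ ρ → ⟪ s ρ , t ρ ⟫)
      dPair′ S T = let P = dUP′ (dUP′ S S) (dUP′ S T) in mkDefT
        (λ ρ v → subst V (sym ⟪⟫≡up) (DefT.closed P ρ v))
        (dMap (λ ρ v → subst (ρ zero ≈_) (sym ⟪⟫≡up) , subst (ρ zero ≈_) ⟪⟫≡up) (DefT.graph P))

      dBall′ : {R : 𝕍 → Env n → Set a} → DefT t → Def {suc n} (λ ρ → R (ρ zero) (λ i → ρ (suc i))) →
        Def (λ ρ → ∀ z → z ∊ t ρ → R z ρ)
      dBall′ {t = t} {R = R} T d = dMap (λ ρ v → (λ h z p → h z (V∊ (DefT.closed T ρ v) p) p) , (λ h z _ p → h z p))
        (dAllV′ {R = λ z ρ → z ∊ t ρ → R z ρ} (d→′ (d∊′ v0 (wkT T)) d))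

      dBex′ : {R : 𝕍 → Env n → Set a} → DefT t → Def {suc n} (λ ρ → R (ρ zero) (λ i → ρ (suc i))) →
        Def (λ ρ → ∃[ z ] z ∊ t ρ × R z ρ)
      dBex′ {t = t} {R = R} T d = dMap (λ ρ v → (λ (z , _ , p , x) → z , p , x) , (λ (z , p , x) → z , V∊ (DefT.closed T ρ v) p , p , x))
        (dExV′ {R = λ z ρ → z ∊ t ρ × R z ρ} (dAnd′ (d∊′ v0 (wkT T)) d))

  Cst : 𝕍 → Set₁
  Cst c = ∀ {n} → DefT {n} (λ _ → c)

  opaque
    cst : ∀ {c} → V c → Cst c
    cst {c} v {n} = mkDefT (λ _ _ → v) (mkDef (c ∷ []) (v ∷ [])
        (zero ≐̇ suc (n ↑ʳ zero))
        λ ρ w → (λ { (eq p) → lift (subst (ρ zero ≐_) (sym (l ρ)) p) }) , (λ { (lift p) → eq (subst (ρ zero ≐_) (l ρ) p) }))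
      where
      l : (ρ : Env (suc n)) → lookup (tabulate (λ i → ρ (suc i)) ++ c ∷ []) (n ↑ʳ zero) ≡ c
      l ρ = lookup-++ʳ (tabulate (λ i → ρ (suc i))) (c ∷ []) zero

  opaque
    instance
      iVar : {i : Fin n} → DefT (λ ρ → ρ i)
      iVar {i = i} = var i
      d⊥ : Def {n} (λ ρ → ⊥)
      d⊥ = d⊥′
      dUP : ⦃ DefT {n} s ⦄ → ⦃ DefT t ⦄ → DefT (λ ρ → up (s ρ) (t ρ))
      dUP ⦃ S ⦄ ⦃ T ⦄ = dUP′ S T
      dPair : ⦃ DefT {n} s ⦄ → ⦃ DefT t ⦄ → DefT (λ ρ → ⟪ s ρ , t ρ ⟫)
      dPair ⦃ S ⦄ ⦃ T ⦄ = dPair′ S T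
      d→ : ⦃ Def {n} A ⦄ → ⦃ Def B ⦄ → Def (λ ρ → A ρ → B ρ)
      d→ ⦃ x ⦄ ⦃ y ⦄ = d→′ x y
      dAnd : ⦃ Def {n} A ⦄ → ⦃ Def B ⦄ → Def (λ ρ → A ρ × B ρ)
      dAnd ⦃ x ⦄ ⦃ y ⦄ = dAnd′ x y
      dOr : ⦃ Def {n} A ⦄ → ⦃ Def B ⦄ → Def (λ ρ → A ρ ⊎ B ρ)
      dOr ⦃ x ⦄ ⦃ y ⦄ = dOr′ x y
      d∊ : ⦃ DefT {n} s ⦄ → ⦃ DefT t ⦄ → Def (λ ρ → s ρ ∊ t ρ)
      d∊ ⦃ x ⦄ ⦃ y ⦄ = d∊′ x y
      d≈ : ⦃ DefT {n} s ⦄ → ⦃ DefT t ⦄ → Def (λ ρ → s ρ ≈ t ρ)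
      d≈ ⦃ x ⦄ ⦃ y ⦄ = d≈′ x y
      dAllV : {R : 𝕍 → Env n → Set a} → ⦃ Def {suc n} (λ ρ → R (ρ zero) (λ i → ρ (suc i))) ⦄ →
        Def (λ ρ → ∀ z → V z → R z ρ)
      dAllV ⦃ d ⦄ = dAllV′ d
      dExV : {R : 𝕍 → Env n → Set a} → ⦃ Def {suc n} (λ ρ → R (ρ zero) (λ i → ρ (suc i))) ⦄ →
        Def (λ ρ → ∃[ z ] V z × R z ρ)
      dExV {R = R} ⦃ d ⦄ = dExV′ {R = R} d
      dBall : {R : 𝕍 → Env n → Set a} → ⦃ DefT t ⦄ → ⦃ Def {suc n} (λ ρ → R (ρ zero) (λ i → ρ (suc i))) ⦄ →
        Def (λ ρ → ∀ z → z ∊ t ρ → R z ρ)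
      dBall {R = R} ⦃ T ⦄ ⦃ d ⦄ = dBall′ {R = R} T d
      dBex : {R : 𝕍 → Env n → Set a} → ⦃ DefT t ⦄ → ⦃ Def {suc n} (λ ρ → R (ρ zero) (λ i → ρ (suc i))) ⦄ →
        Def (λ ρ → ∃[ z ] z ∊ t ρ × R z ρ)
      dBex {R = R} ⦃ T ⦄ ⦃ d ⦄ = dBex′ {R = R} T d

      dAllP : {R : 𝕍 → 𝕍 → Env n → Set a} → ⦃ DefT t ⦄ →
        ⦃ Def {suc (suc n)} (λ ρ → R (ρ (suc zero)) (ρ zero) (λ i → ρ (suc (suc i)))) ⦄ →
        Def (λ ρ → ∀ x y → ⟪ x , y ⟫ ∊ t ρ → R x y ρ)
      dAllP {t = t} {R = R} ⦃ T ⦄ ⦃ d ⦄ = dMap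
        (λ ρ v → (λ h x y p → h x (V⟨l (V∊ (DefT.closed T ρ v) p)) y (V⟨r (V∊ (DefT.closed T ρ v) p)) p) ,
                 (λ h x _ y _ p → h x y p))
        (dAllV′ {R = λ x ρ → ∀ y → V y → ⟪ x , y ⟫ ∊ t ρ → R x y ρ}
          (dAllV′ {R = λ y ρ → ⟪ ρ zero , y ⟫ ∊ t (λ i → ρ (suc i)) → R (ρ zero) y (λ i → ρ (suc i))}
            (d→′ (d∊′ (dPair′ v1 v0) (wkT (wkT T))) d)))
      dAllR : {R : 𝕍 → Env n → Set a} → ⦃ DefT s ⦄ → ⦃ DefT t ⦄ →
        ⦃ Def {suc n} (λ ρ → R (ρ zero) (λ i → ρ (suc i))) ⦄ → Def (λ ρ → ∀ y → ⟪ s ρ , y ⟫ ∊ t ρ → R y ρ)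
      dAllR {s = s} {t = t} {R = R} ⦃ S ⦄ ⦃ T ⦄ ⦃ d ⦄ = dMap
        (λ ρ v → (λ h y p → h y (V⟨r (V∊ (DefT.closed T ρ v) p)) p) , (λ h y _ p → h y p))
        (dAllV′ {R = λ y ρ → ⟪ s ρ , y ⟫ ∊ t ρ → R y ρ}
            (d→′ (d∊′ (dPair′ (wkT S) v0) (wkT T)) d))
      dAllL : {R : 𝕍 → Env n → Set a} → ⦃ DefT s ⦄ → ⦃ DefT t ⦄ →
        ⦃ Def {suc n} (λ ρ → R (ρ zero) (λ i → ρ (suc i))) ⦄ → Def (λ ρ → ∀ x → ⟪ x , s ρ ⟫ ∊ t ρ → R x ρ)
      dAllL {s = s} {t = t} {R = R} ⦃ S ⦄ ⦃ T ⦄ ⦃ d ⦄ = dMap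
        (λ ρ v → (λ h y p → h y (V⟨l (V∊ (DefT.closed T ρ v) p)) p) , (λ h y _ p → h y p))
        (dAllV′ {R = λ y ρ → ⟪ y , s ρ ⟫ ∊ t ρ → R y ρ}
            (d→′ (d∊′ (dPair′ v0 (wkT S)) (wkT T)) d))
      dAllE : {R : 𝕍 → 𝕍 → Env n → Set a} → ⦃ DefT t ⦄ →
        ⦃ Def {suc (suc n)} (λ ρ → R (ρ (suc zero)) (ρ zero) (λ i → ρ (suc (suc i)))) ⦄ →
        Def (λ ρ → ∀ x y → t ρ ≈ ⟪ x , y ⟫ → R x y ρ)
      dAllE {t = t} {R = R} ⦃ T ⦄ ⦃ d ⦄ = dMap
        (λ ρ v → (λ h x y p → h x (V⟨l (V≈ p (DefT.closed T ρ v))) y (V⟨r (V≈ p (DefT.closed T ρ v))) p) ,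
                 (λ h x _ y _ p → h x y p))
        (dAllV′ {R = λ x ρ → ∀ y → V y → t ρ ≈ ⟪ x , y ⟫ → R x y ρ}
          (dAllV′ {R = λ y ρ → t (λ i → ρ (suc i)) ≈ ⟪ ρ zero , y ⟫ → R (ρ zero) y (λ i → ρ (suc i))}
            (d→′ (d≈′ (wkT (wkT T)) (dPair′ v1 v0)) d)))
      dExP : {R : 𝕍 → 𝕍 → Env n → Set a} → ⦃ DefT t ⦄ →
        ⦃ Def {suc (suc n)} (λ ρ → R (ρ (suc zero)) (ρ zero) (λ i → ρ (suc (suc i)))) ⦄ →
        Def (λ ρ → ∃[ x ] ∃[ y ] ⟪ x , y ⟫ ∊ t ρ × R x y ρ)
      dExP {t = t} {R = R} ⦃ T ⦄ ⦃ d ⦄ = dMap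
        (λ ρ v → (λ (x , _ , y , _ , p , r) → x , y , p , r) ,
                 (λ (x , y , p , r) → x , V⟨l (V∊ (DefT.closed T ρ v) p) , y , V⟨r (V∊ (DefT.closed T ρ v) p) , p , r))
        (dExV′ {R = λ x ρ → ∃[ y ] V y × ⟪ x , y ⟫ ∊ t ρ × R x y ρ}
          (dExV′ {R = λ y ρ → ⟪ ρ zero , y ⟫ ∊ t (λ i → ρ (suc i)) × R (ρ zero) y (λ i → ρ (suc i))}
            (dAnd′ (d∊′ (dPair′ v1 v0) (wkT (wkT T))) d)))
      dExR : {R : 𝕍 → Env n → Set a} → ⦃ DefT s ⦄ → ⦃ DefT t ⦄ →
        ⦃ Def {suc n} (λ ρ → R (ρ zero) (λ i → ρ (suc i))) ⦄ → Def (λ ρ → ∃[ y ] ⟪ s ρ , y ⟫ ∊ t ρ × R y ρ)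
      dExR {s = s} {t = t} {R = R} ⦃ S ⦄ ⦃ T ⦄ ⦃ d ⦄ = dMap
        (λ ρ v → (λ (y , _ , p , r) → y , p , r) , (λ (y , p , r) → y , V⟨r (V∊ (DefT.closed T ρ v) p) , p , r))
        (dExV′ {R = λ y ρ → ⟪ s ρ , y ⟫ ∊ t ρ × R y ρ}
            (dAnd′ (d∊′ (dPair′ (wkT S) v0) (wkT T)) d))
      dExL : {R : 𝕍 → Env n → Set a} → ⦃ DefT s ⦄ → ⦃ DefT t ⦄ →
        ⦃ Def {suc n} (λ ρ → R (ρ zero) (λ i → ρ (suc i))) ⦄ → Def (λ ρ → ∃[ x ] ⟪ x , s ρ ⟫ ∊ t ρ × R x ρ)
      dExL {s = s} {t = t} {R = R} ⦃ S ⦄ ⦃ T ⦄ ⦃ d ⦄ = dMap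
        (λ ρ v → (λ (y , _ , p , r) → y , p , r) , (λ (y , p , r) → y , V⟨l (V∊ (DefT.closed T ρ v) p) , p , r))
        (dExV′ {R = λ y ρ → ⟪ y , s ρ ⟫ ∊ t ρ × R y ρ}
            (dAnd′ (d∊′ (dPair′ v0 (wkT S)) (wkT T)) d))
      dExE : {R : 𝕍 → 𝕍 → Env n → Set a} → ⦃ DefT t ⦄ →
        ⦃ Def {suc (suc n)} (λ ρ → R (ρ (suc zero)) (ρ zero) (λ i → ρ (suc (suc i)))) ⦄ →
        Def (λ ρ → ∃[ x ] ∃[ y ] t ρ ≈ ⟪ x , y ⟫ × R x y ρ)
      dExE {t = t} {R = R} ⦃ T ⦄ ⦃ d ⦄ = dMap
        (λ ρ v → (λ (x , _ , y , _ , p , r) → x , y , p , r) ,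
                 (λ (x , y , p , r) → x , V⟨l (V≈ p (DefT.closed T ρ v)) , y , V⟨r (V≈ p (DefT.closed T ρ v)) , p , r))
        (dExV′ {R = λ x ρ → ∃[ y ] V y × t ρ ≈ ⟪ x , y ⟫ × R x y ρ}
          (dExV′ {R = λ y ρ → t (λ i → ρ (suc i)) ≈ ⟪ ρ zero , y ⟫ × R (ρ zero) y (λ i → ρ (suc i))}
            (dAnd′ (d≈′ (wkT (wkT T)) (dPair′ v1 v0)) d)))

  opaque
    instance
      dBex₀ : ⦃ DefT {n} t ⦄ → Def (λ ρ → ∃[ z ] z ∊ t ρ)
      dBex₀ {t = t} ⦃ T ⦄ = dMap (λ ρ v → (λ (z , p , _) → z , p) , (λ (z , p) → z , p , p))
        (dBex′ {R = λ z ρ → z ∊ t ρ} T (d∊′ v0 (wkT T)))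
      dExR₀ : ⦃ DefT {n} s ⦄ → ⦃ DefT t ⦄ → Def (λ ρ → ∃[ y ] ⟪ s ρ , y ⟫ ∊ t ρ)
      dExR₀ {s = s} {t} ⦃ S ⦄ ⦃ T ⦄ = dMap (λ ρ v → (λ (z , p , _) → z , p) , (λ (z , p) → z , p , ≈refl))
        (dExR {R = λ z ρ → z ≈ z} ⦃ S ⦄ ⦃ T ⦄ ⦃ d≈′ v0 v0 ⦄)
      dExL₀ : ⦃ DefT {n} s ⦄ → ⦃ DefT t ⦄ → Def (λ ρ → ∃[ x ] ⟪ x , s ρ ⟫ ∊ t ρ)
      dExL₀ {s = s} {t} ⦃ S ⦄ ⦃ T ⦄ = dMap (λ ρ v → (λ (z , p , _) → z , p) , (λ (z , p) → z , p , ≈refl))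
        (dExL {R = λ z ρ → z ≈ z} ⦃ S ⦄ ⦃ T ⦄ ⦃ d≈′ v0 v0 ⦄)

  D₁ : (𝕍 → Set a) → Set _
  D₁ R = Def {1} (λ ρ → R (ρ zero))

  D₂ : (𝕍 → 𝕍 → Set a) → Set _
  D₂ R = Def {2} (λ ρ → R (ρ zero) (ρ (suc zero)))

  D₃ : (𝕍 → 𝕍 → 𝕍 → Set a) → Set _
  D₃ R = Def {3} (λ ρ → R (ρ zero) (ρ (suc zero)) (ρ (suc (suc zero))))

  opaque
    app₁ : {R : 𝕍 → Set a} → D₁ R → DefT {n} s → Def (λ ρ → R (s ρ))
    app₁ {R = R} d S = dSubst {R = λ z ρ → R z} S
      (dRen (zero ◂ ∅ₑ) {R = λ ρ → R (ρ zero)} d)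

    app₂ : {R : 𝕍 → 𝕍 → Set a} → D₂ R → DefT {n} s → DefT t → Def (λ ρ → R (s ρ) (t ρ))
    app₂ {t = t} {R = R} d S T = dSubst {R = λ z ρ → R z (t ρ)} S (dSubst {R = λ y ρ → R (ρ zero) y} (wkT T)
      (dRen (suc zero ◂ zero ◂ ∅ₑ) {R = λ ρ → R (ρ zero) (ρ (suc zero))} d))

    app₃ : {R : 𝕍 → 𝕍 → 𝕍 → Set a} → D₃ R → DefT {n} s → DefT t → DefT u → Def (λ ρ → R (s ρ) (t ρ) (u ρ))
    app₃ {t = t} {u = u} {R = R} d S T U = dSubst {R = λ z ρ → R z (t ρ) (u ρ)} S
      (dSubst {R = λ y ρ → R (ρ zero) y (u (λ i → ρ (suc i)))} (wkT T)
        (dSubst {R = λ x ρ → R (ρ (suc zero)) (ρ zero) x} (wkT (wkT U))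
          (dRen (suc (suc zero) ◂ suc zero ◂ zero ◂ ∅ₑ) {R = λ ρ → R (ρ zero) (ρ (suc zero)) (ρ (suc (suc zero)))} d)))

    appT : {f : 𝕍 → 𝕍} → DefT {1} (λ ρ → f (ρ zero)) → DefT {n} s → DefT (λ ρ → f (s ρ))
    appT {s = s} {f = f} (mkDefT c g) S = mkDefT
      (λ ρ v → c (s ρ ◂ ∅ₑ) (DefT.closed S ρ v ◂ ∅ₑ))
      (app₂ {R = λ y x → y ≈ f x} g v0 (wkT S))

 open Definability

 module Separation where
  private variable
    n : ℕ
    ℓ ℓ′ : Level
    s t : Env n → 𝕍

  it : ∀ {a} {A : Set a} → ⦃ A ⦄ → A
  it ⦃ x ⦄ = x

  T₀ : 𝕍 → Set₁
  T₀ a = DefT {0} (λ _ → a)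

  VT : ∀ {a} → T₀ a → V a
  VT d = DefT.closed d ∅ₑ ∅ₑ

  T₁ : (𝕍 → 𝕍) → Set₁
  T₁ t = DefT {1} (λ ρ → t (ρ zero))

  resp₂ : {R : 𝕍 → 𝕍 → Set ℓ} → D₂ R → ∀ {x y x′ y′} → V x → V y → x ≈ x′ → y ≈ y′ → R x y → R x′ y′
  resp₂ d vx vy e e′ = dResp d {_ ◂ _ ◂ ∅ₑ} {_ ◂ _ ◂ ∅ₑ} (vx ◂ vy ◂ ∅ₑ) (V≈ e vx ◂ V≈ e′ vy ◂ ∅ₑ)
    (λ { zero → e ; (suc zero) → e′ })

  tresp₁ : {t : 𝕍 → 𝕍} → T₁ t → ∀ {x y} → V x → x ≈ y → t x ≈ t y
  tresp₁ T vx e = tResp T {_ ◂ ∅ₑ} {_ ◂ ∅ₑ} (vx ◂ ∅ₑ) (V≈ e vx ◂ ∅ₑ) (λ { zero → e })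

  dec₁D : {R : 𝕍 → Set ℓ} → D₁ R → ∀ x → V x → Dec (R x)
  dec₁D d x v = decDef d (x ◂ ∅ₑ) (v ◂ ∅ₑ)

  opaque
    sep : (a : 𝕍) (R : 𝕍 → Set ℓ) → ⦃ T₀ a ⦄ → ⦃ D₁ R ⦄ → 𝕍
    sep a R ⦃ A ⦄ ⦃ d ⦄ = proj₁ (IsZFC.separation zfc (Def.φ d) (Def.ps d) (Def.Vps d) a (VT A))

  module _ {a : 𝕍} {R : 𝕍 → Set ℓ} where
    opaque
      unfolding sep
      private
        spec : (A : T₀ a) (d : D₁ R) → ∃[ b ] V b × (∀ z → V z → z ∈ b ⇔ (z ∈ a × Sat V (Def.φ d) (z ∷ Def.ps d)))
        spec A d = IsZFC.separation zfc (Def.φ d) (Def.ps d) (Def.Vps d) a (VT A)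

      Vsep : {A : T₀ a} {d : D₁ R} → V (sep a R ⦃ A ⦄ ⦃ d ⦄)
      Vsep {A} {d} = proj₁ (proj₂ (spec A d))

      ∊sep : {A : T₀ a} {d : D₁ R} → ∀ {z} → z ∊ sep a R ⦃ A ⦄ ⦃ d ⦄ → z ∊ a × R z
      ∊sep {A} {d} {z} p =
        let vz = V∊ (Vsep {A = A} {d}) p
            (q , r) = proj₁ (of⇔ (proj₂ (proj₂ (spec A d)) z vz)) (unmem p)
        in mem q , proj₂ (Def.sat d (z ◂ ∅ₑ) (vz ◂ ∅ₑ)) r

      sep-i : {A : T₀ a} {d : D₁ R} → ∀ {z} → z ∊ a → R z → z ∊ sep a R ⦃ A ⦄ ⦃ d ⦄
      sep-i {A} {d} {z} p r = let vz = V∊ (VT A) p in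
        mem (proj₂ (of⇔ (proj₂ (proj₂ (spec A d)) z vz))
          (unmem p , proj₁ (Def.sat d (z ◂ ∅ₑ) (vz ◂ ∅ₑ)) r))

  instance
    iSep : ∀ {a} {R : 𝕍 → Set ℓ} {A : T₀ a} {d : D₁ R} → Cst (sep a R ⦃ A ⦄ ⦃ d ⦄)
    iSep {A = A} {d} = cst (Vsep {A = A} {d})

  opaque
    pow : 𝕍 → 𝕍
    pow a with em {V a}
    ... | yes v = proj₁ (IsZFC.powerset zfc a v)
    ... | no _ = ∅

    Vpow : ∀ {a} → V a → V (pow a)
    Vpow {a} va with em {V a}
    ... | yes v = proj₁ (proj₂ (IsZFC.powerset zfc a v))
    ... | no h = ⊥-elim (h va)

    ∊pow : ∀ {a z} → V a → z ∊ pow a → z ⊂ a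
    ∊pow {a} va p w q with em {V a}
    ... | no h = ⊥-elim (h va)
    ... | yes v with IsZFC.powerset zfc a v
    ... | b , vb , h = let vz = V∊ vb p in
      mem (proj₁ (of⇔ (h _ vz)) (unmem p) w (V∊ vz q) (unmem q))

    pow-i : ∀ {a z} → V a → V z → z ⊂ a → z ∊ pow a
    pow-i {a} va vz p with em {V a}
    ... | no h = ⊥-elim (h va)
    ... | yes v with IsZFC.powerset zfc a v
    ... | b , vb , h = mem (proj₂ (of⇔ (h _ vz)) λ w _ q → unmem (p w (mem q)))

  ∊pow-V : ∀ {a z} → V a → z ∊ pow a → V z
  ∊pow-V va p = V∊ (Vpow va) p

  V⋃ : ∀ {x} → V x → V (⋃ x)
  V⋃ {x} vx with IsZFC.union zfc x vx
  ... | u , vu , h = V≈ (≈ext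
      (λ z p → let (y , _ , q , r) = proj₁ (of⇔ (h z (V∊ vu p))) (unmem p) in ⋃i (mem q) (mem r))
      (λ z p → let (y , q , r) = ∊⋃ p in
         mem (proj₂ (of⇔ (h z (V∊ (V∊ vx q) r))) (y , V∊ vx q , unmem q , unmem r)))) vu

  repl : ∀ {a} {R : 𝕍 → 𝕍 → Set ℓ} → V a → D₂ R →
    (∀ x → x ∊ a → ∃[ y ] V y × R x y × (∀ y′ → V y′ → R x y′ → y′ ≈ y)) →
    ∃[ b ] V b × (∀ y → y ∊ b ⟺ (V y × (∃[ x ] x ∊ a × R x y)))
  repl {a = a} {R} va (mkDef ps Vps φ sat) h =
    let (b , vb , g) = IsZFC.replacement zfc φ ps Vps a va h′ in b , vb , λ y →
      (λ p → let vy = V∊ vb p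
                 (x , vx , q , r) = proj₁ (of⇔ (g y vy)) (unmem p)
             in vy , x , mem q , proj₂ (sat (x ◂ y ◂ ∅ₑ) (vx ◂ vy ◂ ∅ₑ)) r) ,
      (λ (vy , x , q , r) → mem (proj₂ (of⇔ (g y vy))
        (x , V∊ va q , unmem q , proj₁ (sat (x ◂ y ◂ ∅ₑ) (V∊ va q ◂ vy ◂ ∅ₑ)) r)))
    where
    h′ : ∀ x → V x → x ∈ a → ∃[ y ] V y × Sat V φ (x ∷ y ∷ ps)
      × (∀ y′ → V y′ → Sat V φ (x ∷ y′ ∷ ps) → y′ ≐ y)
    h′ x vx p = let (y , vy , r , u) = h x (mem p) in
      y , vy , proj₁ (sat (x ◂ y ◂ ∅ₑ) (vx ◂ vy ◂ ∅ₑ)) r ,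
      λ y′ vy′ r′ → uneq (u y′ vy′ (proj₂ (sat (x ◂ y′ ◂ ∅ₑ) (vx ◂ vy′ ◂ ∅ₑ)) r′))

  private
    swap₂ : {R : 𝕍 → 𝕍 → Set ℓ} → D₂ R → D₂ (λ x y → R y x)
    swap₂ {R = R} d = dSubst {R = λ z ρ → R z (ρ zero)} {t = λ ρ → ρ (suc zero)} it (dDrop {R = λ x y _ → R x y} d)

  Vimg : ∀ {a t} → V a → T₁ t → V (img a t)
  Vimg {a} {t} va T = fin (repl {R = λ x y → y ≈ t x} va (swap₂ {R = λ y x → y ≈ t x} (DefT.graph T))
      (λ x p → t x , DefT.closed T (x ◂ ∅ₑ) (V∊ va p ◂ ∅ₑ) , ≈refl , λ _ _ e → e))
    where
    fin : ∃[ b ] V b × (∀ y → y ∊ b ⟺ (V y × (∃[ x ] x ∊ a × y ≈ t x))) → V (img a t)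
    fin (b , vb , h) = V≈ (≈ext
      (λ y p → let (_ , x , q , e) = proj₁ (h y) p in img-i (λ z m e → tresp₁ {t = t} T (V∊ va q) e) q e)
      (λ y p → let (x , q , e) = ∊img p in
        proj₂ (h y) (V≈ (≈sym e) (DefT.closed T (x ◂ ∅ₑ) (V∊ va q ◂ ∅ₑ)) , x , q , e))) vb

  private
    tFix : {t : 𝕍 → Env n → 𝕍} → DefT {suc n} (λ ρ → t (ρ zero) (λ i → ρ (suc i))) →
      ∀ ρ → VEnv ρ → T₁ (λ x → t x ρ)
    tFix {t = t} (mkDefT c (mkDef ps Vps φ sat)) ρ v = mkDefT (λ x vx → c (x zero ◂ ρ) (vx zero ◂ v))
      (mkDef (tabulate ρ ++ ps) (All.++⁺ (All.tabulate⁺ v) Vps) φ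
        λ yx vyx → sat (yx zero ◂ yx (suc zero) ◂ ρ) (vyx zero ◂ vyx (suc zero) ◂ v))

  opaque
    instance
      d⋃ : ⦃ DefT {n} t ⦄ → DefT (λ ρ → ⋃ (t ρ))
      d⋃ {t = t} ⦃ T ⦄ = mkT (λ ρ v → V⋃ (DefT.closed T ρ v))
        (dMap (λ ρ v → (λ (y , p , q) → ⋃i p q) , ∊⋃)
          (dBex {t = λ ρ → t (λ i → ρ (suc i))} {R = λ y ρ → ρ zero ∊ y} ⦃ wkT T ⦄))

  opaque
    unfolding _∪_ ⋃ up
    ∪≈ : ∀ {a b} → ⋃ (up a b) ≈ a ∪ b
    ∪≈ = ≈ext (λ z p → let (y , q , r) = ∊⋃ p in [ (λ e → ∪l (∊r e r)) , (λ e → ∪r (∊r e r)) ]′ (∊up q))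
      (λ z p → [ (λ q → ⋃i (upl ≈refl) q) , (λ q → ⋃i (upr ≈refl) q) ]′ (∊∪ p))

  opaque
    instance
      d∪ : ⦃ DefT {n} s ⦄ → ⦃ DefT t ⦄ → DefT (λ ρ → s ρ ∪ t ρ)
      d∪ {s = s} {t} ⦃ S ⦄ ⦃ T ⦄ = mkDefT (λ ρ v → V≈ ∪≈ (DefT.closed D ρ v))
          (dMap (λ ρ v → (λ e → ≈trans e ∪≈) , (λ e → ≈trans e (≈sym ∪≈))) (DefT.graph D))
        where
        D : DefT (λ ρ → ⋃ (up (s ρ) (t ρ)))
        D = it
      dPow : ⦃ DefT {n} t ⦄ → DefT (λ ρ → pow (t ρ))
      dPow {t = t} ⦃ T ⦄ = mkT (λ ρ v → Vpow (DefT.closed T ρ v))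
        (dMap (λ ρ v → let vt = DefT.closed T _ λ i → v (suc i) in pow-i vt (v zero) , ∊pow vt)
          (dBall {t = λ ρ → ρ zero} {R = λ y ρ → y ∊ t (λ i → ρ (suc i))} ⦃ it ⦄ ⦃ d∊ ⦃ it ⦄ ⦃ wkT (wkT T) ⦄ ⦄))
      dImg : {s : Env n → 𝕍} {t : 𝕍 → Env n → 𝕍} → ⦃ DefT s ⦄ →
        ⦃ DefT {suc n} (λ ρ → t (ρ zero) (λ i → ρ (suc i))) ⦄ → DefT (λ ρ → img (s ρ) (λ x → t x ρ))
      dImg {n} {s} {t} ⦃ S ⦄ ⦃ T ⦄ = mkT (λ ρ v → Vimg (DefT.closed S ρ v) (tFix {t = t} T ρ v))
        (dMap (λ ρ v → let v′ = λ i → v (suc i) in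
            (λ (x , p , e) → img-i (λ y m e′ → tresp₁ (tFix {t = t} T _ v′) (V∊ (DefT.closed S _ v′) p) e′) p e) , ∊img)
          (dBex {t = λ ρ → s (λ i → ρ (suc i))} {R = λ x ρ → ρ zero ≈ t x (λ i → ρ (suc i))} ⦃ wkT S ⦄ ⦃ d ⦄))
        where
        d : Def {2 + n} (λ ρ → ρ (suc zero) ≈ t (ρ zero) (λ i → ρ (suc (suc i))))
        d = dSubst {R = λ z ρ → z ≈ t (ρ zero) (λ i → ρ (suc (suc i)))} {t = λ ρ → ρ (suc zero)} it
          (dDrop {R = λ z x ρ → z ≈ t x ρ} (DefT.graph T))

  opaque
    unfolding _⊗_
    ⊗≡ : ∀ {a b} → ⋃ (img a λ x → img b λ y → ⟪ x , y ⟫) ≈ a ⊗ b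
    ⊗≡ = ≈refl

  opaque
    instance
      d⊗ : ⦃ DefT {n} s ⦄ → ⦃ DefT t ⦄ → DefT (λ ρ → s ρ ⊗ t ρ)
      d⊗ {s = s} {t} ⦃ S ⦄ ⦃ T ⦄ = mkDefT (λ ρ v → V≈ ⊗≡ (DefT.closed D ρ v))
          (dMap (λ ρ v → (λ e → ≈trans e ⊗≡) , (λ e → ≈trans e (≈sym ⊗≡))) (DefT.graph D))
        where
        D : DefT (λ ρ → ⋃ (img (s ρ) λ x → img (t ρ) λ y → ⟪ x , y ⟫))
        D = d⋃ ⦃ dImg {t = λ x ρ → img (t ρ) λ y → ⟪ x , y ⟫} ⦃ S ⦄ ⦃ dImg {t = λ y ρ → ⟪ ρ zero , y ⟫} ⦃ wkT T ⦄ ⦃ dPair ⦃ iVar ⦄ ⦃ iVar ⦄ ⦄ ⦄ ⦄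

  -- rel a b R = { ⟨ x , y ⟩ ∈ a × b ∣ R x y }
  module _ (a b : 𝕍) (R : 𝕍 → 𝕍 → Set ℓ) where
    private
      R′ : 𝕍 → Set _
      R′ z = ∃[ x ] ∃[ y ] z ≈ ⟪ x , y ⟫ × R x y

    opaque
      dR′ : D₂ R → D₁ R′
      dR′ d = dExE {t = λ ρ → ρ zero} {R = λ x y ρ → R x y} ⦃ it ⦄ ⦃ dDrop {R = λ x y _ → R y x} (swap₂ {R = R} d) ⦄
      dab : T₀ a → T₀ b → T₀ (a ⊗ b)
      dab A B = d⊗ ⦃ A ⦄ ⦃ B ⦄

    opaque
      rel : ⦃ A : T₀ a ⦄ ⦃ B : T₀ b ⦄ ⦃ d : D₂ R ⦄ → 𝕍
      rel ⦃ A ⦄ ⦃ B ⦄ ⦃ d ⦄ = sep (a ⊗ b) R′ ⦃ dab A B ⦄ ⦃ dR′ d ⦄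

  module _ {a b : 𝕍} {R : 𝕍 → 𝕍 → Set ℓ} where
    opaque
      unfolding rel
      Vrel : {A : T₀ a} {B : T₀ b} {d : D₂ R} → V (rel a b R ⦃ A ⦄ ⦃ B ⦄ ⦃ d ⦄)
      Vrel {A} {B} {d} = Vsep {A = dab a b R A B} {dR′ a b R d}

      ∊rel : {A : T₀ a} {B : T₀ b} {d : D₂ R} → ∀ {x y} →
        ⟪ x , y ⟫ ∊ rel a b R ⦃ A ⦄ ⦃ B ⦄ ⦃ d ⦄ → x ∊ a × y ∊ b × R x y
      ∊rel {A} {B} {d} p with ∊sep {A = dab a b R A B} {dR′ a b R d} p
      ... | q , x′ , y′ , e , r = let (u , v) = ⊗e q ; (f , g) = ⟪⟫-inj e in u , v ,
        resp₂ {R = R} d (V≈ f (V∊ (VT A) u)) (V≈ g (V∊ (VT B) v)) (≈sym f) (≈sym g) r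

      rel-i : {A : T₀ a} {B : T₀ b} {d : D₂ R} → ∀ {x y} →
        x ∊ a → y ∊ b → R x y → ⟪ x , y ⟫ ∊ rel a b R ⦃ A ⦄ ⦃ B ⦄ ⦃ d ⦄
      rel-i {A} {B} {d} p q r = sep-i {A = dab a b R A B} {dR′ a b R d} (⊗i p q) (_ , _ , ≈refl , r)

      rel⊂ : {A : T₀ a} {B : T₀ b} {d : D₂ R} → rel a b R ⦃ A ⦄ ⦃ B ⦄ ⦃ d ⦄ ⊂ a ⊗ b
      rel⊂ {A} {B} {d} z p = proj₁ (∊sep {A = dab a b R A B} {dR′ a b R d} p)

  instance
    iRel : ∀ {a b} {R : 𝕍 → 𝕍 → Set ℓ} {A : T₀ a} {B : T₀ b} {d : D₂ R} → Cst (rel a b R ⦃ A ⦄ ⦃ B ⦄ ⦃ d ⦄)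
    iRel {A = A} {B} {d} = cst (Vrel {A = A} {B} {d})

 open Separation

 module Choices where
  private variable
    n : ℕ
    ℓ ℓ′ : Level
    s t u : Env n → 𝕍

  module GFP (U : 𝕍) ⦃ _ : Cst U ⦄ (Φ : 𝕍 → 𝕍 → Set ℓ) (dΦ : D₂ Φ)
    (mono : ∀ R S u → V R → V S → V u → R ⊂ S → Φ R u → Φ S u) where
    private instance
      iΦ : ⦃ DefT {n} s ⦄ → ⦃ DefT t ⦄ → Def (λ ρ → Φ (s ρ) (t ρ))
      iΦ ⦃ S ⦄ ⦃ T ⦄ = app₂ {R = Φ} dΦ S T
    private
      VU : V U
      VU = VT it
    gfp : 𝕍
    gfp = sep U λ u → ∃[ R ] R ∊ pow U × u ∊ R × (∀ v → v ∊ R → Φ R v)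

    gfp-V : V gfp
    gfp-V = Vsep

    gfp⊂ : gfp ⊂ U
    gfp⊂ u p = proj₁ (∊sep p)

    gfp-out : ∀ {u} → u ∊ gfp → Φ gfp u
    gfp-out {u} p =
      let (_ , R , q , r , h) = ∊sep p in
      mono R gfp u (∊pow-V VU q) gfp-V (V∊ gfp-V p) (λ v m → sep-i (∊pow VU q v m) (R , q , m , h)) (h u r)

    gfp-in : ∀ {u} → u ∊ U → Φ gfp u → u ∊ gfp
    gfp-in {u} p φ = sep-i p (R , pow-i VU VR (λ v m → [ gfp⊂ v , (λ q → ∊l (≈sym (∊sing q)) p) ]′ (∊∪ m)) , ∪r (upl ≈refl) , h)
      where
      R = gfp ∪ up u u
      Vu = V∊ VU p
      VR : V R
      VR = VT (d∪ ⦃ it ⦄ ⦃ dUP ⦃ cst Vu ⦄ ⦃ cst Vu ⦄ ⦄)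
      h : ∀ v → v ∊ R → Φ R v
      h v m with ∊∪ m
      ... | inj₁ q = mono gfp R v gfp-V VR (V∊ gfp-V q) (λ w → ∪l) (gfp-out q)
      ... | inj₂ q = resp₂ {R = Φ} dΦ VR Vu ≈refl (≈sym (∊sing q)) (mono gfp R u gfp-V VR Vu (λ w → ∪l) φ)

  record Choice (a b : 𝕍) (R : 𝕍 → 𝕍 → Set ℓ) : Set (lsuc 0ℓ ⊔ ℓ) where
    field
      fn    : 𝕍
      V-fn  : V fn
      pairs : fn ⊂ a ⊗ b
      sound : ∀ {x y} → ⟪ x , y ⟫ ∊ fn → x ∊ a × y ∊ b × R x y
      total : ∀ {x} → x ∊ a → ∃[ y ] ⟪ x , y ⟫ ∊ fn
      unique : ∀ {x y y′} → ⟪ x , y ⟫ ∊ fn → ⟪ x , y′ ⟫ ∊ fn → y ≈ y′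

  choose : (a b : 𝕍) ⦃ _ : Cst a ⦄ ⦃ _ : Cst b ⦄ (R : 𝕍 → 𝕍 → Set ℓ) → D₂ R →
    (∀ x → x ∊ a → ∃[ y ] y ∊ b × R x y) → Choice a b R
  choose a b R d tot = fin (IsZFC.choice zfc 𝓕 Vsep ne dis)
    where
    instance
      iR : ⦃ DefT {n} s ⦄ → ⦃ DefT t ⦄ → Def (λ ρ → R (s ρ) (t ρ))
      iR ⦃ S ⦄ ⦃ T ⦄ = app₂ {R = R} d S T
    𝓕 : 𝕍
    𝓕 = sep (pow (a ⊗ b)) λ s → ∃[ x ] x ∊ a × (∀ x′ y → ⟪ x′ , y ⟫ ∊ s → x′ ≈ x × R x′ y)
          × (∀ y → y ∊ b → R x y → ⟪ x , y ⟫ ∊ s)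
    Vab : V (a ⊗ b)
    Vab = VT it
    ne : ∀ s → V s → s ∈ 𝓕 → ∃[ z ] V z × z ∈ s
    ne s vs p = let (_ , x , xa , h , g) = ∊sep (mem p) ; (y , yb , r) = tot x xa
                    m = g y yb r in ⟪ x , y ⟫ , V∊ vs m , unmem m
    split : ∀ {s z} → s ∊ 𝓕 → z ∊ s → ∃[ x ] ∃[ y ] x ∊ a × y ∊ b × z ≈ ⟪ x , y ⟫
    split p q = ∊⊗ (∊pow Vab (proj₁ (∊sep p)) _ q)
    half : ∀ {s s′ x y} → s ∊ 𝓕 → s′ ∊ 𝓕 → ⟪ x , y ⟫ ∊ s → ⟪ x , y ⟫ ∊ s′ → s ⊂ s′
    half {s} {s′} {x} {y} p p′ q q′ w m =
      let (_ , x₁ , xa , h , g) = ∊sep p ; (_ , x₂ , xa₂ , h₂ , g₂) = ∊sep p′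
          (c , e , ca , eb , eq₁) = split p m
          (f₁ , r₁) = h c e (∊l eq₁ m)
          c≈ = ≈trans f₁ (≈trans (≈sym (proj₁ (h x y q))) (proj₁ (h₂ x y q′)))
      in ∊l (≈sym (≈trans eq₁ (⟪⟫-cong c≈ ≈refl)))
           (g₂ e eb (resp₂ {R = R} d (V∊ (VT it) ca) (V∊ (VT it) eb) c≈ ≈refl r₁))
    dis : ∀ x y z → V x → V y → V z → x ∈ 𝓕 → y ∈ 𝓕 → z ∈ x → z ∈ y → x ≐ y
    dis s s′ z _ _ _ p p′ q q′ with split (mem p) (mem q)
    ... | x , y , _ , _ , e = uneq (≈ext (half (mem p) (mem p′) (∊l e (mem q)) (∊l e (mem q′)))
                                         (half (mem p′) (mem p) (∊l e (mem q′)) (∊l e (mem q))))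
    fib : ∀ {x} → x ∊ a → ∃[ s ] s ∊ 𝓕 × (∀ {y} → y ∊ b → R x y → ⟪ x , y ⟫ ∊ s)
    fib {x} xa = f , sep-i (pow-i Vab Vsep (λ z m → proj₁ (∊sep m)))
        (x , xa , (λ x′ y m → g x′ y (∊sep m)) , (λ y yb r → sep-i (⊗i xa yb) (x , y , ≈refl , ≈refl , r))) ,
        (λ yb r → sep-i (⊗i xa yb) (x , _ , ≈refl , ≈refl , r))
      where
      instance
        ix : Cst x
        ix = cst (V∊ (VT it) xa)
      f : 𝕍
      f = sep (a ⊗ b) λ z → ∃[ x′ ] ∃[ y ] z ≈ ⟪ x′ , y ⟫ × x′ ≈ x × R x′ y
      g : ∀ x′ y → ⟪ x′ , y ⟫ ∊ a ⊗ b × (∃[ x″ ] ∃[ y′ ] ⟪ x′ , y ⟫ ≈ ⟪ x″ , y′ ⟫ × x″ ≈ x × R x″ y′) → x′ ≈ x × R x′ y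
      g x′ y (m , x″ , y′ , e , e′ , r) = let (u , v) = ⟪⟫-inj e ; (p , q) = ⊗e m in
        ≈trans u e′ , resp₂ {R = R} d (V≈ u (V∊ (VT it) p)) (V≈ v (V∊ (VT it) q)) (≈sym u) (≈sym v) r
    fin : ∃[ t ] V t × (∀ x → V x → x ∈ 𝓕 → ∃[ z ] V z × z ∈ x × z ∈ t
            × (∀ z′ → V z′ → z′ ∈ x → z′ ∈ t → z′ ≐ z)) → Choice a b R
    fin (t , vt , h) = record
      { fn = fn ; V-fn = Vrel ; pairs = rel⊂ ; sound = λ p → let (q , r , (_ , z)) = ∊rel p in q , r , z
      ; total = λ xa → let (s , p , g) = fib xa ; (z , _ , zs , zt , _) = h s (V∊ Vsep p) (unmem p)
                           (x₁ , y , x₁a , yb , e) = split p (mem zs)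
                           (_ , x₀ , _ , h₀ , g₀) = ∊sep p
                           (y₂ , y₂b , r₂) = tot _ xa
                           (e₁ , r₁) = h₀ x₁ y (∊l e (mem zs))
                           (e₂ , _) = h₀ _ y₂ (g y₂b r₂)
                           e₃ = ≈trans e₁ (≈sym e₂)
                       in y , rel-i xa yb (∊l (≈trans e (⟪⟫-cong e₃ ≈refl)) (mem zt) ,
                            resp₂ {R = R} d (V∊ (VT it) x₁a) (V∊ (VT it) yb) e₃ ≈refl r₁)
      ; unique = λ p q → let (xa , yb , pt , r) = ∊rel p ; (_ , yb′ , qt , r′) = ∊rel q
                             (s , m , g) = fib xa
                             (z , _ , _ , _ , un) = h s (V∊ Vsep m) (unmem m)
                             k₁ = un _ (V∊ (V∊ Vsep m) (g yb r)) (unmem (g yb r)) (unmem pt)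
                             k₂ = un _ (V∊ (V∊ Vsep m) (g yb′ r′)) (unmem (g yb′ r′)) (unmem qt)
                         in proj₂ (⟪⟫-inj (≈trans (eq k₁) (≈sym (eq k₂)))) }
      where
      instance
        it′ : Cst t
        it′ = cst vt
      fn : 𝕍
      fn = rel a b λ x y → ⟪ x , y ⟫ ∊ t × R x y

 open Choices

 module Recursion where
  private variable
    n : ℕ
    ℓ ℓ′ : Level
    s t u : Env n → 𝕍

  private
    ZS : 𝕍 → Set₁
    ZS y = (∀ u → u ∊ y → ⊥) ⊎ (∃[ k ] k ∊ y × (∀ u → u ∊ y → u ∊ k ⊎ u ≈ k) × (∀ u → u ∊ k → u ∊ y))

    Nat : 𝕍 → Set₁
    Nat z = (∀ y → y ∊ z → ∀ u → u ∊ y → u ∊ z) × ZS z × (∀ y → y ∊ z → ZS y)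

    num-tr : ∀ n y → y ∊ num n → ∀ u → u ∊ y → u ∊ num n
    num-tr (suc n) y p u q with ∊num-suc n p
    ... | inj₁ r = num-l n (num-tr n y r u q)
    ... | inj₂ r = num-l n (∊r r q)
    num-tr zero y p u q = ⊥-elim (∉∅ p)

    num-ZS : ∀ n → ZS (num n)
    num-ZS zero = inj₁ λ u → ∉∅
    num-ZS (suc n) = inj₂ (num n , num-r n ≈refl , (λ u → ∊num-suc n) , (λ u → num-l n))

    ZS-resp : ∀ {x y} → x ≈ y → ZS x → ZS y
    ZS-resp e (inj₁ h) = inj₁ λ u p → h u (∊r (≈sym e) p)
    ZS-resp e (inj₂ (k , p , q , r)) = inj₂ (k , ∊r e p , (λ u m → q u (∊r (≈sym e) m)) , (λ u m → ∊r e (r u m)))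

    num-ZS′ : ∀ n y → y ∊ num n → ZS y
    num-ZS′ zero y p = ⊥-elim (∉∅ p)
    num-ZS′ (suc n) y p with ∊num-suc n p
    ... | inj₁ r = num-ZS′ n y r
    ... | inj₂ r = ZS-resp (≈sym r) (num-ZS n)

    num-Nat : ∀ n → Nat (num n)
    num-Nat n = num-tr n , num-ZS n , num-ZS′ n

    Nat-num : ∀ z → Nat z → Σ[ n ∈ ℕ ] z ≈ num n
    Nat-num = ∈-ind _ step
      where
      step : ∀ z → (∀ y → y ∊ z → Nat y → Σ[ n ∈ ℕ ] y ≈ num n) → Nat z → Σ[ n ∈ ℕ ] z ≈ num n
      step z ih (t , inj₁ h , g) = zero , ≈ext (λ u p → ⊥-elim (h u p)) (λ u p → ⊥-elim (∉∅ p))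
      step z ih (t , inj₂ (k , kz , p , q) , g) =
        let (n , e) = ih k kz (tk , g k kz , λ y m → g y (q y m)) in
        suc n , ≈ext (λ u m → [ (λ r → num-l n (∊r e r)) , (λ r → num-r n (≈trans r e)) ]′ (p u m))
                     (λ u m → [ (λ r → q u (∊r (≈sym e) r)) , (λ r → ∊l (≈sym (≈trans r (≈sym e))) kz) ]′ (∊num-suc n m))
        where
        tk : ∀ y → y ∊ k → ∀ u → u ∊ y → u ∊ k
        tk y m u m′ with p u (t y (q y m) u m′)
        ... | inj₁ r = r
        ... | inj₂ r = ⊥-elim (∊-asym k y (∊l r m′) m)

  Vω : V ω
  Vω = fin (IsZFC.infinity zfc)
    where
    fin : (∃[ a ] V a × (∃[ e ] V e × e ∈ a × (∀ z → V z → ¬ z ∈ e))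
            × (∀ x → V x → x ∈ a → ∃[ s ] V s × s ∈ a × (∀ z → V z → (z ∈ s) ⇔ (z ∈ x ⊎ z ≐ x)))) → V ω
    fin (a , va , (e , ve , ea , he) , succ) = V≈ (≈ext f g) Vsep
      where
      instance
        ia : Cst a
        ia = cst va
      w : 𝕍
      w = sep a Nat
      f : w ⊂ ω
      f z p = let (n , e) = Nat-num z (proj₂ (∊sep p)) in idx∊ {x = ω} n e
      num∊a : ∀ n → num n ∊ a
      num∊a zero = ∊l (≈ext (λ z p → ⊥-elim (he z (V∊ ve p) (unmem p))) (λ z p → ⊥-elim (∉∅ p))) (mem ea)
      num∊a (suc n) with succ (num n) (V∊ va (num∊a n)) (unmem (num∊a n))
      ... | s , vs , sa , h = ∊l (≈ext
          (λ z p → [ (λ q → num-l n (mem q)) , (λ q → num-r n (eq q)) ]′ (proj₁ (of⇔ (h z (V∊ vs p))) (unmem p)))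
          (λ z p → [ (λ q → mem (proj₂ (of⇔ (h z (V∊ (V∊ va (num∊a n)) q))) (inj₁ (unmem q)))) ,
                     (λ q → mem (proj₂ (of⇔ (h z (V≈ (≈sym q) (V∊ va (num∊a n))))) (inj₂ (uneq q)))) ]′ (∊num-suc n p)))
        (mem sa)
      g : ω ⊂ w
      g z p = let (n , e) = ∊idx p in ∊l (≈sym e) (sep-i (num∊a n) (num-Nat n))

  V∅ : V ∅
  V∅ = V∊ Vω (idx∊ {x = ω} 0 ≈refl)

  instance
    i∅ : Cst ∅
    i∅ = cst V∅

  Tot : 𝕍 → 𝕍 → Set₁
  Tot x R = ∀ k → k ∊ x → ∃[ c ] ⟪ k , c ⟫ ∊ R

  Agr : (𝕍 → 𝕍) → 𝕍 → 𝕍 → Set₁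
  Agr F x R = ∀ k → k ∊ x → ∀ c → ⟪ k , c ⟫ ∊ R → c ≈ F k

  -- ∈-recursion: F is definable as soon as a definable Φ recognises F x
  -- from (a superset of) the graph of F on the members of x.
  module Rec (F : 𝕍 → 𝕍) (Fr : ∀ {x y} → x ≈ y → F x ≈ F y)
    (Φ : 𝕍 → 𝕍 → 𝕍 → Set ℓ) (dΦ : D₃ Φ)
    (ok : ∀ x y R → V x → V y → V R → Tot x R → Agr F x R → Φ x y R ⟺ (y ≈ F x))
    (cl : ∀ x R → V x → V R → Tot x R → Agr F x R → V (F x)) where
    private
      instance
        iΦ : ⦃ DefT {n} s ⦄ → ⦃ DefT t ⦄ → ⦃ DefT u ⦄ → Def (λ ρ → Φ (s ρ) (t ρ) (u ρ))
        iΦ ⦃ S ⦄ ⦃ T ⦄ ⦃ U ⦄ = app₃ {R = Φ} dΦ S T U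

      Cert : 𝕍 → Set _
      Cert R = ∀ x y → ⟪ x , y ⟫ ∊ R → Tot x R × Φ x y R

      agr : ∀ R → V R → Cert R → ∀ x y → ⟪ x , y ⟫ ∊ R → y ≈ F x
      agr R vR cR = ∈-ind _ λ x ih y p → let (t , φ) = cR x y p in
        proj₁ (ok x y R (V⟨l (V∊ vR p)) (V⟨r (V∊ vR p)) vR t ih) φ

      mkCert : ∀ R → V R → (∀ x y → ⟪ x , y ⟫ ∊ R → Tot x R × y ≈ F x) → Cert R
      mkCert R vR h x y p = let (t , e) = h x y p in t ,
        proj₂ (ok x y R (V⟨l (V∊ vR p)) (V⟨r (V∊ vR p)) vR t (λ k _ c q → proj₂ (h k c q))) e

      Least : 𝕍 → 𝕍 → Set _
      Least k R = Cert R × (∃[ c ] ⟪ k , c ⟫ ∊ R) ×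
        (∀ R′ → V R′ → Cert R′ → (∃[ c ] ⟪ k , c ⟫ ∊ R′) → R ⊂ R′)

      opaque
        dLeast : D₂ Least
        dLeast = it

      least : ∀ k → V k → (∃[ R ] V R × Cert R × (∃[ c ] ⟪ k , c ⟫ ∊ R)) →
        ∃[ R ] V R × Least k R × (∀ R′ → V R′ → Least k R′ → R′ ≈ R)
      least k vk (R₀ , v₀ , c₀ , m₀) = R , Vsep , (cR , (F k , mR) , lR) , uR
        where
        instance
          i₀ : Cst R₀
          i₀ = cst v₀
          ik : Cst k
          ik = cst vk
        R : 𝕍
        R = sep R₀ λ z → ∀ R′ → V R′ → Cert R′ → (∃[ c ] ⟪ k , c ⟫ ∊ R′) → z ∊ R′
        mR : ⟪ k , F k ⟫ ∊ R
        mR = sep-i (⟪⟫-resp ≈refl (agr R₀ v₀ c₀ k _ (proj₂ m₀)) (proj₂ m₀))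
          (λ R′ v c m → ⟪⟫-resp ≈refl (agr R′ v c k _ (proj₂ m)) (proj₂ m))
        lR : ∀ R′ → V R′ → Cert R′ → (∃[ c ] ⟪ k , c ⟫ ∊ R′) → R ⊂ R′
        lR R′ v c m z p = proj₂ (∊sep p) R′ v c m
        val∊ : ∀ R′ → V R′ → Cert R′ → ∀ x y → ⟪ x , y ⟫ ∊ R′ → ∀ j → j ∊ x → ⟪ j , F j ⟫ ∊ R′
        val∊ R′ v c x y p j q = let (w , m) = proj₁ (c x y p) j q in ⟪⟫-resp ≈refl (agr R′ v c j w m) m
        cR : Cert R
        cR = mkCert R Vsep λ x y p → let (p₀ , h) = ∊sep p in
          (λ j q → F j , sep-i (val∊ R₀ v₀ c₀ x y p₀ j q) (λ R′ v c m → val∊ R′ v c x y (h R′ v c m) j q)) ,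
          agr R₀ v₀ c₀ x y p₀
        uR : ∀ R′ → V R′ → Least k R′ → R′ ≈ R
        uR R′ v (c , m , l) = ≈ext (l R Vsep cR (F k , mR)) (lR R′ v c m)

      exists : ∀ x → V x → ∃[ R ] V R × Cert R × ⟪ x , F x ⟫ ∊ R
      exists = ∈-ind _ step
        where
        step : ∀ x → (∀ k → k ∊ x → V k → ∃[ R ] V R × Cert R × ⟪ k , F k ⟫ ∊ R) →
          V x → ∃[ R ] V R × Cert R × ⟪ x , F x ⟫ ∊ R
        step x ih vx = fin (repl {R = Least} vx dLeast λ k p →
            let (R , v , c , m) = ih k p (V∊ vx p) in least k (V∊ vx p) (R , v , c , F k , m))
          where
          fin : ∃[ b ] V b × (∀ R → R ∊ b ⟺ (V R × (∃[ k ] k ∊ x × Least k R))) → ∃[ R ] V R × Cert R × ⟪ x , F x ⟫ ∊ R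
          fin (b , vb , h) = R , VR , mkCert R VR cR , ∪r (upl ≈refl)
            where
            U = ⋃ b
            VU = V⋃ vb
            inU : ∀ {z} → z ∊ U → ∃[ R ] V R × Cert R × R ∊ b × z ∊ R
            inU p = let (R , q , r) = ∊⋃ p ; (v , k , _ , c , _) = proj₁ (h R) q in R , v , c , q , r
            kU : ∀ k → k ∊ x → ⟪ k , F k ⟫ ∊ U
            kU k p = let (R₀ , v₀ , c₀ , m₀) = ih k p (V∊ vx p)
                         (R , v , l , _) = least k (V∊ vx p) (R₀ , v₀ , c₀ , F k , m₀)
                         (c , (w , m) , _) = l
                     in ⋃i (proj₂ (h R) (v , k , p , l)) (⟪⟫-resp ≈refl (agr R v c k w m) m)
            VF : V (F x)
            VF = cl x U vx VU (λ k p → F k , kU k p)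
              (λ k _ c p → let (R , v , cR , _ , m) = inU p in agr R v cR k c m)
            instance
              ib : Cst b
              ib = cst vb
              ix : Cst x
              ix = cst vx
              iF : Cst (F x)
              iF = cst VF
            R : 𝕍
            R = ⋃ b ∪ up ⟪ x , F x ⟫ ⟪ x , F x ⟫
            VR : V R
            VR = VT it
            cR : ∀ y z → ⟪ y , z ⟫ ∊ R → Tot y R × z ≈ F y
            cR y z p with ∊∪ p
            ... | inj₁ q = let (R′ , v , c , m , r) = inU q in
              (λ k s → let (w , g) = proj₁ (c y z r) k s in w , ∪l (⋃i m g)) , agr R′ v c y z r
            ... | inj₂ q = let (e , e′) = ⟪⟫-inj (∊sing q) in
              (λ k s → F k , ∪l (kU k (∊r e s))) , ≈trans e′ (Fr (≈sym e))

    private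
      G : 𝕍 → 𝕍 → Set _
      G y x = ∃[ R ] V R × Cert R × ⟪ x , y ⟫ ∊ R

      opaque
        dG : D₂ G
        dG = it

      G⟺ : ∀ y x → V x → G y x ⟺ (y ≈ F x)
      G⟺ y x vx = (λ (R , v , c , m) → agr R v c x y m) ,
        (λ e → let (R , v , c , m) = exists x vx in R , v , c , ⟪⟫-resp ≈refl (≈sym e) m)

      VF : ∀ x → V x → V (F x)
      VF x vx = let (R , v , c , m) = exists x vx in V⟨r (V∊ v m)

    opaque
      dRec : T₁ F
      dRec = mkDefT (λ x vx → VF (x zero) (vx zero))
        (dMap (λ yx v → G⟺ (yx zero) (yx (suc zero)) (v (suc zero))) dG)

  -- The closure of X₀ under Γ is reached after ω steps.
  module Closure (X₀ : 𝕍) ⦃ _ : Cst X₀ ⦄ (Γ : 𝕍 → 𝕍) (Γr : ∀ {x y} → x ≈ y → Γ x ≈ Γ y) (dΓ : T₁ Γ) where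
    private
      instance
        iΓ : ⦃ DefT {n} s ⦄ → DefT (λ ρ → Γ (s ρ))
        iΓ ⦃ S ⦄ = appT {f = Γ} dΓ S

      F : 𝕍 → 𝕍
      F (sup A f) = X₀ ∪ ⋃ (sup A λ a → F (f a) ∪ Γ (F (f a)))

      F⇒ : ∀ x {z} → z ∊ F x → z ∊ X₀ ⊎ (∃[ k ] k ∊ x × (z ∊ F k ⊎ z ∊ Γ (F k)))
      F⇒ (sup A f) p with ∊∪ p
      ... | inj₁ q = inj₁ q
      ... | inj₂ q = let (y , r , s) = ∊⋃ q ; (a , e) = ∊idx r in
        inj₂ (f a , elt∊ (sup A f) a , ∊∪ (∊r e s))

      F⇐₀ : ∀ x {z} → z ∊ X₀ → z ∊ F x
      F⇐₀ (sup A f) p = ∪l p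

      F⇐ᵢ : ∀ x (i : idx x) {z} → z ∊ F (elt x i) ⊎ z ∊ Γ (F (elt x i)) → z ∊ F x
      F⇐ᵢ (sup A f) i {z} p = ∪r (⋃i {y = F (f i) ∪ Γ (F (f i))} (idx∊ i ≈refl) ([ ∪l , ∪r ]′ p))

      Fr : ∀ {x y} → x ≈ y → F x ≈ F y
      Fr {x} {y} = go x y
        where
        go : ∀ x y → x ≈ y → F x ≈ F y
        go (sup A f) (sup B g) (eq (p , q)) = ≈ext
          (λ z m → [ F⇐₀ (sup B g) , (λ n → let (y , r , s) = ∊⋃ n ; (a , e) = ∊idx r ; (b , e′) = p a
                                                E = go (f a) (g b) (eq e′) in
              F⇐ᵢ (sup B g) b ([ (λ r → inj₁ (∊r E r)) , (λ r → inj₂ (∊r (Γr E) r)) ]′ (∊∪ (∊r e s)))) ]′ (∊∪ m))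
          (λ z m → [ F⇐₀ (sup A f) , (λ n → let (y , r , s) = ∊⋃ n ; (b , e) = ∊idx r ; (a , e′) = q b
                                                E = ≈sym (go (f a) (g b) (eq e′)) in
              F⇐ᵢ (sup A f) a ([ (λ r → inj₁ (∊r E r)) , (λ r → inj₂ (∊r (Γr E) r)) ]′ (∊∪ (∊r e s)))) ]′ (∊∪ m))

      F⇐ : ∀ x k {z} → k ∊ x → z ∊ F k ⊎ z ∊ Γ (F k) → z ∊ F x
      F⇐ x k m p = let (i , e) = ∊idx m in F⇐ᵢ x i ([ (λ q → inj₁ (∊r (Fr e) q)) , (λ q → inj₂ (∊r (Γr (Fr e)) q)) ]′ p)

      Φ : 𝕍 → 𝕍 → 𝕍 → Set₁
      Φ x y R = (∀ z → z ∊ y → z ∊ X₀ ⊎ (∃[ k ] k ∊ x × (∃[ c ] ⟪ k , c ⟫ ∊ R × (z ∊ c ⊎ z ∊ Γ c))))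
        × (∀ z → z ∊ X₀ → z ∊ y)
        × (∀ k → k ∊ x → ∀ c → ⟪ k , c ⟫ ∊ R → (∀ z → z ∊ c → z ∊ y) × (∀ z → z ∊ Γ c → z ∊ y))

      ok : ∀ x y R → V x → V y → V R → Tot x R → Agr F x R → Φ x y R ⟺ (y ≈ F x)
      ok x y R vx vy vR tot ag = f , g
        where
        f : Φ x y R → y ≈ F x
        f (p , q , r) = ≈ext
          (λ z m → [ F⇐₀ x , (λ (k , kx , c , kc , s) → let E = ag k kx c kc in
             F⇐ x k kx ([ (λ s → inj₁ (∊r E s)) , (λ s → inj₂ (∊r (Γr E) s)) ]′ s)) ]′ (p z m))
          (λ z m → [ q z , (λ (k , kx , s) → let (c , kc) = tot k kx ; E = ≈sym (ag k kx c kc) ; (u , v) = r k kx c kc in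
             [ (λ s → u z (∊r E s)) , (λ s → v z (∊r (Γr E) s)) ]′ s) ]′ (F⇒ x m))
        g : y ≈ F x → Φ x y R
        g e = (λ z m → [ inj₁ , (λ (k , kx , s) → let (c , kc) = tot k kx ; E = ≈sym (ag k kx c kc) in
                 inj₂ (k , kx , c , kc , [ (λ s → inj₁ (∊r E s)) , (λ s → inj₂ (∊r (Γr E) s)) ]′ s)) ]′ (F⇒ x (∊r e m))) ,
              (λ z m → ∊r (≈sym e) (F⇐₀ x m)) ,
              (λ k kx c kc → let E = ag k kx c kc in
                 (λ z m → ∊r (≈sym e) (F⇐ x k kx (inj₁ (∊r E m)))) ,
                 (λ z m → ∊r (≈sym e) (F⇐ x k kx (inj₂ (∊r (Γr E) m)))))

      cl : ∀ x R → V x → V R → Tot x R → Agr F x R → V (F x)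
      cl x R vx vR tot ag = V≈ (proj₁ (ok x Y R vx VY vR tot ag) Yφ) VY
        where
        instance
          ix : Cst x
          ix = cst vx
          iR : Cst R
          iR = cst vR
        S Y : 𝕍
        S = sep (⋃ (⋃ R)) λ c → ∃[ k ] k ∊ x × ⟪ k , c ⟫ ∊ R
        Y = X₀ ∪ ⋃ (img S λ c → c ∪ Γ c)
        VY : V Y
        VY = VT it
        inS⁻ : ∀ {c} → c ∊ S → ∃[ k ] k ∊ x × ⟪ k , c ⟫ ∊ R
        inS⁻ p = proj₂ (∊sep p)
        inS : ∀ {k c} → k ∊ x → ⟪ k , c ⟫ ∊ R → c ∊ S
        inS p q = sep-i (⋃i (⋃i q ⟪⟫∋) (upr ≈refl)) (_ , p , q)
        ∪r-resp : ∀ {c d} → c ≈ d → (c ∪ Γ c) ≈ (d ∪ Γ d)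
        ∪r-resp e = ≈ext (λ z p → [ (λ q → ∪l (∊r e q)) , (λ q → ∪r (∊r (Γr e) q)) ]′ (∊∪ p))
                         (λ z p → [ (λ q → ∪l (∊r (≈sym e) q)) , (λ q → ∪r (∊r (Γr (≈sym e)) q)) ]′ (∊∪ p))
        inY : ∀ {k c z} → k ∊ x → ⟪ k , c ⟫ ∊ R → z ∊ c ∪ Γ c → z ∊ Y
        inY p q r = ∪r (⋃i (img-i {t = λ c → c ∪ Γ c} (λ _ _ e → ∪r-resp e) (inS p q) ≈refl) r)
        Yφ : Φ x Y R
        Yφ = (λ z m → [ inj₁ , (λ q → let (y , r , s) = ∊⋃ q ; (c , cS , e) = ∊img r ; (k , kx , kc) = inS⁻ cS in
                inj₂ (k , kx , c , kc , ∊∪ (∊r e s))) ]′ (∊∪ m)) ,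
             (λ z m → ∪l m) ,
             (λ k kx c kc → (λ z m → inY kx kc (∪l m)) , (λ z m → inY kx kc (∪r m)))

      opaque
        dF : T₁ F
        dF = Rec.dRec F Fr Φ it ok cl

    stage : ℕ → 𝕍
    stage n = F (num n)

    closure : 𝕍
    closure = F ω

    V-closure : V closure
    V-closure = DefT.closed dF (ω ◂ ∅ₑ) (Vω ◂ ∅ₑ)

    base⊂ : X₀ ⊂ closure
    base⊂ z = F⇐₀ ω

    base⊂stage : ∀ n → X₀ ⊂ stage n
    base⊂stage n z = F⇐₀ (num n)

    stage⊂ : ∀ n → stage n ⊂ closure
    stage⊂ n z p = F⇐ ω (num n) (idx∊ {x = ω} n ≈refl) (inj₁ p)

    stage-suc : ∀ n → stage n ⊂ stage (suc n)
    stage-suc n z p = F⇐ (num (suc n)) (num n) (num-r n ≈refl) (inj₁ p)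

    Γ-stage : ∀ n → Γ (stage n) ⊂ stage (suc n)
    Γ-stage n z p = F⇐ (num (suc n)) (num n) (num-r n ≈refl) (inj₂ p)

    stage+ : ∀ n m → stage n ⊂ stage (m + n)
    stage+ n zero z p = p
    stage+ n (suc m) z p = stage-suc (m + n) z (stage+ n m z p)

    to-stage : ∀ {z} → z ∊ closure → Σ[ n ∈ ℕ ] z ∊ stage n
    to-stage {z} p with F⇒ ω p
    ... | inj₁ q = 0 , F⇐₀ (num 0) q
    ... | inj₂ (k , kω , q) = let (n , e) = ∊idx kω in suc n ,
      [ (λ q → stage-suc n z (∊r (Fr e) q)) , (λ q → Γ-stage n z (∊r (Γr (Fr e)) q)) ]′ q

    closure-ind : (Q : 𝕍 → Set ℓ) → (∀ z → z ∊ X₀ → Q z) →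
      (∀ c → (∀ z → z ∊ c → Q z) → ∀ z → z ∊ Γ c → Q z) → ∀ z → z ∊ closure → Q z
    closure-ind Q base step z p = ∈-ind (λ x → ∀ z → z ∊ F x → Q z) st ω z p
      where
      st : ∀ x → (∀ k → k ∊ x → ∀ z → z ∊ F k → Q z) → ∀ z → z ∊ F x → Q z
      st x ih z m with F⇒ x m
      ... | inj₁ q = base z q
      ... | inj₂ (k , kx , inj₁ q) = ih k kx z q
      ... | inj₂ (k , kx , inj₂ q) = step (F k) (ih k kx) z q

  ⋃-cong : ∀ {x y} → x ≈ y → ⋃ x ≈ ⋃ y
  ⋃-cong e = ≈ext (λ z p → let (y , q , r) = ∊⋃ p in ⋃i (∊r e q) r)
                  (λ z p → let (y , q , r) = ∊⋃ p in ⋃i (∊r (≈sym e) q) r)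

  module _ (x : 𝕍) (vx : V x) where
    private
      instance
        ix : Cst x
        ix = cst vx
      module C = Closure (up x x) ⋃ ⋃-cong it
    opaque
      tc : 𝕍
      tc = C.closure
      V-tc : V tc
      V-tc = C.V-closure
      tc∋ : x ∊ tc
      tc∋ = C.base⊂ x (upl ≈refl)
      tc-trans : ∀ {y z} → y ∊ tc → z ∊ y → z ∊ tc
      tc-trans {z = z} p q = let (n , r) = C.to-stage p in C.stage⊂ (suc n) z (C.Γ-stage n z (⋃i r q))

 open Recursion

 module MaximalElements where
  private variable
    n : ℕ
    ℓ ℓ′ : Level
    s t u : Env n → 𝕍

  -- Zorn's lemma in V, by the least family closed under C ↦ C ∪ { h C } and unions of chains.
  module Zorn (Q lt : 𝕍) ⦃ _ : Cst Q ⦄ ⦃ _ : Cst lt ⦄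
    (irr : ∀ x → x ∊ Q → ¬ ⟪ x , x ⟫ ∊ lt)
    (trn : ∀ x y z → x ∊ Q → y ∊ Q → z ∊ Q → ⟪ x , y ⟫ ∊ lt → ⟪ y , z ⟫ ∊ lt → ⟪ x , z ⟫ ∊ lt) where

    Chain : 𝕍 → Set₁
    Chain C = ∀ x → x ∊ C → ∀ y → y ∊ C → ⟪ x , y ⟫ ∊ lt ⊎ x ≈ y ⊎ ⟪ y , x ⟫ ∊ lt

    module _ (ub : ∀ C → V C → C ⊂ Q → Chain C → ∃[ u ] u ∊ Q × (∀ x → x ∊ C → ⟪ x , u ⟫ ∊ lt ⊎ x ≈ u)) where
      private
        VQ : V Q
        VQ = VT it

        module NoMax (nomax : ∀ m → m ∊ Q → ∃[ y ] y ∊ Q × ⟪ m , y ⟫ ∊ lt) where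
          Ch : 𝕍
          Ch = sep (pow Q) Chain

          Above : 𝕍 → 𝕍 → Set₁
          Above C u = ∀ x → x ∊ C → ⟪ x , u ⟫ ∊ lt

          above : ∀ C → C ∊ Ch → ∃[ u ] u ∊ Q × Above C u
          above C p = let (q , c) = ∊sep p
                          (u , uQ , h) = ub C (∊pow-V VQ q) (∊pow VQ q) c
                          (y , yQ , l) = nomax u uQ
                      in y , yQ , λ x m → [ (λ r → trn x u y (∊pow VQ q x m) uQ yQ r l) , (λ e → ⟪⟫-resp (≈sym e) ≈refl l) ]′ (h x m)

          opaque
            dAbove : D₂ Above
            dAbove = it
            ch : Choice Ch Q Above
            ch = choose Ch Q Above dAbove above

          h : 𝕍
          h = Choice.fn ch

          instance
            ih : Cst h
            ih = cst (Choice.V-fn ch)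

          Lin : 𝕍 → Set₁
          Lin 𝒞 = ∀ C → C ∊ 𝒞 → ∀ D → D ∊ 𝒞 → C ⊂ D ⊎ D ⊂ C

          Tower : 𝕍 → Set₁
          Tower 𝒳 = (∀ C → C ∊ 𝒳 → ∀ u → ⟪ C , u ⟫ ∊ h → C ∪ up u u ∊ 𝒳)
            × (∀ 𝒞 → 𝒞 ∊ pow 𝒳 → Lin 𝒞 → ⋃ 𝒞 ∊ 𝒳)

          L : 𝕍
          L = sep (pow Q) λ C → ∀ 𝒳 → 𝒳 ∊ pow (pow Q) → Tower 𝒳 → C ∊ 𝒳

          VL : V L
          VL = Vsep

          VpQ : V (pow Q)
          VpQ = Vpow VQ

          u∊Q : ∀ {C u} → ⟪ C , u ⟫ ∊ h → u ∊ Q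
          u∊Q p = proj₁ (proj₂ (Choice.sound ch p))

          V-step : ∀ {C u} → V C → V u → V (C ∪ up u u)
          V-step vC vu = VT (d∪ ⦃ cst vC ⦄ ⦃ dUP ⦃ cst vu ⦄ ⦃ cst vu ⦄ ⦄)

          pow-step : ∀ {C u} → C ∊ pow Q → u ∊ Q → C ∪ up u u ∊ pow Q
          pow-step p q = pow-i VQ (V-step (∊pow-V VQ p) (V∊ VQ q))
            λ z m → [ ∊pow VQ p z , (λ r → ∊l (≈sym (∊sing r)) q) ]′ (∊∪ m)

          pow-⋃ : ∀ {𝒞} → V 𝒞 → 𝒞 ⊂ pow Q → ⋃ 𝒞 ∊ pow Q
          pow-⋃ v s = pow-i VQ (V⋃ v) λ z m → let (C , p , q) = ∊⋃ m in ∊pow VQ (s C p) z q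

          L⇒ : ∀ {C} → C ∊ L → C ∊ pow Q × (∀ 𝒳 → 𝒳 ∊ pow (pow Q) → Tower 𝒳 → C ∊ 𝒳)
          L⇒ p = ∊sep p

          L-step : ∀ C → C ∊ L → ∀ u → ⟪ C , u ⟫ ∊ h → C ∪ up u u ∊ L
          L-step C p u q = let (r , g) = L⇒ p in
            sep-i (pow-step r (u∊Q q)) (λ 𝒳 m t → proj₁ t C (g 𝒳 m t) u q)

          L-⋃ : ∀ 𝒞 → 𝒞 ∊ pow L → Lin 𝒞 → ⋃ 𝒞 ∊ L
          L-⋃ 𝒞 p l = sep-i (pow-⋃ (∊pow-V VL p) (λ C m → proj₁ (L⇒ (∊pow VL p C m))))
            (λ 𝒳 m t → proj₂ t 𝒞 (pow-i (∊pow-V VpQ m) (∊pow-V VL p) (λ C c → proj₂ (L⇒ (∊pow VL p C c)) 𝒳 m t)) l)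

          L-ind : (R : 𝕍 → Set₁) → D₁ R →
            (∀ C → C ∊ L → R C → ∀ u → ⟪ C , u ⟫ ∊ h → R (C ∪ up u u)) →
            (∀ 𝒞 → 𝒞 ⊂ L → (∀ C → C ∊ 𝒞 → R C) → Lin 𝒞 → R (⋃ 𝒞)) → ∀ C → C ∊ L → R C
          L-ind R d st un C p = proj₂ (∊X (proj₂ (L⇒ p) X
              (pow-i VpQ VX λ D m → proj₁ (L⇒ (proj₁ (∊X m))))
              ((λ D m u q → let (r , k) = ∊X m in Xi (L-step D r u q) (st D r k u q)) ,
               (λ 𝒞 m l → let s = ∊pow VX m in
                  Xi (L-⋃ 𝒞 (pow-i VL (∊pow-V VX m) (λ D q → proj₁ (∊X (s D q)))) l)
                     (un 𝒞 (λ D q → proj₁ (∊X (s D q))) (λ D q → proj₂ (∊X (s D q))) l)))))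
            where
            X : 𝕍
            X = sep L R ⦃ it ⦄ ⦃ d ⦄
            VX : V X
            VX = Vsep
            ∊X : ∀ {D} → D ∊ X → D ∊ L × R D
            ∊X = ∊sep
            Xi : ∀ {D} → D ∊ L → R D → D ∊ X
            Xi = sep-i

          Comp : 𝕍 → Set₁
          Comp C = ∀ D → D ∊ L → D ⊂ C ⊎ C ⊂ D

          step₁ : ∀ C → C ∊ L → Comp C → ∀ u → ⟪ C , u ⟫ ∊ h → ∀ D → D ∊ L → D ⊂ C ⊎ (C ∪ up u u) ⊂ D
          step₁ C CL comp u Cu = L-ind R it st un
            where
            instance
              iC : Cst C
              iC = cst (V∊ VL CL)
              iu : Cst u
              iu = cst (V∊ VQ (u∊Q Cu))
            R : 𝕍 → Set₁
            R D = D ⊂ C ⊎ (C ∪ up u u) ⊂ D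
            st : ∀ D → D ∊ L → R D → ∀ v → ⟪ D , v ⟫ ∊ h → R (D ∪ up v v)
            st D DL (inj₂ k) v Dv = inj₂ λ z m → ∪l (k z m)
            st D DL (inj₁ k) v Dv with comp (D ∪ up v v) (L-step D DL v Dv)
            ... | inj₁ k′ = inj₁ k′
            ... | inj₂ k′ with dec₀ (v ∊ C)
            ...   | yes vC = inj₁ λ z m → [ k z , (λ r → ∊l (≈sym (∊sing r)) vC) ]′ (∊∪ m)
            ...   | no v∉ = inj₂ λ z m → [ k′ z , (λ r → ∪r (upl (≈trans (∊sing r) u≈v))) ]′ (∊∪ m)
              where
              C⊂D : C ⊂ D
              C⊂D z m = [ (λ r → r) , (λ r → ⊥-elim (v∉ (∊l (∊sing r) m))) ]′ (∊∪ (k′ z m))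
              u≈v : u ≈ v
              u≈v = Choice.unique ch Cu (⟪⟫-resp (≈ext k C⊂D) ≈refl Dv)
            un : ∀ 𝒞 → 𝒞 ⊂ L → (∀ D → D ∊ 𝒞 → R D) → Lin 𝒞 → R (⋃ 𝒞)
            un 𝒞 s r l with dec₁ (∃[ D ] D ∊ 𝒞 × (C ∪ up u u) ⊂ D)
            ... | yes (D , m , k) = inj₂ λ z q → ⋃i m (k z q)
            ... | no k = inj₁ λ z q → let (D , m , zD) = ∊⋃ q in
              [ (λ f → f z zD) , (λ f → ⊥-elim (k (D , m , f))) ]′ (r D m)

          step₂ : ∀ C → C ∊ L → Comp C
          step₂ = L-ind Comp it
            (λ C CL comp u Cu D DL → [ (λ k → inj₁ λ z m → ∪l (k z m)) , inj₂ ]′ (step₁ C CL comp u Cu D DL))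
            un
            where
            un : ∀ 𝒞 → 𝒞 ⊂ L → (∀ C → C ∊ 𝒞 → Comp C) → Lin 𝒞 → Comp (⋃ 𝒞)
            un 𝒞 s r l D DL with dec₁ (∃[ C ] C ∊ 𝒞 × D ⊂ C)
            ... | yes (C , m , k) = inj₁ λ z q → ⋃i m (k z q)
            ... | no k = inj₂ λ z q → let (C , m , zC) = ∊⋃ q in
              [ (λ f → ⊥-elim (k (C , m , f))) , (λ f → f z zC) ]′ (r C m D DL)

          L-chain : ∀ C → C ∊ L → Chain C
          L-chain = L-ind Chain it st un
            where
            st : ∀ C → C ∊ L → Chain C → ∀ u → ⟪ C , u ⟫ ∊ h → Chain (C ∪ up u u)
            st C CL c u Cu x p y q with ∊∪ p | ∊∪ q
            ... | inj₁ a | inj₁ b = c x a y b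
            ... | inj₁ a | inj₂ b = inj₁ (⟪⟫-resp ≈refl (≈sym (∊sing b)) (proj₂ (proj₂ (Choice.sound ch Cu)) x a))
            ... | inj₂ a | inj₁ b = inj₂ (inj₂ (⟪⟫-resp ≈refl (≈sym (∊sing a)) (proj₂ (proj₂ (Choice.sound ch Cu)) y b)))
            ... | inj₂ a | inj₂ b = inj₂ (inj₁ (≈trans (∊sing a) (≈sym (∊sing b))))
            un : ∀ 𝒞 → 𝒞 ⊂ L → (∀ C → C ∊ 𝒞 → Chain C) → Lin 𝒞 → Chain (⋃ 𝒞)
            un 𝒞 s r l x p y q = let (C , m , xC) = ∊⋃ p ; (D , m′ , yD) = ∊⋃ q in
              [ (λ k → r D m′ x (k x xC) y yD) , (λ k → r C m x xC y (k y yD)) ]′ (l C m D m′)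

          absurd : ⊥
          absurd = irr w (u∊Q Uu) (proj₂ (proj₂ (Choice.sound ch Uu)) w (⋃i (L-step U UL w Uu) (∪r (upl ≈refl))))
            where
            U : 𝕍
            U = ⋃ L
            UL : U ∊ L
            UL = L-⋃ L (pow-i VL VL (λ z m → m)) (λ C m D m′ → step₂ D m′ C m)
            UCh : U ∊ Ch
            UCh = sep-i (proj₁ (L⇒ UL)) (L-chain U UL)
            w : 𝕍
            w = proj₁ (Choice.total ch UCh)
            Uu : ⟪ U , w ⟫ ∊ h
            Uu = proj₂ (Choice.total ch UCh)

      zorn : ∃[ m ] m ∊ Q × (∀ y → y ∊ Q → ¬ ⟪ m , y ⟫ ∊ lt)
      zorn with dec₁ (∃[ m ] m ∊ Q × (∀ y → y ∊ Q → ¬ ⟪ m , y ⟫ ∊ lt))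
      ... | yes r = r
      ... | no h = ⊥-elim (NoMax.absurd λ m p → nm m p (dec₁ (∃[ y ] y ∊ Q × ⟪ m , y ⟫ ∊ lt)))
        where
        nm : ∀ m → m ∊ Q → Dec (∃[ y ] y ∊ Q × ⟪ m , y ⟫ ∊ lt) → ∃[ y ] y ∊ Q × ⟪ m , y ⟫ ∊ lt
        nm m p (yes r) = r
        nm m p (no k) = ⊥-elim (h (m , p , λ y q l → k (y , q , l)))

 open MaximalElements

 module ForcingRelation where
  private variable
    n : ℕ
    ℓ ℓ′ : Level
    s t u : Env n → 𝕍

  module Forcing (S : SymmetricSystem) (isS : IsSymmetricSystemIn V S) where
    open SymmetricSystem S public
    private module I = IsSymmetricSystemIn isS

    instance
      iP : Cst P
      iP = cst I.P∈
      i≤ : Cst ≤P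
      i≤ = cst I.≤P∈
      iH : Cst H
      iH = cst I.H∈
      iF : Cst F
      iF = cst I.F∈
      i𝟙 : Cst 𝟙
      i𝟙 = cst (V∊ I.P∈ (mem I.𝟙∈P))

    infix 4 _≼_
    _≼_ : 𝕍 → 𝕍 → Set
    q ≼ p = ⟪ q , p ⟫ ∊ ≤P

    ≼refl : ∀ {p} → p ∊ P → p ≼ p
    ≼refl m = in⟨ (I.reflexive _ (unmem m))

    ≼trans : ∀ {p q r} → p ∊ P → q ∊ P → r ∊ P → p ≼ q → q ≼ r → p ≼ r
    ≼trans a b c h k = in⟨ (I.transitive _ _ _ (unmem a) (unmem b) (unmem c) (out⟨ h) (out⟨ k))

    𝟙P : 𝟙 ∊ P
    𝟙P = mem I.𝟙∈P

    ≼𝟙 : ∀ {p} → p ∊ P → p ≼ 𝟙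
    ≼𝟙 m = in⟨ (I.maximum _ (unmem m))

    record Gen (G : 𝕍) : Set₁ where
      field
        sub : ∀ {p} → p ∊ G → p ∊ P
        ne  : ∃[ p ] p ∊ G
        upw : ∀ {p q} → p ∊ G → q ∊ P → p ≼ q → q ∊ G
        dir : ∀ {p q} → p ∊ G → q ∊ G → ∃[ r ] r ∊ G × r ≼ p × r ≼ q
        gen : ∀ D → V D → D ⊂ P → (∀ p → p ∊ P → ∃[ q ] q ∊ D × q ≼ p) → ∃[ p ] p ∊ G × p ∊ D

      𝟙G : 𝟙 ∊ G
      𝟙G = upw (proj₂ ne) 𝟙P (≼𝟙 (sub (proj₂ ne)))

      decide : (U : 𝕍 → Set ℓ) → D₁ U →
        (∃[ p ] p ∊ G × U p) ⊎ (∃[ p ] p ∊ G × (∀ q → q ∊ P → q ≼ p → ¬ U q))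
      decide U d = fin (gen D (Vsep) (λ p m → proj₁ (D⇒ m)) dense)
        where
        instance
          iU : ⦃ DefT {n} s ⦄ → Def (λ ρ → U (s ρ))
          iU ⦃ T ⦄ = app₁ {R = U} d T
        W : 𝕍 → Set _
        W p = U p ⊎ (∀ q → q ∊ P → q ≼ p → ¬ U q)
        dW : D₁ W
        dW = it
        D : 𝕍
        D = sep P W ⦃ it ⦄ ⦃ dW ⦄
        D⇒ : ∀ {p} → p ∊ D → p ∊ P × W p
        D⇒ = ∊sep
        D⇐ : ∀ {p} → p ∊ P → W p → p ∊ D
        D⇐ = sep-i
        dense : ∀ p → p ∊ P → ∃[ q ] q ∊ D × q ≼ p
        dense p m with dec₁D {R = λ p → ∃[ q ] q ∊ P × q ≼ p × U q} it p (V∊ I.P∈ m)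
        ... | yes (q , qP , h , u) = q , D⇐ qP (inj₁ u) , h
        ... | no k = p , D⇐ m (inj₂ λ q qP h u → k (q , qP , h , u)) , ≼refl m
        fin : ∃[ p ] p ∊ G × p ∊ D → _
        fin (p , m , q) with proj₂ (D⇒ q)
        ... | inj₁ u = inj₁ (p , m , u)
        ... | inj₂ u = inj₂ (p , m , u)

      dense-below : (U : 𝕍 → Set ℓ) → D₁ U → ∀ p → p ∊ G →
        (∀ q → q ∊ P → q ≼ p → ∃[ r ] r ∊ P × r ≼ q × U r) → ∃[ r ] r ∊ G × U r
      dense-below U d p m h with decide U d
      ... | inj₁ r = r
      ... | inj₂ (p′ , m′ , k) =
        let (r , rG , r≤p , r≤p′) = dir m m′
            (t , tP , t≤r , u) = h r (sub rG) r≤p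
        in ⊥-elim (k t tP (≼trans tP (sub rG) (sub m′) t≤r r≤p′) u)

    fromGeneric : ∀ {G} → IsGeneric V S G → Gen G
    fromGeneric g = record
      { sub = λ m → mem (subset _ (unmem m))
      ; ne = let (p , m) = nonempty in p , mem m
      ; upw = λ m n h → mem (upward _ _ (unmem m) (unmem n) (out⟨ h))
      ; dir = λ m n → let (r , a , b , c) = directed _ _ (unmem m) (unmem n) in r , mem a , in⟨ b , in⟨ c
      ; gen = λ D v s h → let (p , a , b) = generic D v ((λ z m → unmem (s z (mem m))) ,
                                λ p m → let (q , a , b) = h p (mem m) in q , unmem a , out⟨ b)
                          in p , mem a , mem b }
      where open IsGeneric g

    -- Forcing for names in N.  Equality is the greatest forcing bisimulation, hence a set in V,
    -- and it satisfies the usual recursive clauses because membership is well-founded.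
    module OnNames (N : 𝕍) ⦃ _ : Cst N ⦄ (pc : ∀ {x s z} → x ∊ N → ⟪ s , z ⟫ ∊ x → z ∊ N) where
      private
        Forth Back : 𝕍 → 𝕍 → 𝕍 → 𝕍 → Set₁
        Forth R p x y = ∀ s z → ⟪ s , z ⟫ ∊ x → s ∊ P → ∀ q → q ∊ P → q ≼ p → q ≼ s →
          ∃[ r ] r ∊ P × r ≼ q × (∃[ t ] ∃[ w ] ⟪ t , w ⟫ ∊ y × t ∊ P × r ≼ t × ⟪ r , ⟪ z , w ⟫ ⟫ ∊ R)
        Back R p x y = ∀ t w → ⟪ t , w ⟫ ∊ y → t ∊ P → ∀ q → q ∊ P → q ≼ p → q ≼ t →
          ∃[ r ] r ∊ P × r ≼ q × (∃[ s ] ∃[ z ] ⟪ s , z ⟫ ∊ x × s ∊ P × r ≼ s × ⟪ r , ⟪ z , w ⟫ ⟫ ∊ R)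

        Φ : 𝕍 → 𝕍 → Set₁
        Φ R u = ∀ p xy → u ≈ ⟪ p , xy ⟫ → ∀ x y → xy ≈ ⟪ x , y ⟫ → Forth R p x y × Back R p x y

        U : 𝕍
        U = P ⊗ N ⊗ N

        opaque
          dΦ : D₂ Φ
          dΦ = it

        mono : ∀ R S u → V R → V S → V u → R ⊂ S → Φ R u → Φ S u
        mono R S u _ _ _ h φ p xy e x y e′ = let (f , b) = φ p xy e x y e′ in
          (λ s z m sP q qP a b → let (r , rP , c , t , w , m′ , tP , d , k) = f s z m sP q qP a b in
             r , rP , c , t , w , m′ , tP , d , h _ k) ,
          (λ s z m sP q qP a c → let (r , rP , c , t , w , m′ , tP , d , k) = b s z m sP q qP a c in
             r , rP , c , t , w , m′ , tP , d , h _ k)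

        module Gf = GFP U Φ dΦ mono

      opaque
        E : 𝕍
        E = Gf.gfp
        V-E : V E
        V-E = Gf.gfp-V

      instance
        iE : Cst E
        iE = cst V-E

      Eq : 𝕍 → 𝕍 → 𝕍 → Set
      Eq p x y = ⟪ p , ⟪ x , y ⟫ ⟫ ∊ E

      private opaque
        unfolding E
        E-dom : ∀ {p x y} → Eq p x y → p ∊ P × x ∊ N × y ∊ N
        E-dom m = let (a , b) = ⊗e (Gf.gfp⊂ _ m) in a , ⊗e b

        E-out : ∀ {p x y} → Eq p x y → Forth E p x y × Back E p x y
        E-out m = Gf.gfp-out m _ _ ≈refl _ _ ≈refl

        E-in : ∀ {p x y} → p ∊ P → x ∊ N → y ∊ N → Forth E p x y → Back E p x y → Eq p x y
        E-in {p} {x} {y} pP xN yN f b = Gf.gfp-in (⊗i pP (⊗i xN yN)) λ p′ xy e x′ y′ e′ →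
          let (ep , exy) = ⟪⟫-inj e ; (ex , ey) = ⟪⟫-inj (≈trans exy e′) in
          (λ s z m sP q qP a c →
            let (r , rP , c , t , w , m′ , tP , d , k) = f s z (∊r (≈sym ex) m) sP q qP (⟪⟫-resp ≈refl (≈sym ep) a) c in
            r , rP , c , t , w , ∊r ey m′ , tP , d , k) ,
          (λ s z m sP q qP a c →
            let (r , rP , c , t , w , m′ , tP , d , k) = b s z (∊r (≈sym ey) m) sP q qP (⟪⟫-resp ≈refl (≈sym ep) a) c in
            r , rP , c , t , w , ∊r ex m′ , tP , d , k)

      Eq-mono : ∀ {p q x y} → Eq p x y → q ∊ P → q ≼ p → Eq q x y
      Eq-mono m qP h = let (pP , xN , yN) = E-dom m ; (f , b) = E-out m in
        E-in qP xN yN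
          (λ s z k sP q′ qP′ a c → f s z k sP q′ qP′ (≼trans qP′ qP pP a h) c)
          (λ s z k sP q′ qP′ a c → b s z k sP q′ qP′ (≼trans qP′ qP pP a h) c)

      private
        MemC : 𝕍 → 𝕍 → 𝕍 → Set₁
        MemC p x y = ∀ q → q ∊ P → q ≼ p →
          ∃[ r ] r ∊ P × r ≼ q × (∃[ t ] ∃[ w ] ⟪ t , w ⟫ ∊ y × t ∊ P × r ≼ t × ⟪ r , ⟪ x , w ⟫ ⟫ ∊ E)

        MemS : 𝕍 → Set₁
        MemS u = ∃[ p ] ∃[ xy ] u ≈ ⟪ p , xy ⟫ × (∃[ x ] ∃[ y ] xy ≈ ⟪ x , y ⟫ × MemC p x y)

        opaque
          dMemS : D₁ MemS
          dMemS = it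

      opaque
        ME : 𝕍
        ME = sep U MemS ⦃ it ⦄ ⦃ dMemS ⦄
        V-ME : V ME
        V-ME = Vsep

      instance
        iME : Cst ME
        iME = cst V-ME

      Mem : 𝕍 → 𝕍 → 𝕍 → Set
      Mem p x y = ⟪ p , ⟪ x , y ⟫ ⟫ ∊ ME

      private opaque
        unfolding ME
        M-out : ∀ {p x y} → Mem p x y → p ∊ P × x ∊ N × y ∊ N × MemC p x y
        M-out {p} {x} {y} m = go (∊sep m)
          where
          go : ⟪ p , ⟪ x , y ⟫ ⟫ ∊ U × MemS ⟪ p , ⟪ x , y ⟫ ⟫ → p ∊ P × x ∊ N × y ∊ N × MemC p x y
          go (k , p′ , xy , e , x′ , y′ , e′ , h) =
            let (ep , exy) = ⟪⟫-inj e ; (ex , ey) = ⟪⟫-inj (≈trans exy e′) ; (a , b) = ⊗e k ; (b , c) = ⊗e b in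
            a , b , c , λ q qP q≤ →
              let (r , rP , r≤ , t , w , m , tP , r≤t , k) = h q qP (⟪⟫-resp ≈refl ep q≤) in
              r , rP , r≤ , t , w , ∊r (≈sym ey) m , tP , r≤t , ⟪⟫-resp ≈refl (⟪⟫-cong (≈sym ex) ≈refl) k

        M-in : ∀ {p x y} → p ∊ P → x ∊ N → y ∊ N → MemC p x y → Mem p x y
        M-in a b c h = sep-i (⊗i a (⊗i b c)) (_ , _ , ≈refl , _ , _ , ≈refl , h)

      Mem-mono : ∀ {p q x y} → Mem p x y → q ∊ P → q ≼ p → Mem q x y
      Mem-mono m qP h = let (pP , xN , yN , f) = M-out m in
        M-in qP xN yN λ q′ qP′ a → f q′ qP′ (≼trans qP′ qP pP a h)

      Mem-dense : ∀ {p x y} → p ∊ P → x ∊ N → y ∊ N →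
        (∀ q → q ∊ P → q ≼ p → ∃[ r ] r ∊ P × r ≼ q × Mem r x y) → Mem p x y
      Mem-dense pP xN yN h = M-in pP xN yN λ q qP a →
        let (r , rP , r≤q , m) = h q qP a
            (_ , _ , _ , f) = M-out m
            (r′ , rP′ , r′≤ , k) = f r rP (≼refl rP)
        in r′ , rP′ , ≼trans rP′ rP qP r′≤ r≤q , k

      module _ {G : 𝕍} (g : Gen G) where
        open Gen g

        Eq-true : ∀ {p x y} → p ∊ G → Eq p x y → Val G x ≈ Val G y
        Eq-true {p} {x} {y} = pair-ind (λ x → ∀ y p → p ∊ G → Eq p x y → Val G x ≈ Val G y) step x y p
          where
          step : ∀ x → (∀ s z → ⟪ s , z ⟫ ∊ x → ∀ y p → p ∊ G → Eq p z y → Val G z ≈ Val G y) →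
            ∀ y p → p ∊ G → Eq p x y → Val G x ≈ Val G y
          step x ih y p pG e = ≈ext left right
            where
            D = E-dom e
            instance
              ix : Cst x
              ix = cst (V∊ (VT it) (proj₁ (proj₂ D)))
              iy : Cst y
              iy = cst (V∊ (VT it) (proj₂ (proj₂ D)))
            left : Val G x ⊂ Val G y
            left v m with ∊val m
            ... | s , z , sG , sz , ev =
              let (p′ , pG′ , a , b) = dir pG sG
                  instance
                    iz : Cst z
                    iz = cst (V⟨r (V∊ (VT it) sz))
                  (r , rG , t , w , tw , tP , r≤t , k) = dense-below
                    (λ r → ∃[ t ] ∃[ w ] ⟪ t , w ⟫ ∊ y × t ∊ P × r ≼ t × ⟪ r , ⟪ z , w ⟫ ⟫ ∊ E) it p′ pG′
                    (λ q qP q≤ → proj₁ (E-out e) s z sz (sub sG) q qP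
                       (≼trans qP (sub pG′) (sub pG) q≤ a) (≼trans qP (sub pG′) (sub sG) q≤ b))
              in val-i (upw rG tP r≤t) tw (≈trans ev (ih s z sz w r rG k))
            right : Val G y ⊂ Val G x
            right v m with ∊val m
            ... | t , w , tG , tw , ev =
              let (p′ , pG′ , a , b) = dir pG tG
                  instance
                    iw : Cst w
                    iw = cst (V⟨r (V∊ (VT it) tw))
                  (r , rG , s , z , sz , sP , r≤s , k) = dense-below
                    (λ r → ∃[ s ] ∃[ z ] ⟪ s , z ⟫ ∊ x × s ∊ P × r ≼ s × ⟪ r , ⟪ z , w ⟫ ⟫ ∊ E) it p′ pG′
                    (λ q qP q≤ → proj₂ (E-out e) t w tw (sub tG) q qP
                       (≼trans qP (sub pG′) (sub pG) q≤ a) (≼trans qP (sub pG′) (sub tG) q≤ b))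
              in val-i (upw rG sP r≤s) sz (≈trans ev (≈sym (ih s z sz w r rG k)))

        Eq-force : ∀ {x y} → x ∊ N → y ∊ N → Val G x ≈ Val G y → ∃[ p ] p ∊ G × Eq p x y
        Eq-force {x} {y} = pair-ind (λ x → ∀ y → x ∊ N → y ∊ N → Val G x ≈ Val G y → ∃[ p ] p ∊ G × Eq p x y) step x y
          where
          step : ∀ x → (∀ s z → ⟪ s , z ⟫ ∊ x → ∀ y → z ∊ N → y ∊ N → Val G z ≈ Val G y → ∃[ p ] p ∊ G × Eq p z y) →
            ∀ y → x ∊ N → y ∊ N → Val G x ≈ Val G y → ∃[ p ] p ∊ G × Eq p x y
          step x ih y xN yN e = fin (decide Bad it)
            where
            instance
              ix : Cst x
              ix = cst (V∊ (VT it) xN)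
              iy : Cst y
              iy = cst (V∊ (VT it) yN)
            BadF BadB Bad : 𝕍 → Set₁
            BadF p = ∃[ s ] ∃[ z ] ⟪ s , z ⟫ ∊ x × s ∊ P × p ≼ s ×
              (∀ r → r ∊ P → r ≼ p → ∀ t w → ⟪ t , w ⟫ ∊ y → t ∊ P → r ≼ t → ¬ ⟪ r , ⟪ z , w ⟫ ⟫ ∊ E)
            BadB p = ∃[ t ] ∃[ w ] ⟪ t , w ⟫ ∊ y × t ∊ P × p ≼ t ×
              (∀ r → r ∊ P → r ≼ p → ∀ s z → ⟪ s , z ⟫ ∊ x → s ∊ P → r ≼ s → ¬ ⟪ r , ⟪ z , w ⟫ ⟫ ∊ E)
            Bad p = BadF p ⊎ BadB p
            fin : (∃[ p ] p ∊ G × Bad p) ⊎ (∃[ p ] p ∊ G × (∀ q → q ∊ P → q ≼ p → ¬ Bad q)) → ∃[ p ] p ∊ G × Eq p x y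
            fin (inj₁ (p , pG , inj₁ (s , z , sz , sP , p≤s , k))) =
              let (t , w , tG , tw , e′) = ∊val (∊r e (val-i (upw pG sP p≤s) sz ≈refl))
                  (r , rG , m) = ih s z sz w (pc xN sz) (pc yN tw) e′
                  (r₁ , r₁G , a , b) = dir pG rG
                  (r₂ , r₂G , c , d) = dir r₁G tG
                  r₂P = sub r₂G
              in ⊥-elim (k r₂ r₂P (≼trans r₂P (sub r₁G) (sub pG) c a) t w tw (sub tG) d
                   (Eq-mono m r₂P (≼trans r₂P (sub r₁G) (sub rG) c b)))
            fin (inj₁ (p , pG , inj₂ (t , w , tw , tP , p≤t , k))) =
              let (s , z , sG , sz , e′) = ∊val (∊r (≈sym e) (val-i (upw pG tP p≤t) tw ≈refl))
                  (r , rG , m) = ih s z sz w (pc xN sz) (pc yN tw) (≈sym e′)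
                  (r₁ , r₁G , a , b) = dir pG rG
                  (r₂ , r₂G , c , d) = dir r₁G sG
                  r₂P = sub r₂G
              in ⊥-elim (k r₂ r₂P (≼trans r₂P (sub r₁G) (sub pG) c a) s z sz (sub sG) d
                   (Eq-mono m r₂P (≼trans r₂P (sub r₁G) (sub rG) c b)))
            fin (inj₂ (p , pG , k)) = p , pG , E-in (sub pG) xN yN f b
              where
              f : Forth E p x y
              f s z sz sP q qP q≤p q≤s with dec₁ (∃[ r ] r ∊ P × r ≼ q × (∃[ t ] ∃[ w ] ⟪ t , w ⟫ ∊ y × t ∊ P × r ≼ t × ⟪ r , ⟪ z , w ⟫ ⟫ ∊ E))
              ... | yes h = h
              ... | no h = ⊥-elim (k q qP q≤p (inj₁ (s , z , sz , sP , q≤s ,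
                  λ r rP r≤q t w tw tP r≤t m → h (r , rP , r≤q , t , w , tw , tP , r≤t , m))))
              b : Back E p x y
              b t w tw tP q qP q≤p q≤t with dec₁ (∃[ r ] r ∊ P × r ≼ q × (∃[ s ] ∃[ z ] ⟪ s , z ⟫ ∊ x × s ∊ P × r ≼ s × ⟪ r , ⟪ z , w ⟫ ⟫ ∊ E))
              ... | yes h = h
              ... | no h = ⊥-elim (k q qP q≤p (inj₂ (t , w , tw , tP , q≤t ,
                  λ r rP r≤q s z sz sP r≤s m → h (r , rP , r≤q , s , z , sz , sP , r≤s , m))))

        Mem-true : ∀ {p x y} → p ∊ G → Mem p x y → Val G x ∊ Val G y
        Mem-true {p} {x} {y} pG m =
          let (r , rG , t , w , tw , tP , r≤t , k) = dense-below
                (λ r → ∃[ t ] ∃[ w ] ⟪ t , w ⟫ ∊ y × t ∊ P × r ≼ t × ⟪ r , ⟪ x , w ⟫ ⟫ ∊ E) it p pG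
                (proj₂ (proj₂ (proj₂ (M-out m))))
          in val-i (upw rG tP r≤t) tw (Eq-true rG k)
          where
          instance
            ix : Cst x
            ix = cst (V∊ (VT it) (proj₁ (proj₂ (M-out m))))
            iy : Cst y
            iy = cst (V∊ (VT it) (proj₁ (proj₂ (proj₂ (M-out m)))))

        Mem-force : ∀ {x y} → x ∊ N → y ∊ N → Val G x ∊ Val G y → ∃[ p ] p ∊ G × Mem p x y
        Mem-force xN yN m =
          let (t , w , tG , tw , e) = ∊val m
              (r , rG , k) = Eq-force xN (pc yN tw) e
              (p , pG , a , b) = dir rG tG
          in p , pG , M-in (sub pG) xN yN λ q qP q≤p → q , qP , ≼refl qP , t , w , tw , sub tG ,
               ≼trans qP (sub pG) (sub tG) q≤p b ,
               Eq-mono k qP (≼trans qP (sub pG) (sub rG) q≤p a)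

 open ForcingRelation

 module SymmetricNames where
  private variable
    n : ℕ
    ℓ ℓ′ : Level
    s t u : Env n → 𝕍

  record Perm (A θ : 𝕍) : Set₁ where
    field
      dom  : ∀ {z} → z ∊ θ → z ∊ A ⊗ A
      tot  : ∀ {x} → x ∊ A → ∃[ y ] ⟪ x , y ⟫ ∊ θ
      srj  : ∀ {y} → y ∊ A → ∃[ x ] ⟪ x , y ⟫ ∊ θ
      sv   : ∀ {x y y′} → ⟪ x , y ⟫ ∊ θ → ⟪ x , y′ ⟫ ∊ θ → y ≈ y′
      inj  : ∀ {x x′ y} → ⟪ x , y ⟫ ∊ θ → ⟪ x′ , y ⟫ ∊ θ → x ≈ x′
    l∊ : ∀ {x y} → ⟪ x , y ⟫ ∊ θ → x ∊ A
    l∊ m = proj₁ (⊗e (dom m))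
    r∊ : ∀ {x y} → ⟪ x , y ⟫ ∊ θ → y ∊ A
    r∊ m = proj₂ (⊗e (dom m))

  fromBij : ∀ {A f} → IsBijection A A f → Perm A f
  fromBij {A} {f} b = record
    { dom = λ {z} m → let (x , y , p , q , e) = F.graph z (unmem m) in ∊l (≈sym (≈⟨ e)) (⊗i (mem p) (mem q))
    ; tot = λ m → let (y , p) = F.total _ (unmem m) in y , in⟨ p
    ; srj = λ m → let (x , p) = B.surjective _ (unmem m) in x , in⟨ p
    ; sv = λ p q → eq (F.single-valued _ _ _ (out⟨ p) (out⟨ q))
    ; inj = λ p q → eq (B.injective _ _ _ (out⟨ p) (out⟨ q)) }
    where
    module B = IsBijection b
    module F = IsFunction B.isFunction

  toBij : ∀ {A f} → Perm A f → IsBijection A A f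
  toBij p = record
    { isFunction = record
      { graph = λ z m → let (x , y , a , b , e) = ∊⊗ (dom (mem m)) in x , y , unmem a , unmem b , ≐⟨ e
      ; total = λ a m → let (y , q) = tot (mem m) in y , out⟨ q
      ; single-valued = λ a b b′ q r → uneq (sv (in⟨ q) (in⟨ r)) }
    ; injective = λ a a′ b q r → uneq (inj (in⟨ q) (in⟨ r))
    ; surjective = λ b m → let (y , q) = srj (mem m) in y , out⟨ q }
    where open Perm p

  module Names (S : SymmetricSystem) (isS : IsSymmetricSystemIn V S)
    (fix𝟙 : ∀ σ → σ ∊ SymmetricSystem.H S → ⟪ SymmetricSystem.𝟙 S , SymmetricSystem.𝟙 S ⟫ ∊ σ) where
    open Forcing S isS
    private
      module I = IsSymmetricSystemIn isS
      module PG = IsPermGroup I.group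

    permH : ∀ {σ} → σ ∊ H → Perm P σ
    permH m = fromBij (PG.bijections _ (unmem m))

    dot : 𝕍 → 𝕍
    dot a = img a λ x → ⟪ 𝟙 , x ⟫

    ∊dot : ∀ {a z} → z ∊ dot a → ∃[ x ] x ∊ a × z ≈ ⟪ 𝟙 , x ⟫
    ∊dot = ∊img

    dot-i : ∀ {a x} → x ∊ a → ⟪ 𝟙 , x ⟫ ∊ dot a
    dot-i m = img-i {t = λ x → ⟪ 𝟙 , x ⟫} (λ _ _ e → ⟪⟫-cong ≈refl e) m ≈refl

    dot-e : ∀ {a p x} → ⟪ p , x ⟫ ∊ dot a → p ≈ 𝟙 × x ∊ a
    dot-e m = let (x , q , e) = ∊dot m ; (a , b) = ⟪⟫-inj e in a , ∊l (≈sym b) q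

    dot-cong : ∀ {a b} → a ≈ b → dot a ≈ dot b
    dot-cong e = ≈ext (λ z m → let (x , q , r) = ∊dot m in ∊l (≈sym r) (dot-i (∊r e q)))
                      (λ z m → let (x , q , r) = ∊dot m in ∊l (≈sym r) (dot-i (∊r (≈sym e) q)))

    opaque
      op : 𝕍 → 𝕍 → 𝕍
      op x y = dot (up (dot (up x x)) (dot (up x y)))

    opaque
      unfolding op
      op-cong : ∀ {x y x′ y′} → x ≈ x′ → y ≈ y′ → op x y ≈ op x′ y′
      op-cong e f = dot-cong (up-cong (dot-cong (up-cong e e)) (dot-cong (up-cong e f)))

    opaque
      unfolding op
      private
        dOp′ : DefT {n} s → DefT t → DefT (λ ρ → op (s ρ) (t ρ))
        dOp′ {n} {s = s} {t} S T = dImg {s = λ ρ → up (dot (up (s ρ) (s ρ))) (dot (up (s ρ) (t ρ)))} ⦃ dUP ⦃ d S S ⦄ ⦃ d S T ⦄ ⦄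
          where
          d : ∀ {s t} → DefT {n} s → DefT t → DefT (λ ρ → dot (up (s ρ) (t ρ)))
          d {s} {t} S T = dImg {s = λ ρ → up (s ρ) (t ρ)} ⦃ dUP ⦃ S ⦄ ⦃ T ⦄ ⦄
      instance
        dOp : ⦃ DefT {n} s ⦄ → ⦃ DefT t ⦄ → DefT (λ ρ → op (s ρ) (t ρ))
        dOp ⦃ S ⦄ ⦃ T ⦄ = dOp′ S T

    chk : 𝕍 → 𝕍
    chk (sup A f) = sup A λ a → ⟪ 𝟙 , chk (f a) ⟫

    private
      chk⇒ : ∀ x {z} → z ∊ chk x → ∃[ k ] k ∊ x × z ≈ ⟪ 𝟙 , chk k ⟫
      chk⇒ (sup A f) (mem (a , p)) = f a , elt∊ (sup A f) a , eq p

      chkᵢ : ∀ x (i : idx x) → ⟪ 𝟙 , chk (elt x i) ⟫ ∊ chk x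
      chkᵢ (sup A f) i = elt∊ (chk (sup A f)) i

    chk-cong : ∀ {x y} → x ≈ y → chk x ≈ chk y
    chk-cong {x} {y} = go x y
      where
      go : ∀ x y → x ≈ y → chk x ≈ chk y
      go (sup A f) (sup B g) (eq (p , q)) = ≈ext
        (λ { z (mem (a , e)) → let (b , r) = p a in ∊l (≈sym (≈trans (eq e) (⟪⟫-cong ≈refl (go (f a) (g b) (eq r))))) (chkᵢ (sup B g) b) })
        (λ { z (mem (b , e)) → let (a , r) = q b in ∊l (≈sym (≈trans (eq e) (⟪⟫-cong ≈refl (≈sym (go (f a) (g b) (eq r)))))) (chkᵢ (sup A f) a) })

    ∊chk : ∀ {x z} → z ∊ chk x → ∃[ k ] k ∊ x × z ≈ ⟪ 𝟙 , chk k ⟫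
    ∊chk {x} = chk⇒ x

    chk-i : ∀ {x k} → k ∊ x → ⟪ 𝟙 , chk k ⟫ ∊ chk x
    chk-i {x} m = let (i , e) = ∊idx m in ⟪⟫-resp ≈refl (chk-cong (≈sym e)) (chkᵢ x i)

    private
      Φ : 𝕍 → 𝕍 → 𝕍 → Set₁
      Φ x y R = (∀ z → z ∊ y → ∃[ k ] k ∊ x × (∃[ c ] ⟪ k , c ⟫ ∊ R × z ≈ ⟪ 𝟙 , c ⟫))
        × (∀ k → k ∊ x → ∀ c → ⟪ k , c ⟫ ∊ R → ⟪ 𝟙 , c ⟫ ∊ y)

      ok : ∀ x y R → V x → V y → V R → Tot x R → Agr chk x R → Φ x y R ⟺ (y ≈ chk x)
      ok x y R _ _ _ tot ag =
        (λ (f , g) → ≈ext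
          (λ z m → let (k , kx , c , kc , e) = f z m in ∊l (≈sym (≈trans e (⟪⟫-cong ≈refl (ag k kx c kc)))) (chk-i kx))
          (λ z m → let (k , kx , e) = ∊chk m ; (c , kc) = tot k kx in
            ∊l (≈sym (≈trans e (⟪⟫-cong ≈refl (≈sym (ag k kx c kc))))) (g k kx c kc))) ,
        (λ e → (λ z m → let (k , kx , e′) = ∊chk (∊r e m) ; (c , kc) = tot k kx in
                  k , kx , c , kc , ≈trans e′ (⟪⟫-cong ≈refl (≈sym (ag k kx c kc)))) ,
               (λ k kx c kc → ∊r (≈sym e) (⟪⟫-resp ≈refl (≈sym (ag k kx c kc)) (chk-i kx))))

      cl : ∀ x R → V x → V R → Tot x R → Agr chk x R → V (chk x)
      cl x R vx vR tot ag = V≈ (proj₁ (ok x Y R vx VY vR tot ag) Yφ) VY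
        where
        instance
          ix : Cst x
          ix = cst vx
          iR : Cst R
          iR = cst vR
        T Y : 𝕍
        T = sep (⋃ (⋃ R)) λ c → ∃[ k ] k ∊ x × ⟪ k , c ⟫ ∊ R
        Y = dot T
        VY : V Y
        VY = VT it
        T⇒ : ∀ {c} → c ∊ T → ∃[ k ] k ∊ x × ⟪ k , c ⟫ ∊ R
        T⇒ m = proj₂ (∊sep m)
        T⇐ : ∀ {k c} → k ∊ x → ⟪ k , c ⟫ ∊ R → c ∊ T
        T⇐ p q = sep-i (⋃i (⋃i q ⟪⟫∋) (upr ≈refl)) (_ , p , q)
        Yφ : Φ x Y R
        Yφ = (λ z m → let (c , cT , e) = ∊dot m ; (k , kx , kc) = T⇒ cT in k , kx , c , kc , e) ,
             (λ k kx c kc → dot-i (T⇐ kx kc))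

      opaque
        dchk : T₁ chk
        dchk = Rec.dRec chk chk-cong Φ it ok cl

    opaque
      instance
        dChk : ⦃ DefT {n} s ⦄ → DefT (λ ρ → chk (s ρ))
        dChk ⦃ T ⦄ = appT {f = chk} dchk T

    V-chk : ∀ {x} → V x → V (chk x)
    V-chk v = VT (dChk ⦃ cst v ⦄)

    module _ {G : 𝕍} (𝟙G : 𝟙 ∊ G) where
      ∊val-dot : ∀ {a z} → z ∊ Val G (dot a) → ∃[ x ] x ∊ a × z ≈ Val G x
      ∊val-dot m = let (p , y , _ , q , e) = ∊val m in y , proj₂ (dot-e q) , e

      val-dot-i : ∀ {a x z} → x ∊ a → z ≈ Val G x → z ∊ Val G (dot a)
      val-dot-i m e = val-i 𝟙G (dot-i m) e

      val-up : ∀ {x y} → Val G (dot (up x y)) ≈ up (Val G x) (Val G y)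
      val-up = ≈ext
        (λ z m → let (w , p , e) = ∊val-dot m in
          [ (λ r → upl (≈trans e (val-cong r))) , (λ r → upr (≈trans e (val-cong r))) ]′ (∊up p))
        (λ z m → [ (λ e → val-dot-i (upl ≈refl) e) , (λ e → val-dot-i (upr ≈refl) e) ]′ (∊up m))

      opaque
        unfolding op
        val-op : ∀ {x y} → Val G (op x y) ≈ ⟪ Val G x , Val G y ⟫
        val-op {x} {y} = subst (Val G (op x y) ≈_) (sym ⟪⟫≡up) (≈trans val-up (up-cong val-up val-up))

      val-chk : ∀ x → Val G (chk x) ≈ x
      val-chk = ∈-ind _ λ x ih → ≈ext
        (λ z m → let (p , y , _ , q , e) = ∊val m ; (k , kx , e′) = ∊chk q in
          ∊l (≈sym (≈trans e (≈trans (val-cong (proj₂ (⟪⟫-inj e′))) (ih k kx)))) kx)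
        (λ z m → val-i 𝟙G (chk-i m) (≈sym (ih z m)))

    name-dot : ∀ {a} → (∀ x → x ∊ a → IsName P x) → IsName P (dot a)
    name-dot h = name-i λ z m → let (x , p , e) = ∊dot m in 𝟙 , x , 𝟙P , e , h x p

    opaque
      unfolding op
      name-op : ∀ {x y} → IsName P x → IsName P y → IsName P (op x y)
      name-op {x} {y} a b = name-dot λ z m → [ (λ e → name-cong (≈sym e) (f a a)) , (λ e → name-cong (≈sym e) (f a b)) ]′ (∊up m)
        where
        f : ∀ {x y} → IsName P x → IsName P y → IsName P (dot (up x y))
        f a b = name-dot λ z m → [ (λ e → name-cong (≈sym e) a) , (λ e → name-cong (≈sym e) b) ]′ (∊up m)

    name-chk : ∀ x → IsName P (chk x)
    name-chk = ∈-ind _ λ x ih → name-i λ z m → let (k , p , e) = ∊chk m in 𝟙 , chk k , 𝟙P , e , ih k p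

    module _ {σ : 𝕍} (σH : σ ∊ H) where
      private
        module σ = Perm (permH σH)

      ∊act-dot : ∀ {a z} → z ∊ Act P σ (dot a) → ∃[ x ] x ∊ a × z ≈ ⟪ 𝟙 , Act P σ x ⟫
      ∊act-dot m = let (p , p′ , y , _ , _ , q , r , e) = ∊act m ; (a , b) = dot-e r in
        y , b , ≈trans e (⟪⟫-cong (σ.sv q (⟪⟫-resp (≈sym a) ≈refl (fix𝟙 σ σH))) ≈refl)

      act-dot-i : ∀ {a x z} → x ∊ a → z ≈ ⟪ 𝟙 , Act P σ x ⟫ → z ∊ Act P σ (dot a)
      act-dot-i m e = act-i 𝟙P 𝟙P (fix𝟙 σ σH) (dot-i m) e

      act-dot : ∀ {a b} → (∀ x → x ∊ a → Act P σ x ∊ b) → (∀ y → y ∊ b → ∃[ x ] x ∊ a × Act P σ x ≈ y) →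
        Act P σ (dot a) ≈ dot b
      act-dot f g = ≈ext
        (λ z m → let (x , p , e) = ∊act-dot m in ∊l (≈sym e) (dot-i (f x p)))
        (λ z m → let (y , p , e) = ∊dot m ; (x , q , e′) = g y p in act-dot-i q (≈trans e (⟪⟫-cong ≈refl (≈sym e′))))

      act-up : ∀ {x y} → Act P σ (dot (up x y)) ≈ dot (up (Act P σ x) (Act P σ y))
      act-up = act-dot
        (λ z m → [ (λ e → upl (act-cong e)) , (λ e → upr (act-cong e)) ]′ (∊up m))
        (λ z m → [ (λ e → _ , upl ≈refl , ≈sym e) , (λ e → _ , upr ≈refl , ≈sym e) ]′ (∊up m))

      opaque
        unfolding op
        act-op : ∀ {x y} → Act P σ (op x y) ≈ op (Act P σ x) (Act P σ y)
        act-op = ≈trans act-up (dot-cong (up-cong act-up act-up))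

      act-chk : ∀ x → Act P σ (chk x) ≈ chk x
      act-chk = ∈-ind _ λ x ih → ≈ext
        (λ z m → let (p , p′ , y , _ , _ , q , r , e) = ∊act m ; (k , kx , e′) = ∊chk r ; (a , b) = ⟪⟫-inj e′ in
          ∊l (≈sym (≈trans e (⟪⟫-cong (σ.sv q (⟪⟫-resp (≈sym a) ≈refl (fix𝟙 σ σH))) (≈trans (act-cong b) (ih k kx))))) (chk-i kx))
        (λ z m → let (k , kx , e) = ∊chk m in
          act-i 𝟙P 𝟙P (fix𝟙 σ σH) (chk-i kx) (≈trans e (⟪⟫-cong ≈refl (≈sym (ih k kx)))))

    act-id : ∀ {ι} → IsId P ι → ∀ {x} → IsName P x → Act P ι x ≈ x
    act-id {ι} h {x} nx = pair-ind (λ x → IsName P x → Act P ι x ≈ x) step x nx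
      where
      step : ∀ x → (∀ s z → ⟪ s , z ⟫ ∊ x → IsName P z → Act P ι z ≈ z) → IsName P x → Act P ι x ≈ x
      step x ih nx = ≈ext
        (λ z m → let (p , p′ , y , _ , _ , q , r , e) = ∊act m
                     pp = eq (proj₂ (proj₁ (of⇔ (h p p′)) (out⟨ q))) in
          ∊l (≈sym (≈trans e (⟪⟫-cong (≈sym pp) (ih p y r (name-sub nx r))))) r)
        (λ z m → let (p , y , pP , e , ny) = name⇒ nx m ; r = ∊l e m in
          act-i pP pP (in⟨ (proj₂ (of⇔ (h p p)) (unmem pP , uneq ≈refl))) r (≈trans e (⟪⟫-cong ≈refl (≈sym (ih p y r ny)))))

    act-comp : ∀ {ρ σ τ} → ρ ∊ H → σ ∊ H → τ ∊ H → IsComp ρ σ τ → ∀ x → Act P ρ x ≈ Act P σ (Act P τ x)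
    act-comp {ρ} {σ} {τ} ρH σH τH h = pair-ind _ λ x ih → ≈ext
      (λ z m → let (p , p″ , y , pP , pP″ , q , r , e) = ∊act m
                   (p′ , a , b) = proj₁ (of⇔ (h p p″)) (out⟨ q)
                   pP′ = Perm.r∊ (permH τH) (in⟨ a) in
        act-i pP′ pP″ (in⟨ b) (act-i pP pP′ (in⟨ a) r ≈refl) (≈trans e (⟪⟫-cong ≈refl (ih p y r))))
      (λ z m → let (p′ , p″ , u , pP′ , pP″ , b , r , e) = ∊act m
                   (p , p₁ , y , pP , _ , a , r′ , e′) = ∊act r
                   (e₁ , e₂) = ⟪⟫-inj e′ in
        act-i pP pP″ (in⟨ (proj₂ (of⇔ (h p p″)) (p′ , out⟨ (⟪⟫-resp ≈refl (≈sym e₁) a) , out⟨ b))) r′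
          (≈trans e (⟪⟫-cong ≈refl (≈trans (act-cong e₂) (≈sym (ih p y r′))))))

    -- The action restricted to names in N is a set in V.
    module ActOn (N : 𝕍) ⦃ _ : Cst N ⦄ (pc : ∀ {x s z} → x ∊ N → ⟪ s , z ⟫ ∊ x → z ∊ N) where
      private
        Ψ : 𝕍 → 𝕍 → Set₁
        Ψ R u = ∀ σ zw → u ≈ ⟪ σ , zw ⟫ → ∀ z w → zw ≈ ⟪ z , w ⟫ →
          (∀ p y → ⟪ p , y ⟫ ∊ z → ∀ p′ → ⟪ p , p′ ⟫ ∊ σ → ∃[ w′ ] ⟪ p′ , w′ ⟫ ∊ w × ⟪ σ , ⟪ y , w′ ⟫ ⟫ ∊ R)
          × (∀ v → v ∊ w → ∃[ p′ ] ∃[ w′ ] v ≈ ⟪ p′ , w′ ⟫ ×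
               (∃[ p ] ∃[ y ] ⟪ p , y ⟫ ∊ z × ⟪ p , p′ ⟫ ∊ σ × ⟪ σ , ⟪ y , w′ ⟫ ⟫ ∊ R))
        opaque
          dΨ : D₂ Ψ
          dΨ = it
        mono : ∀ R S u → V R → V S → V u → R ⊂ S → Ψ R u → Ψ S u
        mono R S u _ _ _ h φ σ zw e z w e′ = let (f , b) = φ σ zw e z w e′ in
          (λ p y m p′ q → let (w′ , a , k) = f p y m p′ q in w′ , a , h _ k) ,
          (λ v m → let (p′ , w′ , a , p , y , b , c , k) = b v m in p′ , w′ , a , p , y , b , c , h _ k)
        module Gf = GFP (H ⊗ N ⊗ N) Ψ dΨ mono
      opaque
        actSet : 𝕍
        actSet = Gf.gfp
        V-actSet : V actSet
        V-actSet = Gf.gfp-V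
      instance
        iActSet : Cst actSet
        iActSet = cst V-actSet
      opaque
        unfolding actSet
        actSet⇒ : ∀ {σ z w} → ⟪ σ , ⟪ z , w ⟫ ⟫ ∊ actSet → Act P σ z ≈ w
        actSet⇒ {σ} {z} {w} = pair-ind (λ z → ∀ w → ⟪ σ , ⟪ z , w ⟫ ⟫ ∊ actSet → Act P σ z ≈ w) step z w
          where
          step : ∀ z → (∀ p y → ⟪ p , y ⟫ ∊ z → ∀ w → ⟪ σ , ⟪ y , w ⟫ ⟫ ∊ actSet → Act P σ y ≈ w) →
            ∀ w → ⟪ σ , ⟪ z , w ⟫ ⟫ ∊ actSet → Act P σ z ≈ w
          step z ih w m = ≈ext
              (λ v q → let (p , p′ , y , _ , _ , r , s , e) = ∊act q ; (w′ , a , k) = f p y s p′ r in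
                ∊l (≈sym (≈trans e (⟪⟫-cong ≈refl (ih p y s w′ k)))) a)
              (λ v q → let (p′ , w′ , e , p , y , s , r , k) = b v q in
                act-i (Perm.l∊ (permH σH) r) (Perm.r∊ (permH σH) r) r s (≈trans e (⟪⟫-cong ≈refl (≈sym (ih p y s w′ k)))))
            where
            σH : σ ∊ H
            σH = proj₁ (⊗e (Gf.gfp⊂ _ m))
            f : ∀ p y → ⟪ p , y ⟫ ∊ z → ∀ p′ → ⟪ p , p′ ⟫ ∊ σ → ∃[ w′ ] ⟪ p′ , w′ ⟫ ∊ w × ⟪ σ , ⟪ y , w′ ⟫ ⟫ ∊ actSet
            f = proj₁ (Gf.gfp-out m _ _ ≈refl _ _ ≈refl)
            b : ∀ v → v ∊ w → ∃[ p′ ] ∃[ w′ ] v ≈ ⟪ p′ , w′ ⟫ ×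
               (∃[ p ] ∃[ y ] ⟪ p , y ⟫ ∊ z × ⟪ p , p′ ⟫ ∊ σ × ⟪ σ , ⟪ y , w′ ⟫ ⟫ ∊ actSet)
            b = proj₂ (Gf.gfp-out m _ _ ≈refl _ _ ≈refl)

        actSet⇐ : ∀ {σ z w} → σ ∊ H → z ∊ N → w ∊ N → Act P σ z ≈ w → ⟪ σ , ⟪ z , w ⟫ ⟫ ∊ actSet
        actSet⇐ {σ} {z} {w} σH = pair-ind (λ z → ∀ w → z ∊ N → w ∊ N → Act P σ z ≈ w → ⟪ σ , ⟪ z , w ⟫ ⟫ ∊ actSet) step z w
          where
          step : ∀ z → (∀ p y → ⟪ p , y ⟫ ∊ z → ∀ w → y ∊ N → w ∊ N → Act P σ y ≈ w → ⟪ σ , ⟪ y , w ⟫ ⟫ ∊ actSet) →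
            ∀ w → z ∊ N → w ∊ N → Act P σ z ≈ w → ⟪ σ , ⟪ z , w ⟫ ⟫ ∊ actSet
          step z ih w zN wN e = Gf.gfp-in (⊗i σH (⊗i zN wN)) λ σ′ zw e₁ z′ w′ e₂ →
            let (eσ , ezw) = ⟪⟫-inj e₁ ; (ez , ew) = ⟪⟫-inj (≈trans ezw e₂) in
            (λ p y m p′ q → let q′ = ∊r (≈sym eσ) q ; m′ = ∊r (≈sym ez) m
                                k = act-i (Perm.l∊ (permH σH) q′) (Perm.r∊ (permH σH) q′) q′ m′ ≈refl
                                k′ = ∊r e k in
               Act P σ y , ∊r ew k′ , ⟪⟫-resp eσ ≈refl (ih p y m′ _ (pc zN m′) (pc wN k′) ≈refl)) ,
            (λ v m → let m′ = ∊r (≈sym ew) m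
                         (p , p′ , y , _ , _ , q , s , e₃) = ∊act (∊r (≈sym e) m′)
                         k = ∊l e₃ m′ in
               p′ , Act P σ y , e₃ , p , y , ∊r ez s , ∊r eσ q , ⟪⟫-resp eσ ≈refl (ih p y s _ (pc zN s) (pc wN k) ≈refl))

    tc-pc : ∀ x (vx : V x) {y s z} → y ∊ tc x vx → ⟪ s , z ⟫ ∊ y → z ∊ tc x vx
    tc-pc x vx m q = tc-trans x vx (tc-trans x vx (tc-trans x vx m q) ⟪⟫∋) (upr ≈refl)

    private
      inverse-act : ∀ {σ π x} → σ ∊ H → π ∊ H → IsInverse σ π → IsName P x → Act P π x ≈ x → Act P σ x ≈ x
      inverse-act {σ} {π} {x} σH πH h nx e = go (PG.products σ π (unmem σH) (unmem πH))
        where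
        go : ∃[ ρ ] ρ ∈ H × IsComp ρ σ π → Act P σ x ≈ x
        go (ρ , ρH , c) = ≈trans (act-cong (≈sym e)) (≈trans (≈sym (act-comp (mem ρH) σH πH c x)) (act-id {ρ} id nx))
          where
          module π = Perm (permH πH)
          id : IsId P ρ
          id a b = to⇔ ((λ m → let (y , p , q) = proj₁ (of⇔ (c a b)) m ; q′ = in⟨ (proj₁ (of⇔ (h y b)) q) in
                           unmem (π.l∊ (in⟨ p)) , uneq (π.inj (in⟨ p) q′)) ,
                        (λ (m , e) → let (y , p) = π.tot (mem m) in
                           proj₂ (of⇔ (c a b)) (y , out⟨ p , proj₂ (of⇔ (h y b)) (out⟨ (⟪⟫-resp (eq e) ≈refl p)))))

    sym-intro : ∀ {x K} → V x → IsName P x → K ∊ F → (∀ σ → σ ∊ K → Act P σ x ≈ x) → IsSymmetric V S x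
    sym-intro {x} {K} vx nx KF h = St , I.supergroups K St Vsep (unmem KF) (sub , grp) K⊆ , λ z → to⇔
        ((λ m → let (a , b) = St⇒ (mem m) in unmem a , lift (unAct b)) , (λ (a , lift b) → unmem (St⇐ (mem a) (mkAct b))))
      where
      N : 𝕍
      N = tc x vx
      xN : x ∊ N
      xN = tc∋ x vx
      instance
        iN : Cst N
        iN = cst (V-tc x vx)
        ix : Cst x
        ix = cst vx
      open ActOn N (tc-pc x vx)
      St : 𝕍
      St = sep H λ σ → ⟪ σ , ⟪ x , x ⟫ ⟫ ∊ actSet
      St⇒ : ∀ {σ} → σ ∊ St → σ ∊ H × Act P σ x ≈ x
      St⇒ m = let (a , b) = ∊sep m in a , actSet⇒ b
      St⇐ : ∀ {σ} → σ ∊ H → Act P σ x ≈ x → σ ∊ St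
      St⇐ a e = sep-i a (actSet⇐ a xN xN e)
      sub : St ⊆ H
      sub z m = unmem (proj₁ (St⇒ (mem m)))
      K⊆ : K ⊆ St
      K⊆ z m = unmem (St⇐ (mem (proj₁ (I.subgroups K (unmem KF)) z m)) (h z (mem m)))
      grp : IsPermGroup P St
      grp = record
        { bijections = λ π m → PG.bijections π (sub π m)
        ; identity = let (ι , m , i) = PG.identity in ι , unmem (St⇐ (mem m) (act-id {ι} i nx)) , i
        ; inverses = λ π m → let (a , b) = St⇒ (mem m) ; (σ , σH , i) = PG.inverses π (unmem a) in
            σ , unmem (St⇐ (mem σH) (inverse-act (mem σH) a i nx b)) , i
        ; products = λ σ τ m m′ → let (a , b) = St⇒ (mem m) ; (c , d) = St⇒ (mem m′)
                                      (ρ , ρH , i) = PG.products σ τ (unmem a) (unmem c) in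
            ρ , unmem (St⇐ (mem ρH) (≈trans (act-comp (mem ρH) a c i x) (≈trans (act-cong d) b))) , i }

    HS : 𝕍 → Set₁
    HS = IsHereditarilySymmetric V S

    sym-cong : ∀ {x y} → x ≈ y → IsSymmetric V S x → IsSymmetric V S y
    sym-cong e (K , KF , h) = K , KF , λ z → to⇔
      ((λ m → let (a , lift b) = proj₁ (of⇔ (h z)) m in a , lift (unAct {P} {z} (≈trans (act-cong (≈sym e)) (≈trans (mkAct {P} {z} b) e)))) ,
       (λ (a , lift b) → proj₂ (of⇔ (h z)) (a , lift (unAct {P} {z} (≈trans (act-cong e) (≈trans (mkAct {P} {z} b) (≈sym e)))))))

    hs-cong : ∀ {x y} → x ≈ y → HS x → HS y
    hs-cong e (hs s h) = hs (sym-cong e s) λ p y m → h p y (out⟨ (∊r (≈sym e) (in⟨ m)))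

    hs-dot : ∀ {a} → IsSymmetric V S (dot a) → (∀ x → x ∊ a → HS x) → HS (dot a)
    hs-dot s h = hs s λ p y m → h y (proj₂ (dot-e (in⟨ m)))

    private
      topK : ∃[ K ] K ∊ F
      topK = let (K , m) = I.nonempty in K , mem m

    sub-F : ∀ {K σ} → K ∊ F → σ ∊ K → σ ∊ H
    sub-F KF m = mem (proj₁ (I.subgroups _ (unmem KF)) _ (unmem m))

    hs-chk : ∀ x → V x → HS (chk x)
    hs-chk = ∈-ind _ λ x ih vx → hs
      (sym-intro (V-chk vx) (name-chk x) (proj₂ topK) (λ σ m → act-chk (sub-F (proj₂ topK) m) x))
      (λ p y m → let (k , kx , e) = ∊chk (in⟨ m) in hs-cong (≈sym (proj₂ (⟪⟫-inj e))) (ih k kx (V∊ vx kx)))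

    opaque
      unfolding op
      hs-op : ∀ {x y K} → V x → V y → IsName P x → IsName P y → HS x → HS y → K ∊ F →
        (∀ σ → σ ∊ K → Act P σ x ≈ x × Act P σ y ≈ y) → HS (op x y)
      hs-op {x} {y} {K} vx vy nx ny hx hy KF h =
        hs-dot (sym-intro (VT (dOp ⦃ cst vx ⦄ ⦃ cst vy ⦄)) (name-op nx ny) KF λ σ m → let (a , b) = h σ m in ≈trans (act-op (sub-F KF m)) (op-cong a b))
          λ z m → [ (λ e → hs-cong (≈sym e) (f vx nx hx λ σ m → let (a , b) = h σ m in a , a)) ,
                    (λ e → hs-cong (≈sym e) (f vy ny hy h)) ]′ (∊up m)
        where
        instance
          ix : Cst x
          ix = cst vx
          iy : Cst y
          iy = cst vy
        f : ∀ {w} → V w → IsName P w → HS w → (∀ σ → σ ∊ K → Act P σ x ≈ x × Act P σ w ≈ w) → HS (dot (up x w))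
        f {w} vw nw hw h = hs-dot
          (sym-intro (VT (dImg ⦃ dUP ⦃ it ⦄ ⦃ cst vw ⦄ ⦄ ⦃ it ⦄))
            (name-dot λ z m → [ (λ e → name-cong (≈sym e) nx) , (λ e → name-cong (≈sym e) nw) ]′ (∊up m))
            KF λ σ m → let (a , b) = h σ m in ≈trans (act-up (sub-F KF m)) (dot-cong (up-cong a b)))
          λ z m → [ (λ e → hs-cong (≈sym e) hx) , (λ e → hs-cong (≈sym e) hw) ]′ (∊up m)

    V⊑W : ∀ {G} → Gen G → V ⊑ SymmetricExtension V S G
    V⊑W g x vx = chk x , V-chk vx , name-chk x , hs-chk x vx , unVal (≈sym (val-chk (Gen.𝟙G g) x))

    W⊑V[G] : ∀ {G} → SymmetricExtension V S G ⊑ GenericExtension V S G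
    W⊑V[G] x (ẋ , v , n , _ , e) = ẋ , v , n , e

    -- σ⁻¹G is generic, and evaluating x by it amounts to evaluating σx by G.
    module Pull {G σ : 𝕍} (g : Gen G) (σH : σ ∊ H) where
      private
        module g = Gen g
        module σ = Perm (permH σH)
        aut : ∀ {p p′ q q′} → ⟪ p , p′ ⟫ ∊ σ → ⟪ q , q′ ⟫ ∊ σ → (p ≼ q) ⟺ (p′ ≼ q′)
        aut a b = let (f , h) = of⇔ (I.automorphisms σ _ _ _ _ (unmem σH) (out⟨ a) (out⟨ b)) in
          (λ m → in⟨ (f (out⟨ m))) , (λ m → in⟨ (h (out⟨ m)))
        instance
          iσ : Cst σ
          iσ = cst (V∊ (VT it) σH)

      pull : 𝕍
      pull = sup (Σ[ i ∈ idx P ] Σ[ j ∈ idx G ] ⟪ elt P i , elt G j ⟫ ∊ σ) λ (i , _) → elt P i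

      ∊pull : ∀ {p} → p ∊ pull → ∃[ p′ ] ⟪ p , p′ ⟫ ∊ σ × p′ ∊ G
      ∊pull (mem ((i , j , m) , e)) = elt G j , ⟪⟫-resp (≈sym (eq e)) ≈refl m , elt∊ G j

      pull-i : ∀ {p p′} → ⟪ p , p′ ⟫ ∊ σ → p′ ∊ G → p ∊ pull
      pull-i m q = let (i , e) = ∊idx (σ.l∊ m) ; (j , e′) = ∊idx q in idx∊ (i , j , ⟪⟫-resp e e′ m) e

      gen-pull : Gen pull
      gen-pull = record
        { sub = λ m → σ.l∊ (proj₁ (proj₂ (∊pull m)))
        ; ne = let (p′ , m) = g.ne ; (p , q) = σ.srj (g.sub m) in p , pull-i q m
        ; upw = λ m qP h → let (p′ , a , b) = ∊pull m ; (q′ , c) = σ.tot qP in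
            pull-i c (g.upw b (σ.r∊ c) (proj₁ (aut a c) h))
        ; dir = λ m n → let (p′ , a , b) = ∊pull m ; (q′ , c , d) = ∊pull n ; (r′ , x , y , z) = g.dir b d
                            (r , w) = σ.srj (g.sub x) in
            r , pull-i w x , proj₂ (aut w a) y , proj₂ (aut w c) z
        ; gen = λ D vD D⊂ dn → let
            (p′ , a , b) = g.gen (D′ D vD) (V-D′ D vD) (λ z m → proj₁ (D′⇒ D vD m))
              (λ q′ m → let (q , c) = σ.srj m ; (r , rD , h) = dn q (σ.l∊ c) ; (r′ , d) = σ.tot (D⊂ r rD) in
                 r′ , D′⇐ D vD (σ.r∊ d) rD d , proj₁ (aut d c) h)
            (_ , p , pD , c) = D′⇒ D vD b
            in p , pull-i c a , pD }
        where
        module _ (D : 𝕍) (vD : V D) where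
          private instance
            iD : Cst D
            iD = cst vD
          D′ : 𝕍
          D′ = sep P λ q → ∃[ p ] p ∊ D × ⟪ p , q ⟫ ∊ σ
          V-D′ : V D′
          V-D′ = Vsep
          D′⇒ : ∀ {q} → q ∊ D′ → q ∊ P × (∃[ p ] p ∊ D × ⟪ p , q ⟫ ∊ σ)
          D′⇒ m = ∊sep m
          D′⇐ : ∀ {q p} → q ∊ P → p ∊ D → ⟪ p , q ⟫ ∊ σ → q ∊ D′
          D′⇐ a b c = sep-i a (_ , b , c)

      val-pull : ∀ x → Val pull x ≈ Val G (Act P σ x)
      val-pull = pair-ind _ λ x ih → ≈ext
        (λ z m → let (p , y , pG , q , e) = ∊val m ; (p′ , a , b) = ∊pull pG in
          val-i b (act-i (σ.l∊ a) (σ.r∊ a) a q ≈refl) (≈trans e (ih p y q)))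
        (λ z m → let (q , u , qG , r , e) = ∊val m ; (p , p′ , y , _ , _ , a , b , e′) = ∊act r ; (e₁ , e₂) = ⟪⟫-inj e′ in
          val-i (pull-i a (∊l e₁ qG)) b (≈trans e (≈trans (val-cong e₂) (≈sym (ih p y b)))))

 open SymmetricNames

 module GenericFilters where
  private variable
    n : ℕ
    ℓ ℓ′ : Level
    s t u : Env n → 𝕍

  module Existence (S : SymmetricSystem) (isS : IsSymmetricSystemIn V S) (cV : Countable V) where
    open Forcing S isS

    private
      e : ℕ → 𝕍
      e = proj₁ cV

      Dense : 𝕍 → Set₁
      Dense D = ∀ p → p ∊ P → ∃[ q ] q ∊ P × q ∊ D × q ≼ p

      next : ℕ → ∃[ p ] p ∊ P → ∃[ p ] p ∊ P
      next n (p , m) with dec₁ (Dense (e n))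
      ... | yes d = let (q , a , _) = d p m in q , a
      ... | no _ = p , m

      next≼ : ∀ n x → proj₁ (next n x) ≼ proj₁ x
      next≼ n (p , m) with dec₁ (Dense (e n))
      ... | yes d = let (q , _ , _ , h) = d p m in h
      ... | no _ = ≼refl m

      next∊ : ∀ n x → Dense (e n) → proj₁ (next n x) ∊ e n
      next∊ n (p , m) k with dec₁ (Dense (e n))
      ... | yes d = let (q , _ , a , _) = d p m in a
      ... | no h = ⊥-elim (h k)

      seq : ℕ → ∃[ p ] p ∊ P
      seq zero = 𝟙 , 𝟙P
      seq (suc n) = next n (seq n)

      pt : ℕ → 𝕍
      pt n = proj₁ (seq n)

      ptP : ∀ n → pt n ∊ P
      ptP n = proj₂ (seq n)

      pt+ : ∀ n m → pt (m + n) ≼ pt n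
      pt+ n zero = ≼refl (ptP n)
      pt+ n (suc m) = ≼trans (ptP (suc m + n)) (ptP (m + n)) (ptP n) (next≼ (m + n) (seq (m + n))) (pt+ n m)

      G : 𝕍
      G = sup (Σ[ i ∈ idx P ] Σ[ n ∈ ℕ ] pt n ≼ elt P i) λ (i , _) → elt P i

      ∊G : ∀ {p} → p ∊ G → p ∊ P × (Σ[ n ∈ ℕ ] pt n ≼ p)
      ∊G (mem ((i , n , h) , r)) = ∊l (≈sym (eq r)) (elt∊ P i) , n , ⟪⟫-resp ≈refl (≈sym (eq r)) h

      G-i : ∀ {p} n → p ∊ P → pt n ≼ p → p ∊ G
      G-i n m h = let (i , r) = ∊idx m in idx∊ (i , n , ⟪⟫-resp ≈refl r h) r

      ptG : ∀ n → pt n ∊ G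
      ptG n = G-i n (ptP n) (≼refl (ptP n))

    exists-generic : ∃[ G ] IsGeneric V S G
    exists-generic = G , record
      { subset = λ z m → unmem (proj₁ (∊G (mem m)))
      ; nonempty = pt 0 , unmem (ptG 0)
      ; upward = λ p q m n h → let (pP , k , a) = ∊G (mem m) in
          unmem (G-i k (mem n) (≼trans (ptP k) pP (mem n) a (in⟨ h)))
      ; directed = λ p q m n → let (pP , k , a) = ∊G (mem m) ; (qP , l , b) = ∊G (mem n) in
          pt (l + k) , unmem (ptG (l + k)) ,
          out⟨ (≼trans (ptP (l + k)) (ptP k) pP (pt+ k l) a) ,
          out⟨ (≼trans (ptP (l + k)) (ptP l) qP (subst (λ n → pt n ≼ pt l) (+-comm k l) (pt+ l k)) b)
      ; generic = λ D vD (s , d) → let (n , r) = proj₂ cV D vD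
                                       dn : Dense (e n)
                                       dn p m = let (q , a , b) = d p (unmem m) in
                                         q , mem (s q a) , ∊r (eq r) (mem a) , in⟨ b in
          pt (suc n) , unmem (ptG (suc n)) , unmem (∊r (≈sym (eq r)) (next∊ n (seq n) dn)) }

 open GenericFilters

 module Smallness where
  private variable
    n : ℕ
    ℓ ℓ′ : Level
    s t u : Env n → 𝕍

  ⊗-cong : ∀ {a b a′ b′} → a ≈ a′ → b ≈ b′ → a ⊗ b ≈ a′ ⊗ b′
  ⊗-cong e f = ≈ext
    (λ z m → let (x , y , p , q , r) = ∊⊗ m in ∊l (≈sym r) (⊗i (∊r e p) (∊r f q)))
    (λ z m → let (x , y , p , q , r) = ∊⊗ m in ∊l (≈sym r) (⊗i (∊r (≈sym e) p) (∊r (≈sym f) q)))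

  -- Smallness relative to a set B closed under pairing: B-indexed unions of small sets are small,
  -- while pow B is not small.
  module Small (X : 𝕍) ⦃ _ : Cst X ⦄ where
    private
      module C = Closure (X ∪ up ∅ ∅) (λ c → c ⊗ c) (λ e → ⊗-cong e e) it

    opaque
      B : 𝕍
      B = C.closure
      V-B : V B
      V-B = C.V-closure
      X⊂B : X ⊂ B
      X⊂B z m = C.base⊂ z (∪l m)
      ∅∊B : ∅ ∊ B
      ∅∊B = C.base⊂ ∅ (∪r (upl ≈refl))
      pair∊B : ∀ {b c} → b ∊ B → c ∊ B → ⟪ b , c ⟫ ∊ B
      pair∊B {b} {c} p q = let (n , p′) = C.to-stage p ; (k , q′) = C.to-stage q in
        C.stage⊂ (suc (k + n)) _ (C.Γ-stage (k + n) _ (⊗i (C.stage+ n k b p′)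
          (subst (λ j → c ∊ C.stage j) (+-comm n k) (C.stage+ k n c q′))))

    instance
      iB : Cst B
      iB = cst V-B

    Small : 𝕍 → Set₁
    Small s = ∃[ h ] V h × (∀ b x → ⟪ b , x ⟫ ∊ h → ∀ x′ → ⟪ b , x′ ⟫ ∊ h → x ≈ x′)
      × (∀ x → x ∊ s → ∃[ b ] ⟪ b , x ⟫ ∊ h × b ∊ B)

    small-sub : ∀ {s t} → s ⊂ t → Small t → Small s
    small-sub f (h , v , u , c) = h , v , u , λ x m → c x (f x m)

    small-⊂B : ∀ {s} → s ⊂ B → Small s
    small-⊂B {s} f = h , Vrel , (λ b x p x′ q → let (_ , _ , e) = h⇒ p ; (_ , _ , e′) = h⇒ q in ≈trans (≈sym e) e′) ,
        λ x m → x , rel-i (f x m) (f x m) ≈refl , f x m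
      where
      h : 𝕍
      h = rel B B λ x y → x ≈ y
      h⇒ : ∀ {x y} → ⟪ x , y ⟫ ∊ h → x ∊ B × y ∊ B × x ≈ y
      h⇒ m = ∊rel m

    small-img : ∀ {s t} → V t → (R : 𝕍 → 𝕍 → Set ℓ) → D₂ R → Small s →
      (∀ x y y′ → y ∊ t → y′ ∊ t → R x y → R x y′ → y ≈ y′) → (∀ y → y ∊ t → ∃[ x ] x ∊ s × R x y) → Small t
    small-img {s = s₀} {t₀} vt R d (h , v , u , c) f g = h′ , Vrel , un , cov
      where
      instance
        iR : ⦃ DefT {n} s ⦄ → ⦃ DefT t ⦄ → Def (λ ρ → R (s ρ) (t ρ))
        iR ⦃ S ⦄ ⦃ T ⦄ = app₂ {R = R} d S T
        it′ : Cst t₀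
        it′ = cst vt
        ih : Cst h
        ih = cst v
      h′ : 𝕍
      h′ = rel B t₀ λ b y → ∃[ x ] ⟪ b , x ⟫ ∊ h × R x y
      h⇒ : ∀ {b y} → ⟪ b , y ⟫ ∊ h′ → b ∊ B × y ∊ t₀ × (∃[ x ] ⟪ b , x ⟫ ∊ h × R x y)
      h⇒ m = ∊rel m
      un : ∀ b y → ⟪ b , y ⟫ ∊ h′ → ∀ y′ → ⟪ b , y′ ⟫ ∊ h′ → y ≈ y′
      un b y m y′ m′ = let (_ , p , x , q , r) = h⇒ m ; (_ , p′ , x′ , q′ , r′) = h⇒ m′ in
        f x′ y y′ p p′ (resp₂ {R = R} d (V⟨r (V∊ v q)) (V∊ vt p) (u b x q x′ q′) ≈refl r) r′
      cov : ∀ y → y ∊ t₀ → ∃[ b ] ⟪ b , y ⟫ ∊ h′ × b ∊ B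
      cov y m = let (x , p , r) = g y m ; (b , q , bB) = c x p in b , rel-i bB m (x , q , r) , bB

    small-⊗ : ∀ {s t} → V s → V t → Small s → Small t → Small (s ⊗ t)
    small-⊗ {s} {t} vs vt (h , v , u , c) (h′ , v′ , u′ , c′) = k , Vrel , un , cov
      where
      instance
        is : Cst s
        is = cst vs
        it′ : Cst t
        it′ = cst vt
        ih : Cst h
        ih = cst v
        ih′ : Cst h′
        ih′ = cst v′
      R : 𝕍 → 𝕍 → Set₁
      R b z = ∃[ b₁ ] ∃[ b₂ ] b ≈ ⟪ b₁ , b₂ ⟫ × (∃[ x ] ∃[ y ] z ≈ ⟪ x , y ⟫ × ⟪ b₁ , x ⟫ ∊ h × ⟪ b₂ , y ⟫ ∊ h′)
      k : 𝕍
      k = rel B (s ⊗ t) R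
      k⇒ : ∀ {b z} → ⟪ b , z ⟫ ∊ k → b ∊ B × z ∊ s ⊗ t × R b z
      k⇒ m = ∊rel m
      un : ∀ b z → ⟪ b , z ⟫ ∊ k → ∀ z′ → ⟪ b , z′ ⟫ ∊ k → z ≈ z′
      un b z m z′ m′ = go (proj₂ (proj₂ (k⇒ m))) (proj₂ (proj₂ (k⇒ m′)))
        where
        go : R b z → R b z′ → z ≈ z′
        go (b₁ , b₂ , e , x , y , f , p , q) (b₁′ , b₂′ , e′ , x′ , y′ , f′ , p′ , q′) =
          let (e₁ , e₂) = ⟪⟫-inj (≈trans (≈sym e′) e) in
          ≈trans f (≈trans (⟪⟫-cong (u b₁ x p x′ (⟪⟫-resp e₁ ≈refl p′)) (u′ b₂ y q y′ (⟪⟫-resp e₂ ≈refl q′))) (≈sym f′))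
      cov : ∀ z → z ∊ s ⊗ t → ∃[ b ] ⟪ b , z ⟫ ∊ k × b ∊ B
      cov z m = let (x , y , p , q , e) = ∊⊗ m ; (b₁ , a₁ , m₁) = c x p ; (b₂ , a₂ , m₂) = c′ y q in
        ⟪ b₁ , b₂ ⟫ , rel-i (pair∊B m₁ m₂) m (b₁ , b₂ , ≈refl , x , y , e , a₁ , a₂) , pair∊B m₁ m₂

    small-⋃ : ∀ {𝒮} → V 𝒮 → Small 𝒮 → (∀ s → s ∊ 𝒮 → Small s) → Small (⋃ 𝒮)
    small-⋃ {𝒮} v𝒮 (h , v , u , c) sm = k , Vrel , un , cov
      where
      instance
        i𝒮 : Cst 𝒮
        i𝒮 = cst v𝒮
        ih : Cst h
        ih = cst v
      Cov : 𝕍 → 𝕍 → Set₁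
      Cov s g = (∀ b x → ⟪ b , x ⟫ ∊ g → ∀ x′ → ⟪ b , x′ ⟫ ∊ g → x ≈ x′) × (∀ x → x ∊ s → ∃[ b ] ⟪ b , x ⟫ ∊ g × b ∊ B)
      V⋃𝒮 : V (B ⊗ ⋃ 𝒮)
      V⋃𝒮 = VT it
      trim : ∀ s → s ∊ 𝒮 → ∃[ g ] g ∊ pow (B ⊗ ⋃ 𝒮) × Cov s g
      trim s m = go (sm s m)
        where
        go : Small s → ∃[ g ] g ∊ pow (B ⊗ ⋃ 𝒮) × Cov s g
        go (h , v , u , c) = g , pow-i V⋃𝒮 Vrel (λ z q → rel⊂ z q) ,
            (λ b x p x′ q → u b x (g⇒ p) x′ (g⇒ q)) ,
            (λ x p → let (b , q , bB) = c x p in b , rel-i bB (⋃i m p) q , bB)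
          where
          instance
            ihh : Cst h
            ihh = cst v
          g : 𝕍
          g = rel B (⋃ 𝒮) λ b x → ⟪ b , x ⟫ ∊ h
          g⇒ : ∀ {b x} → ⟪ b , x ⟫ ∊ g → ⟪ b , x ⟫ ∊ h
          g⇒ m = proj₂ (proj₂ (∊rel m))
      instance
        iPow : Cst (pow (B ⊗ ⋃ 𝒮))
        iPow = cst (Vpow V⋃𝒮)
      opaque
        ch : Choice 𝒮 (pow (B ⊗ ⋃ 𝒮)) Cov
        ch = choose 𝒮 (pow (B ⊗ ⋃ 𝒮)) ⦃ it ⦄ ⦃ iPow ⦄ Cov it trim
      f : 𝕍
      f = Choice.fn ch
      instance
        if : Cst f
        if = cst (Choice.V-fn ch)
      R : 𝕍 → 𝕍 → Set₁
      R b x = ∃[ b₁ ] ∃[ b₂ ] b ≈ ⟪ b₁ , b₂ ⟫ × (∃[ s ] ⟪ b₁ , s ⟫ ∊ h × (∃[ g ] ⟪ s , g ⟫ ∊ f × ⟪ b₂ , x ⟫ ∊ g))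
      k : 𝕍
      k = rel B (⋃ 𝒮) R
      k⇒ : ∀ {b x} → ⟪ b , x ⟫ ∊ k → R b x
      k⇒ m = proj₂ (proj₂ (∊rel m))
      un : ∀ b x → ⟪ b , x ⟫ ∊ k → ∀ x′ → ⟪ b , x′ ⟫ ∊ k → x ≈ x′
      un b x m x′ m′ = go (k⇒ m) (k⇒ m′)
        where
        go : R b x → R b x′ → x ≈ x′
        go (b₁ , b₂ , e , s , p , g , q , r) (b₁′ , b₂′ , e′ , s′ , p′ , g′ , q′ , r′) =
          let (e₁ , e₂) = ⟪⟫-inj (≈trans (≈sym e′) e)
              es = u b₁ s p s′ (⟪⟫-resp e₁ ≈refl p′)
              eg = Choice.unique ch q (⟪⟫-resp (≈sym es) ≈refl q′)
          in proj₁ (proj₂ (proj₂ (Choice.sound ch q))) b₂ x r x′ (⟪⟫-resp e₂ ≈refl (∊r (≈sym eg) r′))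
      cov : ∀ x → x ∊ ⋃ 𝒮 → ∃[ b ] ⟪ b , x ⟫ ∊ k × b ∊ B
      cov x m = let (s , p , q) = ∊⋃ m
                    (b₁ , a , m₁) = c s p
                    (g , r) = Choice.total ch p
                    (b₂ , a₂ , m₂) = proj₂ (proj₂ (proj₂ (Choice.sound ch r))) x q
                in ⟪ b₁ , b₂ ⟫ , rel-i (pair∊B m₁ m₂) m (b₁ , b₂ , ≈refl , s , a , g , r , a₂) , pair∊B m₁ m₂

    small-up : ∀ {x y} → V x → V y → Small (up x y)
    small-up {x} {y} vx vy = h , VT it , un , cov
      where
      instance
        ix : Cst x
        ix = cst vx
        iy : Cst y
        iy = cst vy
      h : 𝕍
      h = up ⟪ ∅ , x ⟫ ⟪ ⟪ ∅ , ∅ ⟫ , y ⟫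
      un : ∀ b z → ⟪ b , z ⟫ ∊ h → ∀ z′ → ⟪ b , z′ ⟫ ∊ h → z ≈ z′
      un b z m z′ m′ with ∊up m | ∊up m′
      ... | inj₁ e | inj₁ e′ = ≈trans (proj₂ (⟪⟫-inj e)) (≈sym (proj₂ (⟪⟫-inj e′)))
      ... | inj₂ e | inj₂ e′ = ≈trans (proj₂ (⟪⟫-inj e)) (≈sym (proj₂ (⟪⟫-inj e′)))
      ... | inj₁ e | inj₂ e′ = ⊥-elim (⟪⟫≉∅ (≈trans (≈sym (proj₁ (⟪⟫-inj e′))) (proj₁ (⟪⟫-inj e))))
      ... | inj₂ e | inj₁ e′ = ⊥-elim (⟪⟫≉∅ (≈trans (≈sym (proj₁ (⟪⟫-inj e))) (proj₁ (⟪⟫-inj e′))))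
      cov : ∀ z → z ∊ up x y → ∃[ b ] ⟪ b , z ⟫ ∊ h × b ∊ B
      cov z m with ∊up m
      ... | inj₁ e = ∅ , upl (⟪⟫-cong ≈refl e) , ∅∊B
      ... | inj₂ e = ⟪ ∅ , ∅ ⟫ , upr (⟪⟫-cong ≈refl e) , pair∊B ∅∊B ∅∊B

    small-∪ : ∀ {s t} → V s → V t → Small s → Small t → Small (s ∪ t)
    small-∪ {s} {t} vs vt a b = small-sub (λ z m → ∊r (≈sym ∪≈) m)
      (small-⋃ (VT (dUP ⦃ cst vs ⦄ ⦃ cst vt ⦄)) (small-up vs vt)
        λ w m → [ (λ e → small-sub (λ z → ∊r e) a) , (λ e → small-sub (λ z → ∊r e) b) ]′ (∊up m))

    I : 𝕍
    I = pow B

    V-I : V I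
    V-I = Vpow V-B

    fresh : ∀ s → Small s → ∃[ i ] i ∊ I × ¬ i ∊ s
    fresh s (h , v , u , c) = i , pow-i V-B Vsep (λ z m → proj₁ (∊sep m)) , λ m →
        let (b , p , bB) = c i m
            no-b : ¬ b ∊ i
            no-b q = proj₂ (i⇒ q) i p q
        in no-b (sep-i bB λ x q r → no-b (∊r (u b x q i p) r))
      where
      instance
        ih : Cst h
        ih = cst v
      i : 𝕍
      i = sep B λ b → ∀ x → ⟪ b , x ⟫ ∊ h → ¬ b ∊ x
      i⇒ : ∀ {b} → b ∊ i → b ∊ B × (∀ x → ⟪ b , x ⟫ ∊ h → ¬ b ∊ x)
      i⇒ m = ∊sep m

    -- k is the symmetric difference of i and j
    SD : 𝕍 → 𝕍 → 𝕍 → Set₁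
    SD i j k = ∀ b → b ∊ B → (b ∊ k → (b ∊ i × ¬ b ∊ j) ⊎ (b ∊ j × ¬ b ∊ i))
      × (b ∊ i → ¬ b ∊ j → b ∊ k) × (b ∊ j → ¬ b ∊ i → b ∊ k)

    private
      I⊂ : ∀ {i} → i ∊ I → i ⊂ B
      I⊂ = ∊pow V-B

    SD-exists : ∀ {i j} → i ∊ I → j ∊ I → ∃[ k ] k ∊ I × SD i j k
    SD-exists {i} {j} p q = k , pow-i V-B Vsep (λ z m → proj₁ (∊sep m)) , λ b m →
        (λ r → proj₂ (∊sep r)) , (λ r r′ → sep-i m (inj₁ (r , r′))) , (λ r r′ → sep-i m (inj₂ (r , r′)))
      where
      instance
        ii : Cst i
        ii = cst (V∊ V-I p)
        ij : Cst j
        ij = cst (V∊ V-I q)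
      k : 𝕍
      k = sep B λ b → (b ∊ i × ¬ b ∊ j) ⊎ (b ∊ j × ¬ b ∊ i)

    SD-unique : ∀ {i j k k′} → k ∊ I → k′ ∊ I → SD i j k → SD i j k′ → k ≈ k′
    SD-unique {i} {j} kI kI′ h h′ = ≈ext (half kI h h′) (half kI′ h′ h)
      where
      half : ∀ {k k′} → k ∊ I → SD i j k → SD i j k′ → k ⊂ k′
      half kI h h′ b m = let bB = I⊂ kI b m ; (f , g) = proj₂ (h′ b bB) in
        [ (λ (x , y) → f x y) , (λ (x , y) → g x y) ]′ (proj₁ (h b bB) m)

    -- i △ j = k implies k △ j = i and i △ k = j
    SD-rot : ∀ {i j k} → SD i j k → SD k j i × SD i k j
    SD-rot {i} {j} {k} h = (λ b m → f b m (h b m) (dec₀ (b ∊ i)) (dec₀ (b ∊ j)) (dec₀ (b ∊ k))) ,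
        (λ b m → g b m (h b m) (dec₀ (b ∊ i)) (dec₀ (b ∊ j)) (dec₀ (b ∊ k)))
      where
      X′ : 𝕍 → 𝕍 → 𝕍 → 𝕍 → Set
      X′ b i j k = (b ∊ k → (b ∊ i × ¬ b ∊ j) ⊎ (b ∊ j × ¬ b ∊ i)) × (b ∊ i → ¬ b ∊ j → b ∊ k) × (b ∊ j → ¬ b ∊ i → b ∊ k)
      f : ∀ b → b ∊ B → X′ b i j k → Dec (b ∊ i) → Dec (b ∊ j) → Dec (b ∊ k) → X′ b k j i
      f b m (u , v , w) (yes x) (yes y) (yes z) = [ (λ (_ , q) → ⊥-elim (q y)) , (λ (_ , q) → ⊥-elim (q x)) ]′ (u z)
      f b m (u , v , w) (yes x) (yes y) (no z) = (λ _ → inj₂ (y , z)) , (λ q → ⊥-elim (z q)) , (λ _ _ → x)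
      f b m (u , v , w) (yes x) (no y) z = (λ _ → inj₁ (v x y , y)) , (λ _ _ → x) , (λ q → ⊥-elim (y q))
      f b m (u , v , w) (no x) (yes y) z = (λ q → ⊥-elim (x q)) , (λ _ q → ⊥-elim (q y)) , (λ _ q → ⊥-elim (q (w y x)))
      f b m (u , v , w) (no x) (no y) z = (λ q → ⊥-elim (x q)) ,
        (λ q _ → [ (λ (r , _) → r) , (λ (r , _) → ⊥-elim (y r)) ]′ (u q)) , (λ q → ⊥-elim (y q))
      g : ∀ b → b ∊ B → X′ b i j k → Dec (b ∊ i) → Dec (b ∊ j) → Dec (b ∊ k) → X′ b i k j
      g b m (u , v , w) (yes x) (yes y) (yes z) = [ (λ (_ , q) → ⊥-elim (q y)) , (λ (_ , q) → ⊥-elim (q x)) ]′ (u z)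
      g b m (u , v , w) (yes x) (yes y) (no z) = (λ _ → inj₁ (x , z)) , (λ _ _ → y) , (λ q → ⊥-elim (z q))
      g b m (u , v , w) (yes x) (no y) z = (λ q → ⊥-elim (y q)) , (λ _ q → ⊥-elim (q (v x y))) , (λ _ q → ⊥-elim (q x))
      g b m (u , v , w) (no x) (yes y) z = (λ _ → inj₂ (w y x , x)) , (λ q → ⊥-elim (x q)) , (λ _ _ → y)
      g b m (u , v , w) (no x) (no y) z = (λ q → ⊥-elim (y q)) , (λ q → ⊥-elim (x q)) ,
        (λ q _ → [ (λ (r , _) → ⊥-elim (x r)) , (λ (r , _) → r) ]′ (u q))

    -- Translation by a fresh i₀ moves a small set off itself.
    translate : ∀ s → V s → Small s → s ⊂ I → ∃[ i₀ ] i₀ ∊ I × (∀ i k → i ∊ s → SD i i₀ k → ¬ k ∊ s)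
    translate s vs sm s⊂ = let (i₀ , p , q) = fresh S′ small-S′ in i₀ , p , λ i k m h n →
        q (sep-i p (i , m , k , n , proj₂ (SD-rot h)))
      where
      instance
        is : Cst s
        is = cst vs
      S′ : 𝕍
      S′ = sep (pow B) λ k → ∃[ i ] i ∊ s × (∃[ j ] j ∊ s × SD i j k)
      S′⇒ : ∀ {k} → k ∊ S′ → k ∊ I × (∃[ i ] i ∊ s × (∃[ j ] j ∊ s × SD i j k))
      S′⇒ m = ∊sep m
      R : 𝕍 → 𝕍 → Set₁
      R z k = ∃[ i ] ∃[ j ] z ≈ ⟪ i , j ⟫ × SD i j k
      small-S′ : Small S′
      small-S′ = small-img Vsep R it (small-⊗ vs vs sm sm)
        (λ { z k k′ m m′ (i , j , e , h) (i′ , j′ , e′ , h′) → let (a , b) = ⟪⟫-inj (≈trans (≈sym e′) e) in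
             SD-unique (proj₁ (S′⇒ m)) (proj₁ (S′⇒ m′)) h (SD-resp a b h′) })
        (λ k m → let (_ , i , p , j , q , h) = S′⇒ m in ⟪ i , j ⟫ , ⊗i p q , i , j , ≈refl , h)
        where
        SD-resp : ∀ {i j k i′ j′} → i ≈ i′ → j ≈ j′ → SD i j k → SD i′ j′ k
        SD-resp e f h b m = let (u , v , w) = h b m in
          (λ q → [ (λ (x , y) → inj₁ (∊r e x , λ r → y (∊r (≈sym f) r))) , (λ (x , y) → inj₂ (∊r f x , λ r → y (∊r (≈sym e) r))) ]′ (u q)) ,
          (λ x y → v (∊r (≈sym e) x) (λ r → y (∊r f r))) , (λ x y → w (∊r (≈sym f) x) (λ r → y (∊r e r)))

 open Smallness

 module Conditions where
  private variable
    n : ℕ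
    ℓ ℓ′ : Level
    s t u : Env n → 𝕍

  module PermOps (A : 𝕍) ⦃ _ : Cst A ⦄ where
    opaque
      idp : 𝕍
      idp = rel A A λ x y → x ≈ y
      V-idp : V idp
      V-idp = Vrel
      ∊idp : ∀ {x y} → ⟪ x , y ⟫ ∊ idp → x ∊ A × x ≈ y
      ∊idp m = let (a , _ , e) = ∊rel m in a , e
      idp-i : ∀ {x y} → x ∊ A → x ≈ y → ⟪ x , y ⟫ ∊ idp
      idp-i m e = rel-i m (∊l e m) e
      perm-id : Perm A idp
      perm-id = record
        { dom = λ m → rel⊂ _ m ; tot = λ m → _ , idp-i m ≈refl ; srj = λ m → _ , idp-i m ≈refl
        ; sv = λ p q → ≈trans (≈sym (proj₂ (∊idp p))) (proj₂ (∊idp q))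
        ; inj = λ p q → ≈trans (proj₂ (∊idp p)) (≈sym (proj₂ (∊idp q))) }

    module _ (θ : 𝕍) (vθ : V θ) where
      private instance
        iθ : Cst θ
        iθ = cst vθ
      opaque
        inv : 𝕍
        inv = rel A A λ x y → ⟪ y , x ⟫ ∊ θ
        V-inv : V inv
        V-inv = Vrel
        ∊inv : ∀ {x y} → ⟪ x , y ⟫ ∊ inv → ⟪ y , x ⟫ ∊ θ
        ∊inv m = proj₂ (proj₂ (∊rel m))
        inv-i : Perm A θ → ∀ {x y} → ⟪ y , x ⟫ ∊ θ → ⟪ x , y ⟫ ∊ inv
        inv-i p m = rel-i (Perm.r∊ p m) (Perm.l∊ p m) m
        perm-inv : Perm A θ → Perm A inv
        perm-inv p = record
          { dom = λ m → rel⊂ _ m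
          ; tot = λ m → let (y , q) = Perm.srj p m in y , inv-i p q
          ; srj = λ m → let (y , q) = Perm.tot p m in y , inv-i p q
          ; sv = λ q r → Perm.inj p (∊inv q) (∊inv r)
          ; inj = λ q r → Perm.sv p (∊inv q) (∊inv r) }

    module _ (θ τ : 𝕍) (vθ : V θ) (vτ : V τ) where
      private instance
        iθ : Cst θ
        iθ = cst vθ
        iτ : Cst τ
        iτ = cst vτ
      -- θ ∘ τ
      opaque
        cmp : 𝕍
        cmp = rel A A λ x z → ∃[ y ] ⟪ x , y ⟫ ∊ τ × ⟪ y , z ⟫ ∊ θ
        V-cmp : V cmp
        V-cmp = Vrel
        ∊cmp : ∀ {x z} → ⟪ x , z ⟫ ∊ cmp → ∃[ y ] ⟪ x , y ⟫ ∊ τ × ⟪ y , z ⟫ ∊ θ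
        ∊cmp m = proj₂ (proj₂ (∊rel m))
        cmp-i : Perm A θ → Perm A τ → ∀ {x y z} → ⟪ x , y ⟫ ∊ τ → ⟪ y , z ⟫ ∊ θ → ⟪ x , z ⟫ ∊ cmp
        cmp-i p q a b = rel-i (Perm.l∊ q a) (Perm.r∊ p b) (_ , a , b)
        perm-cmp : Perm A θ → Perm A τ → Perm A cmp
        perm-cmp p q = record
          { dom = λ m → rel⊂ _ m
          ; tot = λ m → let (y , a) = Perm.tot q m ; (z , b) = Perm.tot p (Perm.r∊ q a) in z , cmp-i p q a b
          ; srj = λ m → let (y , a) = Perm.srj p m ; (z , b) = Perm.srj q (Perm.l∊ p a) in z , cmp-i p q b a
          ; sv = λ r s → let (y , a , b) = ∊cmp r ; (y′ , a′ , b′) = ∊cmp s in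
              Perm.sv p b (⟪⟫-resp (Perm.sv q a′ a) ≈refl b′)
          ; inj = λ r s → let (y , a , b) = ∊cmp r ; (y′ , a′ , b′) = ∊cmp s in
              Perm.inj q a (⟪⟫-resp ≈refl (Perm.inj p b′ b) a′) }

  module System (D 𝓖 𝓘 X : 𝕍) ⦃ _ : Cst D ⦄ ⦃ _ : Cst 𝓖 ⦄ ⦃ _ : Cst 𝓘 ⦄ ⦃ _ : Cst X ⦄
    (grp : IsPermGroup D 𝓖) (ideal : IsIdealIn V D 𝓘) where
    open Small (D ∪ X) public
    private
      module PG = IsPermGroup grp
      module Id = IsIdealIn ideal

    perm𝓖 : ∀ {π} → π ∊ 𝓖 → Perm D π
    perm𝓖 m = fromBij (PG.bijections _ (unmem m))

    Im : 𝕍 → 𝕍 → 𝕍 → Set₁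
    Im π A A′ = ∀ m m′ → ⟪ m , m′ ⟫ ∊ π → (m ∊ A → m′ ∊ A′) × (m′ ∊ A′ → m ∊ A)

    -- The largest 𝓖-invariant ideal contained in 𝓘.
    opaque
      𝓘₀ : 𝕍
      𝓘₀ = sep 𝓘 λ A → ∀ π → π ∊ 𝓖 → ∃[ A′ ] A′ ∊ 𝓘 × Im π A A′

      𝓘₀⇒ : ∀ {A} → A ∊ 𝓘₀ → A ∊ 𝓘 × (∀ π → π ∊ 𝓖 → ∃[ A′ ] A′ ∊ 𝓘 × Im π A A′)
      𝓘₀⇒ m = ∊sep m

      𝓘₀⇐ : ∀ {A} → A ∊ 𝓘 → (∀ π → π ∊ 𝓖 → ∃[ A′ ] A′ ∊ 𝓘 × Im π A A′) → A ∊ 𝓘₀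
      𝓘₀⇐ m h = sep-i m h

      V-𝓘₀ : V 𝓘₀
      V-𝓘₀ = Vsep

    instance
      i𝓘₀ : Cst 𝓘₀
      i𝓘₀ = cst V-𝓘₀

    𝓘₀⊂ : ∀ {A} → A ∊ 𝓘₀ → A ⊂ D
    𝓘₀⊂ m z q = mem (Id.subsets _ (unmem (proj₁ (𝓘₀⇒ m))) z (unmem q))

    𝓘₀-∅ : ∅ ∊ 𝓘₀
    𝓘₀-∅ = 𝓘₀⇐ (mem Id.empty) λ π m → ∅ , mem Id.empty , λ a b q → (λ r → ⊥-elim (∉∅ r)) , (λ r → ⊥-elim (∉∅ r))

    private
      sing𝓘 : ∀ {m} → m ∊ D → up m m ∊ 𝓘
      sing𝓘 m = subst (_∊ 𝓘) (sym up≡) (mem (Id.singletons _ (unmem m)))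

    𝓘₀-sing : ∀ {m} → m ∊ D → up m m ∊ 𝓘₀
    𝓘₀-sing {m} mD = 𝓘₀⇐ (sing𝓘 mD) λ π π𝓖 → let module π = Perm (perm𝓖 π𝓖) ; (m′ , q) = π.tot mD in
      up m′ m′ , sing𝓘 (π.r∊ q) , λ a b r →
        (λ e → upl (π.sv r (⟪⟫-resp (≈sym (∊sing e)) ≈refl q))) , (λ e → upl (π.inj r (⟪⟫-resp ≈refl (≈sym (∊sing e)) q)))

    private
      un𝓘 : ∀ {A B} → A ∊ 𝓘 → B ∊ 𝓘 → ∃[ C ] C ∊ 𝓘 × (∀ z → z ∊ C ⟺ (z ∊ A ⊎ z ∊ B))
      un𝓘 {A} {B} a b = let (C , c , h) = Id.unions A B (unmem a) (unmem b) in C , mem c , λ z →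
        (λ m → let (_ , lift r) = proj₁ (of⇔ (h z)) (unmem m) in [ (λ x → inj₁ (mem x)) , (λ x → inj₂ (mem x)) ]′ r) ,
        (λ { (inj₁ m) → mem (proj₂ (of⇔ (h z)) (Id.subsets A (unmem a) z (unmem m) , lift (inj₁ (unmem m))))
           ; (inj₂ m) → mem (proj₂ (of⇔ (h z)) (Id.subsets B (unmem b) z (unmem m) , lift (inj₂ (unmem m)))) })

    𝓘₀-∪ : ∀ {A B} → A ∊ 𝓘₀ → B ∊ 𝓘₀ → ∃[ C ] C ∊ 𝓘₀ × A ⊂ C × B ⊂ C
    𝓘₀-∪ {A} {B} a b = let (C , c , h) = un𝓘 (proj₁ (𝓘₀⇒ a)) (proj₁ (𝓘₀⇒ b)) in
      C , 𝓘₀⇐ c (λ π m → let (A′ , p , f) = proj₂ (𝓘₀⇒ a) π m ; (B′ , q , g) = proj₂ (𝓘₀⇒ b) π m ; (C′ , r , k) = un𝓘 p q in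
        C′ , r , λ x y xy →
          (λ s → proj₂ (k y) ([ (λ t → inj₁ (proj₁ (f x y xy) t)) , (λ t → inj₂ (proj₁ (g x y xy) t)) ]′ (proj₁ (h x) s))) ,
          (λ s → proj₂ (h x) ([ (λ t → inj₁ (proj₂ (f x y xy) t)) , (λ t → inj₂ (proj₂ (g x y xy) t)) ]′ (proj₁ (k y) s)))) ,
      (λ z m → proj₂ (h z) (inj₁ m)) , (λ z m → proj₂ (h z) (inj₂ m))

    𝓘₀-im : ∀ {A π} → A ∊ 𝓘₀ → π ∊ 𝓖 → ∃[ A′ ] A′ ∊ 𝓘₀ × Im π A A′
    𝓘₀-im {A} {π} a p = let (A′ , a′ , f) = proj₂ (𝓘₀⇒ a) π p in
      A′ , 𝓘₀⇐ a′ (λ ρ r → let (κ , k , c) = PG.products ρ π (unmem r) (unmem p)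
                               (A″ , a″ , g) = proj₂ (𝓘₀⇒ a) κ (mem k) in
        A″ , a″ , λ x y xy → let (w , wx) = Perm.srj (perm𝓖 p) (Perm.l∊ (perm𝓖 r) xy)
                                 wy = in⟨ (proj₂ (of⇔ (c w y)) (x , out⟨ wx , out⟨ xy)) in
          (λ s → proj₁ (g w y wy) (proj₂ (f w x wx) s)) , (λ s → proj₁ (f w x wx) (proj₂ (g w y wy) s))) , f

    At Two Lit : 𝕍
    At = (D ∪ up D D) ⊗ pow B
    Two = up ∅ (up ∅ ∅)
    Lit = (At ⊗ pow B) ⊗ Two

    open PermOps At public

    private
      V-Lit : V Lit
      V-Lit = VT it

    opaque
      P : 𝕍
      P = sep (pow Lit) λ p → Small p × (∀ c b → ⟪ c , b ⟫ ∊ p → ∀ b′ → ⟪ c , b′ ⟫ ∊ p → b ≈ b′)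

      P⇒ : ∀ {p} → p ∊ P → p ⊂ Lit × Small p × (∀ c b → ⟪ c , b ⟫ ∊ p → ∀ b′ → ⟪ c , b′ ⟫ ∊ p → b ≈ b′)
      P⇒ m = let (a , b , c) = ∊sep m in ∊pow V-Lit a , b , c

      P⇐ : ∀ {p} → V p → p ⊂ Lit → Small p → (∀ c b → ⟪ c , b ⟫ ∊ p → ∀ b′ → ⟪ c , b′ ⟫ ∊ p → b ≈ b′) → p ∊ P
      P⇐ v a b c = sep-i (pow-i V-Lit v a) (b , c)

      V-P : V P
      V-P = Vsep

    instance
      iP : Cst P
      iP = cst V-P

    lit⇒ : ∀ {p l} → p ∊ P → l ∊ p → ∃[ a ] ∃[ j ] ∃[ b ] a ∊ At × j ∊ I × b ∊ Two × l ≈ ⟪ ⟪ a , j ⟫ , b ⟫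
    lit⇒ pP m = let (c , b , x , bT , e) = ∊⊗ (proj₁ (P⇒ pP) _ m) ; (a , j , aA , jI , e′) = ∊⊗ x in
      a , j , b , aA , jI , bT , ≈trans e (⟪⟫-cong e′ ≈refl)

    lit-dom : ∀ {p a j b} → p ∊ P → ⟪ ⟪ a , j ⟫ , b ⟫ ∊ p → a ∊ At × j ∊ I × b ∊ Two
    lit-dom pP m = let (x , bT) = ⊗e (proj₁ (P⇒ pP) _ m) ; (aA , jI) = ⊗e x in aA , jI , bT

    opaque
      ≤P : 𝕍
      ≤P = rel P P λ q p → p ⊂ q

      ≤⇒ : ∀ {q p} → ⟪ q , p ⟫ ∊ ≤P → p ⊂ q
      ≤⇒ m = proj₂ (proj₂ (∊rel m))

      ≤⇐ : ∀ {q p} → q ∊ P → p ∊ P → p ⊂ q → ⟪ q , p ⟫ ∊ ≤P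
      ≤⇐ a b h = rel-i a b h

      V-≤P : V ≤P
      V-≤P = Vrel

    instance
      i≤P : Cst ≤P
      i≤P = cst V-≤P

    𝟙∊P : ∅ ∊ P
    𝟙∊P = P⇐ V∅ (λ z m → ⊥-elim (∉∅ m)) (small-⊂B (λ z m → ⊥-elim (∉∅ m))) (λ c b m → ⊥-elim (∉∅ m))

    lit : 𝕍 → 𝕍 → 𝕍 → 𝕍
    lit a j b = up ⟪ ⟪ a , j ⟫ , b ⟫ ⟪ ⟪ a , j ⟫ , b ⟫

    lit-P : ∀ {a j b} → a ∊ At → j ∊ I → b ∊ Two → lit a j b ∊ P
    lit-P {a} {j} {b} aA jI bT = P⇐ (VT (dUP ⦃ cst vl ⦄ ⦃ cst vl ⦄)) (λ z m → ∊l (≈sym (∊sing m)) lL) (small-up vl vl)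
        (λ c b m b′ m′ → ≈trans (proj₂ (⟪⟫-inj (∊sing m))) (≈sym (proj₂ (⟪⟫-inj (∊sing m′)))))
      where
      lL : ⟪ ⟪ a , j ⟫ , b ⟫ ∊ Lit
      lL = ⊗i (⊗i aA jI) bT
      vl : V ⟪ ⟪ a , j ⟫ , b ⟫
      vl = V∊ V-Lit lL

    Mv : 𝕍 → 𝕍 → 𝕍 → Set₁
    Mv θ p p′ = ∀ a a′ → ⟪ a , a′ ⟫ ∊ θ → ∀ j → j ∊ pow B → ∀ b → b ∊ Two →
      (⟪ ⟪ a , j ⟫ , b ⟫ ∊ p → ⟪ ⟪ a′ , j ⟫ , b ⟫ ∊ p′) × (⟪ ⟪ a′ , j ⟫ , b ⟫ ∊ p′ → ⟪ ⟪ a , j ⟫ , b ⟫ ∊ p)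

    module _ {θ : 𝕍} (pθ : Perm At θ) where
      private module θ = Perm pθ

      Mv-⊂ : ∀ {p p′ q q′} → p ∊ P → q ∊ P → Mv θ p p′ → Mv θ q q′ → p′ ⊂ q′ → p ⊂ q
      Mv-⊂ pP qP f g h l m = let (a , j , b , aA , jI , bT , e) = lit⇒ pP m ; (a′ , r) = θ.tot aA in
        ∊l (≈sym e) (proj₂ (g a a′ r j jI b bT) (h _ (proj₁ (f a a′ r j jI b bT) (∊l e m))))

      Mv-⊂′ : ∀ {p p′ q q′} → p′ ∊ P → q′ ∊ P → Mv θ p p′ → Mv θ q q′ → p ⊂ q → p′ ⊂ q′
      Mv-⊂′ pP qP f g h l m = let (a′ , j , b , aA , jI , bT , e) = lit⇒ pP m ; (a , r) = θ.srj aA in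
        ∊l (≈sym e) (proj₁ (g a a′ r j jI b bT) (h _ (proj₂ (f a a′ r j jI b bT) (∊l e m))))

      Mv-sv : ∀ {p p′ p″} → p′ ∊ P → p″ ∊ P → Mv θ p p′ → Mv θ p p″ → p′ ≈ p″
      Mv-sv pP qP f g = ≈ext (Mv-⊂′ pP qP f g (λ z m → m)) (Mv-⊂′ qP pP g f (λ z m → m))

      Mv-inj : ∀ {p q p′} → p ∊ P → q ∊ P → Mv θ p p′ → Mv θ q p′ → p ≈ q
      Mv-inj pP qP f g = ≈ext (Mv-⊂ pP qP f g (λ z m → m)) (Mv-⊂ qP pP g f (λ z m → m))

      Mv-lit : ∀ {a a′ j b} → ⟪ a , a′ ⟫ ∊ θ → Mv θ (lit a j b) (lit a′ j b)
      Mv-lit r c c′ r′ j _ b _ =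
        (λ m → let (x , y) = ⟪⟫-inj (∊sing m) ; (u , v) = ⟪⟫-inj x in
          upl (⟪⟫-cong (⟪⟫-cong (θ.sv r′ (⟪⟫-resp (≈sym u) ≈refl r)) v) y)) ,
        (λ m → let (x , y) = ⟪⟫-inj (∊sing m) ; (u , v) = ⟪⟫-inj x in
          upl (⟪⟫-cong (⟪⟫-cong (θ.inj r′ (⟪⟫-resp ≈refl (≈sym u) r)) v) y))

      Mv-tot : V θ → ∀ {p} → p ∊ P → ∃[ p′ ] p′ ∊ P × Mv θ p p′
      Mv-tot vθ {p} pP = p′ , P⇐ Vsep (λ z m → proj₁ (p′⇒ m)) sm fn , mv
        where
        instance
          iθ : Cst θ
          iθ = cst vθ
          ip : Cst p
          ip = cst (V∊ V-P pP)
        C : 𝕍 → Set₁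
        C l = ∃[ c ] ∃[ b ] l ≈ ⟪ c , b ⟫ × (∃[ a′ ] ∃[ j ] c ≈ ⟪ a′ , j ⟫ × (∃[ a ] ⟪ a , a′ ⟫ ∊ θ × ⟪ ⟪ a , j ⟫ , b ⟫ ∊ p))
        p′ : 𝕍
        p′ = sep Lit C
        p′⇒ : ∀ {l} → l ∊ p′ → l ∊ Lit × C l
        p′⇒ m = ∊sep m
        get : ∀ {a′ j b} → ⟪ ⟪ a′ , j ⟫ , b ⟫ ∊ p′ → ∃[ a ] ⟪ a , a′ ⟫ ∊ θ × ⟪ ⟪ a , j ⟫ , b ⟫ ∊ p
        get m = let (_ , c , b , e , a′ , j , e′ , a , r , q) = p′⇒ m ; (x , y) = ⟪⟫-inj e ; (u , v) = ⟪⟫-inj (≈trans x e′) in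
          a , ⟪⟫-resp ≈refl (≈sym u) r , ⟪⟫-resp (⟪⟫-cong ≈refl (≈sym v)) (≈sym y) q
        put : ∀ {a a′ j b} → j ∊ I → b ∊ Two → ⟪ a , a′ ⟫ ∊ θ → ⟪ ⟪ a , j ⟫ , b ⟫ ∊ p → ⟪ ⟪ a′ , j ⟫ , b ⟫ ∊ p′
        put jI bT r m = sep-i (⊗i (⊗i (θ.r∊ r) jI) bT) (_ , _ , ≈refl , _ , _ , ≈refl , _ , r , m)
        mv : Mv θ p p′
        mv a a′ r j jI b bT = put jI bT r ,
          (λ m → let (a₂ , r₂ , q) = get m in ⟪⟫-resp (⟪⟫-cong (θ.inj r₂ r) ≈refl) ≈refl q)
        R : 𝕍 → 𝕍 → Set₁
        R l l′ = ∃[ c ] ∃[ b ] l ≈ ⟪ c , b ⟫ × (∃[ a ] ∃[ j ] c ≈ ⟪ a , j ⟫ × (∃[ a′ ] ⟪ a , a′ ⟫ ∊ θ × l′ ≈ ⟪ ⟪ a′ , j ⟫ , b ⟫))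
        sm : Small p′
        sm = small-img Vsep R it (proj₁ (proj₂ (P⇒ pP)))
          (λ x y y′ _ _ h h′ → un x y y′ h h′)
          (λ l m → let (_ , c , b , e , a′ , j , e′ , a , r , q) = p′⇒ m in
             ⟪ ⟪ a , j ⟫ , b ⟫ , q , _ , _ , ≈refl , _ , _ , ≈refl , a′ , r , ≈trans e (⟪⟫-cong e′ ≈refl))
          where
          un : ∀ x y y′ → R x y → R x y′ → y ≈ y′
          un x y y′ (c , b , e , a , j , f , a′ , r , g) (c₂ , b₂ , e₂ , a₂ , j₂ , f₂ , a₂′ , r₂ , g₂) =
            let (u , v) = ⟪⟫-inj (≈trans (≈sym e) e₂) ; (w , z) = ⟪⟫-inj (≈trans (≈sym f) (≈trans u f₂)) in
            ≈trans g (≈trans (⟪⟫-cong (⟪⟫-cong (θ.sv r (⟪⟫-resp (≈sym w) ≈refl r₂)) z) v) (≈sym g₂))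
        fn : ∀ c b → ⟪ c , b ⟫ ∊ p′ → ∀ b′ → ⟪ c , b′ ⟫ ∊ p′ → b ≈ b′
        fn c b m b′ m′ =
          let (c₁ , b₁ , x , _ , e) = ∊⊗ (proj₁ (p′⇒ m)) ; (a′ , j , aA , jI , e′) = ∊⊗ x
              ce = ≈trans (proj₁ (⟪⟫-inj e)) e′
              (a₁ , r₁ , q₁) = get (⟪⟫-resp ce ≈refl m)
              (a₂ , r₂ , q₂) = get (⟪⟫-resp ce ≈refl m′)
          in proj₂ (proj₂ (P⇒ pP)) _ b q₁ b′ (⟪⟫-resp (⟪⟫-cong (θ.inj r₂ r₁) ≈refl) ≈refl q₂)

    Lft : 𝕍 → 𝕍 → Set₁
    Lft θ π = ∀ a a′ → ⟪ a , a′ ⟫ ∊ θ → ∀ m i → a ≈ ⟪ m , i ⟫ → ∀ m′ i′ → a′ ≈ ⟪ m′ , i′ ⟫ →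
      ⟪ m , m′ ⟫ ∊ π ⊎ (m ≈ D × m′ ≈ D)

    Fixes : 𝕍 → 𝕍 → Set₁
    Fixes A θ = ∀ m → m ∊ A → ∀ i → i ∊ pow B → ⟪ ⟪ m , i ⟫ , ⟪ m , i ⟫ ⟫ ∊ θ

    Ind : 𝕍 → 𝕍 → Set₁
    Ind θ σ = ∀ p → p ∊ P → ∀ p′ → p′ ∊ P → (⟪ p , p′ ⟫ ∊ σ → Mv θ p p′) × (Mv θ p p′ → ⟪ p , p′ ⟫ ∊ σ)

    IsPerm : 𝕍 → Set₁
    IsPerm θ = (∀ z → z ∊ θ → z ∊ At ⊗ At) × (∀ x → x ∊ At → ∃[ y ] ⟪ x , y ⟫ ∊ θ) × (∀ y → y ∊ At → ∃[ x ] ⟪ x , y ⟫ ∊ θ)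
      × (∀ x y → ⟪ x , y ⟫ ∊ θ → ∀ y′ → ⟪ x , y′ ⟫ ∊ θ → y ≈ y′)
      × (∀ x y → ⟪ x , y ⟫ ∊ θ → ∀ x′ → ⟪ x′ , y ⟫ ∊ θ → x ≈ x′)

    perm⇒ : ∀ {θ} → IsPerm θ → Perm At θ
    perm⇒ (a , b , c , d , e) = record { dom = a _ ; tot = b _ ; srj = c _ ; sv = λ p q → d _ _ p _ q ; inj = λ p q → e _ _ p _ q }

    perm⇐ : ∀ {θ} → Perm At θ → IsPerm θ
    perm⇐ p = (λ z → Perm.dom p) , (λ x → Perm.tot p) , (λ x → Perm.srj p) , (λ x y a y′ → Perm.sv p a) , (λ x y a x′ → Perm.inj p a)

    -- σ is induced by a permutation of the atoms lying over some element of 𝓖 and fixing A × I.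
    Lifts : 𝕍 → 𝕍 → Set₁
    Lifts A σ = ∃[ θ ] V θ × (∃[ π ] π ∊ 𝓖 × IsPerm θ × Lft θ π × Ind θ σ × Fixes A θ)

    opaque
      dIsPerm : D₁ IsPerm
      dIsPerm = it
      dLft : D₂ Lft
      dLft = it
      dInd : D₂ Ind
      dInd = it
      dFixes : D₂ Fixes
      dFixes = it

      dLifts : D₂ Lifts
      dLifts = dExV {R = λ θ ρ → ∃[ π ] π ∊ 𝓖 × IsPerm θ × Lft θ π × Ind θ (ρ (suc zero)) × Fixes (ρ zero) θ} ⦃ dBex
        {t = λ _ → 𝓖} {R = λ π ρ → IsPerm (ρ zero) × Lft (ρ zero) π × Ind (ρ zero) (ρ (suc (suc zero))) × Fixes (ρ (suc zero)) (ρ zero)} ⦃ it ⦄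
        ⦃ dAnd ⦃ app₁ {R = IsPerm} dIsPerm it ⦄ ⦃ dAnd ⦃ app₂ {R = Lft} dLft it it ⦄
          ⦃ dAnd ⦃ app₂ {R = Ind} dInd it it ⦄ ⦃ app₂ {R = Fixes} dFixes it it ⦄ ⦄ ⦄ ⦄ ⦄

      dLifts∅ : D₁ (Lifts ∅)
      dLifts∅ = app₂ {R = Lifts} dLifts it it

      H : 𝕍
      H = sep (pow (P ⊗ P)) (Lifts ∅) ⦃ it ⦄ ⦃ dLifts∅ ⦄

      V-H : V H
      V-H = Vsep

      H⇒ : ∀ {σ} → σ ∊ H → σ ⊂ P ⊗ P × Lifts ∅ σ
      H⇒ m = let (a , b) = ∊sep m in ∊pow (VT it) a , b

      H⇐ : ∀ {σ} → V σ → σ ⊂ P ⊗ P → Lifts ∅ σ → σ ∊ H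
      H⇐ v a b = sep-i (pow-i (VT it) v a) b

    instance
      iH : Cst H
      iH = cst V-H

    module _ (θ : 𝕍) (vθ : V θ) where
      private instance
        iθ : Cst θ
        iθ = cst vθ
      opaque
        ind : 𝕍
        ind = rel P P (Mv θ)
        V-ind : V ind
        V-ind = Vrel
        ind⊂ : ind ⊂ P ⊗ P
        ind⊂ = rel⊂
        ∊ind : ∀ {p p′} → ⟪ p , p′ ⟫ ∊ ind → p ∊ P × p′ ∊ P × Mv θ p p′
        ∊ind m = ∊rel m
        ind-i : ∀ {p p′} → p ∊ P → p′ ∊ P → Mv θ p p′ → ⟪ p , p′ ⟫ ∊ ind
        ind-i a b c = rel-i a b c
      ind-Ind : Ind θ ind
      ind-Ind p a p′ b = (λ m → proj₂ (proj₂ (∊ind m))) , ind-i a b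

    record Lifted (θ π : 𝕍) : Set₁ where
      field
        vθ : V θ
        per : Perm At θ
        π𝓖 : π ∊ 𝓖
        over : Lft θ π

      lifts : ∀ {A σ} → Ind θ σ → Fixes A θ → Lifts A σ
      lifts i f = θ , vθ , π , π𝓖 , perm⇐ per , over , i , f

      indH : ind θ vθ ∊ H
      indH = H⇐ (V-ind θ vθ) (ind⊂ θ vθ) (lifts (ind-Ind θ vθ) λ m q → ⊥-elim (∉∅ q))

    lifted : ∀ {A σ} → Lifts A σ → ∃[ θ ] ∃[ π ] Lifted θ π × Ind θ σ × Fixes A θ
    lifted (θ , v , π , p , q , o , i , f) = θ , π , record { vθ = v ; per = perm⇒ q ; π𝓖 = p ; over = o } , i , f

    lift-id : ∃[ ι ] Lifted idp ι
    lift-id = let (ι , m , h) = PG.identity in ι , record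
      { vθ = V-idp ; per = perm-id ; π𝓖 = mem m ; over = λ a a′ q m i e m′ i′ e′ →
          let (aA , r) = ∊idp q ; (mD , _) = ⊗e (∊l e aA) ; (u , _) = ⟪⟫-inj (≈trans (≈sym e) (≈trans r e′)) in
          [ (λ mD → inj₁ (in⟨ (proj₂ (of⇔ (h m m′)) (unmem mD , uneq u)))) ,
            (λ s → inj₂ (∊sing s , ≈trans (≈sym u) (∊sing s))) ]′ (∊∪ mD) }

    lift-inv : ∀ {θ π} (l : Lifted θ π) → ∃[ π′ ] Lifted (inv θ (Lifted.vθ l)) π′
    lift-inv {θ} {π} l = let (π′ , m , h) = PG.inverses π (unmem L.π𝓖) in π′ , record
        { vθ = V-inv θ L.vθ ; per = perm-inv θ L.vθ L.per ; π𝓖 = mem m ; over = λ a a′ q m i e m′ i′ e′ →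
            [ (λ r → inj₁ (in⟨ (proj₂ (of⇔ (h m m′)) (out⟨ r)))) , (λ (x , y) → inj₂ (y , x)) ]′
              (L.over a′ a (∊inv θ L.vθ q) m′ i′ e′ m i e) }
      where module L = Lifted l

    lift-cmp : ∀ {θ π τ ρ} (l : Lifted θ π) (k : Lifted τ ρ) → ∃[ κ ] Lifted (cmp θ τ (Lifted.vθ l) (Lifted.vθ k)) κ × IsComp κ π ρ
    lift-cmp {θ} {π} {τ} {ρ} l k = let (κ , m , h) = PG.products π ρ (unmem L.π𝓖) (unmem K.π𝓖) in κ , record
        { vθ = V-cmp θ τ L.vθ K.vθ ; per = perm-cmp θ τ L.vθ K.vθ L.per K.per ; π𝓖 = mem m ; over = λ a c q m i e m″ i″ e″ →
            let (b , x , y) = ∊cmp θ τ L.vθ K.vθ q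
                (m′ , i′ , _ , _ , e′) = ∊⊗ (Perm.r∊ K.per x)
            in go h (K.over a b x m i e m′ i′ e′) (L.over b c y m′ i′ e′ m″ i″ e″) } , h
      where
      module L = Lifted l
      module K = Lifted k
      D∉ : ∀ {x} → x ∊ D → ¬ x ≈ D
      D∉ m e = ∊-irrefl D (∊l e m)
      go : ∀ {κ m m′ m″} → IsComp κ π ρ → ⟪ m , m′ ⟫ ∊ ρ ⊎ (m ≈ D × m′ ≈ D) → ⟪ m′ , m″ ⟫ ∊ π ⊎ (m′ ≈ D × m″ ≈ D) → ⟪ m , m″ ⟫ ∊ κ ⊎ (m ≈ D × m″ ≈ D)
      go h (inj₁ x) (inj₁ y) = inj₁ (in⟨ (proj₂ (of⇔ (h _ _)) (_ , out⟨ x , out⟨ y)))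
      go h (inj₁ x) (inj₂ (y , _)) = ⊥-elim (D∉ (Perm.r∊ (perm𝓖 K.π𝓖) x) y)
      go h (inj₂ (_ , x)) (inj₁ y) = ⊥-elim (D∉ (Perm.l∊ (perm𝓖 L.π𝓖) y) x)
      go h (inj₂ (x , _)) (inj₂ (_ , y)) = inj₂ (x , y)

    permH : ∀ {σ} → σ ∊ H → Perm P σ
    permH {σ} m = let (s , l) = H⇒ m ; (θ , π , L , i , _) = lifted l
                      module L = Lifted L
                      pp : ∀ {p p′} → ⟪ p , p′ ⟫ ∊ σ → p ∊ P × p′ ∊ P
                      pp q = ⊗e (s _ q)
                      mv : ∀ {p p′} → ⟪ p , p′ ⟫ ∊ σ → Mv θ p p′
                      mv q = let (a , b) = pp q in proj₁ (i _ a _ b) q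
                  in record
      { dom = s _
      ; tot = λ m → let (p′ , a , b) = Mv-tot L.per L.vθ m in p′ , proj₂ (i _ m _ a) b
      ; srj = λ {p′} m → let (p , a , b) = Mv-tot (perm-inv θ L.vθ L.per) (V-inv θ L.vθ) m in
          p , proj₂ (i _ a _ m) λ x x′ r j jI c cT →
            let (u , v) = b x′ x (inv-i θ L.vθ L.per r) j jI c cT in v , u
      ; sv = λ a b → Mv-sv L.per (proj₂ (pp a)) (proj₂ (pp b)) (mv a) (mv b)
      ; inj = λ a b → Mv-inj L.per (proj₁ (pp a)) (proj₁ (pp b)) (mv a) (mv b) }

 open Conditions

 module NormalFilter where
  private variable
    n : ℕ
    ℓ ℓ′ : Level
    s t u : Env n → 𝕍

  module Filter (D 𝓖 𝓘 X : 𝕍) ⦃ _ : Cst D ⦄ ⦃ _ : Cst 𝓖 ⦄ ⦃ _ : Cst 𝓘 ⦄ ⦃ _ : Cst X ⦄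
    (grp : IsPermGroup D 𝓖) (ideal : IsIdealIn V D 𝓘) where
    open System D 𝓖 𝓘 X grp ideal public

    private
      InvP : 𝕍 → 𝕍 → Set₁
      InvP ρ σ = ∀ x → x ∊ P → ∀ y → y ∊ P → (⟪ x , y ⟫ ∊ ρ → ⟪ y , x ⟫ ∊ σ) × (⟪ y , x ⟫ ∊ σ → ⟪ x , y ⟫ ∊ ρ)

      CompP : 𝕍 → 𝕍 → 𝕍 → Set₁
      CompP ρ σ τ = ∀ x → x ∊ P → ∀ z → z ∊ P →
        (⟪ x , z ⟫ ∊ ρ → ∃[ y ] ⟪ x , y ⟫ ∊ τ × ⟪ y , z ⟫ ∊ σ) × ((∃[ y ] ⟪ x , y ⟫ ∊ τ × ⟪ y , z ⟫ ∊ σ) → ⟪ x , z ⟫ ∊ ρ)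

      Sub : 𝕍 → Set₁
      Sub K = (∀ σ → σ ∊ K → ∃[ ρ ] ρ ∊ K × InvP ρ σ) × (∀ σ → σ ∊ K → ∀ τ → τ ∊ K → ∃[ ρ ] ρ ∊ K × CompP ρ σ τ)

      inv⇒ : ∀ {ρ σ} → ρ ∊ H → σ ∊ H → InvP ρ σ → IsInverse ρ σ
      inv⇒ r s h x y = to⇔
        ((λ m → let m′ = in⟨ m in out⟨ (proj₁ (h x (Perm.l∊ (permH r) m′) y (Perm.r∊ (permH r) m′)) m′)) ,
         (λ m → let m′ = in⟨ m in out⟨ (proj₂ (h x (Perm.r∊ (permH s) m′) y (Perm.l∊ (permH s) m′)) m′)))

      inv⇐ : ∀ {ρ σ} → IsInverse ρ σ → InvP ρ σ
      inv⇐ h x _ y _ = (λ m → in⟨ (proj₁ (of⇔ (h x y)) (out⟨ m))) , (λ m → in⟨ (proj₂ (of⇔ (h x y)) (out⟨ m)))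

      comp⇒ : ∀ {ρ σ τ} → ρ ∊ H → σ ∊ H → τ ∊ H → CompP ρ σ τ → IsComp ρ σ τ
      comp⇒ r s t h x z = to⇔
        ((λ m → let m′ = in⟨ m ; (y , a , b) = proj₁ (h x (Perm.l∊ (permH r) m′) z (Perm.r∊ (permH r) m′)) m′ in y , out⟨ a , out⟨ b) ,
         (λ (y , a , b) → out⟨ (proj₂ (h x (Perm.l∊ (permH t) (in⟨ a)) z (Perm.r∊ (permH s) (in⟨ b))) (y , in⟨ a , in⟨ b))))

      comp⇐ : ∀ {ρ σ τ} → IsComp ρ σ τ → CompP ρ σ τ
      comp⇐ h x _ z _ = (λ m → let (y , a , b) = proj₁ (of⇔ (h x z)) (out⟨ m) in y , in⟨ a , in⟨ b) ,
        (λ (y , a , b) → in⟨ (proj₂ (of⇔ (h x z)) (y , out⟨ a , out⟨ b)))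

      indmv : ∀ {θ σ p p′} → σ ∊ H → Ind θ σ → ⟪ p , p′ ⟫ ∊ σ → Mv θ p p′
      indmv m i q = proj₁ (i _ (Perm.l∊ (permH m) q) _ (Perm.r∊ (permH m) q)) q

    Sup : 𝕍 → 𝕍 → Set₁
    Sup K A = ∀ σ → σ ∊ H → Lifts A σ → σ ∊ K

    opaque
      H-inv : ∀ {A} σ → σ ∊ H → Lifts A σ → ∃[ ρ ] ρ ∊ H × InvP ρ σ × Lifts A ρ
      H-inv {A} σ m l = let (θ , π , L , i , f) = lifted l
                            module L = Lifted L
                            (π′ , L′) = lift-inv L
                            module L′ = Lifted L′
                        in ind (inv θ L.vθ) L′.vθ , L′.indH ,
          (λ x xP y yP →
             (λ q → proj₂ (i y yP x xP) λ a a′ r j jI b bT →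
                let (u , v) = proj₂ (proj₂ (∊ind _ L′.vθ q)) a′ a (inv-i θ L.vθ L.per r) j jI b bT in v , u) ,
             (λ q → ind-i _ L′.vθ xP yP λ a a′ r j jI b bT →
                let (u , v) = indmv m i q a′ a (∊inv θ L.vθ r) j jI b bT in v , u)) ,
          L′.lifts (ind-Ind _ L′.vθ) (λ m mA i iI → inv-i θ L.vθ L.per (f m mA i iI))

      H-comp : ∀ {A} σ τ → σ ∊ H → τ ∊ H → Lifts A σ → Lifts A τ → ∃[ ρ ] ρ ∊ H × CompP ρ σ τ × Lifts A ρ
      H-comp {A} σ τ m n l k = let (θ , π , L , i , f) = lifted l ; (η , π′ , K , i′ , f′) = lifted k
                                   module L = Lifted L
                                   module K = Lifted K
                                   (κ , C , _) = lift-cmp L K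
                                   module C = Lifted C
                               in ind _ C.vθ , C.indH ,
          (λ x xP z zP →
             (λ q → let (y , xy) = Perm.tot (permH n) xP ; yP = Perm.r∊ (permH n) xy in
                y , xy , proj₂ (i y yP z zP) λ b c r j jI t tT →
                  let (a , ab) = Perm.srj K.per (Perm.l∊ L.per r)
                      (u , v) = indmv n i′ xy a b ab j jI t tT
                      (u′ , v′) = proj₂ (proj₂ (∊ind _ C.vθ q)) a c (cmp-i θ η L.vθ K.vθ L.per K.per ab r) j jI t tT
                  in (λ s → u′ (v s)) , (λ s → u (v′ s))) ,
             (λ (y , xy , yz) → ind-i _ C.vθ xP zP λ a c r j jI t tT →
                let (b , ab , bc) = ∊cmp θ η L.vθ K.vθ r
                    (u , v) = indmv n i′ xy a b ab j jI t tT
                    (u′ , v′) = indmv m i yz b c bc j jI t tT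
                in (λ s → u′ (u s)) , (λ s → v (v′ s)))) ,
          C.lifts (ind-Ind _ C.vθ) (λ m mA i iI → cmp-i θ η L.vθ K.vθ L.per K.per (f′ m mA i iI) (f m mA i iI))

    private
      toH : ∀ {σ} → σ ∊ H → Lifts ∅ σ
      toH m = proj₂ (H⇒ m)

    ι : 𝕍
    ι = ind idp V-idp

    ι-lifts : ∀ A → A ⊂ D → ι ∊ H × Lifts A ι
    ι-lifts A s = Lifted.indH (proj₂ lift-id) ,
      Lifted.lifts (proj₂ lift-id) (ind-Ind idp V-idp) (λ m mA i iI → idp-i (⊗i (∪l (s m mA)) iI) ≈refl)

    ι-id : IsId P ι
    ι-id x y = to⇔
      ((λ m → let (a , b , c) = ∊ind idp V-idp (in⟨ m) in unmem a , uneq (Mv-sv perm-id a b self c)) ,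
       (λ (a , e) → out⟨ (⟪⟫-resp ≈refl (eq e) (ind-i idp V-idp (mem a) (mem a) self))))
      where
      self : ∀ {p} → Mv idp p p
      self a a′ r j _ b _ = let (_ , e) = ∊idp r in
        ⟪⟫-resp (⟪⟫-cong e ≈refl) ≈refl , ⟪⟫-resp (⟪⟫-cong (≈sym e) ≈refl) ≈refl

    opaque
      private
        dSub : D₁ Sub
        dSub = it

        dSup : D₂ Sup
        dSup = dBall {t = λ _ → H} {R = λ σ ρ → Lifts (ρ (suc zero)) σ → σ ∊ ρ zero} ⦃ it ⦄
          ⦃ d→ ⦃ app₂ {R = Lifts} dLifts it it ⦄ ⦃ it ⦄ ⦄

        dF : D₁ (λ K → Sub K × (∃[ A ] A ∊ 𝓘₀ × Sup K A))
        dF = dAnd ⦃ dSub ⦄ ⦃ dBex {t = λ _ → 𝓘₀} {R = λ A ρ → Sup (ρ zero) A} ⦃ it ⦄ ⦃ app₂ {R = Sup} dSup it it ⦄ ⦄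

      F : 𝕍
      F = sep (pow H) (λ K → Sub K × (∃[ A ] A ∊ 𝓘₀ × Sup K A)) ⦃ it ⦄ ⦃ dF ⦄

      V-F : V F
      V-F = Vsep

      private
        F⇒′ : ∀ {K} → K ∊ F → K ⊂ H × Sub K × (∃[ A ] A ∊ 𝓘₀ × Sup K A)
        F⇒′ m = let (a , b) = ∊sep m in ∊pow V-H a , b

        F⇐′ : ∀ {K} → V K → K ⊂ H → Sub K → (∃[ A ] A ∊ 𝓘₀ × Sup K A) → K ∊ F
        F⇐′ v a b c = sep-i (pow-i V-H v a) (b , c)

    F-sup : ∀ {K} → K ∊ F → ∃[ A ] A ∊ 𝓘₀ × Sup K A
    F-sup m = proj₂ (proj₂ (F⇒′ m))

    F-V : ∀ {K} → K ∊ F → V K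
    F-V m = V∊ V-F m

    private
      permgroup : ∀ {K A} → K ⊂ H → Sub K → A ⊂ D → Sup K A → IsPermGroup P K
      permgroup {K} {A} s (iv , cm) A⊂ sp = record
        { bijections = λ π m → toBij (permH (s π (mem m)))
        ; identity = let (a , b) = ι-lifts A A⊂ in ι , unmem (sp ι a b) , ι-id
        ; inverses = λ π m → let (ρ , r , h) = iv π (mem m) in ρ , unmem r , inv⇒ (s ρ r) (s π (mem m)) h
        ; products = λ σ τ m n → let (ρ , r , h) = cm σ (mem m) τ (mem n) in
            ρ , unmem r , comp⇒ (s ρ r) (s σ (mem m)) (s τ (mem n)) h }

      sub-of : ∀ {K} → IsPermGroup P K → Sub K
      sub-of g = (λ σ m → let (ρ , r , h) = IsPermGroup.inverses g σ (unmem m) in ρ , mem r , inv⇐ h) ,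
        (λ σ m τ n → let (ρ , r , h) = IsPermGroup.products g σ τ (unmem m) (unmem n) in ρ , mem r , comp⇐ h)

      H-Sub : Sub H
      H-Sub = (λ σ m → let (ρ , r , h , _) = H-inv σ m (toH m) in ρ , r , h) ,
        (λ σ m τ n → let (ρ , r , h , _) = H-comp σ τ m n (toH m) (toH n) in ρ , r , h)

    opaque
      groupH : IsPermGroup P H
      groupH = permgroup (λ z m → m) H-Sub (𝓘₀⊂ 𝓘₀-∅) (λ σ m _ → m)

    -- A family of the lifts fixing A × I, for some A ∈ 𝓘₀, belongs to F.
    fixing : ∀ A → A ∊ 𝓘₀ → ∃[ K ] K ∊ F × (∀ σ → σ ∊ K → σ ∊ H × Lifts A σ)
    fixing A a = K , F⇐′ Vsep′ (λ z m → proj₁ (K⇒ m))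
        ((λ σ m → let (x , y) = K⇒ m ; (ρ , r , h , l) = H-inv σ x y in ρ , K⇐ r l , h) ,
         (λ σ m τ n → let (x , y) = K⇒ m ; (x′ , y′) = K⇒ n ; (ρ , r , h , l) = H-comp σ τ x x′ y y′ in ρ , K⇐ r l , h))
        (A , a , λ σ m l → K⇐ m l) , λ σ → K⇒
      where
      instance
        iA : Cst A
        iA = cst (V∊ V-𝓘₀ a)
      dL : D₁ (Lifts A)
      dL = app₂ {R = Lifts} dLifts it it
      K : 𝕍
      K = sep H (Lifts A) ⦃ it ⦄ ⦃ dL ⦄
      Vsep′ : V K
      Vsep′ = Vsep
      K⇒ : ∀ {σ} → σ ∊ K → σ ∊ H × Lifts A σ
      K⇒ = ∊sep
      K⇐ : ∀ {σ} → σ ∊ H → Lifts A σ → σ ∊ K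
      K⇐ = sep-i

    private
      intersect : ∀ K K′ → K ∊ F → K′ ∊ F → ⦅ K ∣ (λ π → Lift (lsuc 0ℓ) (π ∈ K′)) ⦆∈ F
      intersect K K′ m m′ = J , unmem (F⇐′ Vsep (λ z q → proj₁ (F⇒′ m) z (proj₁ (J⇒ q))) sb (C , c , sp)) , λ z → to⇔
          ((λ q → let (a , b) = J⇒ (mem q) in unmem a , lift (unmem b)) , (λ (a , lift b) → unmem (sep-i (mem a) (mem b))))
        where
        instance
          iK : Cst K
          iK = cst (F-V m)
          iK′ : Cst K′
          iK′ = cst (F-V m′)
        J : 𝕍
        J = sep K λ z → z ∊ K′
        J⇒ : ∀ {z} → z ∊ J → z ∊ K × z ∊ K′
        J⇒ q = ∊sep q
        A = F-sup m
        A′ = F-sup m′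
        U = 𝓘₀-∪ (proj₁ (proj₂ A)) (proj₁ (proj₂ A′))
        C = proj₁ U
        c = proj₁ (proj₂ U)
        weaken : ∀ {A C σ} → A ⊂ C → Lifts C σ → Lifts A σ
        weaken s (θ , v , π , p , q , o , i , f) = θ , v , π , p , q , o , i , λ m mA → f m (s m mA)
        sp : Sup J C
        sp σ σH l = sep-i (proj₂ (proj₂ A) σ σH (weaken (proj₁ (proj₂ (proj₂ U))) l))
                          (proj₂ (proj₂ A′) σ σH (weaken (proj₂ (proj₂ (proj₂ U))) l))
        KH : ∀ {σ} → σ ∊ K → σ ∊ H
        KH q = proj₁ (F⇒′ m) _ q
        KH′ : ∀ {σ} → σ ∊ K′ → σ ∊ H
        KH′ q = proj₁ (F⇒′ m′) _ q
        sb : Sub J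
        sb = (λ σ q → let (a , b) = J⇒ q
                          (ρ , r , h) = proj₁ (proj₁ (proj₂ (F⇒′ m))) σ a
                          (ρ′ , r′ , h′) = proj₁ (proj₁ (proj₂ (F⇒′ m′))) σ b
                          e = perm-ext (KH r) (KH′ r′) (λ x xP y yP → (λ k → proj₂ (h′ x xP y yP) (proj₁ (h x xP y yP) k)) , (λ k → proj₂ (h x xP y yP) (proj₁ (h′ x xP y yP) k)))
                      in ρ , sep-i r (∊l (≈sym e) r′) , h) ,
             (λ σ q τ q′ → let (a , b) = J⇒ q ; (c , d) = J⇒ q′
                               (ρ , r , h) = proj₂ (proj₁ (proj₂ (F⇒′ m))) σ a τ c
                               (ρ′ , r′ , h′) = proj₂ (proj₁ (proj₂ (F⇒′ m′))) σ b τ d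
                               e = perm-ext (KH r) (KH′ r′) (λ x xP y yP → (λ k → proj₂ (h′ x xP y yP) (proj₁ (h x xP y yP) k)) , (λ k → proj₂ (h x xP y yP) (proj₁ (h′ x xP y yP) k)))
                           in ρ , sep-i r (∊l (≈sym e) r′) , h)
          where
          perm-ext : ∀ {ρ ρ′} → ρ ∊ H → ρ′ ∊ H → (∀ x → x ∊ P → ∀ y → y ∊ P → (⟪ x , y ⟫ ∊ ρ → ⟪ x , y ⟫ ∊ ρ′) × (⟪ x , y ⟫ ∊ ρ′ → ⟪ x , y ⟫ ∊ ρ)) → ρ ≈ ρ′
          perm-ext r r′ h = ≈ext
            (λ z q → let (x , y , xP , yP , e) = ∊⊗ (Perm.dom (permH r) q) in ∊l (≈sym e) (proj₁ (h x xP y yP) (∊l e q)))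
            (λ z q → let (x , y , xP , yP , e) = ∊⊗ (Perm.dom (permH r′) q) in ∊l (≈sym e) (proj₂ (h x xP y yP) (∊l e q)))

      -- τ = π σ π⁻¹
      Cj : 𝕍 → 𝕍 → 𝕍 → Set₁
      Cj π τ σ = ∀ x x′ → ⟪ x , x′ ⟫ ∊ π → ∀ y y′ → ⟪ y , y′ ⟫ ∊ π →
        (⟪ x , y ⟫ ∊ σ → ⟪ x′ , y′ ⟫ ∊ τ) × (⟪ x′ , y′ ⟫ ∊ τ → ⟪ x , y ⟫ ∊ σ)

      -- θ₀⁻¹ θ θ₀
      opaque
        conj-lift : ∀ {θ₀ π₀ θ π₁} → Lifted θ₀ π₀ → Lifted θ π₁ → ∃[ η ] ∃[ κ ] Lifted η κ
          × (∀ {a b a′ b′} → ⟪ a , a′ ⟫ ∊ θ₀ → ⟪ a′ , b′ ⟫ ∊ θ → ⟪ b , b′ ⟫ ∊ θ₀ → ⟪ a , b ⟫ ∊ η)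
          × (∀ {a b} → ⟪ a , b ⟫ ∊ η → ∃[ a′ ] ∃[ b′ ] ⟪ a , a′ ⟫ ∊ θ₀ × ⟪ a′ , b′ ⟫ ∊ θ × ⟪ b , b′ ⟫ ∊ θ₀)
        conj-lift {θ₀} {θ = θ} L₀ T =
          let module L₀ = Lifted L₀
              module T = Lifted T
              (_ , C₁ , _) = lift-cmp T L₀
              module C₁ = Lifted C₁
              (_ , L⁻) = lift-inv L₀
              module L⁻ = Lifted L⁻
              (κ , C , _) = lift-cmp L⁻ C₁
          in _ , κ , C ,
            (λ p q r → cmp-i _ _ L⁻.vθ C₁.vθ L⁻.per C₁.per (cmp-i _ _ T.vθ L₀.vθ T.per L₀.per p q) (inv-i θ₀ L₀.vθ L₀.per r)) ,
            (λ q → let (b′ , x , y) = ∊cmp _ _ L⁻.vθ C₁.vθ q ; (a′ , z , w) = ∊cmp _ _ T.vθ L₀.vθ x in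
              a′ , b′ , z , w , ∊inv θ₀ L₀.vθ y)

        conj-mem : ∀ {K π θ₀ π₀ A A′ τ θ ρ} → π ∊ H → Lifted θ₀ π₀ → Ind θ₀ π → A ∊ 𝓘₀ → Sup K A → Im π₀ A A′ →
          τ ∊ H → Lifted θ ρ → Ind θ τ → Fixes A′ θ → ∃[ σ ] σ ∊ K × Cj π τ σ
        conj-mem {K} {π} {θ₀} {π₀} {A} {A′} {τ} {θ} πH L₀ i₀ a sp im τH T iτ fτ = go (conj-lift L₀ T)
          where
          module L₀ = Lifted L₀
          module T = Lifted T
          module π = Perm (permH πH)
          go : ∃[ η ] ∃[ κ ] Lifted η κ
            × (∀ {a b a′ b′} → ⟪ a , a′ ⟫ ∊ θ₀ → ⟪ a′ , b′ ⟫ ∊ θ → ⟪ b , b′ ⟫ ∊ θ₀ → ⟪ a , b ⟫ ∊ η)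
            × (∀ {a b} → ⟪ a , b ⟫ ∊ η → ∃[ a′ ] ∃[ b′ ] ⟪ a , a′ ⟫ ∊ θ₀ × ⟪ a′ , b′ ⟫ ∊ θ × ⟪ b , b′ ⟫ ∊ θ₀) →
            ∃[ σ ] σ ∊ K × Cj π τ σ
          go (η , κ , C , C⇐ , C⇒) = ind η C.vθ , sp _ C.indH (C.lifts (ind-Ind η C.vθ) fx) , cj
            where
            module C = Lifted C
            fx : Fixes A η
            fx m mA i iI =
              let (a′ , p) = Perm.tot L₀.per (⊗i (∪l (𝓘₀⊂ a m mA)) iI)
                  (m′ , i′ , _ , iI′ , e) = ∊⊗ (Perm.r∊ L₀.per p)
              in [ (λ r → let q = fτ m′ (proj₁ (im m m′ r) mA) i′ iI′ in
                     C⇐ p (⟪⟫-resp (≈sym e) (≈sym e) q) p) ,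
                   (λ (x , _) → ⊥-elim (∊-irrefl D (∊l x (𝓘₀⊂ a m mA)))) ]′
                 (L₀.over _ a′ p m i ≈refl m′ i′ e)
            cj : Cj π τ (ind η C.vθ)
            cj x x′ p y y′ p′ =
              (λ k → proj₂ (iτ x′ (π.r∊ p) y′ (π.r∊ p′)) λ a′ b′ r j jI t tT →
                 let (a , aa) = Perm.srj L₀.per (Perm.l∊ T.per r) ; (b , bb) = Perm.srj L₀.per (Perm.r∊ T.per r)
                     (u₁ , v₁) = indmv πH i₀ p a a′ aa j jI t tT
                     (u₂ , v₂) = proj₂ (proj₂ (∊ind η C.vθ k)) a b (C⇐ aa r bb) j jI t tT
                     (u₃ , v₃) = indmv πH i₀ p′ b b′ bb j jI t tT
                 in (λ s → u₃ (u₂ (v₁ s))) , (λ s → u₁ (v₂ (v₃ s)))) ,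
              (λ k → ind-i η C.vθ (π.l∊ p) (π.l∊ p′) λ a b r j jI t tT →
                 let (a′ , b′ , aa , ab , bb) = C⇒ r
                     (u₁ , v₁) = indmv πH i₀ p a a′ aa j jI t tT
                     (u₂ , v₂) = indmv τH iτ k a′ b′ ab j jI t tT
                     (u₃ , v₃) = indmv πH i₀ p′ b b′ bb j jI t tT
                 in (λ s → v₃ (u₂ (u₁ s))) , (λ s → v₁ (v₂ (u₃ s))))

      conj : ∀ K π → K ∊ F → π ∊ H → ⦅ H ∣ (λ τ → ∃[ σ ] σ ∈ K × (∃[ ρ ] IsComp ρ τ π × IsComp ρ π σ)) ⦆∈ F
      conj K π m πH = J , unmem (F⇐′ Vsep (λ z q → proj₁ (J⇒ q)) sb im) , λ z → to⇔ (f , g)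
        where
        instance
          iK : Cst K
          iK = cst (F-V m)
          iπ : Cst π
          iπ = cst (V∊ V-H πH)
        J : 𝕍
        J = sep H λ τ → ∃[ σ ] σ ∊ K × Cj π τ σ
        J⇒ : ∀ {τ} → τ ∊ J → τ ∊ H × (∃[ σ ] σ ∊ K × Cj π τ σ)
        J⇒ q = ∊sep q
        J⇐ : ∀ {τ} → τ ∊ H → (∃[ σ ] σ ∊ K × Cj π τ σ) → τ ∊ J
        J⇐ a b = sep-i a b
        module π = Perm (permH πH)
        KH : ∀ {σ} → σ ∊ K → σ ∊ H
        KH q = proj₁ (F⇒′ m) _ q
        f : ∀ {z} → z ∈ J → z ∈ H × (∃[ σ ] σ ∈ K × (∃[ ρ ] IsComp ρ z π × IsComp ρ π σ))
        f {τ} q = let (τH , σ , σK , c) = J⇒ (mem q) in go τH σ σK c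
          where
          go : τ ∊ H → ∀ σ → σ ∊ K → Cj π τ σ → τ ∈ H × (∃[ σ ] σ ∈ K × (∃[ ρ ] IsComp ρ τ π × IsComp ρ π σ))
          go τH σ σK c = let (ρ , r , h) = IsPermGroup.products groupH τ π (unmem τH) (unmem πH) in
            unmem τH , σ , unmem σK , ρ , h , λ x z → to⇔
              ((λ k → let (y , xy , yz) = proj₁ (of⇔ (h x z)) k ; (w , wz) = π.srj (Perm.r∊ (permH τH) (in⟨ yz)) in
                 w , out⟨ (proj₂ (c x y (in⟨ xy) w z wz) (in⟨ yz)) , out⟨ wz) ,
               (λ (w , xw , wz) → let (y , xy) = π.tot (Perm.l∊ (permH (KH σK)) (in⟨ xw)) in
                 proj₂ (of⇔ (h x z)) (y , out⟨ xy , out⟨ (proj₁ (c x y xy w z (in⟨ wz)) (in⟨ xw)))))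
        g : ∀ {z} → z ∈ H × (∃[ σ ] σ ∈ K × (∃[ ρ ] IsComp ρ z π × IsComp ρ π σ)) → z ∈ J
        g {τ} (τH , σ , σK , ρ , h , k) = unmem (J⇐ (mem τH) (σ , mem σK , λ x x′ p y y′ q →
            (λ r → let (w , a , b) = proj₁ (of⇔ (h x y′)) (proj₂ (of⇔ (k x y′)) (y , out⟨ r , out⟨ q)) in
               ⟪⟫-resp (π.sv (in⟨ a) p) ≈refl (in⟨ b)) ,
            (λ r → let (w , a , b) = proj₁ (of⇔ (k x y′)) (proj₂ (of⇔ (h x y′)) (x′ , out⟨ p , out⟨ r)) in
               ⟪⟫-resp ≈refl (π.inj (in⟨ b) q) (in⟨ a))))
        sb : Sub J
        sb = (λ τ q → let (τH , σ , σK , c) = J⇒ q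
                          (ρ , r , h) = proj₁ (proj₁ (proj₂ (F⇒′ m))) σ σK
                          (τ′ , t , h′ , _) = H-inv τ τH (toH τH) in
                τ′ , J⇐ t (ρ , r , λ x x′ p y y′ p′ →
                  (λ k → proj₂ (h′ x′ (π.r∊ p) y′ (π.r∊ p′)) (proj₁ (c y y′ p′ x x′ p) (proj₁ (h x (π.l∊ p) y (π.l∊ p′)) k))) ,
                  (λ k → proj₂ (h x (π.l∊ p) y (π.l∊ p′)) (proj₂ (c y y′ p′ x x′ p) (proj₁ (h′ x′ (π.r∊ p) y′ (π.r∊ p′)) k)))) , h′) ,
             (λ τ₁ q₁ τ₂ q₂ → let (τH₁ , σ₁ , σK₁ , c₁) = J⇒ q₁ ; (τH₂ , σ₂ , σK₂ , c₂) = J⇒ q₂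
                                  (ρ , r , h) = proj₂ (proj₁ (proj₂ (F⇒′ m))) σ₁ σK₁ σ₂ σK₂
                                  (τ , t , h′ , _) = H-comp τ₁ τ₂ τH₁ τH₂ (toH τH₁) (toH τH₂) in
                τ , J⇐ t (ρ , r , λ x x′ p z z′ p′ →
                  (λ k → let (y , xy , yz) = proj₁ (h x (π.l∊ p) z (π.l∊ p′)) k
                             (y′ , yy) = π.tot (Perm.l∊ (permH (KH σK₁)) yz) in
                     proj₂ (h′ x′ (π.r∊ p) z′ (π.r∊ p′)) (y′ , proj₁ (c₂ x x′ p y y′ yy) xy , proj₁ (c₁ y y′ yy z z′ p′) yz)) ,
                  (λ k → let (y′ , xy , yz) = proj₁ (h′ x′ (π.r∊ p) z′ (π.r∊ p′)) k
                             (y , yy) = π.srj (Perm.l∊ (permH τH₁) yz) in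
                     proj₂ (h x (π.l∊ p) z (π.l∊ p′)) (y , proj₂ (c₂ x x′ p y y′ yy) xy , proj₂ (c₁ y y′ yy z z′ p′) yz))) , h′)
        lπ : ∃[ θ ] ∃[ ρ ] Lifted θ ρ × Ind θ π × Fixes ∅ θ
        lπ = lifted (toH πH)
        im : ∃[ A′ ] A′ ∊ 𝓘₀ × Sup J A′
        im = go lπ (F-sup m)
          where
          go : ∃[ θ ] ∃[ ρ ] Lifted θ ρ × Ind θ π × Fixes ∅ θ → ∃[ A ] A ∊ 𝓘₀ × Sup K A → ∃[ A′ ] A′ ∊ 𝓘₀ × Sup J A′
          go (θ₀ , π₀ , L₀ , i₀ , _) (A , a , sp) = let (A′ , a′ , im) = 𝓘₀-im a (Lifted.π𝓖 L₀) in
            A′ , a′ , λ τ τH lτ → let (θ , ρ , T , iτ , f) = lifted lτ in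
              J⇐ τH (conj-mem πH L₀ i₀ a sp im τH T iτ f)

      -- Every group in F contains the transposition of two atoms over the extra point D.
      nontriv : ∀ K → K ∊ F → ¬ (∀ π → π ∈ K → IsId P π)
      nontriv K m h = ∅≉B (proj₂ (⟪⟫-inj (proj₁ (⟪⟫-inj (proj₁ (⟪⟫-inj l≈))))))
        where
        ∅≉B : ¬ ∅ ≈ B
        ∅≉B e = ∉∅ (∊r (≈sym e) ∅∊B)
        DD : D ∊ D ∪ up D D
        DD = ∪r (upl ≈refl)
        a₀ a₁ : 𝕍
        a₀ = ⟪ D , ∅ ⟫
        a₁ = ⟪ D , B ⟫
        ∅I : ∅ ∊ I
        ∅I = pow-i V-B V∅ (λ z q → ⊥-elim (∉∅ q))
        a₀A : a₀ ∊ At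
        a₀A = ⊗i DD ∅I
        a₁A : a₁ ∊ At
        a₁A = ⊗i DD (pow-i V-B V-B (λ z q → q))
        a₀≉a₁ : ¬ a₀ ≈ a₁
        a₀≉a₁ e = ∅≉B (proj₂ (⟪⟫-inj e))
        R : 𝕍 → 𝕍 → Set
        R a a′ = (a ≈ a₀ × a′ ≈ a₁) ⊎ (a ≈ a₁ × a′ ≈ a₀) ⊎ (¬ a ≈ a₀ × ¬ a ≈ a₁ × a ≈ a′)
        opaque
          dR : D₂ R
          dR = it
        R-sym : ∀ {a b} → R a b → R b a
        R-sym (inj₁ (x , y)) = inj₂ (inj₁ (y , x))
        R-sym (inj₂ (inj₁ (x , y))) = inj₁ (y , x)
        R-sym (inj₂ (inj₂ (x , y , z))) = inj₂ (inj₂ ((λ e → x (≈trans z e)) , (λ e → y (≈trans z e)) , ≈sym z))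
        R-sv : ∀ {a b c} → R a b → R a c → b ≈ c
        R-sv (inj₁ (x , y)) (inj₁ (x′ , y′)) = ≈trans y (≈sym y′)
        R-sv (inj₁ (x , y)) (inj₂ (inj₁ (x′ , y′))) = ⊥-elim (a₀≉a₁ (≈trans (≈sym x) x′))
        R-sv (inj₁ (x , y)) (inj₂ (inj₂ (x′ , y′ , _))) = ⊥-elim (x′ x)
        R-sv (inj₂ (inj₁ (x , y))) (inj₁ (x′ , y′)) = ⊥-elim (a₀≉a₁ (≈trans (≈sym x′) x))
        R-sv (inj₂ (inj₁ (x , y))) (inj₂ (inj₁ (x′ , y′))) = ≈trans y (≈sym y′)
        R-sv (inj₂ (inj₁ (x , y))) (inj₂ (inj₂ (x′ , y′ , _))) = ⊥-elim (y′ x)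
        R-sv (inj₂ (inj₂ (x , y , z))) (inj₁ (x′ , y′)) = ⊥-elim (x x′)
        R-sv (inj₂ (inj₂ (x , y , z))) (inj₂ (inj₁ (x′ , y′))) = ⊥-elim (y x′)
        R-sv (inj₂ (inj₂ (x , y , z))) (inj₂ (inj₂ (x′ , y′ , z′))) = ≈trans (≈sym z) z′
        R-tot : ∀ {a} → a ∊ At → ∃[ b ] b ∊ At × R a b
        R-tot {a} q = go (dec₀ (a ≈ a₀)) (dec₀ (a ≈ a₁))
          where
          go : Dec (a ≈ a₀) → Dec (a ≈ a₁) → ∃[ b ] b ∊ At × R a b
          go (yes e) _ = a₁ , a₁A , inj₁ (e , ≈refl)
          go (no _) (yes e) = a₀ , a₀A , inj₂ (inj₁ (e , ≈refl))
          go (no x) (no y) = a , q , inj₂ (inj₂ (x , y , ≈refl))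
        θ : 𝕍
        θ = rel At At R ⦃ it ⦄ ⦃ it ⦄ ⦃ dR ⦄
        θ⇒ : ∀ {a b} → ⟪ a , b ⟫ ∊ θ → a ∊ At × b ∊ At × R a b
        θ⇒ = ∊rel
        θ⇐ : ∀ {a b} → a ∊ At → b ∊ At → R a b → ⟪ a , b ⟫ ∊ θ
        θ⇐ = rel-i
        per : Perm At θ
        per = record
          { dom = λ q → rel⊂ _ q
          ; tot = λ q → let (b , bA , r) = R-tot q in b , θ⇐ q bA r
          ; srj = λ q → let (b , bA , r) = R-tot q in b , θ⇐ bA q (R-sym r)
          ; sv = λ p q → R-sv (proj₂ (proj₂ (θ⇒ p))) (proj₂ (proj₂ (θ⇒ q)))
          ; inj = λ p q → R-sv (R-sym (proj₂ (proj₂ (θ⇒ p)))) (R-sym (proj₂ (proj₂ (θ⇒ q)))) }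
        G1 = IsPermGroup.identity grp
        over : Lft θ (proj₁ G1)
        over a a′ q m i e m′ i′ e′ with θ⇒ q
        ... | aA , _ , inj₁ (x , y) = inj₂ (proj₁ (⟪⟫-inj (≈trans (≈sym e) x)) , proj₁ (⟪⟫-inj (≈trans (≈sym e′) y)))
        ... | aA , _ , inj₂ (inj₁ (x , y)) = inj₂ (proj₁ (⟪⟫-inj (≈trans (≈sym e) x)) , proj₁ (⟪⟫-inj (≈trans (≈sym e′) y)))
        ... | aA , _ , inj₂ (inj₂ (_ , _ , z)) =
          let (mD , _) = ⊗e (∊l e aA) ; (u , _) = ⟪⟫-inj (≈trans (≈sym e) (≈trans z e′)) in
          [ (λ mD → inj₁ (in⟨ (proj₂ (of⇔ (proj₂ (proj₂ G1) m m′)) (unmem mD , uneq u)))) ,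
            (λ s → inj₂ (∊sing s , ≈trans (≈sym u) (∊sing s))) ]′ (∊∪ mD)
        L : Lifted θ (proj₁ G1)
        L = record { vθ = Vrel ; per = per ; π𝓖 = mem (proj₁ (proj₂ G1)) ; over = over }
        module L = Lifted L
        FA = F-sup m
        σ = ind θ L.vθ
        σK : σ ∊ K
        σK = proj₂ (proj₂ FA) σ L.indH (L.lifts (ind-Ind θ L.vθ) λ m′ mA i iI →
          let mD = 𝓘₀⊂ (proj₁ (proj₂ FA)) m′ mA
              ne : ∀ {i j} → ¬ ⟪ m′ , i ⟫ ≈ ⟪ D , j ⟫
              ne e = ∊-irrefl D (∊l (proj₁ (⟪⟫-inj e)) mD)
              aA = ⊗i (∪l mD) iI
          in θ⇐ aA aA (inj₂ (inj₂ (ne , ne , ≈refl))))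
        l₀ = lit-P a₀A ∅I (upl ≈refl)
        l₁ = lit-P a₁A ∅I (upl ≈refl)
        moved : ⟪ lit a₀ ∅ ∅ , lit a₁ ∅ ∅ ⟫ ∊ σ
        moved = ind-i θ L.vθ l₀ l₁ (Mv-lit per (θ⇐ a₀A a₁A (inj₁ (≈refl , ≈refl))))
        l≈ : ⟪ ⟪ a₀ , ∅ ⟫ , ∅ ⟫ ≈ ⟪ ⟪ a₁ , ∅ ⟫ , ∅ ⟫
        l≈ = ∊sing (∊r (eq (proj₂ (proj₁ (of⇔ (h σ (unmem σK) _ _)) (out⟨ moved)))) (upl ≈refl))

    S : SymmetricSystem
    S = record { P = P ; ≤P = ≤P ; 𝟙 = ∅ ; H = H ; F = F }

    opaque
      isS : IsSymmetricSystemIn V S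
      isS = record
        { P∈ = V-P ; ≤P∈ = V-≤P ; H∈ = V-H ; F∈ = V-F
        ; reflexive = λ p m → out⟨ (≤⇐ (mem m) (mem m) (λ z q → q))
        ; transitive = λ p q r a b c h k → out⟨ (≤⇐ (mem a) (mem c) (λ z m → ≤⇒ (in⟨ h) z (≤⇒ (in⟨ k) z m)))
        ; 𝟙∈P = unmem 𝟙∊P
        ; maximum = λ p m → out⟨ (≤⇐ (mem m) 𝟙∊P (λ z q → ⊥-elim (∉∅ q)))
        ; group = groupH
        ; automorphisms = λ π p p′ q q′ m a b → let (θ , _ , L , i , _) = lifted (toH (mem m))
                                                    module π = Perm (permH (mem m))
                                                    a′ = in⟨ a ; b′ = in⟨ b
                                                    f = indmv (mem m) i a′ ; g = indmv (mem m) i b′ in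
            to⇔ ((λ h → out⟨ (≤⇐ (π.r∊ a′) (π.r∊ b′) (Mv-⊂′ (Lifted.per L) (π.r∊ b′) (π.r∊ a′) g f (≤⇒ (in⟨ h))))) ,
                 (λ h → out⟨ (≤⇐ (π.l∊ a′) (π.l∊ b′) (Mv-⊂ (Lifted.per L) (π.l∊ b′) (π.l∊ a′) g f (≤⇒ (in⟨ h))))))
        ; subgroups = λ K m → let (s , sb , A , a , sp) = F⇒′ (mem m) in
            (λ z q → unmem (s z (mem q))) , permgroup s sb (𝓘₀⊂ a) sp
        ; nonempty = let (K , m , _) = fixing ∅ 𝓘₀-∅ in K , unmem m
        ; supergroups = λ K K′ v m (s , g) h → unmem (F⇐′ v (λ z q → mem (s z (unmem q))) (sub-of g)
            (let (A , a , sp) = F-sup (mem m) in A , a , λ σ σH l → mem (h σ (unmem (sp σ σH l)))))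
        ; intersections = λ K K′ m m′ → intersect K K′ (mem m) (mem m′)
        ; conjugates = λ K π m m′ → conj K π (mem m) (mem m′)
        ; nontrivial = λ K m → nontriv K (mem m) }

      fix𝟙 : ∀ σ → σ ∊ H → ⟪ ∅ , ∅ ⟫ ∊ σ
      fix𝟙 σ m = let (θ , _ , L , i , _) = lifted (toH m) in
        proj₂ (i ∅ 𝟙∊P ∅ 𝟙∊P) λ a a′ r j jI b bT → (λ q → ⊥-elim (∉∅ q)) , (λ q → ⊥-elim (∉∅ q))

 open NormalFilter

 module AtomNames where
  private variable
    n : ℕ
    ℓ ℓ′ : Level
    s t u : Env n → 𝕍

  module Atoms (D 𝓖 𝓘 X : 𝕍) ⦃ _ : Cst D ⦄ ⦃ _ : Cst 𝓖 ⦄ ⦃ _ : Cst 𝓘 ⦄ ⦃ _ : Cst X ⦄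
    (grp : IsPermGroup D 𝓖) (ideal : IsIdealIn V D 𝓘) where
    open Filter D 𝓖 𝓘 X grp ideal public
    open Forcing S isS public using (_≼_; Gen; module Gen; fromGeneric; module OnNames)
    open Names S isS fix𝟙 public using (dot; dot-i; dot-e; ∊dot; dot-cong; op; op-cong; chk; chk-cong; dChk; V-chk;
      ∊val-dot; val-dot-i; val-op; dOp; val-chk; name-dot; name-op; name-chk; act-dot; act-op; act-chk; module ActOn; tc-pc;
      sym-intro; HS; hs-cong; hs-dot; hs-chk; hs-op; sub-F; V⊑W; W⊑V[G]; module Pull)

    c₁ : 𝕍
    c₁ = up ∅ ∅

    c₁T : c₁ ∊ Two
    c₁T = upr ≈refl

    ∅T : ∅ ∊ Two
    ∅T = upl ≈refl

    lit-cong : ∀ {a a′ j j′ b} → a ≈ a′ → j ≈ j′ → lit a j b ≈ lit a′ j′ b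
    lit-cong e f = up-cong (⟪⟫-cong (⟪⟫-cong e f) ≈refl) (⟪⟫-cong (⟪⟫-cong e f) ≈refl)

    opaque
      xn : 𝕍 → 𝕍
      xn a = img (pow B) λ j → ⟪ lit a j (up ∅ ∅) , chk j ⟫

    opaque
      unfolding xn
      ∊xn : ∀ {a p y} → ⟪ p , y ⟫ ∊ xn a → ∃[ j ] j ∊ I × p ≈ lit a j c₁ × y ≈ chk j
      ∊xn m = let (j , q , e) = ∊img m ; (u , v) = ⟪⟫-inj e in j , q , u , v

    opaque
      unfolding xn
      xn-i : ∀ {a j} → j ∊ I → ⟪ lit a j c₁ , chk j ⟫ ∊ xn a
      xn-i {a} m = img-i {t = λ j → ⟪ lit a j c₁ , chk j ⟫} (λ y _ e → ⟪⟫-cong (lit-cong ≈refl e) (chk-cong e)) m ≈refl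

    opaque
      unfolding xn
      xn-cong : ∀ {a a′} → a ≈ a′ → xn a ≈ xn a′
      xn-cong e = ≈ext (half e) (half (≈sym e))
        where
        half : ∀ {a a′} → a ≈ a′ → xn a ⊂ xn a′
        half e z m = let (j , q , r) = ∊img m in ∊l (≈sym (≈trans r (⟪⟫-cong (lit-cong e ≈refl) ≈refl))) (xn-i q)

    opaque
      an : 𝕍 → 𝕍
      an m = dot (img (pow B) λ i → xn ⟪ m , i ⟫)

    private
      fib-i : ∀ {m i} → i ∊ I → xn ⟪ m , i ⟫ ∊ img (pow B) λ i → xn ⟪ m , i ⟫
      fib-i {m} q = img-i {t = λ i → xn ⟪ m , i ⟫} (λ _ _ e → xn-cong (⟪⟫-cong ≈refl e)) q ≈refl

    opaque
      unfolding an
      an-cong : ∀ {m m′} → m ≈ m′ → an m ≈ an m′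
      an-cong e = dot-cong (≈ext (half e) (half (≈sym e)))
        where
        half : ∀ {m m′} → m ≈ m′ → (img (pow B) λ i → xn ⟪ m , i ⟫) ⊂ (img (pow B) λ i → xn ⟪ m′ , i ⟫)
        half e z q = let (i , r , s) = ∊img q in ∊l (≈sym (≈trans s (xn-cong (⟪⟫-cong e ≈refl)))) (fib-i r)

    opaque
      unfolding xn
      name-xn : ∀ {a} → a ∊ At → IsName P (xn a)
      name-xn {a} aA = name-i λ z m → let (j , q , e) = ∊img m in lit a j c₁ , chk j , lit-P aA q c₁T , e , name-chk j

    At-i : ∀ {m i} → m ∊ D → i ∊ I → ⟪ m , i ⟫ ∊ At
    At-i m i = ⊗i (∪l m) i

    opaque
      unfolding an
      name-an : ∀ {m} → m ∊ D → IsName P (an m)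
      name-an mD = name-dot λ x q → let (i , r , e) = ∊img q in name-cong (≈sym e) (name-xn (At-i mD r))

    module _ {θ π σ : 𝕍} (L : Lifted θ π) (i : Ind θ σ) (σH : σ ∊ H) where
      private
        module L = Lifted L
        module σ = Perm (permH σH)

      lit-move : ∀ {a a′ j b} → ⟪ a , a′ ⟫ ∊ θ → j ∊ I → b ∊ Two → ⟪ lit a j b , lit a′ j b ⟫ ∊ σ
      lit-move r jI bT = proj₂ (i _ (lit-P (Perm.l∊ L.per r) jI bT) _ (lit-P (Perm.r∊ L.per r) jI bT)) (Mv-lit L.per r)

      opaque
        unfolding xn
        act-xn : ∀ {a a′} → ⟪ a , a′ ⟫ ∊ θ → Act P σ (xn a) ≈ xn a′
        act-xn {a} {a′} r = ≈ext
          (λ z m → let (p , p′ , y , _ , _ , q , s , e) = ∊act m ; (j , jI , u , v) = ∊xn s in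
            ∊l (≈sym (≈trans e (⟪⟫-cong (σ.sv q (⟪⟫-resp (≈sym u) ≈refl (lit-move r jI c₁T))) (≈trans (act-cong v) (act-chk σH j))))) (xn-i jI))
          (λ z m → let (j , jI , e) = ∊img m ; q = lit-move r jI c₁T in
            act-i (σ.l∊ q) (σ.r∊ q) q (xn-i jI) (≈trans e (⟪⟫-cong ≈refl (≈sym (act-chk σH j)))))

      opaque
        unfolding an
        act-an : ∀ {m m′} → ⟪ m , m′ ⟫ ∊ π → Act P σ (an m) ≈ an m′
        act-an {m} {m′} r = act-dot σH
          (λ x q → let (k , kI , e) = ∊img q
                       (a′ , s) = Perm.tot L.per (At-i mD kI)
                       (n , k′ , _ , kI′ , e′) = ∊⊗ (Perm.r∊ L.per s)
                       n≈ = [ (λ t → π.sv t r) , (λ (t , _) → ⊥-elim (D∉ mD t)) ]′ (L.over _ a′ s m k ≈refl n k′ e′)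
                   in ∊l (≈sym (≈trans (act-cong e) (≈trans (act-xn s) (xn-cong (≈trans e′ (⟪⟫-cong n≈ ≈refl)))))) (fib-i kI′))
          (λ y q → let (k′ , kI′ , e) = ∊img q
                       (a , s) = Perm.srj L.per (At-i mD′ kI′)
                       (n , k , _ , kI , e′) = ∊⊗ (Perm.l∊ L.per s)
                       n≈ = [ (λ t → π.inj t r) , (λ (_ , t) → ⊥-elim (D∉ mD′ t)) ]′ (L.over a _ s n k e′ m′ k′ ≈refl)
                   in xn ⟪ m , k ⟫ , fib-i kI , ≈trans (act-xn (⟪⟫-resp (≈trans e′ (⟪⟫-cong n≈ ≈refl)) ≈refl s)) (≈sym e))
          where
          module π = Perm (perm𝓖 L.π𝓖)
          mD : m ∊ D
          mD = π.l∊ r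
          mD′ : m′ ∊ D
          mD′ = π.r∊ r
          D∉ : ∀ {x} → x ∊ D → ¬ x ≈ D
          D∉ m e = ∊-irrefl D (∊l e m)

    fix-an : ∀ {A σ m} → A ⊂ D → σ ∊ H → Lifts A σ → m ∊ A → Act P σ (an m) ≈ an m
    fix-an {A} {σ} {m} A⊂ σH l mA = let (θ , π , L , i , f) = lifted l in act-an L i σH (fixed L f)
      where
      fixed : ∀ {θ π} → Lifted θ π → Fixes A θ → ⟪ m , m ⟫ ∊ π
      fixed {θ} {π} L f = [ (λ q → q) , (λ (e , _) → ⊥-elim (∊-irrefl D (∊l e (A⊂ m mA)))) ]′
        (Lifted.over L _ _ (f m mA ∅ (pow-i V-B V∅ λ z q → ⊥-elim (∉∅ q))) m ∅ ≈refl m ∅ ≈refl)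

    fix-xn : ∀ {A σ m i} → σ ∊ H → Lifts A σ → m ∊ A → i ∊ I → Act P σ (xn ⟪ m , i ⟫) ≈ xn ⟪ m , i ⟫
    fix-xn σH l mA iI = let (θ , π , L , i , f) = lifted l in act-xn L i σH (f _ mA _ iI)

    opaque
      unfolding xn an
      private
        dan : T₁ an
        dan = it
      instance
        dAn : ⦃ DefT {n} s ⦄ → DefT (λ ρ → an (s ρ))
        dAn ⦃ S ⦄ = appT {f = an} dan S

    V-an : ∀ {m} → m ∊ D → V (an m)
    V-an mD = VT (dAn ⦃ cst (V∊ (VT it) mD) ⦄)

    opaque
      unfolding xn
      V-xn : ∀ {a} → V a → V (xn a)
      V-xn {a} va = VT it
        where
        instance
          ia : Cst a
          ia = cst va

    hs-xn : ∀ {m i} → m ∊ D → i ∊ I → HS (xn ⟪ m , i ⟫)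
    hs-xn {m} {i} mD iI = let (K , KF , h) = fixing (up m m) (𝓘₀-sing mD) in
      hs (sym-intro (V-xn (V∊ (VT it) (At-i mD iI))) (name-xn (At-i mD iI)) KF
            (λ σ q → let (a , b) = h σ q in fix-xn a b (upl ≈refl) iI))
         (λ p y q → let (j , jI , _ , e) = ∊xn (in⟨ q) in hs-cong (≈sym e) (hs-chk j (V∊ V-I jI)))

    opaque
      unfolding an
      hs-an : ∀ {m} → m ∊ D → HS (an m)
      hs-an {m} mD = let (K , KF , h) = fixing (up m m) (𝓘₀-sing mD) in
        hs-dot (sym-intro (V-an mD) (name-an mD) KF (λ σ q → let (a , b) = h σ q in fix-an (𝓘₀⊂ (𝓘₀-sing mD)) a b (upl ≈refl)))
          (λ x q → let (i , r , e) = ∊img q in hs-cong (≈sym e) (hs-xn mD r))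

    tup tn : Vec 𝕍 n → 𝕍
    tup [] = ∅
    tup (x ∷ xs) = ⟪ x , tup xs ⟫
    tn [] = ∅
    tn (x ∷ xs) = op (an x) (tn xs)

    name-∅ : IsName P ∅
    name-∅ = name-i λ z m → ⊥-elim (∉∅ m)

    name-tn : (xs : Vec 𝕍 n) → All (_∊ D) xs → IsName P (tn xs)
    name-tn [] [] = name-∅
    name-tn (x ∷ xs) (p ∷ ps) = name-op (name-an p) (name-tn xs ps)

    V-tn : (xs : Vec 𝕍 n) → All (_∊ D) xs → V (tn xs)
    V-tn [] [] = V∅
    V-tn (x ∷ xs) (p ∷ ps) = V-op (V-an p) (V-tn xs ps)
      where
      V-op : ∀ {x y} → V x → V y → V (op x y)
      V-op {x} {y} vx vy = VT it
        where
        instance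
          ix : Cst x
          ix = cst vx
          iy : Cst y
          iy = cst vy

    act-∅ : ∀ {σ} → Act P σ ∅ ≈ ∅
    act-∅ = ≈ext (λ z m → let (p , p′ , y , _ , _ , _ , q , _) = ∊act m in ⊥-elim (∉∅ q)) (λ z m → ⊥-elim (∉∅ m))

    act-tn : ∀ {θ π σ} → Lifted θ π → Ind θ σ → σ ∊ H → {xs ys : Vec 𝕍 n} →
      Pointwise (λ x y → ⟪ x , y ⟫ ∊ π) xs ys → Act P σ (tn xs) ≈ tn ys
    act-tn L i σH [] = act-∅
    act-tn L i σH (r ∷ rs) = ≈trans (act-op σH) (op-cong (act-an L i σH r) (act-tn L i σH rs))

    sup-tn : (xs : Vec 𝕍 n) → All (_∊ D) xs → ∃[ A ] A ∊ 𝓘₀ × (∀ σ → σ ∊ H → Lifts A σ → Act P σ (tn xs) ≈ tn xs) × HS (tn xs)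
    sup-tn [] [] = ∅ , 𝓘₀-∅ , (λ σ _ _ → act-∅) , hs-cong (≈ext (λ z m → m) (λ z m → m)) (hs-∅)
      where
      hs-∅ : HS ∅
      hs-∅ = hs-cong (≈ext (λ z m → let (k , q , _) = C.∊chk m in ⊥-elim (∉∅ q)) (λ z m → ⊥-elim (∉∅ m))) (hs-chk ∅ V∅)
        where module C = Names S isS fix𝟙
    sup-tn (x ∷ xs) (p ∷ ps) =
      let (A , a , f , h) = sup-tn xs ps
          (C , c , s , s′) = 𝓘₀-∪ a (𝓘₀-sing p)
          (K , KF , k) = fixing C c
          fx : ∀ σ → σ ∊ H → Lifts C σ → Act P σ (an x) ≈ an x × Act P σ (tn xs) ≈ tn xs
          fx σ q l = fix-an (𝓘₀⊂ c) q l (s′ x (upl ≈refl)) , f σ q (weaken s l)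
      in C , c , (λ σ q l → let (u , v) = fx σ q l in ≈trans (act-op q) (op-cong u v)) ,
        hs-op (V-an p) (V-tn xs ps) (name-an p) (name-tn xs ps) (hs-an p) h KF (λ σ q → let (u , v) = k σ q in fx σ u v)
      where
      weaken : ∀ {A C σ} → A ⊂ C → Lifts C σ → Lifts A σ
      weaken s (θ , v , π , p , q , o , i , f) = θ , v , π , p , q , o , i , λ m mA → f m (s m mA)

    module Values {G : 𝕍} (g : Gen G) where
      open Gen g

      av : 𝕍 → 𝕍
      av m = Val G (an m)

      av-cong : ∀ {m m′} → m ≈ m′ → av m ≈ av m′
      av-cong e = val-cong (an-cong e)

      ∊val-xn : ∀ {a z} → z ∊ Val G (xn a) → ∃[ j ] j ∊ I × lit a j c₁ ∊ G × z ≈ j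
      ∊val-xn m = let (p , y , pG , q , e) = ∊val m ; (j , jI , u , v) = ∊xn q in
        j , jI , ∊l u pG , ≈trans e (≈trans (val-cong v) (val-chk 𝟙G j))

      val-xn-i : ∀ {a j} → j ∊ I → lit a j c₁ ∊ G → j ∊ Val G (xn a)
      val-xn-i {a} {j} jI m = val-i m (xn-i jI) (≈sym (val-chk 𝟙G j))

      xn-differ : ∀ {a a′} → a ∊ At → a′ ∊ At → ¬ a ≈ a′ → ¬ Val G (xn a) ≈ Val G (xn a′)
      xn-differ {a} {a′} aA aA′ ne e = go (dense-below U it ∅ 𝟙G dense)
        where
        instance
          ia : Cst a
          ia = cst (V∊ (VT it) aA)
          ia′ : Cst a′
          ia′ = cst (V∊ (VT it) aA′)
        U : 𝕍 → Set₁
        U p = ∃[ j ] j ∊ pow B × ⟪ ⟪ a , j ⟫ , up ∅ ∅ ⟫ ∊ p × ⟪ ⟪ a′ , j ⟫ , ∅ ⟫ ∊ p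
        dense : ∀ q → q ∊ P → q ≼ ∅ → ∃[ r ] r ∊ P × r ≼ q × U r
        dense q qP _ = mk (fresh J smJ)
          where
          instance
            iq : Cst q
            iq = cst (V∊ V-P qP)
          C : 𝕍 → Set₁
          C j = ∃[ c ] ∃[ b ] ⟪ c , b ⟫ ∊ q × (∃[ a ] a ∊ At × c ≈ ⟪ a , j ⟫)
          opaque
            dC : D₁ C
            dC = it
          J : 𝕍
          J = sep (pow B) C ⦃ it ⦄ ⦃ dC ⦄
          J⇒ : ∀ {j} → j ∊ J → j ∊ I × C j
          J⇒ = ∊sep
          R : 𝕍 → 𝕍 → Set₁
          R l j = ∃[ c ] ∃[ b ] l ≈ ⟪ c , b ⟫ × (∃[ a ] a ∊ At × c ≈ ⟪ a , j ⟫)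
          smJ : Small J
          smJ = small-img (Vsep) R it (proj₁ (proj₂ (P⇒ qP)))
            (λ l j j′ _ _ h h′ → un l j j′ h h′)
            (λ j m → let (_ , c , b , s , a , aA , f) = J⇒ m in ⟪ c , b ⟫ , s , c , b , ≈refl , a , aA , f)
            where
            un : ∀ l j j′ → R l j → R l j′ → j ≈ j′
            un l j j′ (c , b , e , a , _ , f) (c₂ , b₂ , e₂ , a₂ , _ , f₂) =
              proj₂ (⟪⟫-inj (≈trans (≈sym f) (≈trans (proj₁ (⟪⟫-inj (≈trans (≈sym e) e₂))) f₂)))
          mk : ∃[ j ] j ∊ I × ¬ j ∊ J → ∃[ r ] r ∊ P × r ≼ q × U r
          mk (j , jI , nj) = r , rP , ≤⇐ rP qP (λ z → ∪l) , j , jI , ∪r (upl ≈refl) , ∪r (upr ≈refl)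
            where
            instance
              ij : Cst j
              ij = cst (V∊ V-I jI)
            w : 𝕍
            w = up ⟪ ⟪ a , j ⟫ , up ∅ ∅ ⟫ ⟪ ⟪ a′ , j ⟫ , ∅ ⟫
            r : 𝕍
            r = q ∪ w
            notq : ∀ {a b} → a ∊ At → ¬ ⟪ ⟪ a , j ⟫ , b ⟫ ∊ q
            notq {a} aA m = nj (sep-i jI (_ , _ , m , a , aA , ≈refl))
            w⇒ : ∀ {c b} → ⟪ c , b ⟫ ∊ w → (c ≈ ⟪ a , j ⟫ × b ≈ c₁) ⊎ (c ≈ ⟪ a′ , j ⟫ × b ≈ ∅)
            w⇒ m = [ (λ e → inj₁ (⟪⟫-inj e)) , (λ e → inj₂ (⟪⟫-inj e)) ]′ (∊up m)
            w∉q : ∀ {c b b′} → ⟪ c , b ⟫ ∊ w → ¬ ⟪ c , b′ ⟫ ∊ q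
            w∉q m n = [ (λ (e , _) → notq aA (⟪⟫-resp e ≈refl n)) , (λ (e , _) → notq aA′ (⟪⟫-resp e ≈refl n)) ]′ (w⇒ m)
            fn : ∀ c b → ⟪ c , b ⟫ ∊ r → ∀ b′ → ⟪ c , b′ ⟫ ∊ r → b ≈ b′
            fn c b m b′ m′ = f₁ (∊∪ m) (∊∪ m′)
              where
              f₂ : (c ≈ ⟪ a , j ⟫ × b ≈ c₁) ⊎ (c ≈ ⟪ a′ , j ⟫ × b ≈ ∅) → (c ≈ ⟪ a , j ⟫ × b′ ≈ c₁) ⊎ (c ≈ ⟪ a′ , j ⟫ × b′ ≈ ∅) → b ≈ b′
              f₂ (inj₁ (e , f)) (inj₁ (e′ , f′)) = ≈trans f (≈sym f′)
              f₂ (inj₂ (e , f)) (inj₂ (e′ , f′)) = ≈trans f (≈sym f′)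
              f₂ (inj₁ (e , f)) (inj₂ (e′ , f′)) = ⊥-elim (ne (proj₁ (⟪⟫-inj (≈trans (≈sym e) e′))))
              f₂ (inj₂ (e , f)) (inj₁ (e′ , f′)) = ⊥-elim (ne (proj₁ (⟪⟫-inj (≈trans (≈sym e′) e))))
              f₁ : ⟪ c , b ⟫ ∊ q ⊎ ⟪ c , b ⟫ ∊ w → ⟪ c , b′ ⟫ ∊ q ⊎ ⟪ c , b′ ⟫ ∊ w → b ≈ b′
              f₁ (inj₁ x) (inj₁ y) = proj₂ (proj₂ (P⇒ qP)) c b x b′ y
              f₁ (inj₁ x) (inj₂ y) = ⊥-elim (w∉q y x)
              f₁ (inj₂ x) (inj₁ y) = ⊥-elim (w∉q x y)
              f₁ (inj₂ x) (inj₂ y) = f₂ (w⇒ x) (w⇒ y)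
            Vw : V w
            Vw = VT it
            rP : r ∊ P
            rP = P⇐ (VT it)
              (λ z m → [ proj₁ (P⇒ qP) z , (λ n → [ (λ e → ∊l (≈sym e) (⊗i (⊗i aA jI) c₁T)) , (λ e → ∊l (≈sym e) (⊗i (⊗i aA′ jI) ∅T)) ]′ (∊up n)) ]′ (∊∪ m))
              (small-∪ (V∊ V-P qP) Vw (proj₁ (proj₂ (P⇒ qP))) (small-up (V∊ Vw (upl ≈refl)) (V∊ Vw (upr ≈refl))))
              fn
        go : ∃[ p ] p ∊ G × U p → ⊥
        go (p , pG , j , jI , x , y) =
          let lP = lit-P aA jI c₁T
              lG = upw pG lP (≤⇐ (sub pG) lP (λ z m → ∊l (≈sym (∊sing m)) x))
              (j′ , jI′ , lG′ , e′) = ∊val-xn (∊r e (val-xn-i jI lG))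
              (r , rG , r≤p , r≤l) = dir pG lG′
              f = proj₂ (proj₂ (P⇒ (sub rG))) ⟪ a′ , j ⟫ ∅ (≤⇒ r≤p _ y) c₁ (≤⇒ r≤l _ (upl (⟪⟫-cong (⟪⟫-cong ≈refl e′) ≈refl)))
          in ∉∅ (∊r (≈sym f) (upl ≈refl))

      opaque
        unfolding an
        av-inj : ∀ {m m′} → m ∊ D → m′ ∊ D → av m ≈ av m′ → m ≈ m′
        av-inj {m} {m′} mD mD′ e with dec₀ (m ≈ m′)
        ... | yes r = r
        ... | no ne = let ∅I = pow-i V-B V∅ (λ z q → ⊥-elim (∉∅ q))
                          (x , q , f) = ∊val-dot 𝟙G (∊r e (val-dot-i 𝟙G (fib-i ∅I) ≈refl))
                          (i , iI , f′) = ∊img q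
                      in ⊥-elim (xn-differ (At-i mD ∅I) (At-i mD′ iI) (λ h → ne (proj₁ (⟪⟫-inj h))) (≈trans f (val-cong f′)))

      val-∅ : Val G ∅ ≈ ∅
      val-∅ = ≈ext (λ z m → let (p , y , _ , q , _) = ∊val m in ⊥-elim (∉∅ q)) (λ z m → ⊥-elim (∉∅ m))

      val-tn : (xs : Vec 𝕍 n) → Val G (tn xs) ≈ tup (map av xs)
      val-tn [] = val-∅
      val-tn (x ∷ xs) = ≈trans (val-op 𝟙G) (⟪⟫-cong ≈refl (val-tn xs))

 open AtomNames

 module Homogeneous where
  private variable
    n : ℕ
    ℓ ℓ′ : Level
    s t u : Env n → 𝕍

  module Homogeneity (D 𝓖 𝓘 X : 𝕍) ⦃ _ : Cst D ⦄ ⦃ _ : Cst 𝓖 ⦄ ⦃ _ : Cst 𝓘 ⦄ ⦃ _ : Cst X ⦄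
    (grp : IsPermGroup D 𝓖) (ideal : IsIdealIn V D 𝓘) where
    open Atoms D 𝓖 𝓘 X grp ideal public

    -- A permutation of the atoms over π, fixing A × I and translating the other fibres over D by i₀.
    module Shift (A π i₀ : 𝕍) (A𝓘 : A ∊ 𝓘₀) (π𝓖 : π ∊ 𝓖) (iI₀ : i₀ ∊ I) (fixA : ∀ b → b ∊ A → ⟪ b , b ⟫ ∊ π) where
      private
        module π = Perm (perm𝓖 π𝓖)
        instance
          iA : Cst A
          iA = cst (V∊ V-𝓘₀ A𝓘)
          iπ : Cst π
          iπ = cst (V∊ (VT it) π𝓖)
          ii₀ : Cst i₀
          ii₀ = cst (V∊ V-I iI₀)

      Stay : 𝕍 → 𝕍 → 𝕍 → 𝕍 → Set
      Stay m i m′ i′ = (m ∊ A ⊎ m ≈ D) × m ≈ m′ × i ≈ i′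

      Move : 𝕍 → 𝕍 → 𝕍 → 𝕍 → Set₁
      Move m i m′ i′ = ¬ m ∊ A × ⟪ m , m′ ⟫ ∊ π × SD i i₀ i′

      R : 𝕍 → 𝕍 → Set₁
      R a a′ = ∃[ m ] ∃[ i ] a ≈ ⟪ m , i ⟫ × (∃[ m′ ] ∃[ i′ ] a′ ≈ ⟪ m′ , i′ ⟫ × (Stay m i m′ i′ ⊎ Move m i m′ i′))

      opaque
        dR : D₂ R
        dR = it

        θ : 𝕍
        θ = rel At At R ⦃ it ⦄ ⦃ it ⦄ ⦃ dR ⦄
        vθ : V θ
        vθ = Vrel
        θ⇒ : ∀ {a b} → ⟪ a , b ⟫ ∊ θ → a ∊ At × b ∊ At × R a b
        θ⇒ = ∊rel
        θ⇐ : ∀ {a b} → a ∊ At → b ∊ At → R a b → ⟪ a , b ⟫ ∊ θ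
        θ⇐ = rel-i
        θ⊂ : θ ⊂ At ⊗ At
        θ⊂ = rel⊂

      private
        D∉ : ∀ {x} → x ∊ D → ¬ x ≈ D
        D∉ m e = ∊-irrefl D (∊l e m)

        SDresp : ∀ {i k i′ k′} → i ≈ i′ → k ≈ k′ → SD i i₀ k → SD i′ i₀ k′
        SDresp e f h b m = let (u , v , w) = h b m in
          (λ q → [ (λ (x , y) → inj₁ (∊r e x , y)) , (λ (x , y) → inj₂ (x , λ r → y (∊r (≈sym e) r))) ]′ (u (∊r (≈sym f) q))) ,
          (λ x y → ∊r f (v (∊r (≈sym e) x) y)) , (λ x y → ∊r f (w x (λ r → y (∊r e r))))

        at : ∀ {m i m′ i′} → ⟪ ⟪ m , i ⟫ , ⟪ m′ , i′ ⟫ ⟫ ∊ θ → Stay m i m′ i′ ⊎ Move m i m′ i′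
        at q = go (proj₂ (proj₂ (θ⇒ q)))
          where
          go : ∀ {m i m′ i′} → R ⟪ m , i ⟫ ⟪ m′ , i′ ⟫ → Stay m i m′ i′ ⊎ Move m i m′ i′
          go (n , k , e , n′ , k′ , e′ , inj₁ (x , y , z)) = let (a , b) = ⟪⟫-inj e ; (c , d) = ⟪⟫-inj e′ in
            inj₁ ([ (λ r → inj₁ (∊l (≈sym a) r)) , (λ r → inj₂ (≈trans a r)) ]′ x , ≈trans a (≈trans y (≈sym c)) , ≈trans b (≈trans z (≈sym d)))
          go (n , k , e , n′ , k′ , e′ , inj₂ (x , y , z)) = let (a , b) = ⟪⟫-inj e ; (c , d) = ⟪⟫-inj e′ in
            inj₂ ((λ r → x (∊l a r)) , ⟪⟫-resp (≈sym a) (≈sym c) y , SDresp (≈sym b) (≈sym d) z)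

        mk : ∀ {m i m′ i′} → ⟪ m , i ⟫ ∊ At → ⟪ m′ , i′ ⟫ ∊ At → Stay m i m′ i′ ⊎ Move m i m′ i′ → ⟪ ⟪ m , i ⟫ , ⟪ m′ , i′ ⟫ ⟫ ∊ θ
        mk a b h = θ⇐ a b (_ , _ , ≈refl , _ , _ , ≈refl , h)

        tot′ : ∀ {m i} → m ∊ D ∪ up D D → i ∊ I → ∃[ y ] ⟪ ⟪ m , i ⟫ , y ⟫ ∊ θ
        tot′ {m} {i} mD iI = go (∊∪ mD) (dec₀ (m ∊ A))
          where
          go : m ∊ D ⊎ m ∊ up D D → Dec (m ∊ A) → ∃[ y ] ⟪ ⟪ m , i ⟫ , y ⟫ ∊ θ
          go _ (yes mA) = _ , mk (⊗i mD iI) (⊗i mD iI) (inj₁ (inj₁ mA , ≈refl , ≈refl))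
          go (inj₂ e) _ = _ , mk (⊗i mD iI) (⊗i mD iI) (inj₁ (inj₂ (∊sing e) , ≈refl , ≈refl))
          go (inj₁ m∊ ) (no nA) = let (m′ , r) = π.tot m∊ ; (k , kI , h) = SD-exists iI iI₀ in
            _ , mk (⊗i mD iI) (⊗i (∪l (π.r∊ r)) kI) (inj₂ (nA , r , h))

        srj′ : ∀ {m i} → m ∊ D ∪ up D D → i ∊ I → ∃[ x ] ⟪ x , ⟪ m , i ⟫ ⟫ ∊ θ
        srj′ {m} {i} mD iI = go (∊∪ mD) (dec₀ (m ∊ A))
          where
          go : m ∊ D ⊎ m ∊ up D D → Dec (m ∊ A) → ∃[ x ] ⟪ x , ⟪ m , i ⟫ ⟫ ∊ θ
          go _ (yes mA) = _ , mk (⊗i mD iI) (⊗i mD iI) (inj₁ (inj₁ mA , ≈refl , ≈refl))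
          go (inj₂ e) _ = _ , mk (⊗i mD iI) (⊗i mD iI) (inj₁ (inj₂ (∊sing e) , ≈refl , ≈refl))
          go (inj₁ m∊ ) (no nA) = let (m′ , r) = π.srj m∊ ; (k , kI , h) = SD-exists iI iI₀ in
            _ , mk (⊗i (∪l (π.l∊ r)) kI) (⊗i mD iI) (inj₂ ((λ mA → nA (∊l (π.sv (fixA m′ mA) r) mA)) , r , proj₁ (SD-rot h)))

        mix : ∀ {m i m′ i′ n k} → Stay m i m′ i′ → Move n k m′ i′ → ⊥
        mix (inj₁ mA , e , _) (nA , r , _) = nA (∊l (π.inj (fixA _ mA) (⟪⟫-resp ≈refl (≈sym e) r)) mA)
        mix (inj₂ d , e , _) (nA , r , _) = D∉ (π.r∊ r) (≈trans (≈sym e) d)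

        mix′ : ∀ {m i m′ i′ n k} → Stay m i m′ i′ → Move m i n k → ⊥
        mix′ (inj₁ mA , e , _) (nA , r , _) = nA mA
        mix′ (inj₂ d , e , _) (nA , r , _) = D∉ (π.l∊ r) d

        sv′ : ∀ {m i m₁ i₁ m₂ i₂} → i₁ ∊ I → i₂ ∊ I → Stay m i m₁ i₁ ⊎ Move m i m₁ i₁ → Stay m i m₂ i₂ ⊎ Move m i m₂ i₂ → ⟪ m₁ , i₁ ⟫ ≈ ⟪ m₂ , i₂ ⟫
        sv′ _ _ (inj₁ (_ , e , f)) (inj₁ (_ , e′ , f′)) = ⟪⟫-cong (≈trans (≈sym e) e′) (≈trans (≈sym f) f′)
        sv′ _ _ (inj₁ h) (inj₂ k) = ⊥-elim (mix′ h k)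
        sv′ _ _ (inj₂ k) (inj₁ h) = ⊥-elim (mix′ h k)
        sv′ a b (inj₂ (_ , r , h)) (inj₂ (_ , r′ , h′)) = ⟪⟫-cong (π.sv r r′) (SD-unique a b h h′)

        inj′ : ∀ {m i m₁ i₁ m₂ i₂} → i₁ ∊ I → i₂ ∊ I → Stay m₁ i₁ m i ⊎ Move m₁ i₁ m i → Stay m₂ i₂ m i ⊎ Move m₂ i₂ m i → ⟪ m₁ , i₁ ⟫ ≈ ⟪ m₂ , i₂ ⟫
        inj′ _ _ (inj₁ (_ , e , f)) (inj₁ (_ , e′ , f′)) = ⟪⟫-cong (≈trans e (≈sym e′)) (≈trans f (≈sym f′))
        inj′ _ _ (inj₁ h) (inj₂ k) = ⊥-elim (mix h k)
        inj′ _ _ (inj₂ k) (inj₁ h) = ⊥-elim (mix h k)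
        inj′ a b (inj₂ (_ , r , h)) (inj₂ (_ , r′ , h′)) = ⟪⟫-cong (π.inj r r′) (SD-unique a b (proj₁ (SD-rot h)) (proj₁ (SD-rot h′)))

      θ-cases : ∀ {a a′} → ⟪ a , a′ ⟫ ∊ θ → a ≈ a′ ⊎
        (∃[ m ] ∃[ i ] ∃[ m′ ] ∃[ i′ ] a ≈ ⟪ m , i ⟫ × a′ ≈ ⟪ m′ , i′ ⟫ × SD i i₀ i′)
      θ-cases q = go (proj₂ (proj₂ (θ⇒ q)))
        where
        go : ∀ {a a′} → R a a′ → a ≈ a′ ⊎ (∃[ m ] ∃[ i ] ∃[ m′ ] ∃[ i′ ] a ≈ ⟪ m , i ⟫ × a′ ≈ ⟪ m′ , i′ ⟫ × SD i i₀ i′)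
        go (m , i , e , m′ , i′ , e′ , inj₁ (_ , x , y)) = inj₁ (≈trans e (≈trans (⟪⟫-cong x y) (≈sym e′)))
        go (m , i , e , m′ , i′ , e′ , inj₂ (_ , _ , h)) = inj₂ (m , i , m′ , i′ , e , e′ , h)

      shift : Lifted θ π
      shift = record
        { vθ = vθ
        ; per = record
          { dom = λ q → θ⊂ _ q
          ; tot = λ q → let (m , i , mD , iI , e) = ∊⊗ q ; (y , r) = tot′ mD iI in y , ⟪⟫-resp (≈sym e) ≈refl r
          ; srj = λ q → let (m , i , mD , iI , e) = ∊⊗ q ; (y , r) = srj′ mD iI in y , ⟪⟫-resp ≈refl (≈sym e) r
          ; sv = λ p q → let (m , i , _ , _ , e) = ∊⊗ (proj₁ (θ⇒ p))
                             (m₁ , i₁ , _ , j₁ , e₁) = ∊⊗ (proj₁ (proj₂ (θ⇒ p)))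
                             (m₂ , i₂ , _ , j₂ , e₂) = ∊⊗ (proj₁ (proj₂ (θ⇒ q)))
                         in ≈trans e₁ (≈trans (sv′ j₁ j₂ (at (⟪⟫-resp e e₁ p)) (at (⟪⟫-resp e e₂ q))) (≈sym e₂))
          ; inj = λ p q → let (m , i , _ , _ , e) = ∊⊗ (proj₁ (proj₂ (θ⇒ p)))
                              (m₁ , i₁ , _ , j₁ , e₁) = ∊⊗ (proj₁ (θ⇒ p))
                              (m₂ , i₂ , _ , j₂ , e₂) = ∊⊗ (proj₁ (θ⇒ q))
                          in ≈trans e₁ (≈trans (inj′ j₁ j₂ (at (⟪⟫-resp e₁ e p)) (at (⟪⟫-resp e₂ e q))) (≈sym e₂)) }
        ; π𝓖 = π𝓖
        ; over = λ a a′ q m i e m′ i′ e′ → over (at (⟪⟫-resp e e′ q)) (proj₁ (⊗e (∊l e (proj₁ (θ⇒ q))))) }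
        where
        over : ∀ {m i m′ i′} → Stay m i m′ i′ ⊎ Move m i m′ i′ → m ∊ D ∪ up D D → ⟪ m , m′ ⟫ ∊ π ⊎ (m ≈ D × m′ ≈ D)
        over (inj₁ (inj₁ mA , e , _)) _ = inj₁ (⟪⟫-resp ≈refl e (fixA _ mA))
        over (inj₁ (inj₂ d , e , _)) _ = inj₂ (d , ≈trans (≈sym e) d)
        over (inj₂ (_ , r , _)) _ = inj₁ r

      fixes : Fixes A θ
      fixes m mA i iI = let a = ⊗i (∪l (𝓘₀⊂ A𝓘 m mA)) iI in mk a a (inj₁ (inj₁ mA , ≈refl , ≈refl))

    Over : 𝕍 → 𝕍 → 𝕍 → Set₁
    Over A π σ = ∃[ θ ] V θ × IsPerm θ × Lft θ π × Ind θ σ × Fixes A θ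

    module _ {A π : 𝕍} (A𝓘 : A ∊ 𝓘₀) (π𝓖 : π ∊ 𝓖) (fixA : ∀ b → b ∊ A → ⟪ b , b ⟫ ∊ π) where
      private
        instance
          iA : Cst A
          iA = cst (V∊ V-𝓘₀ A𝓘)
          iπ : Cst π
          iπ = cst (V∊ (VT it) π𝓖)

      compatible : ∀ {p q} → p ∊ P → q ∊ P → p ⊂ q → ∃[ r ] r ∊ P × q ⊂ r × (∃[ σ ] σ ∊ H × Over A π σ × (∃[ p′ ] ⟪ p , p′ ⟫ ∊ σ × p′ ⊂ r))
      compatible {p} {q} pP qP p⊂q = go (translate T VT′ smT (λ i m → proj₁ (T⇒ m)))
        where
        instance
          iq : Cst q
          iq = cst (V∊ V-P qP)
        C : 𝕍 → Set₁
        C i = ∃[ c ] ∃[ b ] ⟪ c , b ⟫ ∊ q × (∃[ a ] ∃[ j ] c ≈ ⟪ a , j ⟫ × (∃[ m ] m ∊ D ∪ up D D × a ≈ ⟪ m , i ⟫))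
        opaque
          dC : D₁ C
          dC = it
        T : 𝕍
        T = sep (pow B) C ⦃ it ⦄ ⦃ dC ⦄
        VT′ : V T
        VT′ = Vsep
        T⇒ : ∀ {i} → i ∊ T → i ∊ I × C i
        T⇒ = ∊sep
        inT : ∀ {a j b m i} → ⟪ ⟪ a , j ⟫ , b ⟫ ∊ q → a ≈ ⟪ m , i ⟫ → i ∊ T
        inT s e = let (mD , iI) = ⊗e (∊l e (proj₁ (lit-dom qP s))) in
          sep-i iI (_ , _ , s , _ , _ , ≈refl , _ , mD , e)
        Rl : 𝕍 → 𝕍 → Set₁
        Rl l i = ∃[ c ] ∃[ b ] l ≈ ⟪ c , b ⟫ × (∃[ a ] ∃[ j ] c ≈ ⟪ a , j ⟫ × (∃[ m ] m ∊ D ∪ up D D × a ≈ ⟪ m , i ⟫))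
        opaque
          dRl : D₂ Rl
          dRl = it
        un : ∀ l i i′ → Rl l i → Rl l i′ → i ≈ i′
        un l i i′ (c , b , e , a , j , f , m , _ , g) (c₂ , b₂ , e₂ , a₂ , j₂ , f₂ , m₂ , _ , g₂) =
          let (x , _) = ⟪⟫-inj (≈trans (≈sym e) e₂) ; (y , _) = ⟪⟫-inj (≈trans (≈sym f) (≈trans x f₂)) in
          proj₂ (⟪⟫-inj (≈trans (≈sym g) (≈trans y g₂)))
        smT : Small T
        smT = small-img VT′ Rl dRl (proj₁ (proj₂ (P⇒ qP))) (λ l i i′ _ _ h h′ → un l i i′ h h′)
          (λ i m → let (_ , c , b , s , k) = T⇒ m in ⟪ c , b ⟫ , s , c , b , ≈refl , k)
        go : ∃[ i₀ ] i₀ ∊ I × (∀ i k → i ∊ T → SD i i₀ k → ¬ k ∊ T) →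
          ∃[ r ] r ∊ P × q ⊂ r × (∃[ σ ] σ ∊ H × Over A π σ × (∃[ p′ ] ⟪ p , p′ ⟫ ∊ σ × p′ ⊂ r))
        go (i₀ , iI₀ , away) = fin (Mv-tot L.per L.vθ pP)
          where
          module Sh = Shift A π i₀ A𝓘 π𝓖 iI₀ fixA
          module L = Lifted Sh.shift
          σ : 𝕍
          σ = ind Sh.θ L.vθ
          fin : ∃[ p′ ] p′ ∊ P × Mv Sh.θ p p′ → ∃[ r ] r ∊ P × q ⊂ r × (∃[ σ ] σ ∊ H × Over A π σ × (∃[ p′ ] ⟪ p , p′ ⟫ ∊ σ × p′ ⊂ r))
          fin (p′ , pP′ , mv) = q ∪ p′ , rP , (λ z → ∪l) , σ , L.indH ,
              (Sh.θ , L.vθ , perm⇐ L.per , L.over , ind-Ind Sh.θ L.vθ , Sh.fixes) ,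
              p′ , ind-i Sh.θ L.vθ pP pP′ mv , (λ z → ∪r)
            where
            clash : ∀ {c b b′} → ⟪ c , b ⟫ ∊ q → ⟪ c , b′ ⟫ ∊ p′ → b ≈ b′
            clash {c} {b} {b′} x y =
              let (a′ , j , b″ , aA , jI , bT , e) = lit⇒ pP′ y
                  (ce , be) = ⟪⟫-inj e
                  (a , r) = Perm.srj L.per aA
                  y₀ = proj₂ (mv a a′ r j jI b″ bT) (⟪⟫-resp ce be y)
                  x₀ = ⟪⟫-resp ce ≈refl x
              in [ (λ e′ → ≈trans (proj₂ (proj₂ (P⇒ qP)) ⟪ a′ , j ⟫ b x₀ b″ (⟪⟫-resp (⟪⟫-cong e′ ≈refl) ≈refl (p⊂q _ y₀))) (≈sym be)) ,
                   (λ (m , i , m′ , i′ , f , f′ , h) → ⊥-elim (away i i′ (inT (p⊂q _ y₀) f) h (inT x₀ f′))) ]′ (Sh.θ-cases r)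
            fn : ∀ c b → ⟪ c , b ⟫ ∊ q ∪ p′ → ∀ b′ → ⟪ c , b′ ⟫ ∊ q ∪ p′ → b ≈ b′
            fn c b m b′ m′ = f₁ (∊∪ m) (∊∪ m′)
              where
              f₁ : ⟪ c , b ⟫ ∊ q ⊎ ⟪ c , b ⟫ ∊ p′ → ⟪ c , b′ ⟫ ∊ q ⊎ ⟪ c , b′ ⟫ ∊ p′ → b ≈ b′
              f₁ (inj₁ x) (inj₁ y) = proj₂ (proj₂ (P⇒ qP)) c b x b′ y
              f₁ (inj₂ x) (inj₂ y) = proj₂ (proj₂ (P⇒ pP′)) c b x b′ y
              f₁ (inj₁ x) (inj₂ y) = clash x y
              f₁ (inj₂ x) (inj₁ y) = ≈sym (clash y x)
            rP : q ∪ p′ ∊ P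
            rP = P⇐ (VT (d∪ ⦃ it ⦄ ⦃ cst (V∊ V-P pP′) ⦄))
              (λ z m → [ proj₁ (P⇒ qP) z , proj₁ (P⇒ pP′) z ]′ (∊∪ m))
              (small-∪ (V∊ V-P qP) (V∊ V-P pP′) (proj₁ (proj₂ (P⇒ qP))) (proj₁ (proj₂ (P⇒ pP′)))) fn

      homogeneous : ∀ {G} → Gen G → ∀ {p} → p ∊ G →
        ∃[ θ ] ∃[ σ ] σ ∊ H × Lifted θ π × Ind θ σ × Fixes A θ × (∃[ p′ ] ⟪ p , p′ ⟫ ∊ σ × p′ ∊ G)
      homogeneous {G} g {p} pG = fin (dense-below U dU p pG λ q qP q≤p →
          let (r , rP , q⊂r , k) = compatible (sub pG) qP (≤⇒ q≤p) in r , rP , ≤⇐ rP qP q⊂r , k)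
        where
        open Gen g
        instance
          ip : Cst p
          ip = cst (V∊ V-P (sub pG))
        U : 𝕍 → Set₁
        U r = ∃[ σ ] σ ∊ H × Over A π σ × (∃[ p′ ] ⟪ p , p′ ⟫ ∊ σ × p′ ⊂ r)
        opaque
          dOver : D₁ (Over A π)
          dOver = dExV {R = λ θ ρ → IsPerm θ × Lft θ π × Ind θ (ρ zero) × Fixes A θ}
            ⦃ dAnd ⦃ app₁ {R = IsPerm} dIsPerm it ⦄ ⦃ dAnd ⦃ app₂ {R = Lft} dLft it it ⦄
              ⦃ dAnd ⦃ app₂ {R = Ind} dInd it it ⦄ ⦃ app₂ {R = Fixes} dFixes it it ⦄ ⦄ ⦄ ⦄
          dU : D₁ U
          dU = dBex {t = λ _ → H} {R = λ σ ρ → Over A π σ × (∃[ p′ ] ⟪ p , p′ ⟫ ∊ σ × p′ ⊂ ρ zero)} ⦃ it ⦄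
            ⦃ dAnd ⦃ app₁ {R = Over A π} dOver it ⦄ ⦃ it ⦄ ⦄
        fin : ∃[ r ] r ∊ G × U r → ∃[ θ ] ∃[ σ ] σ ∊ H × Lifted θ π × Ind θ σ × Fixes A θ × (∃[ p′ ] ⟪ p , p′ ⟫ ∊ σ × p′ ∊ G)
        fin (r , rG , σ , σH , (θ , v , pe , o , i , f) , p′ , m , s) =
          θ , σ , σH , record { vθ = v ; per = perm⇒ pe ; π𝓖 = π𝓖 ; over = o } , i , f , p′ , m ,
          (let pP′ = Perm.r∊ (permH σH) m in upw rG pP′ (≤⇐ (sub rG) pP′ s))

 open Homogeneous

 module StructureNames where
  private variable
    n : ℕ
    ℓ ℓ′ : Level
    s t u : Env n → 𝕍

  module Copy (L : Language) (M : Structure) (isM : IsStructureIn V L M) (𝓖 𝓘 X : 𝕍)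
    ⦃ _ : Cst (Structure.dom M) ⦄ ⦃ _ : Cst (Structure.rels M) ⦄ ⦃ _ : Cst (Structure.funs M) ⦄
    ⦃ _ : Cst 𝓖 ⦄ ⦃ _ : Cst 𝓘 ⦄ ⦃ _ : Cst X ⦄
    (aut : IsAutGroup L M 𝓖) (ideal : IsIdealIn V (Structure.dom M) 𝓘) where
    open Language L
    open Structure M renaming (dom to D)
    private
      module Aut = IsAutGroup aut
      module St = IsStructureIn isM
    open Homogeneity D 𝓖 𝓘 X Aut.group ideal public

    tup≡ : (xs : Vec 𝕍 n) → tup xs ≡ tuple xs
    tup≡ [] = refl
    tup≡ (x ∷ xs) = trans ⟪⟫≡ (cong (λ t → ⟨ x , t ⟩) (tup≡ xs))

    all∊ : ∀ {A} {xs : Vec 𝕍 n} → All (_∈ A) xs → All (_∊ A) xs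
    all∊ [] = []
    all∊ (p ∷ ps) = mem p ∷ all∊ ps

    all∈ : ∀ {A} {xs : Vec 𝕍 n} → All (_∊ A) xs → All (_∈ A) xs
    all∈ [] = []
    all∈ (p ∷ ps) = unmem p ∷ all∈ ps

    tup∈ : ∀ {x z} {xs : Vec 𝕍 n} → ⟪ x , tup xs ⟫ ∊ z → ⟨ x , tuple xs ⟩ ∈ z
    tup∈ {x = x} {z} {xs} m = subst (λ t → ⟨ x , t ⟩ ∈ z) (tup≡ xs) (out⟨ m)

    tup∊ : ∀ {x z} {xs : Vec 𝕍 n} → ⟨ x , tuple xs ⟩ ∈ z → ⟪ x , tup xs ⟫ ∊ z
    tup∊ {x = x} {z} {xs} m = in⟨ (subst (λ t → ⟨ x , t ⟩ ∈ z) (sym (tup≡ xs)) m)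

    tup²∊ : ∀ {x y z} {xs : Vec 𝕍 n} → ⟨ ⟨ x , tuple xs ⟩ , y ⟩ ∈ z → ⟪ ⟪ x , tup xs ⟫ , y ⟫ ∊ z
    tup²∊ {x = x} {y} {z} {xs} m = in⟨ (subst (λ t → ⟨ t , y ⟩ ∈ z) (sym (trans ⟪⟫≡ (cong (λ t → ⟨ x , t ⟩) (tup≡ xs)))) m)

    tup²∈ : ∀ {x y z} {xs : Vec 𝕍 n} → ⟪ ⟪ x , tup xs ⟫ , y ⟫ ∊ z → ⟨ ⟨ x , tuple xs ⟩ , y ⟩ ∈ z
    tup²∈ {x = x} {y} {z} {xs} m = subst (λ t → ⟨ t , y ⟩ ∈ z) (trans ⟪⟫≡ (cong (λ t → ⟨ x , t ⟩) (tup≡ xs))) (out⟨ m)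

    ≈tup : ∀ {x z} {xs : Vec 𝕍 n} → z ≐ ⟨ x , tuple xs ⟩ → z ≈ ⟪ x , tup xs ⟫
    ≈tup {x = x} {z} {xs} e = ≈⟨ (subst (λ t → z ≐ ⟨ x , t ⟩) (sym (tup≡ xs)) e)

    tup-tn : ∀ {n m} (xs : Vec 𝕍 n) (ys : Vec 𝕍 m) → tup xs ≈ tup ys → tn xs ≈ tn ys
    tup-tn [] [] e = ≈refl
    tup-tn [] (y ∷ ys) e = ⊥-elim (⟪⟫≉∅ (≈sym e))
    tup-tn (x ∷ xs) [] e = ⊥-elim (⟪⟫≉∅ e)
    tup-tn (x ∷ xs) (y ∷ ys) e = let (a , b) = ⟪⟫-inj e in op-cong (an-cong a) (tup-tn xs ys b)

    module _ (f : 𝕍 → 𝕍) where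
      tup-map : (∀ {x y} → x ≈ y → f x ≈ f y) → ∀ {n m} (xs : Vec 𝕍 n) (ys : Vec 𝕍 m) → tup xs ≈ tup ys → tup (map f xs) ≈ tup (map f ys)
      tup-map c [] [] e = ≈refl
      tup-map c [] (y ∷ ys) e = ⊥-elim (⟪⟫≉∅ (≈sym e))
      tup-map c (x ∷ xs) [] e = ⊥-elim (⟪⟫≉∅ e)
      tup-map c (x ∷ xs) (y ∷ ys) e = let (a , b) = ⟪⟫-inj e in ⟪⟫-cong (c a) (tup-map c xs ys b)

      tup-unmap : (∀ {x y} → x ∊ D → y ∊ D → f x ≈ f y → x ≈ y) → ∀ {n m} (xs : Vec 𝕍 n) (ys : Vec 𝕍 m) →
        All (_∊ D) xs → All (_∊ D) ys → tup (map f xs) ≈ tup (map f ys) → tup xs ≈ tup ys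
      tup-unmap c [] [] _ _ e = ≈refl
      tup-unmap c [] (y ∷ ys) _ _ e = ⊥-elim (⟪⟫≉∅ (≈sym e))
      tup-unmap c (x ∷ xs) [] _ _ e = ⊥-elim (⟪⟫≉∅ e)
      tup-unmap c (x ∷ xs) (y ∷ ys) (p ∷ ps) (q ∷ qs) e =
        let (a , b) = ⟪⟫-inj e in ⟪⟫-cong (c p q a) (tup-unmap c xs ys ps qs b)

    tup-all : ∀ {A n m} (xs : Vec 𝕍 n) (ys : Vec 𝕍 m) → All (_∊ A) ys → tup xs ≈ tup ys → All (_∊ A) xs
    tup-all [] ys h e = []
    tup-all (x ∷ xs) [] h e = ⊥-elim (⟪⟫≉∅ e)
    tup-all (x ∷ xs) (y ∷ ys) (q ∷ qs) e = let (a , b) = ⟪⟫-inj e in ∊l (≈sym a) q ∷ tup-all xs ys qs b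

    module _ {π : 𝕍} (π𝓖 : π ∊ 𝓖) where
      private module π = Perm (perm𝓖 π𝓖)

      push : (xs : Vec 𝕍 n) → All (_∊ D) xs → Σ[ ys ∈ Vec 𝕍 n ] Pointwise (λ x y → ⟪ x , y ⟫ ∊ π) xs ys × All (_∊ D) ys
      push [] [] = [] , [] , []
      push (x ∷ xs) (p ∷ ps) = let (y , r) = π.tot p ; (ys , rs , qs) = push xs ps in y ∷ ys , r ∷ rs , π.r∊ r ∷ qs

      pop : (ys : Vec 𝕍 n) → All (_∊ D) ys → Σ[ xs ∈ Vec 𝕍 n ] Pointwise (λ x y → ⟪ x , y ⟫ ∊ π) xs ys × All (_∊ D) xs
      pop [] [] = [] , [] , []
      pop (x ∷ xs) (p ∷ ps) = let (y , r) = π.srj p ; (ys , rs , qs) = pop xs ps in y ∷ ys , r ∷ rs , π.l∊ r ∷ qs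

      rng : {xs ys : Vec 𝕍 n} → Pointwise (λ x y → ⟪ x , y ⟫ ∊ π) xs ys → All (_∊ D) xs × All (_∊ D) ys
      rng [] = [] , []
      rng (r ∷ rs) = let (a , b) = rng rs in π.l∊ r ∷ a , π.r∊ r ∷ b

      maps∈ : {xs ys : Vec 𝕍 n} → Pointwise (λ x y → ⟪ x , y ⟫ ∊ π) xs ys → Maps π xs ys
      maps∈ [] = []
      maps∈ (r ∷ rs) = out⟨ r ∷ maps∈ rs

      rel-inv : ∀ {R} {xs ys : Vec 𝕍 n} → ⟨ R , num n ⟩ ∈ arRel → Pointwise (λ x y → ⟪ x , y ⟫ ∊ π) xs ys →
        ⟪ R , tup xs ⟫ ∊ rels ⟺ ⟪ R , tup ys ⟫ ∊ rels
      rel-inv {R = R} {xs} {ys} ar p = let (f , g) = of⇔ (IsIso.relations (Aut.automorphisms π (unmem π𝓖)) _ R xs ys ar (maps∈ p)) in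
        (λ m → tup∊ {xs = ys} (f (tup∈ {xs = xs} m))) , (λ m → tup∊ {xs = xs} (g (tup∈ {xs = ys} m)))

      fun-inv : ∀ {R x y} {xs ys : Vec 𝕍 n} → ⟨ R , num n ⟩ ∈ arFun → Pointwise (λ x y → ⟪ x , y ⟫ ∊ π) xs ys → ⟪ x , y ⟫ ∊ π →
        ⟪ ⟪ R , tup xs ⟫ , x ⟫ ∊ funs → ⟪ ⟪ R , tup ys ⟫ , y ⟫ ∊ funs
      fun-inv {R = R} {x} {y} {xs} {ys} ar p q m = tup²∊ {xs = ys}
        (IsIso.functions (Aut.automorphisms π (unmem π𝓖)) _ R xs ys x y ar (maps∈ p) (out⟨ q) (tup²∈ {xs = xs} m))

    inverse𝓖 : ∀ {π} → π ∊ 𝓖 → ∃[ ρ ] ρ ∊ 𝓖 × (∀ x y → ⟪ x , y ⟫ ∊ ρ ⟺ ⟪ y , x ⟫ ∊ π)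
    inverse𝓖 {π} m = let (ρ , r , h) = IsPermGroup.inverses Aut.group π (unmem m) in ρ , mem r , λ x y →
      let (f , g) = of⇔ (h x y) in (λ q → in⟨ (f (out⟨ q))) , (λ q → in⟨ (g (out⟨ q)))

    flip-all : ∀ {π ρ} → (∀ x y → ⟪ x , y ⟫ ∊ ρ ⟺ ⟪ y , x ⟫ ∊ π) → {xs ys : Vec 𝕍 n} →
      Pointwise (λ x y → ⟪ x , y ⟫ ∊ π) xs ys → Pointwise (λ x y → ⟪ x , y ⟫ ∊ ρ) ys xs
    flip-all h [] = []
    flip-all h (r ∷ rs) = proj₂ (h _ _) r ∷ flip-all h rs

    -- TN = { ⟨ tuple xs , name of the tuple of the ȧₓ ⟩ ∣ xs ∈ D^{<ω} }
    private
      Γ : 𝕍 → 𝕍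
      Γ c = sup (Σ[ i ∈ idx D ] Σ[ j ∈ idx (⋃ (⋃ c)) ] Σ[ k ∈ idx (⋃ (⋃ c)) ] ⟪ elt (⋃ (⋃ c)) j , elt (⋃ (⋃ c)) k ⟫ ∊ c)
        λ (i , j , k , _) → ⟪ ⟪ elt D i , elt (⋃ (⋃ c)) j ⟫ , op (an (elt D i)) (elt (⋃ (⋃ c)) k) ⟫

      ΓC : 𝕍 → 𝕍 → Set₁
      ΓC z c = ∃[ m ] m ∊ D × (∃[ t ] ∃[ u ] ⟪ t , u ⟫ ∊ c × z ≈ ⟪ ⟪ m , t ⟫ , op (an m) u ⟫)

      ∊Γ : ∀ {z c} → z ∊ Γ c → ΓC z c
      ∊Γ {c = c} (mem ((i , j , k , m) , e)) = elt D i , elt∊ D i , elt (⋃ (⋃ c)) j , elt (⋃ (⋃ c)) k , m , eq e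

      fld-l : ∀ {x y z} → ⟪ x , y ⟫ ∊ z → x ∊ ⋃ (⋃ z)
      fld-l m = ⋃i (⋃i m ⟪⟫∋) (upl ≈refl)

      fld-r : ∀ {x y z} → ⟪ x , y ⟫ ∊ z → y ∊ ⋃ (⋃ z)
      fld-r m = ⋃i (⋃i m ⟪⟫∋) (upr ≈refl)

      Γ-i : ∀ {z c} → ΓC z c → z ∊ Γ c
      Γ-i (m , mD , t , u , q , e) = let (i , ei) = ∊idx mD ; (j , ej) = ∊idx (fld-l q) ; (k , ek) = ∊idx (fld-r q) in
        idx∊ (i , j , k , ⟪⟫-resp ej ek q) (≈trans e (⟪⟫-cong (⟪⟫-cong ei ej) (op-cong (an-cong ei) ek)))

      Γr : ∀ {x y} → x ≈ y → Γ x ≈ Γ y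
      Γr e = ≈ext (half e) (half (≈sym e))
        where
        half : ∀ {x y} → x ≈ y → Γ x ⊂ Γ y
        half e z q = let (m , mD , t , u , r , f) = ∊Γ q in Γ-i (m , mD , t , u , ∊r e r , f)

      opaque
        dΓC : D₂ ΓC
        dΓC = it

      img-resp : ∀ {a} {f g : 𝕍 → 𝕍} → (∀ x → f x ≈ g x) → (∀ {x y} → x ≈ y → g x ≈ g y) → img a f ⊂ img a g
      img-resp h c z m = let (x , p , e) = ∊img m in img-i (λ _ _ → c) p (≈trans e (h x))

      img²-i : ∀ {a b x y} (f : 𝕍 → 𝕍 → 𝕍) → (∀ {x y x′ y′} → x ≈ x′ → y ≈ y′ → f x y ≈ f x′ y′) →
        x ∊ a → y ∊ b → f x y ∊ ⋃ (img a λ x → img b λ y → f x y)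
      img²-i {a} {b} {x} f c p q = ⋃i (img-i {t = λ x → img b λ y → f x y}
          (λ _ _ e → ≈ext (img-resp (λ y → c e ≈refl) (c ≈refl)) (img-resp (λ y → c (≈sym e) ≈refl) (c ≈refl))) p ≈refl)
        (img-i {t = f x} (λ _ _ e → c ≈refl e) q ≈refl)

      V-Γ : ∀ {c} → V c → V (Γ c)
      V-Γ {c} vc = V≈ (≈ext (λ z q → Γ-i (proj₂ (∊sep {A = dBig} {dG} q)))
                            (λ z q → sep-i (inBig (∊Γ q)) (∊Γ q))) Vsep
        where
        instance
          ic : Cst c
          ic = cst vc
        big : 𝕍
        big = (D ⊗ ⋃ (⋃ c)) ⊗ ⋃ (img D λ m → img (⋃ (⋃ c)) λ u → op (an m) u)
        opaque
          dBig : T₀ big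
          dBig = it
        dG : D₁ (λ z → ΓC z c)
        dG = app₂ {R = ΓC} dΓC it it
        inBig : ∀ {z} → ΓC z c → z ∊ big
        inBig (m , mD , t , u , q , e) = ∊l (≈sym e) (⊗i (⊗i mD (fld-l q))
          (img²-i (λ m u → op (an m) u) (λ e f → op-cong (an-cong e) f) mD (fld-r q)))

      opaque
        dΓ : T₁ Γ
        dΓ = mkT (λ c vc → V-Γ (vc zero)) (dMap (λ _ _ → Γ-i , ∊Γ) dΓC)

      module C = Closure (up ⟪ ∅ , ∅ ⟫ ⟪ ∅ , ∅ ⟫) Γ Γr dΓ

    opaque
      TN : 𝕍
      TN = C.closure
      V-TN : V TN
      V-TN = C.V-closure

      TN⇒′ : ∀ {z} → z ∊ TN → Σ[ n ∈ ℕ ] Σ[ xs ∈ Vec 𝕍 n ] All (_∊ D) xs × z ≈ ⟪ tup xs , tn xs ⟫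
      TN⇒′ {z} = C.closure-ind (λ z → Σ[ n ∈ ℕ ] Σ[ xs ∈ Vec 𝕍 n ] All (_∊ D) xs × z ≈ ⟪ tup xs , tn xs ⟫)
        (λ z q → 0 , [] , [] , ∊sing q)
        (λ c ih z q → let (m , mD , t , u , r , e) = ∊Γ q ; (n , xs , h , e′) = ih _ r ; (a , b) = ⟪⟫-inj e′ in
           suc n , m ∷ xs , mD ∷ h , ≈trans e (⟪⟫-cong (⟪⟫-cong ≈refl a) (op-cong ≈refl b))) z

      TN⇐ : (xs : Vec 𝕍 n) → All (_∊ D) xs → ⟪ tup xs , tn xs ⟫ ∊ TN
      TN⇐ {n} xs h = C.stage⊂ n _ (go xs h)
        where
        go : ∀ {n} (xs : Vec 𝕍 n) → All (_∊ D) xs → ⟪ tup xs , tn xs ⟫ ∊ C.stage n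
        go [] [] = C.base⊂stage 0 _ (upl ≈refl)
        go {suc n} (x ∷ xs) (p ∷ ps) = C.Γ-stage n _ (Γ-i (x , p , tup xs , tn xs , go xs ps , ≈refl))

    instance
      iTN : Cst TN
      iTN = cst V-TN

    TN⇒ : ∀ {t u} → ⟪ t , u ⟫ ∊ TN → Σ[ n ∈ ℕ ] Σ[ xs ∈ Vec 𝕍 n ] All (_∊ D) xs × t ≈ tup xs × u ≈ tn xs
    TN⇒ m = let (n , xs , h , e) = TN⇒′ m ; (a , b) = ⟪⟫-inj e in n , xs , h , a , b

    private
      RC FC : 𝕍 → Set₁
      RC w = ∃[ r ] ∃[ t ] ⟪ r , t ⟫ ∊ rels × (∃[ u ] ⟪ t , u ⟫ ∊ TN × w ≈ op (chk r) u)
      FC w = ∃[ gt ] ∃[ y ] ⟪ gt , y ⟫ ∊ funs × y ∊ D × (∃[ g ] ∃[ t ] gt ≈ ⟪ g , t ⟫ × (∃[ u ] ⟪ t , u ⟫ ∊ TN × w ≈ op (op (chk g) u) (an y)))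

      opaque
        dRC : D₁ RC
        dRC = it
        dFC : D₁ FC
        dFC = it

      RB FB₁ FB : 𝕍
      RB = ⋃ (img (⋃ (⋃ rels)) λ r → img (⋃ (⋃ TN)) λ u → op (chk r) u)
      FB₁ = ⋃ (img (⋃ (⋃ (⋃ (⋃ funs)))) λ g → img (⋃ (⋃ TN)) λ u → op (chk g) u)
      FB = ⋃ (img FB₁ λ z → img D λ y → op z (an y))

      opaque
        dRB : T₀ RB
        dRB = it
        dFB : T₀ FB
        dFB = it

    opaque
      RS FS : 𝕍
      RS = sep RB RC ⦃ dRB ⦄ ⦃ dRC ⦄
      FS = sep FB FC ⦃ dFB ⦄ ⦃ dFC ⦄
      V-RS : V RS
      V-RS = Vsep
      V-FS : V FS
      V-FS = Vsep

      private
        RS⇒′ : ∀ {w} → w ∊ RS → RC w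
        RS⇒′ m = proj₂ (∊sep m)
        RS⇐′ : ∀ {w} → RC w → w ∊ RS
        RS⇐′ (r , t , m , u , q , e) = sep-i
          (∊l (≈sym e) (img²-i (λ r u → op (chk r) u) (λ e f → op-cong (chk-cong e) f) (fld-l m) (fld-r q))) (r , t , m , u , q , e)
        FS⇒′ : ∀ {w} → w ∊ FS → FC w
        FS⇒′ m = proj₂ (∊sep m)
        FS⇐′ : ∀ {w} → FC w → w ∊ FS
        FS⇐′ (gt , y , m , yD , g , t , e , u , q , f) = sep-i
          (∊l (≈sym f) (img²-i (λ z y → op z (an y)) (λ e f → op-cong e (an-cong f))
            (img²-i (λ r u → op (chk r) u) (λ e f → op-cong (chk-cong e) f) (fld-l (∊l e (fld-l m))) (fld-r q)) yD))
          (gt , y , m , yD , g , t , e , u , q , f)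

    record RelAt (n : ℕ) (r : 𝕍) (xs : Vec 𝕍 n) : Set₁ where
      field
        ar  : ⟨ r , num n ⟩ ∈ arRel
        xsD : All (_∊ D) xs
        hld : ⟪ r , tup xs ⟫ ∊ rels

    record FunAt (n : ℕ) (g : 𝕍) (xs : Vec 𝕍 n) (y : 𝕍) : Set₁ where
      field
        ar  : ⟨ g , num n ⟩ ∈ arFun
        xsD : All (_∊ D) xs
        yD  : y ∊ D
        hld : ⟪ ⟪ g , tup xs ⟫ , y ⟫ ∊ funs

    relAt : ∀ {z} → z ∊ rels → Σ[ n ∈ ℕ ] ∃[ r ] Σ[ xs ∈ Vec 𝕍 n ] RelAt n r xs × z ≈ ⟪ r , tup xs ⟫
    relAt {z} m = let (n , r , xs , ar , h , e) = St.rels-graph z (unmem m) ; e′ = ≈tup {xs = xs} e in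
      n , r , xs , record { ar = ar ; xsD = all∊ h ; hld = ∊l e′ m } , e′

    funAt : ∀ {z} → z ∊ funs → Σ[ n ∈ ℕ ] ∃[ g ] Σ[ xs ∈ Vec 𝕍 n ] ∃[ y ] FunAt n g xs y × z ≈ ⟪ ⟪ g , tup xs ⟫ , y ⟫
    funAt {z} m = let (n , g , xs , y , ar , h , yD , e) = St.funs-graph z (unmem m)
                      e′ = ≈⟨ (subst (λ t → z ≐ ⟨ t , y ⟩) (sym (trans ⟪⟫≡ (cong (λ t → ⟨ g , t ⟩) (tup≡ xs)))) e) in
      n , g , xs , y , record { ar = ar ; xsD = all∊ h ; yD = mem yD ; hld = ∊l e′ m } , e′

    RS⇒ : ∀ {w} → w ∊ RS → Σ[ n ∈ ℕ ] ∃[ r ] Σ[ xs ∈ Vec 𝕍 n ] RelAt n r xs × w ≈ op (chk r) (tn xs)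
    RS⇒ m = let (r , t , q , u , p , e) = RS⇒′ m
                (_ , ys , _ , e₁ , e₂) = TN⇒ p
                (n , r′ , xs , h , e₃) = relAt q
                (a , b) = ⟪⟫-inj e₃
            in n , r′ , xs , h , ≈trans e (op-cong (chk-cong a) (≈trans e₂ (tup-tn ys xs (≈trans (≈sym e₁) b))))

    RS⇐ : ∀ {r} {xs : Vec 𝕍 n} → RelAt n r xs → op (chk r) (tn xs) ∊ RS
    RS⇐ {r = r} {xs} h = RS⇐′ (r , tup xs , RelAt.hld h , tn xs , TN⇐ xs (RelAt.xsD h) , ≈refl)

    FS⇒ : ∀ {w} → w ∊ FS → Σ[ n ∈ ℕ ] ∃[ g ] Σ[ xs ∈ Vec 𝕍 n ] ∃[ y ] FunAt n g xs y × w ≈ op (op (chk g) (tn xs)) (an y)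
    FS⇒ m = let (gt , y , q , _ , g , t , e₀ , u , p , e) = FS⇒′ m
                (_ , ys , _ , e₁ , e₂) = TN⇒ p
                (n , g′ , xs , y′ , h , e₃) = funAt q
                (a , b) = ⟪⟫-inj e₃
                (c , d) = ⟪⟫-inj (≈trans (≈sym e₀) a)
            in n , g′ , xs , y′ , h , ≈trans e (op-cong (op-cong (chk-cong c) (≈trans e₂ (tup-tn ys xs (≈trans (≈sym e₁) d)))) (an-cong b))

    FS⇐ : ∀ {g y} {xs : Vec 𝕍 n} → FunAt n g xs y → op (op (chk g) (tn xs)) (an y) ∊ FS
    FS⇐ {g = g} {y} {xs} h = FS⇐′ (_ , y , FunAt.hld h , FunAt.yD h , g , tup xs , ≈refl , tn xs , TN⇐ xs (FunAt.xsD h) , ≈refl)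

    private
      dotHS : ∀ {a} → V a → (∀ x → x ∊ a → IsName P x × HS x) →
        (∀ {θ π σ} → Lifted θ π → Ind θ σ → σ ∊ H → (∀ x → x ∊ a → Act P σ x ∊ a) × (∀ y → y ∊ a → ∃[ x ] x ∊ a × Act P σ x ≈ y)) →
        V (dot a) × IsName P (dot a) × HS (dot a)
      dotHS {a} va h s = vd , nd , hs-dot (sym-intro vd nd KF λ σ m →
            let (σH , l) = k σ m ; (θ , π , L , i , _) = lifted l ; (f , g) = s L i σH in act-dot σH f g)
          (λ x q → proj₂ (h x q))
        where
        instance
          ia : Cst a
          ia = cst va
        vd : V (dot a)
        vd = VT it
        nd : IsName P (dot a)
        nd = name-dot λ x q → proj₁ (h x q)
        K = proj₁ (fixing ∅ 𝓘₀-∅)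
        KF : K ∊ F
        KF = proj₁ (proj₂ (fixing ∅ 𝓘₀-∅))
        k : ∀ σ → σ ∊ K → σ ∊ H × Lifts ∅ σ
        k = proj₂ (proj₂ (fixing ∅ 𝓘₀-∅))

    an-i : ∀ {m} → m ∊ D → an m ∊ img D an
    an-i m = img-i {t = an} (λ _ _ → an-cong) m ≈refl

    opaque
      domHS : V (dot (img D an)) × IsName P (dot (img D an)) × HS (dot (img D an))
      domHS = dotHS (VT it)
        (λ x q → let (m , mD , e) = ∊img q in name-cong (≈sym e) (name-an mD) , hs-cong (≈sym e) (hs-an mD))
        (λ L i σH → (λ x q → let (m , mD , e) = ∊img q ; (m′ , r) = Perm.tot (perm𝓖 (Lifted.π𝓖 L)) mD in
                       ∊l (≈sym (≈trans (act-cong e) (act-an L i σH r))) (an-i (Perm.r∊ (perm𝓖 (Lifted.π𝓖 L)) r))) ,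
                    (λ y q → let (m′ , mD , e) = ∊img q ; (m , r) = Perm.srj (perm𝓖 (Lifted.π𝓖 L)) mD in
                       an m , an-i (Perm.l∊ (perm𝓖 (Lifted.π𝓖 L)) r) , ≈trans (act-an L i σH r) (≈sym e)))

      opHS : ∀ {r} (xs : Vec 𝕍 n) → V r → All (_∊ D) xs → V (op (chk r) (tn xs)) × IsName P (op (chk r) (tn xs)) × HS (op (chk r) (tn xs))
        × (∃[ A ] A ∊ 𝓘₀ × (∀ σ → σ ∊ H → Lifts A σ → Act P σ (op (chk r) (tn xs)) ≈ op (chk r) (tn xs)))
      opHS {r = r} xs vr h = let (A , a , f , k) = sup-tn xs h ; (K , KF , q) = fixing A a in
          VT (dOp ⦃ cst (V-chk vr) ⦄ ⦃ cst (V-tn xs h) ⦄) , name-op (name-chk r) (name-tn xs h) ,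
          hs-op (V-chk vr) (V-tn xs h) (name-chk r) (name-tn xs h) (hs-chk r vr) k KF
            (λ σ m → let (σH , l) = q σ m in act-chk σH r , f σ σH l) ,
          A , a , λ σ σH l → ≈trans (act-op σH) (op-cong (act-chk σH r) (f σ σH l))

      relsHS : V (dot RS) × IsName P (dot RS) × HS (dot RS)
      relsHS = dotHS V-RS
        (λ x q → let (n , r , xs , h , e) = RS⇒ q
                     (_ , b , c , _) = opHS xs (V⟨l (V∊ (VT it) (RelAt.hld h))) (RelAt.xsD h) in name-cong (≈sym e) b , hs-cong (≈sym e) c)
        (λ L i σH →
          (λ x q → let (n , r , xs , h , e) = RS⇒ q ; (ys , ps , ysD) = push (Lifted.π𝓖 L) xs (RelAt.xsD h) in
             ∊l (≈sym (≈trans (act-cong e) (≈trans (act-op σH) (op-cong (act-chk σH r) (act-tn L i σH ps)))))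
               (RS⇐ {xs = ys} (record { ar = RelAt.ar h ; xsD = ysD ; hld = proj₁ (rel-inv (Lifted.π𝓖 L) {xs = xs} {ys = ys} (RelAt.ar h) ps) (RelAt.hld h) }))) ,
          (λ y q → let (n , r , ys , h , e) = RS⇒ q ; (xs , ps , xsD) = pop (Lifted.π𝓖 L) ys (RelAt.xsD h) in
             op (chk r) (tn xs) ,
             RS⇐ {xs = xs} (record { ar = RelAt.ar h ; xsD = xsD ; hld = proj₂ (rel-inv (Lifted.π𝓖 L) {xs = xs} {ys = ys} (RelAt.ar h) ps) (RelAt.hld h) }) ,
             ≈trans (act-op σH) (≈trans (op-cong (act-chk σH r) (act-tn L i σH ps)) (≈sym e))))

      funsHS : V (dot FS) × IsName P (dot FS) × HS (dot FS)
      funsHS = dotHS V-FS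
        (λ x q → let (n , g , xs , y , h , e) = FS⇒ q
                     (a , b , c , A , aI , f) = opHS {r = g} xs (V⟨l (V⟨l (V∊ (VT it) (FunAt.hld h)))) (FunAt.xsD h)
                     (C , cI , s , s′) = 𝓘₀-∪ aI (𝓘₀-sing (FunAt.yD h))
                     (K , KF , k) = fixing C cI
                 in name-cong (≈sym e) (name-op b (name-an (FunAt.yD h))) ,
                    hs-cong (≈sym e) (hs-op a (V-an (FunAt.yD h)) b (name-an (FunAt.yD h)) c (hs-an (FunAt.yD h)) KF
                      (λ σ m → let (σH , l) = k σ m in f σ σH (weak s l) , fix-an (𝓘₀⊂ cI) σH l (s′ _ (upl ≈refl)))))
        (λ L i σH →
          (λ x q → let (n , g , xs , y , h , e) = FS⇒ q ; (ys , ps , ysD) = push (Lifted.π𝓖 L) xs (FunAt.xsD h)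
                       (y′ , r) = Perm.tot (perm𝓖 (Lifted.π𝓖 L)) (FunAt.yD h) in
             ∊l (≈sym (≈trans (act-cong e) (≈trans (act-op σH) (op-cong (≈trans (act-op σH) (op-cong (act-chk σH g) (act-tn L i σH ps))) (act-an L i σH r)))))
               (FS⇐ {xs = ys} (record { ar = FunAt.ar h ; xsD = ysD ; yD = Perm.r∊ (perm𝓖 (Lifted.π𝓖 L)) r ; hld = fun-inv (Lifted.π𝓖 L) {xs = xs} {ys = ys} (FunAt.ar h) ps r (FunAt.hld h) }))) ,
          (λ z q → let (n , g , ys , y , h , e) = FS⇒ q ; (xs , ps , xsD) = pop (Lifted.π𝓖 L) ys (FunAt.xsD h)
                       (x , r) = Perm.srj (perm𝓖 (Lifted.π𝓖 L)) (FunAt.yD h)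
                       (ρ , ρ𝓖 , iv) = inverse𝓖 (Lifted.π𝓖 L) in
             op (op (chk g) (tn xs)) (an x) ,
             FS⇐ {xs = xs} (record { ar = FunAt.ar h ; xsD = xsD ; yD = Perm.l∊ (perm𝓖 (Lifted.π𝓖 L)) r ; hld = fun-inv ρ𝓖 {xs = ys} {ys = xs} (FunAt.ar h) (flip-all iv ps) (proj₂ (iv _ _) r) (FunAt.hld h) }) ,
             ≈trans (act-op σH) (≈trans (op-cong (≈trans (act-op σH) (op-cong (act-chk σH g) (act-tn L i σH ps))) (act-an L i σH r)) (≈sym e))))
        where
        weak : ∀ {A C σ} → A ⊂ C → Lifts C σ → Lifts A σ
        weak s (θ , v , π , p , q , o , i , f) = θ , v , π , p , q , o , i , λ m mA → f m (s m mA)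

 open StructureNames

 module SymmetricCopies where
  private variable
    n : ℕ
    ℓ ℓ′ : Level
    s t u : Env n → 𝕍

  module CopyTheorem (L : Language) (M : Structure) (isM : IsStructureIn V L M) (𝓖 𝓘 X : 𝕍)
    ⦃ _ : Cst (Structure.dom M) ⦄ ⦃ _ : Cst (Structure.rels M) ⦄ ⦃ _ : Cst (Structure.funs M) ⦄
    ⦃ _ : Cst 𝓖 ⦄ ⦃ _ : Cst 𝓘 ⦄ ⦃ _ : Cst X ⦄
    (aut : IsAutGroup L M 𝓖) (ideal : IsIdealIn V (Structure.dom M) 𝓘) where
    open Language L
    open Structure M renaming (dom to D)
    private
      module Aut = IsAutGroup aut
      module St = IsStructureIn isM
      module Id = IsIdealIn ideal
    open Copy L M isM 𝓖 𝓘 X aut ideal public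

    W V[G] : 𝕍 → Class
    W = SymmetricExtension V S
    V[G] = GenericExtension V S

    module _ {G : 𝕍} (g : Gen G) where
      open Gen g
      open Values g

      inW : ∀ {x y} → V x × IsName P x × HS x → y ≈ Val G x → W G y
      inW {x} (v , n , h) e = x , v , n , h , unVal e

      dN rN fN : 𝕍
      dN = Val G (dot (img D an))
      rN = Val G (dot RS)
      fN = Val G (dot FS)

      private
        N : Structure
        N = record { dom = dN ; rels = rN ; funs = fN }

      ∊dN : ∀ {y} → y ∊ dN → ∃[ m ] m ∊ D × y ≈ av m
      ∊dN q = let (x , p , e) = ∊val-dot 𝟙G q ; (m , mD , e′) = ∊img p in m , mD , ≈trans e (val-cong e′)

      dN-i : ∀ {m} → m ∊ D → av m ∊ dN
      dN-i mD = val-dot-i 𝟙G (an-i mD) ≈refl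

      val-opt : ∀ {r} (xs : Vec 𝕍 n) → Val G (op (chk r) (tn xs)) ≈ ⟪ r , tup (map av xs) ⟫
      val-opt {r = r} xs = ≈trans (val-op 𝟙G) (⟪⟫-cong (val-chk 𝟙G r) (val-tn xs))

      ∊rN : ∀ {z} → z ∊ rN → Σ[ n ∈ ℕ ] ∃[ r ] Σ[ xs ∈ Vec 𝕍 n ] RelAt n r xs × z ≈ ⟪ r , tup (map av xs) ⟫
      ∊rN q = let (x , p , e) = ∊val-dot 𝟙G q ; (n , r , xs , h , e′) = RS⇒ p in
        n , r , xs , h , ≈trans e (≈trans (val-cong e′) (val-opt xs))

      rN-i : ∀ {r} {xs : Vec 𝕍 n} → RelAt n r xs → ⟪ r , tup (map av xs) ⟫ ∊ rN
      rN-i {xs = xs} h = val-dot-i 𝟙G (RS⇐ {xs = xs} h) (≈sym (val-opt xs))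

      ∊fN : ∀ {z} → z ∊ fN → Σ[ n ∈ ℕ ] ∃[ f ] Σ[ xs ∈ Vec 𝕍 n ] ∃[ y ] FunAt n f xs y × z ≈ ⟪ ⟪ f , tup (map av xs) ⟫ , av y ⟫
      ∊fN q = let (x , p , e) = ∊val-dot 𝟙G q ; (n , f , xs , y , h , e′) = FS⇒ p in
        n , f , xs , y , h , ≈trans e (≈trans (val-cong e′) (≈trans (val-op 𝟙G) (⟪⟫-cong (val-opt xs) ≈refl)))

      fN-i : ∀ {f y} {xs : Vec 𝕍 n} → FunAt n f xs y → ⟪ ⟪ f , tup (map av xs) ⟫ , av y ⟫ ∊ fN
      fN-i {xs = xs} h = val-dot-i 𝟙G (FS⇐ {xs = xs} h) (≈sym (≈trans (val-op 𝟙G) (⟪⟫-cong (val-opt xs) ≈refl)))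

      map-av : {xs : Vec 𝕍 n} → All (_∊ D) xs → All (_∊ dN) (map av xs)
      map-av [] = []
      map-av (p ∷ ps) = dN-i p ∷ map-av ps

      unav : {ys : Vec 𝕍 n} → All (_∊ dN) ys → Σ[ xs ∈ Vec 𝕍 n ] All (_∊ D) xs × Pointwise (λ y x → y ≈ av x) ys xs
      unav [] = [] , [] , []
      unav (q ∷ qs) = let (m , mD , e) = ∊dN q ; (xs , h , es) = unav qs in m ∷ xs , mD ∷ h , e ∷ es

      tup-pw : {ys xs : Vec 𝕍 n} → Pointwise (λ y x → y ≈ av x) ys xs → tup ys ≈ tup (map av xs)
      tup-pw [] = ≈refl
      tup-pw (e ∷ es) = ⟪⟫-cong e (tup-pw es)

      tup-av : ∀ {n m} (xs : Vec 𝕍 n) (ys : Vec 𝕍 m) → tup xs ≈ tup ys → tup (map av xs) ≈ tup (map av ys)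
      tup-av = tup-map av av-cong

      tup-av⁻ : ∀ {n m} (xs : Vec 𝕍 n) (ys : Vec 𝕍 m) → All (_∊ D) xs → All (_∊ D) ys →
        tup (map av xs) ≈ tup (map av ys) → tup xs ≈ tup ys
      tup-av⁻ = tup-unmap av av-inj

      eqtup : ∀ {x z} {xs : Vec 𝕍 n} → z ≈ ⟪ x , tup xs ⟫ → z ≐ ⟨ x , tuple xs ⟩
      eqtup {x = x} {z} {xs} e = subst (λ t → z ≐ ⟨ x , t ⟩) (tup≡ xs) (≐⟨ e)

      eqtup² : ∀ {x y z} {xs : Vec 𝕍 n} → z ≈ ⟪ ⟪ x , tup xs ⟫ , y ⟫ → z ≐ ⟨ ⟨ x , tuple xs ⟩ , y ⟩
      eqtup² {x = x} {y} {z} {xs} e = subst (λ t → z ≐ ⟨ t , y ⟩) (trans ⟪⟫≡ (cong (λ t → ⟨ x , t ⟩) (tup≡ xs))) (≐⟨ e)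

      opaque
        isN : IsStructureIn (W G) L N
        isN = record
          { dom∈ = inW domHS ≈refl
          ; rels∈ = inW relsHS ≈refl
          ; funs∈ = inW funsHS ≈refl
          ; rels-graph = λ z m → let (n , r , xs , h , e) = ∊rN (mem m) in
              n , r , map av xs , RelAt.ar h , all∈ (map-av (RelAt.xsD h)) , eqtup {xs = map av xs} e
          ; funs-graph = λ z m → let (n , f , xs , y , h , e) = ∊fN (mem m) in
              n , f , map av xs , av y , FunAt.ar h , all∈ (map-av (FunAt.xsD h)) , unmem (dN-i (FunAt.yD h)) , eqtup² {xs = map av xs} e
          ; funs-total = λ n f ys ar h → let (xs , xsD , es) = unav (all∊ h)
                                             (y , m) = St.funs-total n f xs ar (all∈ xsD)
                                             yD = fun-yD (tup²∊ {xs = xs} m)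
                                             k = fN-i {xs = xs} record { ar = ar ; xsD = xsD ; yD = yD ; hld = tup²∊ {xs = xs} m } in
              av y , tup²∈ {xs = ys} (⟪⟫-resp (⟪⟫-cong ≈refl (≈sym (tup-pw es))) ≈refl k)
          ; funs-single-valued = λ w y y′ m m′ → let (n , f , xs , u , h , e) = ∊fN (in⟨ m) ; (n′ , f′ , xs′ , u′ , h′ , e′) = ∊fN (in⟨ m′)
                                                     (a , b) = ⟪⟫-inj e ; (a′ , b′) = ⟪⟫-inj e′
                                                     (c , d) = ⟪⟫-inj (≈trans (≈sym a) a′)
                                                     t≈ = tup-av⁻ xs xs′ (FunAt.xsD h) (FunAt.xsD h′) d
                                                     u≈ = eq (St.funs-single-valued _ u u′ (out⟨ (FunAt.hld h)) (out⟨ (⟪⟫-resp (⟪⟫-cong (≈sym c) (≈sym t≈)) ≈refl (FunAt.hld h′)))) in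
              uneq (≈trans b (≈trans (av-cong u≈) (≈sym b′))) }
          where
          fun-yD : ∀ {w y} → ⟪ w , y ⟫ ∊ funs → y ∊ D
          fun-yD m = let (n , f , xs , y , h , e) = funAt m in ∊l (≈sym (proj₂ (⟪⟫-inj e))) (FunAt.yD h)

      fName : 𝕍
      fName = dot (img D λ m → op (chk m) (an m))

      private
        fn-i : ∀ {m} → m ∊ D → op (chk m) (an m) ∊ img D λ m → op (chk m) (an m)
        fn-i mD = img-i {t = λ m → op (chk m) (an m)} (λ _ _ e → op-cong (chk-cong e) (an-cong e)) mD ≈refl

      f : 𝕍
      f = Val G fName

      ∊f : ∀ {x y} → ⟪ x , y ⟫ ∊ f → x ∊ D × y ≈ av x
      ∊f q = let (x , p , e) = ∊val-dot 𝟙G q ; (m , mD , e′) = ∊img p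
                 (a , b) = ⟪⟫-inj (≈trans e (≈trans (val-cong e′) (≈trans (val-op 𝟙G) (⟪⟫-cong (val-chk 𝟙G m) ≈refl))))
             in ∊l (≈sym a) mD , ≈trans b (av-cong (≈sym a))

      f⇒ : ∀ {z} → z ∊ f → ∃[ m ] m ∊ D × z ≈ ⟪ m , av m ⟫
      f⇒ q = let (x , p , e) = ∊val-dot 𝟙G q ; (m , mD , e′) = ∊img p in
        m , mD , ≈trans e (≈trans (val-cong e′) (≈trans (val-op 𝟙G) (⟪⟫-cong (val-chk 𝟙G m) ≈refl)))

      f-i : ∀ {x y} → x ∊ D → y ≈ av x → ⟪ x , y ⟫ ∊ f
      f-i {x} p e = val-dot-i 𝟙G (fn-i p) (≈trans (⟪⟫-cong (≈sym (val-chk 𝟙G x)) e) (≈sym (val-op 𝟙G)))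

      opaque
        f∈ : V[G] G f
        f∈ = fName , VT it , name-dot (λ x p → let (m , mD , e) = ∊img p in name-cong (≈sym e) (name-op (name-chk m) (name-an mD))) , unVal ≈refl

      maps-f : {xs ys : Vec 𝕍 n} → Maps f xs ys → All (_∊ D) xs × tup ys ≈ tup (map av xs)
      maps-f [] = [] , ≈refl
      maps-f (m ∷ ms) = let (a , b) = ∊f (in⟨ m) ; (c , d) = maps-f ms in a ∷ c , ⟪⟫-cong b d

      opaque
        iso : IsIso L M N f
        iso = record
          { bijection = record
            { isFunction = record
              { graph = λ z m → let (x , xD , e) = f⇒ (mem m) in x , av x , unmem xD , unmem (dN-i xD) , ≐⟨ e
              ; total = λ a m → av a , out⟨ (f-i (mem m) ≈refl)
              ; single-valued = λ a b b′ m m′ → uneq (≈trans (proj₂ (∊f (in⟨ m))) (≈sym (proj₂ (∊f (in⟨ m′))))) }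
            ; injective = λ a a′ b m m′ → let (p , e) = ∊f (in⟨ m) ; (p′ , e′) = ∊f (in⟨ m′) in uneq (av-inj p p′ (≈trans (≈sym e) e′))
            ; surjective = λ b m → let (x , xD , e) = ∊dN (mem m) in x , out⟨ (f-i xD e) }
          ; relations = λ n R xs ys ar ms → let (xsD , e) = maps-f ms in to⇔
              ((λ m → tup∈ {xs = ys} (⟪⟫-resp ≈refl (≈sym e) (rN-i {xs = xs} record { ar = ar ; xsD = xsD ; hld = tup∊ {xs = xs} m }))) ,
               (λ m → let (n′ , r , zs , h , e′) = ∊rN (tup∊ {xs = ys} m) ; (a , b) = ⟪⟫-inj e′ in
                  tup∈ {xs = xs} (⟪⟫-resp (≈sym a) (≈sym (tup-av⁻ xs zs xsD (RelAt.xsD h) (≈trans (≈sym e) b))) (RelAt.hld h))))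
          ; functions = λ n g xs ys x y ar ms q m → let (xsD , e) = maps-f ms ; (xD , e′) = ∊f (in⟨ q) in
              tup²∈ {xs = ys} (⟪⟫-resp (⟪⟫-cong ≈refl (≈sym e)) (≈sym e′)
                (fN-i {xs = xs} record { ar = ar ; xsD = xsD ; yD = xD ; hld = tup²∊ {xs = xs} m })) }

      module Transfer (k : ℕ) (Y Ẏ : 𝕍) (vẎ : V Ẏ) (nẎ : IsName P Ẏ) (hẎ : HS Ẏ) (Y≈ : Y ≈ Val G Ẏ)
        (sY : SubsetOfPower k dN Y) where
        private
          instance
            iẎ : Cst Ẏ
            iẎ = cst vẎ
          T : 𝕍
          T = up Ẏ TN
          vT : V T
          vT = VT it
          Nm : 𝕍
          Nm = tc T vT
          instance
            iNm : Cst Nm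
            iNm = cst (V-tc T vT)
          ẎN : Ẏ ∊ Nm
          ẎN = tc-trans T vT (tc∋ T vT) (upl ≈refl)
          tnN : (xs : Vec 𝕍 n) → All (_∊ D) xs → tn xs ∊ Nm
          tnN xs h = tc-pc T vT (tc-trans T vT (tc∋ T vT) (upr ≈refl)) (TN⇐ xs h)
          module O = OnNames Nm (tc-pc T vT)

          XC : 𝕍 → Set₁
          XC z = ∃[ p ] ∃[ c ] z ≈ ⟪ p , c ⟫ × (∃[ t ] ∃[ u ] ⟪ t , u ⟫ ∊ TN × c ≈ chk t × ⟪ p , ⟪ u , Ẏ ⟫ ⟫ ∊ O.ME)
          opaque
            dXC : D₁ XC
            dXC = it
            dXB : T₀ (P ⊗ img (⋃ (⋃ TN)) chk)
            dXB = it
          Ẋ : 𝕍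
          Ẋ = sep (P ⊗ img (⋃ (⋃ TN)) chk) XC ⦃ dXB ⦄ ⦃ dXC ⦄
          Ẋ⇒ : ∀ {z} → z ∊ Ẋ → z ∊ P ⊗ img (⋃ (⋃ TN)) chk × XC z
          Ẋ⇒ = ∊sep
          Ẋ⇐ : ∀ {z} → z ∊ P ⊗ img (⋃ (⋃ TN)) chk → XC z → z ∊ Ẋ
          Ẋ⇐ = sep-i

        X* : 𝕍
        X* = Val G Ẋ

        X*∈ : V[G] G X*
        X*∈ = Ẋ , Vsep , name-i (λ z m → nm (proj₁ (Ẋ⇒ m))) , unVal ≈refl
          where
          nm : ∀ {z} → z ∊ P ⊗ img (⋃ (⋃ TN)) chk → ∃[ p ] ∃[ y ] p ∊ P × z ≈ ⟪ p , y ⟫ × IsName P y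
          nm m = let (p , c , pP , q , e) = ∊⊗ m ; (t , _ , e′) = ∊img q in p , c , pP , e , name-cong (≈sym e′) (name-chk t)

        X*⇒ : ∀ {z} → z ∊ X* → Σ[ n ∈ ℕ ] Σ[ xs ∈ Vec 𝕍 n ] All (_∊ D) xs × z ≈ tup xs × tup (map av xs) ∊ Y
        X*⇒ m = go (∊val m)
          where
          go : ∀ {z} → ∃[ p ] ∃[ y ] p ∊ G × ⟪ p , y ⟫ ∊ Ẋ × z ≈ Val G y → Σ[ n ∈ ℕ ] Σ[ xs ∈ Vec 𝕍 n ] All (_∊ D) xs × z ≈ tup xs × tup (map av xs) ∊ Y
          go (p , y , pG , q , e) =
            let (p′ , c , e₁ , t , u , tu , e₂ , mm) = proj₂ (Ẋ⇒ q)
                (ep , ey) = ⟪⟫-inj e₁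
                (n , xs , h , et , eu) = TN⇒ tu
            in n , xs , h ,
               ≈trans e (≈trans (val-cong (≈trans ey e₂)) (≈trans (val-chk 𝟙G t) et)) ,
               ∊l (≈trans (val-cong eu) (val-tn xs)) (∊r (≈sym Y≈) (O.Mem-true g (∊l ep pG) mm))

        X*⇐ : (xs : Vec 𝕍 n) → All (_∊ D) xs → tup (map av xs) ∊ Y → tup xs ∊ X*
        X*⇐ xs h m =
          let (p , pG , mm) = O.Mem-force g (tnN xs h) ẎN (∊l (≈sym (val-tn xs)) (∊r Y≈ m))
              tu = TN⇐ xs h
          in val-i pG (Ẋ⇐ (⊗i (sub pG) (img-i {t = chk} (λ _ _ → chk-cong) (⋃i (⋃i tu ⟪⟫∋) (upl ≈refl)) ≈refl))
                          (p , chk (tup xs) , ≈refl , tup xs , tn xs , tu , ≈refl , mm)) (≈sym (val-chk 𝟙G (tup xs)))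

        Y⇒ : ∀ {z} → z ∊ Y → Σ[ xs ∈ Vec 𝕍 k ] All (_∊ D) xs × z ≈ tup (map av xs)
        Y⇒ {z} m = go (sY z (unmem m))
          where
          go : Σ[ ys ∈ Vec 𝕍 k ] All (_∈ dN) ys × z ≐ tuple ys → Σ[ xs ∈ Vec 𝕍 k ] All (_∊ D) xs × z ≈ tup (map av xs)
          go (ys , h , e) = go₂ (unav (all∊ h))
            where
            go₂ : Σ[ xs ∈ Vec 𝕍 k ] All (_∊ D) xs × Pointwise (λ y x → y ≈ av x) ys xs → Σ[ xs ∈ Vec 𝕍 k ] All (_∊ D) xs × z ≈ tup (map av xs)
            go₂ (xs , xsD , es) = xs , xsD , ≈trans (subst (z ≈_) (sym (tup≡ ys)) (eq e)) (tup-pw {ys = ys} {xs = xs} es)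

        sub* : SubsetOfPower k D X*
        sub* z m = go (X*⇒ (mem m))
          where
          go : Σ[ n ∈ ℕ ] Σ[ xs ∈ Vec 𝕍 n ] All (_∊ D) xs × z ≈ tup xs × tup (map av xs) ∊ Y → Σ[ xs ∈ Vec 𝕍 k ] All (_∈ D) xs × z ≐ tuple xs
          go (n , xs , h , e , q) = go₂ (Y⇒ q)
            where
            go₂ : Σ[ xs′ ∈ Vec 𝕍 k ] All (_∊ D) xs′ × tup (map av xs) ≈ tup (map av xs′) → Σ[ xs ∈ Vec 𝕍 k ] All (_∈ D) xs × z ≐ tuple xs
            go₂ (xs′ , h′ , e′) = xs′ , all∈ h′ , subst (z ≐_) (tup≡ xs′) (uneq (≈trans e (tup-av⁻ xs xs′ h h′ e′)))

        tuple∈ : ∀ {m z} (xs : Vec 𝕍 m) → tup xs ∊ z → tuple xs ∈ z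
        tuple∈ {z = z} xs q = subst (_∈ z) (tup≡ xs) (unmem q)

        tuple∊ : ∀ {m z} (xs : Vec 𝕍 m) → tuple xs ∈ z → tup xs ∊ z
        tuple∊ {z = z} xs q = subst (_∊ z) (sym (tup≡ xs)) (mem q)

        X*-get : ∀ {n} (xs : Vec 𝕍 n) → tup xs ∊ X* → All (_∊ D) xs × tup (map av xs) ∊ Y
        X*-get xs m = go (X*⇒ m)
          where
          go : Σ[ n ∈ ℕ ] Σ[ xs′ ∈ Vec 𝕍 n ] All (_∊ D) xs′ × tup xs ≈ tup xs′ × tup (map av xs′) ∊ Y → All (_∊ D) xs × tup (map av xs) ∊ Y
          go (n′ , xs′ , h , e , q) = tup-all xs xs′ h e , ∊l (≈sym (tup-av xs xs′ e)) q

        carries : Carries k f X* Y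
        carries ys = to⇔ (fwd , bwd)
          where
          mk : ∀ {n} (xs ys : Vec 𝕍 n) → All (_∊ D) xs → tup ys ≈ tup (map av xs) → Maps f xs ys
          mk [] [] _ _ = []
          mk (x ∷ xs) (y ∷ ys) (p ∷ ps) e = let (a , b) = ⟪⟫-inj e in out⟨ (f-i p a) ∷ mk xs ys ps b
          fwd : tuple ys ∈ Y → Σ[ xs ∈ Vec 𝕍 k ] tuple xs ∈ X* × Maps f xs ys
          fwd m = go (Y⇒ (tuple∊ ys m))
            where
            go : Σ[ xs ∈ Vec 𝕍 k ] All (_∊ D) xs × tup ys ≈ tup (map av xs) → Σ[ xs ∈ Vec 𝕍 k ] tuple xs ∈ X* × Maps f xs ys
            go (xs , h , e) = xs , tuple∈ xs (X*⇐ xs h (∊l e (tuple∊ ys m))) , mk xs ys h e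
          bwd : Σ[ xs ∈ Vec 𝕍 k ] tuple xs ∈ X* × Maps f xs ys → tuple ys ∈ Y
          bwd (xs , m , ms) = tuple∈ ys (∊l (≈sym (proj₂ (maps-f {xs = xs} {ys = ys} ms))) (proj₂ (X*-get xs (tuple∊ xs m))))

        stable : ∀ {A K π} → K ∊ F → A ∊ 𝓘₀ → Sup K A → (∀ σ → σ ∊ K → Act P σ Ẏ ≈ Ẏ) → π ∊ 𝓖 → (∀ b → b ∊ A → ⟪ b , b ⟫ ∊ π) →
          ∀ {n} {xs ys : Vec 𝕍 n} → All (_∊ D) xs → Pointwise (λ x y → ⟪ x , y ⟫ ∊ π) xs ys → tup (map av xs) ∊ Y → tup (map av ys) ∊ Y
        stable {A} {K} {π} KF A𝓘 sp st π𝓖 fx {n} {xs} {ys} h ps m = go (O.Mem-force g (tnN xs h) ẎN (∊l (≈sym (val-tn xs)) (∊r Y≈ m)))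
          where
          go : ∃[ p ] p ∊ G × O.Mem p (tn xs) Ẏ → tup (map av ys) ∊ Y
          go (p , pG , mm) = go₂ (homogeneous A𝓘 π𝓖 fx g pG)
            where
            go₂ : ∃[ θ ] ∃[ σ ] σ ∊ H × Lifted θ π × Ind θ σ × Fixes A θ × (∃[ p′ ] ⟪ p , p′ ⟫ ∊ σ × p′ ∊ G) → tup (map av ys) ∊ Y
            go₂ (θ , σ , σH , Lθ , i , fA , p′ , q , pG′) =
              ∊l (≈trans (Pl.val-pull (tn xs)) (≈trans (val-cong (act-tn Lθ i σH ps)) (val-tn ys)))
                (∊r (≈trans (Pl.val-pull Ẏ) (≈trans (val-cong (st σ (sp σ σH (Lifted.lifts Lθ i fA)))) (≈sym Y≈)))
                  (O.Mem-true Pl.gen-pull (Pl.pull-i q pG′) mm))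
              where module Pl = Pull g σH

        conclusion : ∃[ X* ] V[G] G X* × SubsetOfPower k D X* × Carries k f X* Y ×
          (∃[ K ] IsLargeIn V D 𝓖 𝓘 K × (∀ π → π ∈ K → Carries k π X* X*))
        conclusion = X* , X*∈ , sub* , carries , fromHS hẎ
          where
          fromHS : HS Ẏ → ∃[ K ] IsLargeIn V D 𝓖 𝓘 K × (∀ π → π ∈ K → Carries k π X* X*)
          fromHS (hs (K , KF , spec) _) = go (F-sup (mem KF))
            where
            fixK : ∀ σ → σ ∊ K → Act P σ Ẏ ≈ Ẏ
            fixK σ m = let (_ , lift e) = proj₁ (of⇔ (spec σ)) (unmem m) in mkAct {P} {σ} e
            go : ∃[ A ] A ∊ 𝓘₀ × Sup K A → ∃[ K ] IsLargeIn V D 𝓖 𝓘 K × (∀ π → π ∈ K → Carries k π X* X*)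
            go (A , a , sp) = Q , (Vsep , (Q⊆ , grpQ) , A , unmem (proj₁ (𝓘₀⇒ a)) , (λ π m h → unmem (Q⇐ (mem m) λ b q → in⟨ (h b (unmem q))))) , car
              where
              instance
                iA : Cst A
                iA = cst (V∊ V-𝓘₀ a)
              Q : 𝕍
              Q = sep 𝓖 λ π → ∀ b → b ∊ A → ⟪ b , b ⟫ ∊ π
              Q⇒ : ∀ {π} → π ∊ Q → π ∊ 𝓖 × (∀ b → b ∊ A → ⟪ b , b ⟫ ∊ π)
              Q⇒ m = ∊sep m
              Q⇐ : ∀ {π} → π ∊ 𝓖 → (∀ b → b ∊ A → ⟪ b , b ⟫ ∊ π) → π ∊ Q
              Q⇐ m h = sep-i m h
              Q⊆ : Q ⊆ 𝓖
              Q⊆ z m = unmem (proj₁ (Q⇒ (mem m)))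
              module PG = IsPermGroup Aut.group
              A⊂ : A ⊂ D
              A⊂ = 𝓘₀⊂ a
              grpQ : IsPermGroup D Q
              grpQ = record
                { bijections = λ π m → PG.bijections π (Q⊆ π m)
                ; identity = let (ι , m , h) = PG.identity in
                    ι , unmem (Q⇐ (mem m) λ b q → in⟨ (proj₂ (of⇔ (h b b)) (unmem (A⊂ b q) , uneq ≈refl))) , h
                ; inverses = λ π m → let (ρ , r , h) = PG.inverses π (Q⊆ π m) in
                    ρ , unmem (Q⇐ (mem r) λ b q → in⟨ (proj₂ (of⇔ (h b b)) (out⟨ (proj₂ (Q⇒ (mem m)) b q)))) , h
                ; products = λ σ τ m m′ → let (ρ , r , h) = PG.products σ τ (Q⊆ σ m) (Q⊆ τ m′) in
                    ρ , unmem (Q⇐ (mem r) λ b q → in⟨ (proj₂ (of⇔ (h b b)) (b , out⟨ (proj₂ (Q⇒ (mem m′)) b q) , out⟨ (proj₂ (Q⇒ (mem m)) b q)))) , h }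
              pw : ∀ {π n} {xs ys : Vec 𝕍 n} → Maps π xs ys → Pointwise (λ x y → ⟪ x , y ⟫ ∊ π) xs ys
              pw [] = []
              pw (r ∷ rs) = in⟨ r ∷ pw rs
              car : ∀ π → π ∈ Q → Carries k π X* X*
              car π m ys = to⇔ (fwd , bwd)
                where
                π𝓖 : π ∊ 𝓖
                π𝓖 = proj₁ (Q⇒ (mem m))
                fx : ∀ b → b ∊ A → ⟪ b , b ⟫ ∊ π
                fx = proj₂ (Q⇒ (mem m))
                fwd : tuple ys ∈ X* → Σ[ xs ∈ Vec 𝕍 k ] tuple xs ∈ X* × Maps π xs ys
                fwd q = go₁ (X*-get ys (tuple∊ ys q))
                  where
                  go₁ : All (_∊ D) ys × tup (map av ys) ∊ Y → Σ[ xs ∈ Vec 𝕍 k ] tuple xs ∈ X* × Maps π xs ys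
                  go₁ (ysD , yY) = go₂ (pop π𝓖 ys ysD) (inverse𝓖 π𝓖)
                    where
                    go₂ : Σ[ xs ∈ Vec 𝕍 k ] Pointwise (λ x y → ⟪ x , y ⟫ ∊ π) xs ys × All (_∊ D) xs →
                      ∃[ ρ ] ρ ∊ 𝓖 × (∀ x y → ⟪ x , y ⟫ ∊ ρ ⟺ ⟪ y , x ⟫ ∊ π) → Σ[ xs ∈ Vec 𝕍 k ] tuple xs ∈ X* × Maps π xs ys
                    go₂ (xs , ps , xsD) (ρ , ρ𝓖 , iv) = xs , tuple∈ xs (X*⇐ xs xsD
                      (stable (mem KF) a sp fixK ρ𝓖 (λ b r → proj₂ (iv b b) (fx b r)) {xs = ys} {ys = xs} ysD (flip-all {π = π} {ρ} iv ps) yY)) ,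
                      maps∈ π𝓖 ps
                bwd : Σ[ xs ∈ Vec 𝕍 k ] tuple xs ∈ X* × Maps π xs ys → tuple ys ∈ X*
                bwd (xs , q , ms) = go₃ (X*-get xs (tuple∊ xs q))
                  where
                  ps : Pointwise (λ x y → ⟪ x , y ⟫ ∊ π) xs ys
                  ps = pw {π} ms
                  go₃ : All (_∊ D) xs × tup (map av xs) ∊ Y → tuple ys ∈ X*
                  go₃ (xsD , xY) = tuple∈ ys (X*⇐ ys (proj₂ (rng π𝓖 ps)) (stable (mem KF) a sp fixK π𝓖 fx {xs = xs} {ys = ys} xsD ps xY))

      hasCopy : HasSymmetricCopy V (W G) (V[G] G) L M 𝓖 𝓘
      hasCopy = N , isN , f , f∈ , iso , λ k Y (Ẏ , vẎ , nẎ , hẎ , e) sY →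
        Transfer.conclusion k Y Ẏ vẎ nẎ hẎ (mkVal e) sY

 open SymmetricCopies

 module NewSubsets where
  private variable
    n : ℕ
    ℓ ℓ′ : Level
    s t u : Env n → 𝕍

  stab₀ : {A : Set} → ¬ ¬ A → A
  stab₀ {A} h with dec₀ A
  ... | yes r = r
  ... | no r = ⊥-elim (h r)

  stab₁ : {A : Set₁} → ¬ ¬ A → A
  stab₁ {A} h with dec₁ A
  ... | yes r = r
  ... | no r = ⊥-elim (h r)

  module Distributive (D 𝓖 𝓘 X : 𝕍) ⦃ _ : Cst D ⦄ ⦃ _ : Cst 𝓖 ⦄ ⦃ _ : Cst 𝓘 ⦄ ⦃ _ : Cst X ⦄
    (grp : IsPermGroup D 𝓖) (ideal : IsIdealIn V D 𝓘) where
    open Atoms D 𝓖 𝓘 X grp ideal public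

    ChainP : 𝕍 → Set₁
    ChainP C = ∀ {s q s′ q′} → ⟪ s , q ⟫ ∊ C → ⟪ s′ , q′ ⟫ ∊ C → (s ⊂ s′ × q ⊂ q′) ⊎ (s′ ⊂ s × q′ ⊂ q)

    record Union (C S Q : 𝕍) : Set₁ where
      field
        V-S : V S
        V-Q : V Q
        chain : ChainP C
        nonempty : ∃[ s ] ∃[ q ] ⟪ s , q ⟫ ∊ C
        S⇒ : ∀ {x} → x ∊ S → ∃[ s ] ∃[ q ] ⟪ s , q ⟫ ∊ C × x ∊ s
        S⇐ : ∀ {x s q} → ⟪ s , q ⟫ ∊ C → x ∊ s → x ∊ S
        Q⇒ : ∀ {l} → l ∊ Q → ∃[ s ] ∃[ q ] ⟪ s , q ⟫ ∊ C × l ∊ q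
        Q⇐ : ∀ {l s q} → ⟪ s , q ⟫ ∊ C → l ∊ q → l ∊ Q

    -- Maximal partial solutions: a chain of pairs with strictly increasing small first components
    -- has a condition as the union of its second components.
    module Extend (Good : 𝕍) ⦃ _ : Cst Good ⦄
      (pairs : ∀ {z} → z ∊ Good → ∃[ s ] ∃[ q ] z ≈ ⟪ s , q ⟫)
      (inP : ∀ {s q} → ⟪ s , q ⟫ ∊ Good → q ∊ P)
      (start : ∃[ z ] z ∊ Good)
      (small : ∀ C S Q → C ⊂ Good → Union C S Q → Small S)
      (close : ∀ C S Q → C ⊂ Good → Union C S Q → Q ∊ P → ⟪ S , Q ⟫ ∊ Good) where
      private
        LT : 𝕍 → 𝕍 → Set₁
        LT z w = ∃[ s ] ∃[ q ] z ≈ ⟪ s , q ⟫ × (∃[ s′ ] ∃[ q′ ] w ≈ ⟪ s′ , q′ ⟫ × s ⊂ s′ × (∃[ x ] x ∊ s′ × ¬ x ∊ s) × q ⊂ q′)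

        opaque
          dLT : D₂ LT
          dLT = it

        lt : 𝕍
        lt = rel Good Good LT ⦃ it ⦄ ⦃ it ⦄ ⦃ dLT ⦄

        lt⇒ : ∀ {s q s′ q′} → ⟪ ⟪ s , q ⟫ , ⟪ s′ , q′ ⟫ ⟫ ∊ lt → s ⊂ s′ × (∃[ x ] x ∊ s′ × ¬ x ∊ s) × q ⊂ q′
        lt⇒ m = go (proj₂ (proj₂ (∊rel m)))
          where
          go : ∀ {s q s′ q′} → LT ⟪ s , q ⟫ ⟪ s′ , q′ ⟫ → s ⊂ s′ × (∃[ x ] x ∊ s′ × ¬ x ∊ s) × q ⊂ q′
          go (s , q , e , s′ , q′ , e′ , f , (x , a , b) , g) =
            let (u , v) = ⟪⟫-inj e ; (u′ , v′) = ⟪⟫-inj e′ in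
            (λ z m → ∊r (≈sym u′) (f z (∊r u m))) , (x , ∊r (≈sym u′) a , λ m → b (∊r u m)) , (λ z m → ∊r (≈sym v′) (g z (∊r v m)))

        lt⇐ : ∀ {s q s′ q′} → ⟪ s , q ⟫ ∊ Good → ⟪ s′ , q′ ⟫ ∊ Good → s ⊂ s′ → (∃[ x ] x ∊ s′ × ¬ x ∊ s) → q ⊂ q′ → ⟪ ⟪ s , q ⟫ , ⟪ s′ , q′ ⟫ ⟫ ∊ lt
        lt⇐ a b f x g = rel-i a b (_ , _ , ≈refl , _ , _ , ≈refl , f , x , g)

        instance
          ilt : Cst lt
          ilt = cst (Vrel)

        irr : ∀ x → x ∊ Good → ¬ ⟪ x , x ⟫ ∊ lt
        irr x m h = let (s , q , e) = pairs m ; (_ , (y , a , b) , _) = lt⇒ (⟪⟫-resp e e h) in b a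

        trn : ∀ x y z → x ∊ Good → y ∊ Good → z ∊ Good → ⟪ x , y ⟫ ∊ lt → ⟪ y , z ⟫ ∊ lt → ⟪ x , z ⟫ ∊ lt
        trn x y z a b c h k =
          let (s , q , e) = pairs a ; (s′ , q′ , e′) = pairs b ; (s″ , q″ , e″) = pairs c
              (f , (w , u , v) , g) = lt⇒ (⟪⟫-resp e e′ h) ; (f′ , _ , g′) = lt⇒ (⟪⟫-resp e′ e″ k)
          in ⟪⟫-resp (≈sym e) (≈sym e″) (lt⇐ (∊l e a) (∊l e″ c) (λ z m → f′ z (f z m)) (w , f′ w u , v) (λ z m → g′ z (g z m)))

        module Z = Zorn Good lt ⦃ it ⦄ ⦃ ilt ⦄ irr trn

        ub : ∀ C → V C → C ⊂ Good → Z.Chain C → ∃[ u ] u ∊ Good × (∀ x → x ∊ C → ⟪ x , u ⟫ ∊ lt ⊎ x ≈ u)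
        ub C vC C⊂ ch = go (dec₁ (∃[ z ] z ∊ C))
          where
          instance
            iC : Cst C
            iC = cst vC
          SS QS Sᵤ Qᵤ : 𝕍
          SS = sep (⋃ (⋃ C)) λ s → ∃[ q ] ⟪ s , q ⟫ ∊ C
          QS = sep (⋃ (⋃ C)) λ q → ∃[ s ] ⟪ s , q ⟫ ∊ C
          Sᵤ = ⋃ SS
          Qᵤ = ⋃ QS
          SS⇒ : ∀ {s} → s ∊ SS → ∃[ q ] ⟪ s , q ⟫ ∊ C
          SS⇒ m = proj₂ (∊sep m)
          QS⇒ : ∀ {q} → q ∊ QS → ∃[ s ] ⟪ s , q ⟫ ∊ C
          QS⇒ m = proj₂ (∊sep m)
          SS⇐ : ∀ {s q} → ⟪ s , q ⟫ ∊ C → s ∊ SS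
          SS⇐ m = sep-i (⋃i (⋃i m ⟪⟫∋) (upl ≈refl)) (_ , m)
          QS⇐ : ∀ {s q} → ⟪ s , q ⟫ ∊ C → q ∊ QS
          QS⇐ m = sep-i (⋃i (⋃i m ⟪⟫∋) (upr ≈refl)) (_ , m)
          chainP : ChainP C
          chainP m m′ = [ (λ h → let (f , _ , g) = lt⇒ h in inj₁ (f , g)) ,
            [ (λ e → let (a , b) = ⟪⟫-inj e in inj₁ ((λ z → ∊r a) , (λ z → ∊r b))) , (λ h → let (f , _ , g) = lt⇒ h in inj₂ (f , g)) ]′ ]′
            (ch _ m _ m′)
          beyond : ∀ {s q s′ q′ x} → ⟪ s , q ⟫ ∊ C → ⟪ s′ , q′ ⟫ ∊ C → x ∊ s′ → ¬ x ∊ s → q ⊂ q′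
          beyond m m′ a b = [ (λ (_ , g) → g) , (λ (f , _) → ⊥-elim (b (f _ a))) ]′ (chainP m m′)
          below : ∀ {s q s′ q′} → ⟪ s , q ⟫ ∊ C → ⟪ s′ , q′ ⟫ ∊ C → s′ ⊂ s → q′ ⊂ q
          below m m′ f = [ (λ h → let (_ , (x , a , b) , _) = lt⇒ h in ⊥-elim (b (f x a))) ,
            [ (λ e z → ∊r (≈sym (proj₂ (⟪⟫-inj e)))) , (λ h → proj₂ (proj₂ (lt⇒ h))) ]′ ]′ (ch _ m _ m′)
          module _ (ne : ∃[ z ] z ∊ C) where
            U : Union C Sᵤ Qᵤ
            U = record
              { V-S = V⋃ Vsep ; V-Q = V⋃ Vsep ; chain = chainP
              ; nonempty = let (z , m) = ne ; (s , q , e) = pairs (C⊂ z m) in s , q , ∊l e m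
              ; S⇒ = λ m → let (s , a , b) = ∊⋃ m ; (q , c) = SS⇒ a in s , q , c , b
              ; S⇐ = λ m a → ⋃i (SS⇐ m) a
              ; Q⇒ = λ m → let (q , a , b) = ∊⋃ m ; (s , c) = QS⇒ a in s , q , c , b
              ; Q⇐ = λ m a → ⋃i (QS⇐ m) a }
            open Union U using (S⇒; S⇐; Q⇒; Q⇐)

            Rq : 𝕍 → 𝕍 → Set₁
            Rq x q = ∃[ s ] ⟪ s , q ⟫ ∊ C × x ∊ s

            opaque
              chz : Choice Sᵤ QS Rq
              chz = choose Sᵤ QS Rq it λ x m → let (s , q , a , b) = S⇒ m in q , QS⇐ a , s , a , b

            fn : 𝕍
            fn = Choice.fn chz

            instance
              ifn : Cst fn
              ifn = cst (Choice.V-fn chz)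

            𝒬 : 𝕍
            𝒬 = sep QS λ q → ∃[ x ] ⟪ x , q ⟫ ∊ fn
            𝒬⇒ : ∀ {q} → q ∊ 𝒬 → q ∊ QS × (∃[ x ] ⟪ x , q ⟫ ∊ fn)
            𝒬⇒ m = ∊sep m

            smQ : Small Qᵤ
            smQ = go (dec₁ (∃[ s ] ∃[ q ] ⟪ s , q ⟫ ∊ C × Sᵤ ⊂ s))
              where
              go : Dec (∃[ s ] ∃[ q ] ⟪ s , q ⟫ ∊ C × Sᵤ ⊂ s) → Small Qᵤ
              go (yes (s , q , m , f)) = small-sub (λ l a → let (s′ , q′ , m′ , b) = Q⇒ a in below m m′ (λ x c → f x (S⇐ m′ c)) l b)
                (proj₁ (proj₂ (P⇒ (inP (C⊂ _ m)))))
              go (no k) = small-sub Q⊂ (small-⋃ Vsep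
                  (small-img Vsep (λ x q → ⟪ x , q ⟫ ∊ fn) it (small C Sᵤ Qᵤ C⊂ U) (λ x q q′ _ _ a b → Choice.unique chz a b)
                    (λ q m → let (_ , x , a) = 𝒬⇒ m in x , proj₁ (Choice.sound chz a) , a))
                  (λ q m → let (s , a) = QS⇒ (proj₁ (𝒬⇒ m)) in proj₁ (proj₂ (P⇒ (inP (C⊂ _ a))))))
                where
                miss : ∀ {s q} → ⟪ s , q ⟫ ∊ C → ∃[ x ] x ∊ Sᵤ × ¬ x ∊ s
                miss {s} {q} m = stab₁ λ h → k (s , q , m , λ x a → stab₀ λ r → h (x , a , r))
                Q⊂ : Qᵤ ⊂ ⋃ 𝒬
                Q⊂ l a = let (s , q , m , b) = Q⇒ a
                             (x , xS , x∉) = miss m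
                             (q′ , c) = Choice.total chz xS
                             (_ , q′QS , s′ , m′ , xs′) = Choice.sound chz c
                         in ⋃i (sep-i q′QS (x , c)) (beyond m m′ xs′ x∉ l b)

            QP : Qᵤ ∊ P
            QP = P⇐ (V⋃ Vsep)
              (λ l a → let (s , q , m , b) = Q⇒ a in proj₁ (P⇒ (inP (C⊂ _ m))) l b)
              smQ
              (λ c b m b′ m′ → let (s , q , a , x) = Q⇒ m ; (s′ , q′ , a′ , x′) = Q⇒ m′ in
                [ (λ (_ , f) → proj₂ (proj₂ (P⇒ (inP (C⊂ _ a′)))) c b (f _ x) b′ x′) ,
                  (λ (_ , f) → proj₂ (proj₂ (P⇒ (inP (C⊂ _ a)))) c b x b′ (f _ x′)) ]′ (chainP a a′))

            bound : ∃[ u ] u ∊ Good × (∀ x → x ∊ C → ⟪ x , u ⟫ ∊ lt ⊎ x ≈ u)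
            bound = ⟪ Sᵤ , Qᵤ ⟫ , SQ , λ z m → let (s , q , e) = pairs (C⊂ z m) in
                [ (λ h → inj₁ (⟪⟫-resp (≈sym e) ≈refl h)) , (λ h → inj₂ (≈trans e h)) ]′ (at (∊l e m))
              where
              SQ : ⟪ Sᵤ , Qᵤ ⟫ ∊ Good
              SQ = close C Sᵤ Qᵤ C⊂ U QP
              at : ∀ {s q} → ⟪ s , q ⟫ ∊ C → ⟪ ⟪ s , q ⟫ , ⟪ Sᵤ , Qᵤ ⟫ ⟫ ∊ lt ⊎ ⟪ s , q ⟫ ≈ ⟪ Sᵤ , Qᵤ ⟫
              at {s} {q} m = go (dec₁ (∃[ x ] x ∊ Sᵤ × ¬ x ∊ s))
                where
                go : Dec (∃[ x ] x ∊ Sᵤ × ¬ x ∊ s) → ⟪ ⟪ s , q ⟫ , ⟪ Sᵤ , Qᵤ ⟫ ⟫ ∊ lt ⊎ ⟪ s , q ⟫ ≈ ⟪ Sᵤ , Qᵤ ⟫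
                go (yes w) = inj₁ (lt⇐ (C⊂ _ m) SQ (λ x → S⇐ m) w (λ l → Q⇐ m))
                go (no h) = inj₂ (⟪⟫-cong (≈ext (λ x → S⇐ m) S⊂)
                  (≈ext (λ l → Q⇐ m) (λ l a → let (s′ , q′ , m′ , b) = Q⇒ a in below m m′ (λ x c → S⊂ x (S⇐ m′ c)) l b)))
                  where
                  S⊂ : Sᵤ ⊂ s
                  S⊂ x a = stab₀ λ r → h (x , a , r)
          go : Dec (∃[ z ] z ∊ C) → ∃[ u ] u ∊ Good × (∀ x → x ∊ C → ⟪ x , u ⟫ ∊ lt ⊎ x ≈ u)
          go (yes ne) = bound ne
          go (no h) = let (z , m) = start in z , m , λ x a → ⊥-elim (h (x , a))

      maximal : ∃[ s ] ∃[ q ] ⟪ s , q ⟫ ∊ Good × (∀ {s′ q′} → ⟪ s′ , q′ ⟫ ∊ Good → s ⊂ s′ → q ⊂ q′ → s′ ⊂ s)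
      maximal = go (Z.zorn ub)
        where
        go : ∃[ m ] m ∊ Good × (∀ y → y ∊ Good → ¬ ⟪ m , y ⟫ ∊ lt) →
          ∃[ s ] ∃[ q ] ⟪ s , q ⟫ ∊ Good × (∀ {s′ q′} → ⟪ s′ , q′ ⟫ ∊ Good → s ⊂ s′ → q ⊂ q′ → s′ ⊂ s)
        go (z , m , mx) = let (s , q , e) = pairs m in s , q , ∊l e m , λ a f g x b → st e (∊l e m) a f g x b
          where
          st : ∀ {s q s′ q′} → z ≈ ⟪ s , q ⟫ → ⟪ s , q ⟫ ∊ Good → ⟪ s′ , q′ ⟫ ∊ Good → s ⊂ s′ → q ⊂ q′ → ∀ x → x ∊ s′ → x ∊ s
          st {s} e m a f g x b = stab₀ λ r → mx _ a (⟪⟫-resp (≈sym e) ≈refl (lt⇐ m a f (x , b , r) g))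

    module NoNew {G Ẋ : 𝕍} (g : Gen G) (vẊ : V Ẋ) where
      open Gen g
      private
        instance
          iẊ : Cst Ẋ
          iẊ = cst vẊ
        T : 𝕍
        T = up Ẋ (img D chk)
        vT : V T
        vT = VT it
        Nm : 𝕍
        Nm = tc T vT
        instance
          iNm : Cst Nm
          iNm = cst (V-tc T vT)
        ẊN : Ẋ ∊ Nm
        ẊN = tc-trans T vT (tc∋ T vT) (upl ≈refl)
        chkN : ∀ {m} → m ∊ D → chk m ∊ Nm
        chkN mD = tc-trans T vT (tc-trans T vT (tc∋ T vT) (upr ≈refl)) (img-i {t = chk} (λ _ _ → chk-cong) mD ≈refl)
        module O = OnNames Nm (tc-pc T vT)

        Dc : 𝕍 → 𝕍 → Set₁
        Dc q m = ⟪ q , ⟪ chk m , Ẋ ⟫ ⟫ ∊ O.ME ⊎ (∀ r → r ∊ P → r ≼ q → ¬ ⟪ r , ⟪ chk m , Ẋ ⟫ ⟫ ∊ O.ME)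

        Dc-mono : ∀ {q q′ m} → q ∊ P → q′ ∊ P → q ⊂ q′ → Dc q m → Dc q′ m
        Dc-mono a b f (inj₁ h) = inj₁ (O.Mem-mono h b (≤⇐ b a f))
        Dc-mono a b f (inj₂ h) = inj₂ λ r rP k → h r rP (≤⇐ rP a λ z m → ≤⇒ k z (f z m))

        All-dec : 𝕍 → Set₁
        All-dec q = ∀ m → m ∊ D → Dc q m

        opaque
          dAll-dec : D₁ All-dec
          dAll-dec = it

        module Below {p : 𝕍} (pP : p ∊ P) where
          instance
            ip : Cst p
            ip = cst (V∊ V-P pP)
          GC : 𝕍 → Set₁
          GC z = ∃[ s ] ∃[ q ] z ≈ ⟪ s , q ⟫ × p ⊂ q × (∀ m → m ∊ s → Dc q m)
          opaque
            dGC : D₁ GC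
            dGC = it
            dGB : T₀ (pow D ⊗ P)
            dGB = it
          opaque
            Good : 𝕍
            Good = sep (pow D ⊗ P) GC ⦃ dGB ⦄ ⦃ dGC ⦄
            V-Good : V Good
            V-Good = Vsep {R = GC}
            Good⇒′ : ∀ {z} → z ∊ Good → z ∊ pow D ⊗ P × GC z
            Good⇒′ = ∊sep {R = GC}
            Good⇐ : ∀ {s q} → V s → s ⊂ D → q ∊ P → p ⊂ q → (∀ m → m ∊ s → Dc q m) → ⟪ s , q ⟫ ∊ Good
            Good⇐ v a b c d = sep-i {R = GC} (⊗i (pow-i (VT it) v a) b) (_ , _ , ≈refl , c , d)
          instance
            iGood : Cst Good
            iGood = cst V-Good
          Dc-resp : ∀ {q q′ m} → q ≈ q′ → Dc q m → Dc q′ m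
          Dc-resp e (inj₁ h) = inj₁ (⟪⟫-resp e ≈refl h)
          Dc-resp e (inj₂ h) = inj₂ λ r a k → h r a (⟪⟫-resp ≈refl (≈sym e) k)
          Good⇒ : ∀ {s q} → ⟪ s , q ⟫ ∊ Good → V s × s ⊂ D × q ∊ P × p ⊂ q × (∀ m → m ∊ s → Dc q m)
          Good⇒ m = go (Good⇒′ m)
            where
            go : ∀ {s q} → ⟪ s , q ⟫ ∊ pow D ⊗ P × GC ⟪ s , q ⟫ → V s × s ⊂ D × q ∊ P × p ⊂ q × (∀ m → m ∊ s → Dc q m)
            go (x , s′ , q′ , e , f , h) = let (a , b) = ⊗e x ; (u , v) = ⟪⟫-inj e in
              ∊pow-V (VT it) a , ∊pow (VT it) a , b , (λ z m → ∊r (≈sym v) (f z m)) , (λ m k → Dc-resp (≈sym v) (h m (∊r u k)))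
          pairs : ∀ {z} → z ∊ Good → ∃[ s ] ∃[ q ] z ≈ ⟪ s , q ⟫
          pairs m = let (_ , s , q , e , _) = Good⇒′ m in s , q , e
          most : ∃[ s ] ∃[ q ] ⟪ s , q ⟫ ∊ Good × (∀ {s′ q′} → ⟪ s′ , q′ ⟫ ∊ Good → s ⊂ s′ → q ⊂ q′ → s′ ⊂ s)
          most = Extend.maximal Good pairs (λ m → let (_ , _ , a , _) = Good⇒ m in a)
            (⟪ ∅ , p ⟫ , Good⇐ V∅ (λ z m → ⊥-elim (∉∅ m)) pP (λ z m → m) (λ m k → ⊥-elim (∉∅ k)))
            (λ C S Q C⊂ U → small-⊂B λ x m → let (s , q , a , b) = Union.S⇒ U m in X⊂B x (∪l (proj₁ (proj₂ (Good⇒ (C⊂ _ a))) x b)))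
            (λ C S Q C⊂ U QP → Good⇐ (Union.V-S U)
              (λ x m → let (s , q , a , b) = Union.S⇒ U m in proj₁ (proj₂ (Good⇒ (C⊂ _ a))) x b) QP
              (λ l m → let (s , q , a) = Union.nonempty U ; (_ , _ , _ , f , _) = Good⇒ (C⊂ _ a) in Union.Q⇐ U a (f l m))
              (λ m k → let (s , q , a , b) = Union.S⇒ U k ; (_ , _ , qP , _ , h) = Good⇒ (C⊂ _ a) in
                 Dc-mono qP QP (λ l → Union.Q⇐ U a) (h m b)))
          decided : ∃[ q ] q ∊ P × q ≼ p × All-dec q
          decided = go most
            where
            go : ∃[ s ] ∃[ q ] ⟪ s , q ⟫ ∊ Good × (∀ {s′ q′} → ⟪ s′ , q′ ⟫ ∊ Good → s ⊂ s′ → q ⊂ q′ → s′ ⊂ s) → ∃[ q ] q ∊ P × q ≼ p × All-dec q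
            go (s , q , m , mx) = let (vs , s⊂ , qP , f , h) = Good⇒ m in q , qP , ≤⇐ qP pP f , λ d dD →
                h d (st vs s⊂ qP f h d dD (dec₁ (∃[ r ] r ∊ P × r ≼ q × ⟪ r , ⟪ chk d , Ẋ ⟫ ⟫ ∊ O.ME)))
              where
              st : V s → s ⊂ D → q ∊ P → p ⊂ q → (∀ m → m ∊ s → Dc q m) → ∀ d → d ∊ D → Dec (∃[ r ] r ∊ P × r ≼ q × ⟪ r , ⟪ chk d , Ẋ ⟫ ⟫ ∊ O.ME) → d ∊ s
              st vs s⊂ qP f h d dD c = mx (add (new c)) (λ z → ∪l) (proj₁ (proj₂ (proj₂ (new c)))) d (∪r (upl ≈refl))
                where
                new : Dec (∃[ r ] r ∊ P × r ≼ q × ⟪ r , ⟪ chk d , Ẋ ⟫ ⟫ ∊ O.ME) → ∃[ q′ ] q′ ∊ P × q ⊂ q′ × Dc q′ d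
                new (yes (r , rP , k , x)) = r , rP , ≤⇒ k , inj₁ x
                new (no x) = q , qP , (λ z m → m) , inj₂ λ r rP k y → x (r , rP , k , y)
                add : (w : ∃[ q′ ] q′ ∊ P × q ⊂ q′ × Dc q′ d) → ⟪ s ∪ up d d , proj₁ w ⟫ ∊ Good
                add (q′ , qP′ , k , x) = Good⇐ (VT (d∪ ⦃ cst vs ⦄ ⦃ dUP ⦃ cst vd ⦄ ⦃ cst vd ⦄ ⦄))
                  (λ z m → [ s⊂ z , (λ n → ∊l (≈sym (∊sing n)) dD) ]′ (∊∪ m)) qP′ (λ z m → k z (f z m))
                  (λ m n → [ (λ n → Dc-mono qP qP′ k (h m n)) , (λ n → Dc-resp₂ (≈sym (∊sing n)) x) ]′ (∊∪ n))
                  where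
                  vd : V d
                  vd = V∊ (VT it) dD
                  Dc-resp₂ : ∀ {q m m′} → m ≈ m′ → Dc q m → Dc q m′
                  Dc-resp₂ e (inj₁ h) = inj₁ (⟪⟫-resp ≈refl (⟪⟫-cong (chk-cong e) ≈refl) h)
                  Dc-resp₂ e (inj₂ h) = inj₂ λ r a b k → h r a b (⟪⟫-resp ≈refl (⟪⟫-cong (chk-cong (≈sym e)) ≈refl) k)

      in-V : Val G Ẋ ⊂ D → V (Val G Ẋ)
      in-V X⊂ = go (decide All-dec dAll-dec)
        where
        go : (∃[ p ] p ∊ G × All-dec p) ⊎ (∃[ p ] p ∊ G × (∀ q → q ∊ P → q ≼ p → ¬ All-dec q)) → V (Val G Ẋ)
        go (inj₂ (p , pG , k)) = let (q , qP , q≤ , h) = Below.decided (sub pG) in ⊥-elim (k q qP q≤ h)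
        go (inj₁ (p , pG , h)) = V≈ (≈ext f b) Vsep
          where
          instance
            ip : Cst p
            ip = cst (V∊ V-P (sub pG))
          Y : 𝕍
          Y = sep D λ m → ⟪ p , ⟪ chk m , Ẋ ⟫ ⟫ ∊ O.ME
          Y⇒ : ∀ {m} → m ∊ Y → m ∊ D × O.Mem p (chk m) Ẋ
          Y⇒ m = ∊sep m
          f : Y ⊂ Val G Ẋ
          f m k = ∊l (val-chk 𝟙G m) (O.Mem-true g pG (proj₂ (Y⇒ k)))
          b : Val G Ẋ ⊂ Y
          b m k = [ (λ x → sep-i (X⊂ m k) x) , (λ x →
              let (r , rG , y) = O.Mem-force g (chkN (X⊂ m k)) ẊN (∊l (≈sym (val-chk 𝟙G m)) k)
                  (t , tG , t≤r , t≤p) = dir rG pG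
              in ⊥-elim (x t (sub tG) t≤p (O.Mem-mono y (sub tG) t≤r))) ]′ (h m (X⊂ m k))

    noNew : ∀ {G} → Gen G → NoNewSubsets V (GenericExtension V S G) D
    noNew g X (Ẋ , vẊ , _ , e) s = let e′ = mkVal e in
      V≈ (≈sym e′) (NoNew.in-V g vẊ (λ z m → mem (s z (unmem (∊r (≈sym e′) m)))))

 open NewSubsets

 module Chains where
  private variable
    n : ℕ
    ℓ ℓ′ : Level
    s t u : Env n → 𝕍

  ∈-min : (Q : 𝕍 → Set₁) → (∃[ x ] Q x) → ∃[ x ] Q x × (∀ y → y ∊ x → ¬ Q y)
  ∈-min Q (x , q) = stab₁ λ h → ∈-ind (λ x → ¬ Q x) (λ x ih q → h (x , q , ih)) x q

  module DependentChoice (D 𝓖 𝓘 κ : 𝕍) ⦃ _ : Cst D ⦄ ⦃ _ : Cst 𝓖 ⦄ ⦃ _ : Cst 𝓘 ⦄ ⦃ _ : Cst κ ⦄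
    (grp : IsPermGroup D 𝓖) (ideal : IsIdealIn V D 𝓘) (κ-ord : IsOrdinal κ) (complete : IsCompleteIn V D 𝓘 κ) where
    open Distributive D 𝓖 𝓘 κ grp ideal public

    private
      compl : ∀ {δ f} → δ ∊ κ → V f → f ⊂ δ ⊗ 𝓘 → (∀ {x} → x ∊ δ → ∃[ y ] ⟪ x , y ⟫ ∊ f) →
        (∀ {x y y′} → ⟪ x , y ⟫ ∊ f → ⟪ x , y′ ⟫ ∊ f → y ≈ y′) →
        ∃[ b ] b ∊ 𝓘 × (∀ z → z ∊ b → ∃[ ξ ] ∃[ A ] ⟪ ξ , A ⟫ ∊ f × z ∊ A) × (∀ {z ξ A} → ⟪ ξ , A ⟫ ∊ f → z ∊ A → z ∊ b)
      compl {δ} {f} δκ vf f⊂ tot un =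
        let (b , bI , h) = complete δ f (unmem δκ) vf (record
              { graph = λ z m → let (x , y , p , q , e) = ∊⊗ (f⊂ z (mem m)) in x , y , unmem p , unmem q , ≐⟨ e
              ; total = λ a m → let (y , p) = tot (mem m) in y , out⟨ p
              ; single-valued = λ a b b′ p q → uneq (un (in⟨ p) (in⟨ q)) })
        in b , mem bI ,
           (λ z m → let (_ , ξ , A , p , q) = proj₁ (of⇔ (h z)) (unmem m) in ξ , A , in⟨ p , mem q) ,
           (λ {z} p q → mem (proj₂ (of⇔ (h z)) (IsIdealIn.subsets ideal _ (unmem (proj₂ (⊗e (f⊂ _ p)))) z (unmem q) , _ , _ , out⟨ p , unmem q)))

    𝓘₀-complete : ∀ {δ f} → δ ∊ κ → V f → f ⊂ δ ⊗ 𝓘₀ → (∀ {x} → x ∊ δ → ∃[ y ] ⟪ x , y ⟫ ∊ f) →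
        (∀ {x y y′} → ⟪ x , y ⟫ ∊ f → ⟪ x , y′ ⟫ ∊ f → y ≈ y′) → ∃[ b ] b ∊ 𝓘₀ × (∀ {ξ A} → ⟪ ξ , A ⟫ ∊ f → A ⊂ b)
    𝓘₀-complete {δ} {f} δκ vf f⊂ tot un = go (compl δκ vf f⊂′ tot un)
      where
      f⊂′ : f ⊂ δ ⊗ 𝓘
      f⊂′ z m = let (x , y , p , q , e) = ∊⊗ (f⊂ z m) in ∊l (≈sym e) (⊗i p (proj₁ (𝓘₀⇒ q)))
      go : ∃[ b ] b ∊ 𝓘 × (∀ z → z ∊ b → ∃[ ξ ] ∃[ A ] ⟪ ξ , A ⟫ ∊ f × z ∊ A) × (∀ {z ξ A} → ⟪ ξ , A ⟫ ∊ f → z ∊ A → z ∊ b) →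
        ∃[ b ] b ∊ 𝓘₀ × (∀ {ξ A} → ⟪ ξ , A ⟫ ∊ f → A ⊂ b)
      go (b , bI , b⇒ , b⇐) = b , 𝓘₀⇐ bI im , λ p z → b⇐ p
        where
        im : ∀ π → π ∊ 𝓖 → ∃[ b′ ] b′ ∊ 𝓘 × Im π b b′
        im π π𝓖 = go₂ (compl δκ Vrel rel⊂ tot′ un′)
          where
          module π = Perm (perm𝓖 π𝓖)
          instance
            iδ : Cst δ
            iδ = cst (V∊ (VT it) δκ)
            if : Cst f
            if = cst vf
            iπ : Cst π
            iπ = cst (V∊ (VT it) π𝓖)
          R : 𝕍 → 𝕍 → Set₁
          R ξ A′ = ∃[ A ] ⟪ ξ , A ⟫ ∊ f × Im π A A′
          f′ : 𝕍
          f′ = rel δ 𝓘 R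
          f⇒ : ∀ {ξ A′} → ⟪ ξ , A′ ⟫ ∊ f′ → ξ ∊ δ × A′ ∊ 𝓘 × R ξ A′
          f⇒ m = ∊rel m
          tot′ : ∀ {ξ} → ξ ∊ δ → ∃[ A′ ] ⟪ ξ , A′ ⟫ ∊ f′
          tot′ m = let (A , p) = tot m ; (A′ , a , h) = proj₂ (𝓘₀⇒ (proj₂ (⊗e (f⊂ _ p)))) π π𝓖 in A′ , rel-i m a (A , p , h)
          A⊂D : ∀ {A} → A ∊ 𝓘 → A ⊂ D
          A⊂D a z m = mem (IsIdealIn.subsets ideal _ (unmem a) z (unmem m))
          half : ∀ {A B A′ B′} → A ≈ B → A′ ∊ 𝓘 → Im π A A′ → Im π B B′ → A′ ⊂ B′
          half e a h k z m = let (x , r) = π.srj (A⊂D a z m) in proj₁ (k x z r) (∊r e (proj₂ (h x z r) m))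
          un′ : ∀ {ξ A B} → ⟪ ξ , A ⟫ ∊ f′ → ⟪ ξ , B ⟫ ∊ f′ → A ≈ B
          un′ p q = let (_ , a , A₀ , x , h) = f⇒ p ; (_ , b , B₀ , y , k) = f⇒ q ; e = un x y in
            ≈ext (half e a h k) (half (≈sym e) b k h)
          go₂ : ∃[ b′ ] b′ ∊ 𝓘 × (∀ z → z ∊ b′ → ∃[ ξ ] ∃[ A ] ⟪ ξ , A ⟫ ∊ f′ × z ∊ A) × (∀ {z ξ A} → ⟪ ξ , A ⟫ ∊ f′ → z ∊ A → z ∊ b′) →
            ∃[ b′ ] b′ ∊ 𝓘 × Im π b b′
          go₂ (b′ , bI′ , b⇒′ , b⇐′) = b′ , bI′ , λ m m′ r →
            (λ k → let (ξ , A , p , q) = b⇒ m k ; (A′ , p′) = tot′ (proj₁ (⊗e (f⊂ _ p))) ; (_ , _ , A₀ , p₀ , h) = f⇒ p′ in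
               b⇐′ p′ (proj₁ (h m m′ r) (∊r (un p p₀) q))) ,
            (λ k → let (ξ , A′ , p′ , q) = b⇒′ m′ k ; (_ , _ , A , p , h) = f⇒ p′ in b⇐ p (proj₂ (h m m′ r) q))

    module Tree {G : 𝕍} (g : Gen G) (lm : 𝕍) (lmκ : lm ∊ κ) (lm-ord : IsOrdinal lm) (Ṫ Ė : 𝕍)
      (vT : V Ṫ) (nT : IsName P Ṫ) (hT : HS Ṫ) (vE : V Ė) where
      open Gen g
      private
        module Od = IsOrdinal lm-ord
        instance
          iT : Cst Ṫ
          iT = cst vT
          iE : Cst Ė
          iE = cst vE
          ilm : Cst lm
          ilm = cst (V∊ (VT it) lmκ)

      Y : 𝕍
      Y = sep (⋃ (⋃ Ṫ)) λ y → ∃[ p ] ⟪ p , y ⟫ ∊ Ṫ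

      Y⇒ : ∀ {y} → y ∊ Y → ∃[ p ] ⟪ p , y ⟫ ∊ Ṫ
      Y⇒ m = proj₂ (∊sep m)

      Y⇐ : ∀ {p y} → ⟪ p , y ⟫ ∊ Ṫ → y ∊ Y
      Y⇐ m = sep-i (⋃i (⋃i m ⟪⟫∋) (upr ≈refl)) (_ , m)

      private
        ops base : 𝕍
        ops = ⋃ (img Y λ y → img Y λ y′ → op y y′)
        base = up (up Ṫ Ė) ops
        opaque
          vB : V base
          vB = VT it
        Nm : 𝕍
        Nm = tc base vB
        instance
          iNm : Cst Nm
          iNm = cst (V-tc base vB)
        TN : Ṫ ∊ Nm
        TN = tc-trans base vB (tc-trans base vB (tc∋ base vB) (upl ≈refl)) (upl ≈refl)
        EN : Ė ∊ Nm
        EN = tc-trans base vB (tc-trans base vB (tc∋ base vB) (upl ≈refl)) (upr ≈refl)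
        YN : ∀ {y} → y ∊ Y → y ∊ Nm
        YN m = tc-pc base vB TN (proj₂ (Y⇒ m))
        opN : ∀ {y y′} → y ∊ Y → y′ ∊ Y → op y y′ ∊ Nm
        opN {y} {y′} m m′ = tc-trans base vB (tc-trans base vB (tc∋ base vB) (upr ≈refl))
          (⋃i (img-i {t = λ y → img Y λ y′ → op y y′} (λ _ _ e → ≈ext (half e) (half (≈sym e))) m ≈refl)
              (img-i {t = λ y′ → op y y′} (λ _ _ e → op-cong ≈refl e) m′ ≈refl))
          where
          half : ∀ {y z} → y ≈ z → img Y (λ y′ → op y y′) ⊂ img Y (λ y′ → op z y′)
          half {z = z} e w k = let (x , p , f) = ∊img k in img-i {t = λ y′ → op z y′} (λ _ _ e → op-cong ≈refl e) p (≈trans f (op-cong e ≈refl))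
        module O = OnNames Nm (tc-pc base vB)

        Seq : 𝕍 → Set₁
        Seq t = (∀ β y → ⟪ β , y ⟫ ∊ t → ∀ y′ → ⟪ β , y′ ⟫ ∊ t → y ≈ y′)
          × (∀ β y → ⟪ β , y ⟫ ∊ t → ∀ γ → γ ∊ β → ∃[ y′ ] ⟪ γ , y′ ⟫ ∊ t)

        Apart : 𝕍 → 𝕍 → 𝕍 → Set₁
        Apart q y y′ = ⟪ q , ⟪ op y y′ , Ė ⟫ ⟫ ∊ O.ME × (∀ r → r ∊ P → r ≼ q → ¬ ⟪ r , ⟪ y , y′ ⟫ ⟫ ∊ O.E)

        FCh : 𝕍 → 𝕍 → Set₁
        FCh q t = (∀ β y → ⟪ β , y ⟫ ∊ t → ⟪ q , ⟪ y , Ṫ ⟫ ⟫ ∊ O.ME)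
          × (∀ β y → ⟪ β , y ⟫ ∊ t → ∀ γ y′ → ⟪ γ , y′ ⟫ ∊ t → β ∊ γ → Apart q y y′)

        SUB : 𝕍 → 𝕍 → 𝕍 → Set₁
        SUB q t y = ⟪ q , ⟪ y , Ṫ ⟫ ⟫ ∊ O.ME × (∀ β s → ⟪ β , s ⟫ ∊ t → Apart q s y)

        Full : 𝕍 → Set₁
        Full t = ∀ β → β ∊ lm → ∃[ y ] ⟪ β , y ⟫ ∊ t

        Stuck : 𝕍 → 𝕍 → Set₁
        Stuck q t = ∃[ β ] β ∊ lm × (∀ γ → γ ∊ β → ∃[ y ] ⟪ γ , y ⟫ ∊ t) × (∀ γ y → ⟪ γ , y ⟫ ∊ t → γ ∊ β)
          × (∀ y → y ∊ Y → ∀ r → r ∊ P → r ≼ q → ¬ SUB r t y)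

        Solved : 𝕍 → Set₁
        Solved q = ∃[ t ] t ∊ pow (lm ⊗ Y) × Seq t × FCh q t × (Full t ⊎ Stuck q t)

        opaque
          dSeq : D₁ Seq
          dSeq = it
          dFCh : D₂ FCh
          dFCh = it
          dFull : D₁ Full
          dFull = it
          dStuck : D₂ Stuck
          dStuck = it
          dSolved : D₁ Solved
          dSolved = dBex {t = λ _ → pow (lm ⊗ Y)} {R = λ t ρ → Seq t × FCh (ρ zero) t × (Full t ⊎ Stuck (ρ zero) t)} ⦃ it ⦄
            ⦃ dAnd ⦃ app₁ {R = Seq} dSeq it ⦄ ⦃ dAnd ⦃ app₂ {R = FCh} dFCh it it ⦄
              ⦃ dOr ⦃ app₁ {R = Full} dFull it ⦄ ⦃ app₂ {R = Stuck} dStuck it it ⦄ ⦄ ⦄ ⦄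

        VlY : V (lm ⊗ Y)
        VlY = VT it

        Apart-mono : ∀ {q q′ y y′} → q ∊ P → q′ ∊ P → q ⊂ q′ → Apart q y y′ → Apart q′ y y′
        Apart-mono a b f (h , k) = O.Mem-mono h b (≤⇐ b a f) , λ r rP r≤ → k r rP (≤⇐ rP a λ z m → ≤⇒ r≤ z (f z m))

        Apart-resp : ∀ {q y y′ z z′} → y ≈ z → y′ ≈ z′ → Apart q y y′ → Apart q z z′
        Apart-resp e f (h , k) = ⟪⟫-resp ≈refl (⟪⟫-cong (op-cong e f) ≈refl) h ,
          λ r rP r≤ m → k r rP r≤ (⟪⟫-resp ≈refl (⟪⟫-cong (≈sym e) (≈sym f)) m)

        FCh-mono : ∀ {q q′ t} → q ∊ P → q′ ∊ P → q ⊂ q′ → FCh q t → FCh q′ t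
        FCh-mono a b f (h , k) = (λ β y m → O.Mem-mono (h β y m) b (≤⇐ b a f)) ,
          (λ β y m γ y′ m′ l → Apart-mono a b f (k β y m γ y′ m′ l))

        module Below {p : 𝕍} (pP : p ∊ P) where
          instance
            ip : Cst p
            ip = cst (V∊ V-P pP)
          GC : 𝕍 → Set₁
          GC z = ∃[ t ] ∃[ q ] z ≈ ⟪ t , q ⟫ × p ⊂ q × Seq t × FCh q t
          opaque
            dGC : D₁ GC
            dGC = dExE {t = λ ρ → ρ zero} {R = λ t q ρ → p ⊂ q × Seq t × FCh q t} ⦃ it ⦄
              ⦃ dAnd ⦃ it ⦄ ⦃ dAnd ⦃ app₁ {R = Seq} dSeq it ⦄ ⦃ app₂ {R = FCh} dFCh it it ⦄ ⦄ ⦄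
            dGB : T₀ (pow (lm ⊗ Y) ⊗ P)
            dGB = it
          opaque
            Good : 𝕍
            Good = sep (pow (lm ⊗ Y) ⊗ P) GC ⦃ dGB ⦄ ⦃ dGC ⦄
            V-Good : V Good
            V-Good = Vsep {R = GC}
            Good⇒′ : ∀ {z} → z ∊ Good → z ∊ pow (lm ⊗ Y) ⊗ P × GC z
            Good⇒′ = ∊sep {R = GC}
            Good⇐ : ∀ {t q} → V t → t ⊂ lm ⊗ Y → q ∊ P → p ⊂ q → Seq t → FCh q t → ⟪ t , q ⟫ ∊ Good
            Good⇐ v a b c d e = sep-i {R = GC} (⊗i (pow-i VlY v a) b) (_ , _ , ≈refl , c , d , e)
          instance
            iGood : Cst Good
            iGood = cst V-Good

          record GoodR (t q : 𝕍) : Set₁ where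
            field
              vt : V t
              t⊂ : t ⊂ lm ⊗ Y
              qP : q ∊ P
              p⊂ : p ⊂ q
              sq : Seq t
              fc : FCh q t

          Good⇒ : ∀ {t q} → ⟪ t , q ⟫ ∊ Good → GoodR t q
          Good⇒ m = go (Good⇒′ m)
            where
            go : ∀ {t q} → ⟪ t , q ⟫ ∊ pow (lm ⊗ Y) ⊗ P × GC ⟪ t , q ⟫ → GoodR t q
            go (x , t′ , q′ , e , f , (s₁ , s₂) , h , k) = let (a , b) = ⊗e x ; (u , v) = ⟪⟫-inj e in record
              { vt = ∊pow-V VlY a ; t⊂ = ∊pow VlY a ; qP = b ; p⊂ = λ z m → ∊r (≈sym v) (f z m)
              ; sq = (λ β y m y′ m′ → s₁ β y (∊r u m) y′ (∊r u m′)) ,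
                     (λ β y m γ l → let (y′ , m′) = s₂ β y (∊r u m) γ l in y′ , ∊r (≈sym u) m′)
              ; fc = (λ β y m → ⟪⟫-resp (≈sym v) ≈refl (h β y (∊r u m))) ,
                     (λ β y m γ y′ m′ l → let (c , d) = k β y (∊r u m) γ y′ (∊r u m′) l in
                        ⟪⟫-resp (≈sym v) ≈refl c , λ r rP r≤ → d r rP (⟪⟫-resp ≈refl v r≤)) }

          pairs : ∀ {z} → z ∊ Good → ∃[ s ] ∃[ q ] z ≈ ⟪ s , q ⟫
          pairs m = let (_ , s , q , e , _) = Good⇒′ m in s , q , e

          module OfChain {C S′ Q : 𝕍} (C⊂ : C ⊂ Good) (U : Union C S′ Q) where
            open Union U
            good : ∀ {t q} → ⟪ t , q ⟫ ∊ C → GoodR t q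
            good m = Good⇒ (C⊂ _ m)
            both : ∀ {x y} → x ∊ S′ → y ∊ S′ → ∃[ t ] ∃[ q ] ⟪ t , q ⟫ ∊ C × x ∊ t × y ∊ t
            both m m′ = let (t , q , a , x) = S⇒ m ; (t′ , q′ , a′ , x′) = S⇒ m′ in
              [ (λ (f , _) → t′ , q′ , a′ , f _ x , x′) , (λ (f , _) → t , q , a , x , f _ x′) ]′ (chain a a′)
            ⊂lY : S′ ⊂ lm ⊗ Y
            ⊂lY x m = let (t , q , a , b) = S⇒ m in GoodR.t⊂ (good a) x b
            seq : Seq S′
            seq = (λ β y m y′ m′ → let (t , q , a , x , x′) = both m m′ in proj₁ (GoodR.sq (good a)) β y x y′ x′) ,
              (λ β y m γ l → let (t , q , a , x) = S⇒ m ; (y′ , x′) = proj₂ (GoodR.sq (good a)) β y x γ l in y′ , S⇐ a x′)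
            fch : Q ∊ P → FCh Q S′
            fch QP = (λ β y m → let (t , q , a , x) = S⇒ m in proj₁ (FCh-mono (GoodR.qP (good a)) QP (λ l → Q⇐ a) (GoodR.fc (good a))) β y x) ,
              (λ β y m γ y′ m′ l → let (t , q , a , x , x′) = both m m′ in
                 proj₂ (FCh-mono (GoodR.qP (good a)) QP (λ l → Q⇐ a) (GoodR.fc (good a))) β y x γ y′ x′ l)
            sml : Small S′
            sml = small-img V-S (λ β z → ∃[ b ] ∃[ y ] z ≈ ⟪ b , y ⟫ × b ≈ β) it (small-⊂B λ x m → X⊂B x (∪r (mem (IsOrdinal.transitive κ-ord lm x (unmem lmκ) (unmem m)))))
              (λ { β z z′ m m′ (b , y , e , f) (b′ , y′ , e′ , f′) → let c = ≈trans f (≈sym f′) in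
                   ≈trans e (≈trans (⟪⟫-cong c (proj₁ seq b y (∊l e m) y′ (∊l (≈trans e′ (⟪⟫-cong (≈sym c) ≈refl)) m′))) (≈sym e′)) })
              (λ z m → let (b , y , p , _ , e) = ∊⊗ (⊂lY z m) in b , p , b , y , e , ≈refl)
            cls : Q ∊ P → ⟪ S′ , Q ⟫ ∊ Good
            cls QP = Good⇐ V-S ⊂lY QP (λ l m → let (t , q , a) = nonempty in Q⇐ a (GoodR.p⊂ (good a) l m)) seq (fch QP)

          none : ∀ {z} → ¬ z ∊ ∅
          none = ∉∅

          module Ex = Extend Good pairs (λ m → GoodR.qP (Good⇒ m))
            (⟪ ∅ , p ⟫ , Good⇐ V∅ (λ z m → ⊥-elim (none m)) pP (λ z m → m)
              ((λ β y m → ⊥-elim (none m)) , (λ β y m → ⊥-elim (none m))) ((λ β y m → ⊥-elim (none m)) , (λ β y m → ⊥-elim (none m))))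
            (λ C S′ Q C⊂ U → OfChain.sml C⊂ U) (λ C S′ Q C⊂ U → OfChain.cls C⊂ U)

          module Max {t q : 𝕍} (m : ⟪ t , q ⟫ ∊ Good) (mx : ∀ {s′ q′} → ⟪ s′ , q′ ⟫ ∊ Good → t ⊂ s′ → q ⊂ q′ → s′ ⊂ t) where
            open GoodR (Good⇒ m)
            Free : 𝕍 → Set₁
            Free β = β ∊ lm × ¬ (∃[ y ] ⟪ β , y ⟫ ∊ t)
            module At {β : 𝕍} (βf : Free β) (βm : ∀ γ → γ ∊ β → ¬ Free γ) where
              up′ : ∀ γ → γ ∊ β → ∃[ y ] ⟪ γ , y ⟫ ∊ t
              up′ γ l = stab₁ λ h → βm γ l (mem (Od.transitive β γ (unmem (proj₁ βf)) (unmem l)) , h)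
              dn : ∀ γ y → ⟪ γ , y ⟫ ∊ t → γ ∊ β
              dn γ y k = go (Od.linear γ β (unmem (proj₁ (⊗e (t⊂ _ k)))) (unmem (proj₁ βf)))
                where
                go : (γ ∈ β) ⊎ (γ ≐ β) ⊎ (β ∈ γ) → γ ∊ β
                go (inj₁ r) = mem r
                go (inj₂ (inj₁ r)) = ⊥-elim (proj₂ βf (y , ⟪⟫-resp (eq r) ≈refl k))
                go (inj₂ (inj₂ r)) = ⊥-elim (proj₂ βf (proj₂ sq γ y k β (mem r)))
              stuck : ∀ y → y ∊ Y → ∀ r → r ∊ P → r ≼ q → ¬ SUB r t y
              stuck y yY r rP r≤ (h , k) = proj₂ βf (y , mx new (λ z → ∪l) (≤⇒ r≤) _ (∪r (upl ≈refl)))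
                where
                t′ : 𝕍
                t′ = t ∪ up ⟪ β , y ⟫ ⟪ β , y ⟫
                βy : ⟪ β , y ⟫ ∊ lm ⊗ Y
                βy = ⊗i (proj₁ βf) yY
                cs : ∀ {γ z} → ⟪ γ , z ⟫ ∊ t′ → ⟪ γ , z ⟫ ∊ t ⊎ (γ ≈ β × z ≈ y)
                cs n = [ inj₁ , (λ e → inj₂ (⟪⟫-inj (∊sing e))) ]′ (∊∪ n)
                sq₁ : ∀ γ z → ⟪ γ , z ⟫ ∊ t′ → ∀ z′ → ⟪ γ , z′ ⟫ ∊ t′ → z ≈ z′
                sq₁ γ z n z′ n′ = go (cs n) (cs n′)
                  where
                  go : ⟪ γ , z ⟫ ∊ t ⊎ (γ ≈ β × z ≈ y) → ⟪ γ , z′ ⟫ ∊ t ⊎ (γ ≈ β × z′ ≈ y) → z ≈ z′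
                  go (inj₁ a) (inj₁ b) = proj₁ sq γ z a z′ b
                  go (inj₁ a) (inj₂ (e , _)) = ⊥-elim (proj₂ βf (z , ⟪⟫-resp e ≈refl a))
                  go (inj₂ (e , _)) (inj₁ b) = ⊥-elim (proj₂ βf (z′ , ⟪⟫-resp e ≈refl b))
                  go (inj₂ (_ , e)) (inj₂ (_ , e′)) = ≈trans e (≈sym e′)
                sq₂ : ∀ γ z → ⟪ γ , z ⟫ ∊ t′ → ∀ δ → δ ∊ γ → ∃[ z′ ] ⟪ δ , z′ ⟫ ∊ t′
                sq₂ γ z n δ l = go (cs n)
                  where
                  go : ⟪ γ , z ⟫ ∊ t ⊎ (γ ≈ β × z ≈ y) → ∃[ z′ ] ⟪ δ , z′ ⟫ ∊ t′
                  go (inj₁ a) = let (z′ , b) = proj₂ sq γ z a δ l in z′ , ∪l b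
                  go (inj₂ (e , _)) = let (z′ , b) = up′ δ (∊r e l) in z′ , ∪l b
                fc′ : FCh r t
                fc′ = FCh-mono qP rP (≤⇒ r≤) fc
                fc₁ : ∀ γ z → ⟪ γ , z ⟫ ∊ t′ → ⟪ r , ⟪ z , Ṫ ⟫ ⟫ ∊ O.ME
                fc₁ γ z n = [ proj₁ fc′ γ z , (λ (_ , e) → ⟪⟫-resp ≈refl (⟪⟫-cong (≈sym e) ≈refl) h) ]′ (cs n)
                fc₂ : ∀ γ z → ⟪ γ , z ⟫ ∊ t′ → ∀ δ z′ → ⟪ δ , z′ ⟫ ∊ t′ → γ ∊ δ → Apart r z z′
                fc₂ γ z n δ z′ n′ l = go (cs n) (cs n′)
                  where
                  go : ⟪ γ , z ⟫ ∊ t ⊎ (γ ≈ β × z ≈ y) → ⟪ δ , z′ ⟫ ∊ t ⊎ (δ ≈ β × z′ ≈ y) → Apart r z z′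
                  go (inj₁ a) (inj₁ b) = proj₂ fc′ γ z a δ z′ b l
                  go (inj₁ a) (inj₂ (_ , e)) = Apart-resp ≈refl (≈sym e) (k γ z a)
                  go (inj₂ (e , _)) (inj₁ b) = ⊥-elim (∊-asym β δ (∊l e l) (dn δ z′ b))
                  go (inj₂ (e , _)) (inj₂ (e′ , _)) = ⊥-elim (∊-irrefl β (∊l e (∊r e′ l)))
                new : ⟪ t′ , r ⟫ ∊ Good
                new = Good⇐ (VT (d∪ ⦃ cst vt ⦄ ⦃ dUP ⦃ cst vβy ⦄ ⦃ cst vβy ⦄ ⦄))
                  (λ z n → [ t⊂ z , (λ e → ∊l (≈sym (∊sing e)) βy) ]′ (∊∪ n)) rP (λ z n → ≤⇒ r≤ z (p⊂ z n)) (sq₁ , sq₂) (fc₁ , fc₂)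
                  where
                  vβy : V ⟪ β , y ⟫
                  vβy = V∊ VlY βy
            solved : Solved q
            solved = t , pow-i VlY vt t⊂ , sq , fc , go (dec₁ (∃[ β ] Free β))
              where
              go : Dec (∃[ β ] Free β) → Full t ⊎ Stuck q t
              go (no h) = inj₁ λ β βl → stab₁ λ k → h (β , βl , k)
              go (yes w) = go₂ (∈-min Free w)
                where
                go₂ : ∃[ β ] Free β × (∀ γ → γ ∊ β → ¬ Free γ) → Full t ⊎ Stuck q t
                go₂ (β , βf , βm) = inj₂ (β , proj₁ βf , At.up′ βf βm , At.dn βf βm , At.stuck βf βm)

          solution : ∃[ q ] q ∊ P × q ≼ p × Solved q
          solution = go Ex.maximal
            where
            go : ∃[ s ] ∃[ q ] ⟪ s , q ⟫ ∊ Good × (∀ {s′ q′} → ⟪ s′ , q′ ⟫ ∊ Good → s ⊂ s′ → q ⊂ q′ → s′ ⊂ s) → ∃[ q ] q ∊ P × q ≼ p × Solved q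
            go (t , q , m , mx) = q , GoodR.qP (Good⇒ m) , ≤⇐ (GoodR.qP (Good⇒ m)) pP (GoodR.p⊂ (Good⇒ m)) , Max.solved m mx

      solve : ∃[ q ] q ∊ G × Solved q
      solve = go (decide Solved dSolved)
        where
        go : (∃[ p ] p ∊ G × Solved p) ⊎ (∃[ p ] p ∊ G × (∀ q → q ∊ P → q ≼ p → ¬ Solved q)) → ∃[ q ] q ∊ G × Solved q
        go (inj₁ r) = r
        go (inj₂ (p , pG , k)) = let (q , qP , q≤ , h) = Below.solution (sub pG) in ⊥-elim (k q qP q≤ h)

      -- the function β ↦ Val G (t β) lies in the symmetric extension
      module Sequence {t δ : 𝕍} (vt : V t) (t⊂ : t ⊂ lm ⊗ Y) (δκ : δ ∊ κ)
        (dom⇒ : ∀ γ → γ ∊ δ → ∃[ y ] ⟪ γ , y ⟫ ∊ t) (dom⇐ : ∀ γ y → ⟪ γ , y ⟫ ∊ t → γ ∊ δ)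
        (fun : ∀ β y → ⟪ β , y ⟫ ∊ t → ∀ y′ → ⟪ β , y′ ⟫ ∊ t → y ≈ y′) where
        private
          instance
            it′ : Cst t
            it′ = cst vt
            iδ : Cst δ
            iδ = cst (V∊ (VT it) δκ)

          t-Y : ∀ {β y} → ⟪ β , y ⟫ ∊ t → y ∊ Y
          t-Y m = proj₂ (⊗e (t⊂ _ m))

          CC : 𝕍 → Set₁
          CC w = ∃[ β ] ∃[ y ] ⟪ β , y ⟫ ∊ t × w ≈ op (chk β) y
          CB : 𝕍
          CB = ⋃ (img (⋃ (⋃ t)) λ β → img (⋃ (⋃ t)) λ y → op (chk β) y)
          opaque
            dCC : D₁ CC
            dCC = it
            dCB : T₀ CB
            dCB = it

        CS : 𝕍
        CS = sep CB CC ⦃ dCB ⦄ ⦃ dCC ⦄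

        private
          V-CS : V CS
          V-CS = Vsep {R = CC}
          V-dot : V (dot CS)
          V-dot = VT (dImg ⦃ cst V-CS ⦄ ⦃ it ⦄)

          CS⇒ : ∀ {w} → w ∊ CS → CC w
          CS⇒ m = proj₂ (∊sep {R = CC} m)

          CS⇐ : ∀ {β y} → ⟪ β , y ⟫ ∊ t → op (chk β) y ∊ CS
          CS⇐ {β} {y} m = sep-i {R = CC}
            (⋃i (img-i {t = λ β → img (⋃ (⋃ t)) λ y → op (chk β) y} (λ _ _ e → ≈ext (half e) (half (≈sym e)))
                   (⋃i (⋃i m ⟪⟫∋) (upl ≈refl)) ≈refl)
                (img-i {t = λ y → op (chk β) y} (λ _ _ e → op-cong ≈refl e) (⋃i (⋃i m ⟪⟫∋) (upr ≈refl)) ≈refl))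
            (β , y , m , ≈refl)
            where
            half : ∀ {β γ} → β ≈ γ → img (⋃ (⋃ t)) (λ y → op (chk β) y) ⊂ img (⋃ (⋃ t)) (λ y → op (chk γ) y)
            half {γ = γ} e w k = let (x , p , f) = ∊img k in
              img-i {t = λ y → op (chk γ) y} (λ _ _ e → op-cong ≈refl e) p (≈trans f (op-cong (chk-cong e) ≈refl))

        c : 𝕍
        c = Val G (dot CS)

        c⇒ : ∀ {z} → z ∊ c → ∃[ β ] ∃[ y ] ⟪ β , y ⟫ ∊ t × z ≈ ⟪ β , Val G y ⟫
        c⇒ m = let (x , p , e) = ∊val-dot 𝟙G m ; (β , y , q , e′) = CS⇒ p in
          β , y , q , ≈trans e (≈trans (val-cong e′) (≈trans (val-op 𝟙G) (⟪⟫-cong (val-chk 𝟙G β) ≈refl)))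

        c⇐ : ∀ {β y} → ⟪ β , y ⟫ ∊ t → ⟪ β , Val G y ⟫ ∊ c
        c⇐ {β} {y} m = val-dot-i 𝟙G (CS⇐ m) (≈trans (⟪⟫-cong (≈sym (val-chk 𝟙G β)) ≈refl) (≈sym (val-op 𝟙G)))

        private
          name-Y : ∀ {y} → y ∊ Y → IsName P y
          name-Y m = name-sub nT (proj₂ (Y⇒ m))

          hs-Y : ∀ {y} → y ∊ Y → HS y
          hs-Y m = go hT
            where
            go : HS Ṫ → HS _
            go (hs _ h) = h _ _ (out⟨ (proj₂ (Y⇒ m)))

          module AO = ActOn Nm (tc-pc base vB)

          Spt : 𝕍 → 𝕍 → Set₁
          Spt β A = ∃[ y ] ⟪ β , y ⟫ ∊ t × (∀ σ → σ ∊ H → Lifts A σ → ⟪ σ , ⟪ y , y ⟫ ⟫ ∊ AO.actSet)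

          opaque
            dSpt : D₂ Spt
            dSpt = dExR {t = λ _ → t} {R = λ y ρ → ∀ σ → σ ∊ H → Lifts (ρ (suc zero)) σ → ⟪ σ , ⟪ y , y ⟫ ⟫ ∊ AO.actSet} ⦃ it ⦄ ⦃ it ⦄
              ⦃ dBall {t = λ _ → H} {R = λ σ ρ → Lifts (ρ (suc (suc zero))) σ → ⟪ σ , ⟪ ρ zero , ρ zero ⟫ ⟫ ∊ AO.actSet} ⦃ it ⦄
                ⦃ d→ ⦃ app₂ {R = Lifts} dLifts it it ⦄ ⦃ it ⦄ ⦄ ⦄

          spt : ∀ β → β ∊ δ → ∃[ A ] A ∊ 𝓘₀ × Spt β A
          spt β m = let (y , q) = dom⇒ β m in go y q (hs-Y (t-Y q))
            where
            go : ∀ y → ⟪ β , y ⟫ ∊ t → HS y → ∃[ A ] A ∊ 𝓘₀ × Spt β A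
            go y q (hs (K , KF , sp) _) = let (A , a , s) = F-sup (mem KF) in
              A , a , y , q , λ σ σH l → let (_ , lift e) = proj₁ (of⇔ (sp σ)) (unmem (s σ σH l)) in
                AO.actSet⇐ σH (YN (t-Y q)) (YN (t-Y q)) (mkAct {P} {σ} e)

          opaque
            chs : Choice δ 𝓘₀ Spt
            chs = choose δ 𝓘₀ Spt dSpt spt

          bnd : ∃[ b ] b ∊ 𝓘₀ × (∀ {ξ A} → ⟪ ξ , A ⟫ ∊ Choice.fn chs → A ⊂ b)
          bnd = 𝓘₀-complete δκ (Choice.V-fn chs) (Choice.pairs chs) (Choice.total chs) (Choice.unique chs)

          weaken : ∀ {A C σ} → A ⊂ C → Lifts C σ → Lifts A σ
          weaken s (θ , v , π , p , q , o , i , f) = θ , v , π , p , q , o , i , λ m mA → f m (s m mA)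

          fixed : ∀ {σ β y} → σ ∊ H → Lifts (proj₁ bnd) σ → ⟪ β , y ⟫ ∊ t → Act P σ y ≈ y
          fixed {σ} {β} {y} σH l m =
            let (A , q) = Choice.total chs (dom⇐ β y m)
                (_ , _ , y′ , r , h) = Choice.sound chs q
                e = fun β y m y′ r
            in ≈trans (act-cong e) (≈trans (AO.actSet⇒ (h σ σH (weaken (proj₂ (proj₂ bnd) q) l))) (≈sym e))

        c∈W : SymmetricExtension V S G c
        c∈W = dot CS , V-dot , nm , hs-dot (sym-intro V-dot nm KF sy) each , unVal ≈refl
          where
          fx : ∃[ K ] K ∊ F × (∀ σ → σ ∊ K → σ ∊ H × Lifts (proj₁ bnd) σ)
          fx = fixing (proj₁ bnd) (proj₁ (proj₂ bnd))
          KF : proj₁ fx ∊ F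
          KF = proj₁ (proj₂ fx)
          nm : IsName P (dot CS)
          nm = name-dot λ x m → let (β , y , q , e) = CS⇒ m in name-cong (≈sym e) (name-op (name-chk β) (name-Y (t-Y q)))
          ac : ∀ {σ β y} → σ ∊ H → Lifts (proj₁ bnd) σ → ⟪ β , y ⟫ ∊ t → Act P σ (op (chk β) y) ≈ op (chk β) y
          ac {β = β} σH l m = ≈trans (act-op σH) (op-cong (act-chk σH β) (fixed σH l m))
          sy : ∀ σ → σ ∊ proj₁ fx → Act P σ (dot CS) ≈ dot CS
          sy σ k = let (σH , l) = proj₂ (proj₂ fx) σ k in act-dot σH
            (λ x m → let (β , y , q , e) = CS⇒ m in ∊l (≈sym (≈trans (act-cong e) (ac σH l q))) (CS⇐ q))
            (λ x m → let (β , y , q , e) = CS⇒ m in op (chk β) y , CS⇐ q , ≈trans (ac σH l q) (≈sym e))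
          each : ∀ x → x ∊ CS → HS x
          each x m = let (β , y , q , e) = CS⇒ m ; vq = V∊ vt q in
            hs-cong (≈sym e) (hs-op (V-chk (V⟨l vq)) (V⟨r vq) (name-chk β) (name-Y (t-Y q)) (hs-chk β (V⟨l vq)) (hs-Y (t-Y q)) KF
              (λ σ k → let (σH , l) = proj₂ (proj₂ fx) σ k in act-chk σH β , fixed σH l q))

      module Conclude (T ≤T : 𝕍) (T≈ : T ≈ Val G Ṫ) (E≈ : ≤T ≈ Val G Ė)
        (tree : IsTreeIn (SymmetricExtension V S G) T ≤T)
        (cl : ∀ α c → α ∈ lm → SymmetricExtension V S G c → IsChainOfType T ≤T α c →
          ∃[ u ] u ∈ T × (∀ β s → ⟨ β , s ⟩ ∈ c → ⟨ s , u ⟩ ∈ ≤T)) where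
        private
          module Tr = IsTreeIn tree

          apart-true : ∀ {q y y′} → q ∊ G → y ∊ Y → y′ ∊ Y → Apart q y y′ → ⟪ Val G y , Val G y′ ⟫ ∊ ≤T × ¬ Val G y ≈ Val G y′
          apart-true qG a b (h , k) = ∊r (≈sym E≈) (∊l (val-op 𝟙G) (O.Mem-true g qG h)) , λ e →
            let (r , rG , m) = O.Eq-force g (YN a) (YN b) e ; (r′ , rG′ , x , y) = dir rG qG in
            k r′ (sub rG′) y (O.Eq-mono m (sub rG′) x)

          mem-true : ∀ {q y} → q ∊ G → ⟪ q , ⟪ y , Ṫ ⟫ ⟫ ∊ O.ME → Val G y ∊ T
          mem-true qG h = ∊r (≈sym T≈) (O.Mem-true g qG h)

          module Chain {q t δ : 𝕍} (qG : q ∊ G) (vt : V t) (t⊂ : t ⊂ lm ⊗ Y) (sq : Seq t) (fc : FCh q t) (δκ : δ ∊ κ)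
            (dom⇒ : ∀ γ → γ ∊ δ → ∃[ y ] ⟪ γ , y ⟫ ∊ t) (dom⇐ : ∀ γ y → ⟪ γ , y ⟫ ∊ t → γ ∊ δ) where
            open Sequence vt t⊂ δκ dom⇒ dom⇐ (proj₁ sq) public

            tY : ∀ {β y} → ⟪ β , y ⟫ ∊ t → y ∊ Y
            tY m = proj₂ (⊗e (t⊂ _ m))

            c-at : ∀ {β s} → ⟪ β , s ⟫ ∊ c → ∃[ y ] ⟪ β , y ⟫ ∊ t × s ≈ Val G y
            c-at m = let (β , y , q , e) = c⇒ m ; (a , b) = ⟪⟫-inj e in y , ⟪⟫-resp (≈sym a) ≈refl q , b

            isChain : IsChainOfType T ≤T δ c
            isChain = record
              { function = record
                { graph = λ z m → let (β , y , q , e) = c⇒ (mem m) in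
                    β , Val G y , unmem (dom⇐ β y q) , unmem (mem-true qG (proj₁ fc β y q)) , ≐⟨ e
                ; total = λ β m → let (y , q) = dom⇒ β (mem m) in Val G y , out⟨ (c⇐ q)
                ; single-valued = λ β s s′ m m′ → let (y , q , e) = c-at (in⟨ m) ; (y′ , q′ , e′) = c-at (in⟨ m′) in
                    uneq (≈trans e (≈trans (val-cong (proj₁ sq β y q y′ q′)) (≈sym e′))) }
              ; increasing = λ β γ s u l m m′ → let (y , q , e) = c-at (in⟨ m) ; (y′ , q′ , e′) = c-at (in⟨ m′)
                                                    (a , b) = apart-true qG (tY q) (tY q′) (proj₂ fc β y q γ y′ q′ (mem l)) in
                  out⟨ (⟪⟫-resp (≈sym e) (≈sym e′) a) , λ f → b (≈trans (≈sym e) (≈trans (eq f) e′)) }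

          -- a member of T strictly above the chain would force its own existence
          no-bound : ∀ {q t} → q ∊ G → V t → t ⊂ lm ⊗ Y → (∀ y → y ∊ Y → ∀ r → r ∊ P → r ≼ q → ¬ SUB r t y) →
            ∀ {y} → y ∊ Y → Val G y ∊ T → (∀ β s → ⟪ β , s ⟫ ∊ t → ⟪ Val G s , Val G y ⟫ ∊ ≤T × ¬ Val G s ≈ Val G y) → ⊥
          no-bound {q} {t} qG vt t⊂ stk {y} yY yT h = go (decide Bad dBad)
            where
            instance
              it′ : Cst t
              it′ = cst vt
              iy : Cst y
              iy = cst (V∊ Vsep yY)
            Bad : 𝕍 → Set₁
            Bad r = (∀ r′ → r′ ∊ P → r′ ≼ r → ¬ ⟪ r′ , ⟪ y , Ṫ ⟫ ⟫ ∊ O.ME)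
              ⊎ (∃[ γ ] ∃[ s ] ⟪ γ , s ⟫ ∊ t × ((∀ r′ → r′ ∊ P → r′ ≼ r → ¬ ⟪ r′ , ⟪ op s y , Ė ⟫ ⟫ ∊ O.ME) ⊎ ⟪ r , ⟪ s , y ⟫ ⟫ ∊ O.E))
            opaque
              dBad : D₁ Bad
              dBad = it
            sY : ∀ {γ s} → ⟪ γ , s ⟫ ∊ t → s ∊ Y
            sY m = proj₂ (⊗e (t⊂ _ m))
            go : (∃[ p ] p ∊ G × Bad p) ⊎ (∃[ p ] p ∊ G × (∀ q → q ∊ P → q ≼ p → ¬ Bad q)) → ⊥
            go (inj₁ (p , pG , inj₁ k)) =
              let (r , rG , m) = O.Mem-force g (YN yY) TN (∊r T≈ yT) ; (r′ , rG′ , a , b) = dir rG pG in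
              k r′ (sub rG′) b (O.Mem-mono m (sub rG′) a)
            go (inj₁ (p , pG , inj₂ (γ , s , m , inj₁ k))) =
              let (r , rG , m′) = O.Mem-force g (opN (sY m) yY) EN (∊l (≈sym (val-op 𝟙G)) (∊r E≈ (proj₁ (h γ s m)))) ; (r′ , rG′ , a , b) = dir rG pG in
              k r′ (sub rG′) b (O.Mem-mono m′ (sub rG′) a)
            go (inj₁ (p , pG , inj₂ (γ , s , m , inj₂ k))) = proj₂ (h γ s m) (O.Eq-true g pG k)
            go (inj₂ (p , pG , k)) = let (r , rG , r≤p , r≤q) = dir pG qG in stk y yY r (sub rG) r≤q (sb r (sub rG) r≤p)
              where
              ext : ∀ {r r′} → r ∊ P → r′ ∊ P → r ≼ p → r′ ≼ r → r′ ≼ p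
              ext a b f e = ≤⇐ b (sub pG) λ z m → ≤⇒ e z (≤⇒ f z m)
              sb : ∀ r → r ∊ P → r ≼ p → SUB r t y
              sb r rP r≤ =
                O.Mem-dense rP (YN yY) TN (λ q qP q≤ → stab₁ λ n → k q qP (ext rP qP r≤ q≤) (inj₁ λ r′ rP′ x m → n (r′ , rP′ , x , m))) ,
                λ β s m →
                  O.Mem-dense rP (opN (sY m) yY) EN (λ q qP q≤ → stab₁ λ n → k q qP (ext rP qP r≤ q≤)
                    (inj₂ (β , s , m , inj₁ λ r′ rP′ x z → n (r′ , rP′ , x , z)))) ,
                  (λ r′ rP′ x z → k r′ rP′ (ext rP rP′ r≤ x) (inj₂ (β , s , m , inj₂ z)))

          lm⊂κ : ∀ {β} → β ∊ lm → β ∊ κ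
          lm⊂κ m = mem (IsOrdinal.transitive κ-ord lm _ (unmem lmκ) (unmem m))

        conclude : (∃[ m ] m ∈ T × (∀ t → t ∈ T → ⟨ m , t ⟩ ∈ ≤T → t ≐ m))
          ⊎ (∃[ c ] SymmetricExtension V S G c × IsChainOfType T ≤T lm c)
        conclude = go solve
          where
          go : ∃[ q ] q ∊ G × Solved q → (∃[ m ] m ∈ T × (∀ t → t ∈ T → ⟨ m , t ⟩ ∈ ≤T → t ≐ m))
            ⊎ (∃[ c ] SymmetricExtension V S G c × IsChainOfType T ≤T lm c)
          go (q , qG , t , tp , sq , fc , inj₁ full) = inj₂ (Ch.c , Ch.c∈W , Ch.isChain)
            where module Ch = Chain qG (∊pow-V VlY tp) (∊pow VlY tp) sq fc lmκ full (λ γ y m → proj₁ (⊗e (∊pow VlY tp _ m)))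
          go (q , qG , t , tp , sq , fc , inj₂ (β , βl , d₁ , d₂ , stk)) = inj₁ (fin (cl β Ch.c (unmem βl) Ch.c∈W Ch.isChain))
            where
            module Ch = Chain qG (∊pow-V VlY tp) (∊pow VlY tp) sq fc (lm⊂κ βl) d₁ d₂
            fin : ∃[ u ] u ∈ T × (∀ β s → ⟨ β , s ⟩ ∈ Ch.c → ⟨ s , u ⟩ ∈ ≤T) → ∃[ m ] m ∈ T × (∀ t → t ∈ T → ⟨ m , t ⟩ ∈ ≤T → t ≐ m)
            fin (u , uT , ubd) = u , uT , λ v vT u≤v → uneq (stab₀ λ ne → above v vT u≤v ne (∊val (∊r T≈ (mem vT))))
              where
              above : ∀ v → v ∈ T → ⟨ u , v ⟩ ∈ ≤T → ¬ v ≈ u → ∃[ p ] ∃[ y ] p ∊ G × ⟪ p , y ⟫ ∊ Ṫ × v ≈ Val G y → ⊥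
              above v vT u≤v ne (p , y , pG , py , e) = no-bound qG (∊pow-V VlY tp) (∊pow VlY tp) stk (Y⇐ py) (∊l e (mem vT)) λ γ s m →
                let sT = mem-true qG (proj₁ fc γ s m)
                    s≤u = ubd γ (Val G s) (out⟨ (Ch.c⇐ m))
                    s≤v = Tr.transitive (Val G s) u v (unmem sT) uT vT s≤u u≤v
                in ⟪⟫-resp ≈refl e (in⟨ s≤v) , λ f →
                  let f′ = ≈trans e (≈sym f)
                      u≤s : ⟨ u , Val G s ⟩ ∈ ≤T
                      u≤s = out⟨ {z = ≤T} (⟪⟫-resp ≈refl f′ (in⟨ {z = ≤T} u≤v))
                  in ne (≈trans f′ (eq (Tr.antisymmetric (Val G s) u (unmem sT) uT s≤u u≤s)))

    dc : ∀ {G} → Gen G → DC< (SymmetricExtension V S G) κ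
    dc g lm lmκ al T ≤T tree cl =
      let (Ṫ , vT , nT , hT , eT) = IsTreeIn.T∈ tree ; (Ė , vE , _ , _ , eE) = IsTreeIn.≤T∈ tree in
      Tree.Conclude.conclude g lm (mem lmκ) (IsAlephIn.ordinal al) Ṫ Ė vT nT hT vE T ≤T (mkVal eT) (mkVal eE) tree cl

 open Chains

 module Assembly where
  module Main (L : Language) (M : Structure) (isM : IsStructureIn V L M)
    (𝓖 : 𝕍) (v𝓖 : V 𝓖) (aut : IsAutGroup L M 𝓖) (𝓘 : 𝕍) (ideal : IsIdealIn V (Structure.dom M) 𝓘) where
    private
      module St = IsStructureIn isM
      instance
        iD : Cst (Structure.dom M)
        iD = cst St.dom∈
        iR : Cst (Structure.rels M)
        iR = cst St.rels∈
        iF : Cst (Structure.funs M)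
        iF = cst St.funs∈
        i𝓖 : Cst 𝓖
        i𝓖 = cst v𝓖
        i𝓘 : Cst 𝓘
        i𝓘 = cst (IsIdealIn.member ideal)

    Φ₀ Φ₁ : (W V[G] : Class) → Set₁
    Φ₀ W V[G] = HasSymmetricCopy V W V[G] L M 𝓖 𝓘
    Φ₁ W V[G] = Φ₀ W V[G] × NoNewSubsets V V[G] (Structure.dom M)

    Φ₂ Φ₃ : 𝕍 → (W V[G] : Class) → Set₁
    Φ₂ κ W V[G] = Φ₀ W V[G] × DC< W κ
    Φ₃ κ W V[G] = Φ₀ W V[G] × DC< W κ × NoNewSubsets V V[G] (Structure.dom M)

    module Part (X : 𝕍) (vX : V X) where
      private
        instance
          iX : Cst X
          iX = cst vX
      open CopyTheorem L M isM 𝓖 𝓘 X aut ideal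
      module Dist = Distributive (Structure.dom M) 𝓖 𝓘 X (IsAutGroup.group aut) ideal

      extension : (Φ : (W V[G] : Class) → Set₁) →
        (∀ G → Gen G → Φ (SymmetricExtension V S G) (GenericExtension V S G)) → ThereIsSymmetricExtension V Φ
      extension Φ h = S , isS , (λ c → Existence.exists-generic S isS c) , λ G gen →
        let g = fromGeneric gen in V⊑W g , W⊑V[G] {G} , h G g

      copy : ThereIsSymmetricExtension V Φ₁
      copy = extension Φ₁ λ G g → hasCopy g , Dist.noNew g

    module WithDC (κ : 𝕍) (al : IsAlephIn V κ) (compl : IsCompleteIn V (Structure.dom M) 𝓘 κ) where
      private
        instance
          iκ : Cst κ
          iκ = cst (IsAlephIn.member al)
      module P = Part κ (IsAlephIn.member al)
      module C = CopyTheorem L M isM 𝓖 𝓘 κ aut ideal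
      module DCh = DependentChoice (Structure.dom M) 𝓖 𝓘 κ (IsAutGroup.group aut) ideal (IsAlephIn.ordinal al) compl

      copy-dc : ThereIsSymmetricExtension V (Φ₃ κ)
      copy-dc = P.extension (Φ₃ κ) λ G g → C.hasCopy g , DCh.dc g , P.Dist.noNew g

    weaken : (Φ Ψ : (W V[G] : Class) → Set₁) → (∀ W V[G] → Φ W V[G] → Ψ W V[G]) →
      ThereIsSymmetricExtension V Φ → ThereIsSymmetricExtension V Ψ
    weaken Φ Ψ f (S , isS , ex , h) = S , isS , ex , λ G g → let (a , b , c) = h G g in a , b , f _ _ c

    result : ThereIsSymmetricExtension V Φ₀ × ThereIsSymmetricExtension V Φ₁
      × ((κ : 𝕍) → IsAlephIn V κ → IsCompleteIn V (Structure.dom M) 𝓘 κ →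
         ThereIsSymmetricExtension V (Φ₂ κ) × ThereIsSymmetricExtension V (Φ₃ κ))
    result = weaken Φ₁ Φ₀ (λ _ _ → proj₁) c , c , λ κ al compl → let d = WithDC.copy-dc κ al compl in
        weaken (Φ₃ κ) (Φ₂ κ) (λ _ _ (x , y , _) → x , y) d , d
      where
      c = Part.copy ∅ V∅

theorem3p2 : ExcludedMiddle (lsuc 0ℓ) →
    (V : Class) → IsTransitive V → IsZFC V →
    (L : Language) → IsLanguageIn V L →
    (M : Structure) → IsStructureIn V L M →
    (𝓖 : 𝕍) → V 𝓖 → IsAutGroup L M 𝓖 →
    (𝓘 : 𝕍) → IsIdealIn V (Structure.dom M) 𝓘 →
    ThereIsSymmetricExtension V (λ W V[G] →
    HasSymmetricCopy V W V[G] L M 𝓖 𝓘)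
    × ThereIsSymmetricExtension V (λ W V[G] →
    HasSymmetricCopy V W V[G] L M 𝓖 𝓘 × NoNewSubsets V V[G] (Structure.dom M))
    × ((κ : 𝕍) → IsAlephIn V κ → IsCompleteIn V (Structure.dom M) 𝓘 κ →
    ThereIsSymmetricExtension V (λ W V[G] →
    HasSymmetricCopy V W V[G] L M 𝓖 𝓘 × DC< W κ)
    × ThereIsSymmetricExtension V (λ W V[G] →
    HasSymmetricCopy V W V[G] L M 𝓖 𝓘 × DC< W κ × NoNewSubsets V V[G] (Structure.dom M)))
theorem3p2 em V tr zfc L _ M isM 𝓖 v𝓖 aut 𝓘 ideal =
  Universe.Assembly.Main.result em V tr zfc L M isM 𝓖 v𝓖 aut 𝓘 ideal
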